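{- There is an algorithm which, given a homogeneous relation $H$ on a finite set $X$ whose umodule family $\mathcal{U}_H$ is self-complemented, computes in $O(|X|^4\log|X|)$ time the unique umodular decomposition tree of $H$ (with its node labels and orderings).
   Context: Let $X$ be a finite set. A reflectless triple is $(x|yz)$ with $x,y,z\in X$, $x\neq y$, $x\neq z$. A homogeneous relation $H$ on $X$ is a boolean relation on reflectless triples such that for every $x\in X$ the binary relation $H_x$ on $X\setminus\{x\}$ given by $H_x(y,z)\Leftrightarrow H(x|yz)$ is an equivalence relation. The input $H$ is given by listing, for each $x\in X$, the partition of $X\setminus\{x\}$ into the classes of $H_x$. A subset $U\subseteq X$ is a umodule of $H$ if for all $u,u'\in U$ and all $x,x'\in X\setminus U$: $H(u|xx')\Leftrightarrow H(u'|xx')$. The family of umodules is $\mathcal{U}_H$; it is self-complemented if $U\in\mathcal{U}_H$ implies $X\setminus U\in\mathcal{U}_H$. Umodular decomposition tree (for self-complemented $\mathcal{U}_H$). Let $\mathcal{B}=\{\{U,X\setminus U\}: U\in\mathcal{U}_H,\ \emptyset\neq U\neq X\}$. Two bipartitions $\{A^1,A^2\}$, $\{B^1,B^2\}$ of $X$ overlap if all four intersections $A^i\cap B^j$ are nonempty; a bipartition in $\mathcal{B}$ is strong if it overlaps no other member of $\mathcal{B}$. The umodular decomposition tree is the unique unrooted tree $T$ whose leaves are labelled bijectively by $X$ and whose edges $e$ correspond bijectively to the strong bipartitions of $\mathcal{B}$ (the leaf labels of the two components of $T-e$ being the two parts). For an internal node $N$ of degree $k$, the leaf labels of the components of $T-N$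 form a partition $X_1,\dots,X_k$ of $X$; for $I\subseteq\{1,\dots,k\}$, $1\le|I|<k$, let $B_N(I)=\{\bigcup_{i\in I}X_i, X\setminus\bigcup_{i\in I}X_i\}$. Internal nodes are labelled complete, circular or prime, and the neighbouring subtrees of circular nodes are ordered, so that $\mathcal{B}$ consists exactly of: all $B_N(I)$ for $N$ complete; all $B_N(I)$ with $I$ an interval of $\{1,\dots,k\}$ for $N$ circular; all $B_N(\{a\})$ for $N$ prime. -}

module Defs where

open import Data.Bool using (Bool; T; if_then_else_; _∧_)
open import Data.Empty using (⊥)
open import Data.Fin as Fin using (Fin; toℕ)
open import Data.Fin.Subset using (Subset; _∈_; _∉_; _∩_; ∁; Nonempty; ⁅_⁆; ∣_∣)
  renaming (⊥ to ∅; ⊤ to full)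
open import Data.List using (List; []; _∷_; _++_; [_]; length; lookup; map; concat; concatMap; allFin)
import Data.List.Membership.Propositional as List
open import Data.List.Relation.Unary.All using (All)
open import Data.List.Relation.Unary.Linked using (Linked)
open import Data.List.Relation.Unary.Unique.Propositional using (Unique)
open import Data.Nat using (ℕ; zero; suc; _+_; _*_; _∸_; _/_; _≤_; _<_; _<ᵇ_; _≡ᵇ_)
open import Data.Product using (Σ-syntax; ∃; ∃-syntax; ∃!; _×_; _,_)
open import Data.Sum using (_⊎_)
open import Data.Unit using (⊤)
open import Function using (_⇔_; _↔_; Inverse)
open import Relation.Binary.Construct.Closure.ReflexiveTransitive using (Star)
open import Relation.Binary.PropositionalEquality using (_≡_; _≢_)
open import Relation.Binary.Structures using (IsEquivalence)
open import Relation.Nullary using (¬_)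

private
  variable
    n : ℕ

------------------------------------------------------------------------
-- Homogeneous relations and umodules on X = Fin n

-- The elements of X ∖ {x}.
record Other (x : Fin n) : Set where
  constructor other
  field
    elem      : Fin n
    .distinct : x ≢ elem

-- H x y z is H(x|yz).
record HomogeneousRelation (n : ℕ) : Set where
  field
    H             : (x : Fin n) → Other x → Other x → Bool
    isEquivalence : ∀ x → IsEquivalence (λ y z → T (H x y z))

-- x ≢ y, from u ∈ U and y ∉ U.
separated : {U : Subset n} {u y : Fin n} → u ∈ U → y ∉ U → u ≢ y
separated u∈U y∉U _≡_.refl = y∉U u∈U

module _ (R : HomogeneousRelation n) where
  open HomogeneousRelation R

  IsUmodule : Subset n → Set
  IsUmodule U =
    ∀ {u u′ x x′} (u∈U : u ∈ U) (u′∈U : u′ ∈ U) (x∉U : x ∉ U) (x′∉U : x′ ∉ U) →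
    H u  (other x (separated u∈U  x∉U)) (other x′ (separated u∈U  x′∉U)) ≡
    H u′ (other x (separated u′∈U x∉U)) (other x′ (separated u′∈U x′∉U))

  SelfComplemented : Set
  SelfComplemented = ∀ U → IsUmodule U → IsUmodule (∁ U)

  -- A bipartition {U , ∁ U} is handled through either of its two sides.
  -- The predicates below do not depend on the side chosen when R is
  -- self-complemented.

  InB : Subset n → Set
  InB U = IsUmodule U × U ≢ ∅ × U ≢ full

  Overlap : Subset n → Subset n → Set
  Overlap A B = Nonempty (A ∩ B)   × Nonempty (A ∩ ∁ B) ×
                Nonempty (∁ A ∩ B) × Nonempty (∁ A ∩ ∁ B)

  Strong : Subset n → Set
  Strong U = InB U × (∀ V → InB V → ¬ Overlap U V)

------------------------------------------------------------------------
-- The input: for every x, a listing of the classes of H_x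

Listing : ℕ → Set
Listing n = Fin n → List (List (Fin n))

record Lists (R : HomogeneousRelation n) (L : Listing n) : Set where
  open HomogeneousRelation R
  field
    nonempty : ∀ x → All (_≢ []) (L x)
    disjoint : ∀ x → Unique (concat (L x))
    avoids   : ∀ x → ¬ (x List.∈ concat (L x))
    classes  : ∀ x (y z : Other x) →
      T (H x y z) ⇔
      (∃[ C ] C List.∈ L x × Other.elem y List.∈ C × Other.elem z List.∈ C)

------------------------------------------------------------------------
-- Labelled trees

data Kind (n : ℕ) : Set where
  leaf                    : Fin n → Kind n
  complete circular prime : Kind n

-- The order of the list nbrs N is the order of the neighbouring subtrees
-- of N; it carries information only when N is circular.
record LabelledGraph (n : ℕ) : Set where
  field
    order : ℕ
    nbrs  : Fin order → List (Fin order)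
    kind  : Fin order → Kind n

  Vertex : Set
  Vertex = Fin order

  Adj : Vertex → Vertex → Set
  Adj v w = w List.∈ nbrs v

  degree : Vertex → ℕ
  degree v = length (nbrs v)

  record IsSimple : Set where
    field
      unique    : ∀ v → Unique (nbrs v)
      loopless  : ∀ v → ¬ Adj v v
      symmetric : ∀ v w → Adj v w → Adj w v

  -- The graph without vertices qualifies; it is the tree for n = 0.
  record IsTree : Set where
    field
      isSimple  : IsSimple
      connected : ∀ v w → Star Adj v w
      acyclic   : ∀ v vs → 2 ≤ length vs → Unique (v ∷ vs) →
                  ¬ Linked Adj (v ∷ vs ++ [ v ])

  -- The degree-0 case is the one-vertex tree, for n = 1.
  record LeavesLabelledBijectively : Set where
    field
      leaves : ∀ v → degree v ≤ 1 ⇔ (∃[ x ] kind v ≡ leaf x)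
      labels : ∀ x → ∃! _≡_ (λ v → kind v ≡ leaf x)

  WithoutEdge : Vertex → Vertex → Vertex → Vertex → Set
  WithoutEdge a b v w = Adj v w × ¬ (v ≡ a × w ≡ b) × ¬ (v ≡ b × w ≡ a)

  WithoutVertex : Vertex → Vertex → Vertex → Set
  WithoutVertex N v w = Adj v w × v ≢ N × w ≢ N

  -- x labels a leaf of the component of b, for the adjacency E.
  LeafOf : (E : Vertex → Vertex → Set) → Vertex → Fin n → Set
  LeafOf E b x = ∃[ v ] kind v ≡ leaf x × Star E b v

  -- U is the set of leaf labels on the b side of the edge ab.
  EdgeSide : Vertex → Vertex → Subset n → Set
  EdgeSide a b U = ∀ x → x ∈ U ⇔ LeafOf (WithoutEdge a b) b x

  -- U is the union of the X_i with i ∈ I.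
  NodeSide : (N : Vertex) → Subset (degree N) → Subset n → Set
  NodeSide N I U =
    ∀ x → x ∈ U ⇔
    (∃[ i ] i ∈ I × LeafOf (WithoutVertex N) (lookup (nbrs N) i) x)

IsInterval : Subset n → Set
IsInterval {n} I =
  Σ[ a ∈ Fin n ] Σ[ b ∈ Fin n ] (∀ i → i ∈ I ⇔ (a Fin.≤ i × i Fin.≤ b))

Admissible : ∀ {k} → Kind n → Subset k → Set
Admissible (leaf _) I = ⊥
Admissible complete I = ⊤
Admissible circular I = IsInterval I
Admissible prime    I = ∃[ a ] I ≡ ⁅ a ⁆

record IsUmodularDecompositionTree
  (R : HomogeneousRelation n) (G : LabelledGraph n) : Set where
  open LabelledGraph G
  field
    isTree     : IsTree
    labelling  : LeavesLabelledBijectively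

    -- Edges ab correspond bijectively to strong bipartitions. Choosing an
    -- orientation of the edge amounts to choosing a side of the bipartition.
    edgeStrong : ∀ a b → Adj a b → ∃[ U ] EdgeSide a b U × Strong R U
    strongEdge : ∀ U → Strong R U →
      ∃! _≡_ (λ ((a , b) : Vertex × Vertex) → Adj a b × EdgeSide a b U)

    -- For n = 2 the tree is a single edge and has no internal node, although
    -- there is one bipartition; for n ≤ 2 every bipartition is strong, hence
    -- already accounted for by the edges.
    nodes      : 3 ≤ n → ∀ U →
      InB R U ⇔
      (∃[ N ] ∃[ I ] 1 ≤ ∣ I ∣ × ∣ I ∣ < degree N × Admissible (kind N) I ×
        (NodeSide N I U ⊎ NodeSide N I (∁ U)))

-- Isomorphism of leaf-labelled trees.
record _≅_ (G G′ : LabelledGraph n) : Set where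
  private
    module G  = LabelledGraph G
    module G′ = LabelledGraph G′
  field
    vertices : G.Vertex ↔ G′.Vertex
  open Inverse vertices using (to)
  field
    adjacent : ∀ v w → G.Adj v w ⇔ G′.Adj (to v) (to w)
    labelled : ∀ v x → G.kind v ≡ leaf x ⇔ G′.kind (to v) ≡ leaf x

------------------------------------------------------------------------
-- Random access machine: structured programs over finitely many arrays,
-- with unit-cost operations on words

data Op : Set where
  add sub mul div less equal : Op

data Expr : Set where
  lit  : ℕ → Expr
  read : (array : ℕ) → Expr → Expr
  op   : Op → Expr → Expr → Expr

data Program : Set where
  skip  : Program
  write : (array : ℕ) (index value : Expr) → Program
  _⨾_   : Program → Program → Program
  cond  : Expr → Program → Program → Program
  while : Expr → Program → Program

infixr 5 _⨾_

-- σ a i is the content of cell i of array a. Scalar variables are arrays of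
-- which only cell 0 is used.
Store : Set
Store = ℕ → ℕ → ℕ

_[_,_≔_] : Store → ℕ → ℕ → ℕ → Store
(σ [ a , i ≔ v ]) b j = if (b ≡ᵇ a) ∧ (j ≡ᵇ i) then v else σ b j

apply : Op → ℕ → ℕ → ℕ
apply add   k l       = k + l
apply sub   k l       = k ∸ l
apply mul   k l       = k * l
apply div   k zero    = 0
apply div   k (suc l) = k / suc l
apply less  k l       = if k <ᵇ l then 1 else 0
apply equal k l       = if k ≡ᵇ l then 1 else 0

⟦_⟧ : Expr → Store → ℕ
⟦ lit k ⟧     σ = k
⟦ read a e ⟧  σ = σ a (⟦ e ⟧ σ)
⟦ op o e e′ ⟧ σ = apply o (⟦ e ⟧ σ) (⟦ e′ ⟧ σ)

exprCost : Expr → ℕ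
exprCost (lit k)     = 1
exprCost (read a e)  = 1 + exprCost e
exprCost (op o e e′) = 1 + exprCost e + exprCost e′

-- All values and addresses occurring in the evaluation are words, i.e. < W.
Fits : ℕ → Store → Expr → Set
Fits W σ e@(lit k)       = ⟦ e ⟧ σ < W
Fits W σ e@(read a e₁)   = Fits W σ e₁ × ⟦ e ⟧ σ < W
Fits W σ e@(op o e₁ e₂)  = Fits W σ e₁ × Fits W σ e₂ × ⟦ e ⟧ σ < W

-- W ⊢ P , σ ⇓ σ′ , t : with words < W, the program P started in σ halts in
-- σ′ after t steps. A program whose evaluation leaves the words is stuck.
data _⊢_,_⇓_,_ (W : ℕ) : Program → Store → Store → ℕ → Set where
  skip : ∀ {σ} → W ⊢ skip , σ ⇓ σ , 1
  write : ∀ {σ a i e} → Fits W σ i → Fits W σ e →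
    W ⊢ write a i e , σ ⇓ (σ [ a , ⟦ i ⟧ σ ≔ ⟦ e ⟧ σ ]) ,
      (1 + exprCost i + exprCost e)
  _⨾_ : ∀ {P Q σ σ′ σ″ s t} →
    W ⊢ P , σ ⇓ σ′ , s → W ⊢ Q , σ′ ⇓ σ″ , t →
    W ⊢ P ⨾ Q , σ ⇓ σ″ , (s + t)
  cond-true : ∀ {e P Q σ σ′ t} → Fits W σ e → ⟦ e ⟧ σ ≢ 0 →
    W ⊢ P , σ ⇓ σ′ , t →
    W ⊢ cond e P Q , σ ⇓ σ′ , (1 + exprCost e + t)
  cond-false : ∀ {e P Q σ σ′ t} → Fits W σ e → ⟦ e ⟧ σ ≡ 0 →
    W ⊢ Q , σ ⇓ σ′ , t →
    W ⊢ cond e P Q , σ ⇓ σ′ , (1 + exprCost e + t)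
  while-true : ∀ {e P σ σ′ σ″ s t} → Fits W σ e → ⟦ e ⟧ σ ≢ 0 →
    W ⊢ P , σ ⇓ σ′ , s → W ⊢ while e P , σ′ ⇓ σ″ , t →
    W ⊢ while e P , σ ⇓ σ″ , (1 + exprCost e + (s + t))
  while-false : ∀ {e P σ} → Fits W σ e → ⟦ e ⟧ σ ≡ 0 →
    W ⊢ while e P , σ ⇓ σ , (1 + exprCost e)

------------------------------------------------------------------------
-- Input and output conventions

encodeList : ∀ {A : Set} → (A → List ℕ) → List A → List ℕ
encodeList f xs = length xs ∷ concatMap f xs

encodeFin : Fin n → List ℕ
encodeFin i = [ toℕ i ]

encodeListing : Listing n → List ℕ
encodeListing {n} L =
  encodeList (λ x → encodeList (encodeList encodeFin) (L x)) (allFin n)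

encodeKind : Kind n → List ℕ
encodeKind (leaf x) = 0 ∷ toℕ x ∷ []
encodeKind complete = 1 ∷ 0 ∷ []
encodeKind circular = 2 ∷ 0 ∷ []
encodeKind prime    = 3 ∷ 0 ∷ []

encodeGraph : LabelledGraph n → List ℕ
encodeGraph G =
  encodeList (λ v → encodeKind (kind v) ++ encodeList encodeFin (nbrs v)) (allFin order)
  where open LabelledGraph G

cell : List ℕ → ℕ → ℕ
cell []       i       = 0
cell (k ∷ ks) zero    = k
cell (k ∷ ks) (suc i) = cell ks i

-- The input is in array 0; all other cells are initially 0.
initial : List ℕ → Store
initial ks zero    i = cell ks i
initial ks (suc a) i = 0

-- The output is read from the beginning of array 1.
Outputs : Store → List ℕ → Set
Outputs σ ks = ∀ i → i < length ks → σ 1 i ≡ cell ks i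

infix 4 _∈O_

_∈O_ : (ℕ → ℕ) → (ℕ → ℕ) → Set
f ∈O g = ∃[ C ] ∃[ n₀ ] (∀ n → n₀ ≤ n → f n ≤ C * g n)

{-# OPTIONS --safe #-}
module Submission where

-- Root the tree at the leaf 0 and identify a vertex with its cluster, the set
-- of leaf labels below it: the clusters are X and the strong umodules avoiding
-- 0, and adjacency is the covering relation of inclusion, which determines the
-- tree. For a, b let M a b be the least umodule avoiding 0 that contains a and
-- b (or X if there is none), obtained by closing {a , b}, and let S a b be the
-- least cluster containing a and b, namely the set of all d with d ∈ M a b or
-- b ∉ M a d or a ∉ M b d. Every cluster is some S a b, and the kind of a vertex
-- and the order of its children are read off the sizes of the sets M a b.
--
-- The algorithm tabulates labels of the classes, M, S and then parents,
-- children, kinds and orders. It is a program with bounded loops of nesting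
-- depth four, whence the bound O(n⁴).

open import Defs
open import Data.Bool using (Bool; true; false; T; if_then_else_; _∧_)
open import Data.Bool.Properties using (∧-zeroʳ; T-∧)
open import Data.Empty using (⊥; ⊥-elim)
open import Data.Fin as Fin using (Fin; zero; suc; toℕ; fromℕ<)
import Data.Fin.Properties as Finₚ
open import Data.Fin.Properties using (toℕ<n; toℕ-injective; toℕ-fromℕ<)
open import Data.Fin.Subset using (Subset; _∈_; _∉_; _⊆_; _∪_; _∩_; ∁; Nonempty; ⁅_⁆; ∣_∣)
  renaming (⊥ to ∅; ⊤ to full)
open import Data.Fin.Subset.Properties using
  (_∈?_; ∈⊤; ∉⊥; x∈⁅x⁆; x∈⁅y⁆⇒x≡y; ⊆-antisym; x∈p∩q⁺; x∈p∩q⁻; x∈p∪q⁺; x∈p∪q⁻; x∈p⇒x∉∁p;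
   x∈∁p⇒x∉p; x∉p⇒x∈∁p; x∉∁p⇒x∈p; _⊆?_; nonempty?; Empty-unique; anySubset?; p⊆q⇒∣p∣≤∣q∣; p⊂q⇒∣p∣<∣q∣; ∣p∣≤n; ∣p∣≡n⇒p≡⊤; ∣⊤∣≡n; ∣⊥∣≡0; ∣⁅x⁆∣≡1)
open import Data.List using (List; []; _∷_; _++_; [_]; length; map; concat; concatMap; allFin)
import Data.List as List
import Data.List.Properties as Listₚ
import Data.List.Membership.Propositional as Mem
import Data.List.Membership.Propositional.Properties as Memₚ
open import Data.List.Relation.Unary.All using (All; []; _∷_)
import Data.List.Relation.Unary.All as All
import Data.List.Relation.Unary.All.Properties as Allₚ
import Data.List.Relation.Unary.Any as Any
import Data.List.Relation.Unary.Any.Properties as Anyₚ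
import Data.List.Relation.Unary.AllPairs as AllPairs
import Data.List.Relation.Unary.AllPairs.Properties as AllPairsₚ
open import Data.List.Relation.Unary.Unique.Propositional using (Unique)
open import Data.List.Relation.Unary.Any using (here; there)
open import Data.Nat
  using (ℕ; zero; suc; _+_; _*_; _∸_; _^_; _⊔_; _≤_; _<_; _≤?_; _<?_; _<ᵇ_; _≤ᵇ_; _≡ᵇ_; z≤n; s≤s; NonZero)
open import Data.Nat.Properties using
  (≤-refl; ≤-trans; ≤-reflexive; ≤-antisym; <-trans; <-irrefl; ≤-<-trans; <-≤-trans; <⇒≤; <⇒≢; ≰⇒>; ≮⇒≥; ≤⇒≯; +-cancelˡ-≡; n≤1+n;
   m≤m+n; m≤n+m; m≤m⊔n; m≤n⊔m; +-mono-≤; +-monoˡ-≤; +-monoʳ-≤; +-mono-<-≤; *-mono-≤; *-monoˡ-≤; *-monoʳ-≤;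
   +-comm; +-assoc; +-identityʳ; +-suc; *-identityʳ; m∸n≤m; ^-monoˡ-≤; ^-monoʳ-≤;
   ^-distribˡ-+-*; m^n>0; ≤ᵇ⇒≤; ≡ᵇ⇒≡; <ᵇ⇒<; <⇒<ᵇ; module ≤-Reasoning)
open import Data.Nat.DivMod using (m/n≤m)
open import Data.Nat.Logarithm using (⌊log₂_⌋; ⌊log₂⌋-mono-≤; ⌊log₂[2^n]⌋≡n)
open import Data.Nat.Tactic.RingSolver using (solve-∀)
open import Data.Product using (Σ; Σ-syntax; ∃; ∃-syntax; ∃!; _×_; _,_; proj₁; proj₂)
open import Data.Sum using (_⊎_; inj₁; inj₂; [_,_]′)
open import Data.Unit using (⊤; tt)
open import Data.Vec using (Vec; []; _∷_)
import Data.Vec as Vec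
import Data.Vec.Properties as Vecₚ
open import Function using (_⇔_; mk⇔; mk↔ₛ′; _∘_; id; case_of_; Equivalence)
open import Relation.Binary.PropositionalEquality
  using (_≡_; _≢_; refl; sym; trans; cong; cong₂; subst; subst₂)
open import Relation.Nullary using (¬_; Dec; yes; no; does; contradiction)
open import Relation.Nullary.Decidable using (_×-dec_; _⊎-dec_; _→-dec_; ¬?; dec-true; dec-false; decidable-stable)
open import Relation.Binary.Definitions using (tri<; tri≈; tri>)
open import Relation.Binary.Structures using (IsEquivalence)
open import Relation.Binary.Construct.Closure.ReflexiveTransitive using (Star; ε; _◅_; _◅◅_)
import Relation.Binary.Construct.Closure.ReflexiveTransitive as Star
open import Data.List.Relation.Unary.Linked using (Linked)
import Data.List.Relation.Unary.Linked as Linked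

-- Choosing from each bipartition the side without `zero` turns overlap of bipartitions into overlap
-- of sets, because `zero` always lies in the fourth region. Self-complementedness then supplies two
-- things. It makes the chosen sides a weakly partitive family, closed under union and intersection
-- of meeting members and under difference of overlapping ones; the order theory rests on this
-- alone. It also lets membership be tested by comparing rows: every row outside `U` must induce on
-- `U` the same partition as row `zero`, a condition that can be maintained while a set is being
-- closed. The kind of a node is told by its full pairs, points of different children whose least
-- member is the whole node: a complete node has none, in a prime node all crossing pairs are full,
-- in a circular node some but not all. If `e` begins a full pair of a circular node, the sets
-- `M e x` form a chain, so their sizes sort the children. The parent is put last, and arcs of the
-- circle become linear intervals up to complement.

module _ {n : ℕ} where

  subset : {P : Fin n → Set} → (∀ x → Dec (P x)) → Subset n
  subset P? = Vec.tabulate (λ x → does (P? x))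

  abstract
    ∈-subset⁺ : {P : Fin n → Set} (P? : ∀ x → Dec (P x)) → ∀ {x} → P x → x ∈ subset P?
    ∈-subset⁺ P? {x} p = Vecₚ.lookup⇒[]= x (subset P?)
      (trans (Vecₚ.lookup∘tabulate (λ x → does (P? x)) x) (dec-true (P? x) p))

    ∈-subset⁻ : {P : Fin n → Set} (P? : ∀ x → Dec (P x)) → ∀ {x} → x ∈ subset P? → P x
    ∈-subset⁻ P? {x} x∈ with P? x in eq
    ... | yes p = p
    ... | no _  = case trans (sym (Vecₚ.[]=⇒lookup x∈))
        (trans (Vecₚ.lookup∘tabulate (λ x → does (P? x)) x) (cong does eq)) of λ ()

    ∈-∖⁺ : ∀ {U V : Subset n} {x} → x ∈ U → x ∉ V → x ∈ U ∩ ∁ V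
    ∈-∖⁺ x∈U x∉V = x∈p∩q⁺ (x∈U , x∉p⇒x∈∁p x∉V)

    ∈-∖⁻ : ∀ (U V : Subset n) {x} → x ∈ U ∩ ∁ V → x ∈ U × x ∉ V
    ∈-∖⁻ U V x∈ = let x∈U , x∈∁V = x∈p∩q⁻ U (∁ V) x∈ in x∈U , x∈∁p⇒x∉p x∈∁V

    ⊈⇒∃ : ∀ {U V : Subset n} → ¬ U ⊆ V → ∃[ x ] x ∈ U × x ∉ V
    ⊈⇒∃ {U} {V} U⊈V with Finₚ.any? (λ x → (x ∈? U) ×-dec ¬? (x ∈? V))
    ... | yes w = w
    ... | no ¬w = contradiction
      (λ {x} x∈U → decidable-stable (x ∈? V) (λ x∉V → ¬w (x , x∈U , x∉V))) U⊈V

-- Weakly partitive families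

module Partitive {n : ℕ} (F : Subset n → Set) (F? : ∀ U → Dec (F U)) (F-full : F full)
  (F-∪ : ∀ {U V x} → F U → F V → x ∈ U → x ∈ V → F (U ∪ V))
  (F-∩ : ∀ {U V x} → F U → F V → x ∈ U → x ∈ V → F (U ∩ V))
  (F-∖ : ∀ {U V x y z} → F U → F V → x ∈ U → x ∈ V → y ∈ V → y ∉ U → z ∈ U → z ∉ V → F (U ∩ ∁ V))
  where

  private
    Avoiding : Fin n → Fin n → Fin n → Subset n → Set
    Avoiding a b x U = F U × a ∈ U × b ∈ U × x ∉ U

    avoiding? : ∀ a b x → Dec (∃[ U ] Avoiding a b x U)
    avoiding? a b x = anySubset? λ U → F? U ×-dec (a ∈? U) ×-dec (b ∈? U) ×-dec ¬? (x ∈? U)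

  -- The least member of F containing a and b.
  abstract
    M : Fin n → Fin n → Subset n
    M a b = subset (λ x → ¬? (avoiding? a b x))

    M-min : ∀ {a b U} → F U → a ∈ U → b ∈ U → M a b ⊆ U
    M-min {a} {b} {U} FU a∈ b∈ {x} x∈M = decidable-stable (x ∈? U)
      (λ x∉U → ∈-subset⁻ (λ x → ¬? (avoiding? a b x)) x∈M (U , FU , a∈ , b∈ , x∉U))

    a∈M : ∀ a b → a ∈ M a b
    a∈M a b = ∈-subset⁺ (λ x → ¬? (avoiding? a b x)) λ (U , _ , a∈ , _ , a∉) → a∉ a∈

    b∈M : ∀ a b → b ∈ M a b
    b∈M a b = ∈-subset⁺ (λ x → ¬? (avoiding? a b x)) λ (U , _ , _ , b∈ , b∉) → b∉ b∈

    -- Each point outside `M a b` is excluded by some member through `a` and `b`. These finitely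
    -- many members all meet in `a`, and their intersection is `M a b`.
    M-F : ∀ a b → F (M a b)
    M-F a b = finish (separate (allFin n))
      where
      Separating : List (Fin n) → Set
      Separating xs = ∃[ U ] F U × a ∈ U × b ∈ U × (∀ {x} → x Mem.∈ xs → x ∉ M a b → x ∉ U)
      separate : ∀ xs → Separating xs
      separate [] = full , F-full , ∈⊤ , ∈⊤ , λ ()
      separate (x ∷ xs) with separate xs | avoiding? a b x
      ... | U , FU , a∈ , b∈ , h | yes (V , FV , a∈V , b∈V , x∉V) =
        U ∩ V , F-∩ FU FV a∈ a∈V , x∈p∩q⁺ (a∈ , a∈V) , x∈p∩q⁺ (b∈ , b∈V) ,
        λ { (here refl) _ y∈ → x∉V (proj₂ (x∈p∩q⁻ U V y∈))
          ; (there y∈xs) y∉M y∈ → h y∈xs y∉M (proj₁ (x∈p∩q⁻ U V y∈)) }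
      ... | U , FU , a∈ , b∈ , h | no ¬av =
        U , FU , a∈ , b∈ ,
        λ { (here refl) x∉M _ → x∉M (∈-subset⁺ (λ x → ¬? (avoiding? a b x)) ¬av)
          ; (there y∈xs) → h y∈xs }
      finish : Separating (allFin n) → F (M a b)
      finish (U , FU , a∈U , b∈U , h) = subst F (⊆-antisym
        (λ {x} x∈U → decidable-stable (x ∈? M a b) (λ x∉M → h (Memₚ.∈-allFin x) x∉M x∈U))
        (M-min FU a∈U b∈U)) FU

  abstract
    M-sym : ∀ {a b} → M a b ⊆ M b a
    M-sym {a} {b} = M-min (M-F b a) (b∈M b a) (a∈M b a)

    M-mono : ∀ {a b c d} → c ∈ M a b → d ∈ M a b → M c d ⊆ M a b
    M-mono {a} {b} = M-min (M-F a b)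

    -- Two members p, q of F that meet: the least member through two points of the
    -- union stays inside it.
    M-∪ : ∀ {U V x a b} → F U → F V → x ∈ U → x ∈ V → a ∈ U ⊎ a ∈ V → b ∈ U ⊎ b ∈ V →
      ∀ {z} → z ∈ M a b → z ∈ U ⊎ z ∈ V
    M-∪ {U} {V} FU FV x∈U x∈V a∈ b∈ z∈ =
      x∈p∪q⁻ U V (M-min (F-∪ FU FV x∈U x∈V) (x∈p∪q⁺ a∈) (x∈p∪q⁺ b∈) z∈)

    -- The difference of the overlapping sets `U` and `V` is a member through `a` and `b`. The usual
    -- application is a refutation: some point of `M a b` is known to lie in `V`.
    M-∖ : ∀ {U V x y a b} → F U → F V → x ∈ U → x ∈ V → y ∈ V → y ∉ U →
      a ∈ U → a ∉ V → b ∈ U → b ∉ V → ∀ {z} → z ∈ M a b → z ∉ V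
    M-∖ {U} {V} FU FV x∈U x∈V y∈V y∉U a∈ a∉ b∈ b∉ z∈ = proj₂ (∈-∖⁻ U V
      (M-min (F-∖ FU FV x∈U x∈V y∈V y∉U a∈ a∉) (∈-∖⁺ a∈ a∉) (∈-∖⁺ b∈ b∉) z∈))

  -- Overlap of sets is witnessed by three regions. For sides of bipartitions that avoid `zero` the
  -- fourth region contains `zero`, which is how this notion will match `Strong`.
  StrongF : Subset n → Set
  StrongF T = F T ×
    (∀ {V x y z} → F V → x ∈ T → x ∈ V → y ∈ V → y ∉ T → z ∈ T → z ∉ V → ⊥)

  abstract
    absorb : ∀ {T V x z} → StrongF T → F V → x ∈ T → x ∈ V → z ∈ T → z ∉ V → V ⊆ T
    absorb {T} (FT , st) FV x∈T x∈V z∈T z∉V {y} y∈V =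
      decidable-stable (y ∈? T) (λ y∉T → st FV x∈T x∈V y∈V y∉T z∈T z∉V)

    nested : ∀ {T V x} → StrongF T → F V → x ∈ T → x ∈ V → T ⊆ V ⊎ V ⊆ T
    nested {T} {V} sT FV x∈T x∈V with T ⊆? V
    ... | yes T⊆V = inj₁ T⊆V
    ... | no T⊈V  = let z , z∈T , z∉V = ⊈⇒∃ {U = T} {V} T⊈V in inj₂ (absorb sT FV x∈T x∈V z∈T z∉V)

  -- The least strong member of F containing a and b: d is outside iff
  -- M a b is strictly below M a d = M b d.

  Near : Fin n → Fin n → Fin n → Set
  Near a b d = d ∈ M a b ⊎ b ∉ M a d ⊎ a ∉ M b d

  near? : ∀ a b d → Dec (Near a b d)
  near? a b d = (d ∈? M a b) ⊎-dec ¬? (b ∈? M a d) ⊎-dec ¬? (a ∈? M b d)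

  abstract
    S : Fin n → Fin n → Subset n
    S a b = subset (near? a b)

    S⁺ : ∀ {a b d} → Near a b d → d ∈ S a b
    S⁺ {a} {b} = ∈-subset⁺ (near? a b)

    S⁻ : ∀ {a b d} → d ∈ S a b → Near a b d
    S⁻ {a} {b} = ∈-subset⁻ (near? a b)

  abstract
    M⊆S : ∀ {a b} → M a b ⊆ S a b
    M⊆S z∈ = S⁺ (inj₁ z∈)

    a∈S : ∀ a b → a ∈ S a b
    a∈S a b = M⊆S (a∈M a b)

    b∈S : ∀ a b → b ∈ S a b
    b∈S a b = M⊆S (b∈M a b)

    S-sym : ∀ {a b} → S a b ⊆ S b a
    S-sym d∈ with S⁻ d∈
    ... | inj₁ d∈M        = S⁺ (inj₁ (M-sym d∈M))
    ... | inj₂ (inj₁ b∉M) = S⁺ (inj₂ (inj₂ b∉M))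
    ... | inj₂ (inj₂ a∉M) = S⁺ (inj₂ (inj₁ a∉M))

  private
    abstract
      far : ∀ {a b w} → w ∉ S a b → b ∈ M a w × a ∈ M b w
      far {a} {b} {w} w∉ =
        decidable-stable (b ∈? M a w) (λ b∉ → w∉ (S⁺ (inj₂ (inj₁ b∉)))) ,
        decidable-stable (a ∈? M b w) (λ a∉ → w∉ (S⁺ (inj₂ (inj₂ a∉))))

      side⊆S : ∀ {a b d} → b ∉ M a d → M a d ⊆ S a b
      side⊆S {a} {b} {d} b∉ {z} z∈ = S⁺ (inj₂ (inj₁ λ b∈ → b∉ (M-mono (a∈M a d) z∈ b∈)))

  abstract
    -- `S a b` is the union of `M a b`, the `M a d` without `b` and the `M b d` without `a`. Each of
    -- them contains `a` or `b`, so it meets what has been collected and `F-∪` applies.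
    S-F : ∀ a b → F (S a b)
    S-F a b = finish (grow (allFin n))
      where
      Growing : List (Fin n) → Set
      Growing xs = ∃[ U ] F U × a ∈ U × b ∈ U × U ⊆ S a b × (∀ {x} → x Mem.∈ xs → x ∈ S a b → x ∈ U)
      grow : ∀ xs → Growing xs
      grow [] = M a b , M-F a b , a∈M a b , b∈M a b , M⊆S , λ ()
      grow (x ∷ xs) with grow xs | near? a b x
      ... | U , FU , a∈ , b∈ , U⊆ , h | no ¬near =
        U , FU , a∈ , b∈ , U⊆ , λ { (here refl) x∈ → contradiction (S⁻ x∈) ¬near ; (there y) → h y }
      ... | U , FU , a∈ , b∈ , U⊆ , h | yes (inj₁ x∈M) =
        U , FU , a∈ , b∈ , U⊆ , λ { (here refl) _ → M-min FU a∈ b∈ x∈M ; (there y) → h y }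
      ... | U , FU , a∈ , b∈ , U⊆ , h | yes (inj₂ (inj₁ b∉)) =
        U ∪ M a x , F-∪ FU (M-F a x) a∈ (a∈M a x) , x∈p∪q⁺ (inj₁ a∈) , x∈p∪q⁺ (inj₁ b∈) ,
        (λ z∈ → [ U⊆ , side⊆S b∉ ]′ (x∈p∪q⁻ U (M a x) z∈)) ,
        λ { (here refl) _ → x∈p∪q⁺ (inj₂ (b∈M a x)) ; (there y) z → x∈p∪q⁺ (inj₁ (h y z)) }
      ... | U , FU , a∈ , b∈ , U⊆ , h | yes (inj₂ (inj₂ a∉)) =
        U ∪ M b x , F-∪ FU (M-F b x) b∈ (a∈M b x) , x∈p∪q⁺ (inj₁ a∈) , x∈p∪q⁺ (inj₁ b∈) ,
        (λ z∈ → [ U⊆ , (λ z → S-sym (side⊆S a∉ z)) ]′ (x∈p∪q⁻ U (M b x) z∈)) ,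
        λ { (here refl) _ → x∈p∪q⁺ (inj₂ (b∈M b x)) ; (there y) z → x∈p∪q⁺ (inj₁ (h y z)) }
      finish : Growing (allFin n) → F (S a b)
      finish (U , FU , _ , _ , below , above) =
        subst F (⊆-antisym below (λ {x} → above (Memₚ.∈-allFin x))) FU

  private
    abstract
      -- For w outside S a b.
      side-outside : ∀ {a b d w} → w ∉ S a b → b ∉ M a d → d ∈ M b w
      side-outside {a} {b} {d} {w} w∉ b∉ = decidable-stable (d ∈? M b w) λ d∉ →
        M-∖ (M-F b w) (M-F a d) (proj₂ (far w∉)) (a∈M a d) (b∈M a d) d∉
          (a∈M b w) b∉ (b∈M b w) (λ w∈ → w∉ (side⊆S b∉ w∈)) (proj₂ (far w∉)) (a∈M a d)

      S⊆outside : ∀ {a b w} → w ∉ S a b → S a b ⊆ M b w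
      S⊆outside {a} {b} {w} w∉ d∈ with S⁻ d∈
      ... | inj₁ d∈M        = M-mono (proj₂ (far w∉)) (a∈M b w) d∈M
      ... | inj₂ (inj₁ b∉M) = side-outside w∉ b∉M
      ... | inj₂ (inj₂ a∉M) =
        M-mono (proj₂ (far w∉)) (b∈M b w) (side-outside (λ w∈ → w∉ (S-sym w∈)) a∉M)

  abstract
    -- Suppose that `V` leaves `S a b` at `w`. If `V` contained `a` or `b`, it would contain `M b w`
    -- and with it `S a b`. So `V` misses both, and each reason for the common point `v` to be near
    -- is refuted: either `M a b` minus `V` is a smaller member through `a` and `b`, or the union of
    -- `V` with `M a v` (or `M b v`) contains `M a w` (or `M b w`) but lacks `b` (or `a`).
    S-strong : ∀ a b → StrongF (S a b)
    S-strong a b = S-F a b , no-overlap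
      where
      no-overlap : ∀ {V v w k} → F V → v ∈ S a b → v ∈ V → w ∈ V → w ∉ S a b → k ∈ S a b → k ∉ V → ⊥
      no-overlap {V} {v} {w} {k} FV v∈S v∈V w∈V w∉S k∈S k∉V = by (S⁻ v∈S)
        where
        b∉V : b ∉ V
        b∉V b∈V = k∉V (M-min FV b∈V w∈V (S⊆outside w∉S k∈S))
        a∉V : a ∉ V
        a∉V a∈V = b∉V (M-min FV a∈V w∈V (proj₁ (far w∉S)))
        by : Near a b v → ⊥
        by (inj₁ v∈M) = M-∖ (M-F a b) FV v∈M v∈V w∈V (λ w∈M → w∉S (M⊆S w∈M))
          (a∈M a b) a∉V (b∈M a b) b∉V v∈M v∈V
        by (inj₂ (inj₁ b∉M)) =
          [ b∉M , b∉V ]′ (M-∪ (M-F a v) FV (b∈M a v) v∈V (inj₁ (a∈M a v)) (inj₂ w∈V) (proj₁ (far w∉S)))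
        by (inj₂ (inj₂ a∉M)) =
          [ a∉M , a∉V ]′ (M-∪ (M-F b v) FV (b∈M b v) v∈V (inj₁ (a∈M b v)) (inj₂ w∈V) (proj₂ (far w∉S)))

    -- A piece `M a d` of `S a b` meets `T` in `a` and misses the point `b` of `T`, so the strong
    -- set `T` absorbs it; symmetrically for `M b d`.
    S-min : ∀ {T a b} → StrongF T → a ∈ T → b ∈ T → S a b ⊆ T
    S-min {T} {a} {b} sT@(FT , st) a∈T b∈T {d} d∈S with S⁻ d∈S
    ... | inj₁ d∈M        = M-min FT a∈T b∈T d∈M
    ... | inj₂ (inj₁ b∉M) = absorb sT (M-F a d) a∈T (a∈M a d) b∈T b∉M (b∈M a d)
    ... | inj₂ (inj₂ a∉M) = absorb sT (M-F b d) b∈T (a∈M b d) a∈T a∉M (b∈M b d)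

    S-mono : ∀ {a b c d} → c ∈ S a b → d ∈ S a b → S c d ⊆ S a b
    S-mono = S-min (S-strong _ _)

    S-cong : ∀ {a b c d} → c ∈ S a b → d ∈ S a b → a ∈ S c d → b ∈ S c d → S a b ≡ S c d
    S-cong c∈ d∈ a∈ b∈ = ⊆-antisym (S-mono a∈ b∈) (S-mono c∈ d∈)

    full-strong : StrongF full
    full-strong = F-full , λ _ _ _ _ y∉ _ _ → y∉ ∈⊤

    -- The sets `S a x` all contain `a` and are therefore nested; a largest one with `x` in `U`
    -- covers `U`.
    span : ∀ {U a} → a ∈ U → ∃[ b ] b ∈ U × U ⊆ S a b
    span {U} {a} a∈U with go (allFin n)
      where
      go : ∀ xs → ∃[ b ] b ∈ U × (∀ {x} → x Mem.∈ xs → x ∈ U → x ∈ S a b)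
      go [] = a , a∈U , λ ()
      go (x ∷ xs) with go xs
      ... | b , b∈U , h with x ∈? U
      ...   | no x∉U = b , b∈U , λ { (here refl) x∈ → contradiction x∈ x∉U ; (there y) → h y }
      ...   | yes x∈U with nested (S-strong a b) (S-F a x) (a∈S a b) (a∈S a x)
      ...     | inj₁ b⊆x = x , x∈U , λ { (here refl) _ → b∈S a x ; (there y) z → b⊆x (h y z) }
      ...     | inj₂ x⊆b = b , b∈U , λ { (here refl) _ → x⊆b (b∈S a x) ; (there y) z → h y z }
    ... | b , b∈U , h = b , b∈U , λ {x} x∈U → h (Memₚ.∈-allFin x) x∈U

    strong-S : ∀ {T a} → StrongF T → a ∈ T → ∃[ b ] b ∈ T × T ≡ S a b
    strong-S sT a∈T = let b , b∈T , T⊆S = span a∈T in b , b∈T , ⊆-antisym T⊆S (S-min sT a∈T b∈T)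

    -- Dually, `S a d` is a least one among the `S a x` with `x` outside `U`. For a cluster `U`
    -- through `a` it turns out to be the parent cluster.
    cospan : ∀ {U a y} → y ∉ U → ∃[ d ] d ∉ U × (∀ {x} → x ∉ U → d ∈ S a x)
    cospan {U} {a} {y} y∉U with go (allFin n)
      where
      go : ∀ xs → ∃[ d ] d ∉ U × (∀ {x} → x Mem.∈ xs → x ∉ U → d ∈ S a x)
      go [] = y , y∉U , λ ()
      go (x ∷ xs) with go xs
      ... | d , d∉U , h with x ∈? U
      ...   | yes x∈U = d , d∉U , λ { (here refl) x∉ → contradiction x∈U x∉ ; (there y) → h y }
      ...   | no x∉U with nested (S-strong a d) (S-F a x) (a∈S a d) (a∈S a x)
      ...     | inj₁ d⊆x = d , d∉U , λ { (here refl) _ → d⊆x (b∈S a d) ; (there y) z → h y z }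
      ...     | inj₂ x⊆d = x , x∉U ,
        λ { (here refl) _ → b∈S a x ; (there y) z → S-mono (a∈S a _) (h y z) (x⊆d (b∈S a x)) }
    ... | d , d∉U , h = d , d∉U , λ {x} x∉U → h (Memₚ.∈-allFin x) x∉U

  -- Full pairs and the structure of a node

  module Node (T : Subset n) where

    -- a and b lie in different children of T.
    Cross : Fin n → Fin n → Set
    Cross a b = T ⊆ S a b

    cross-sym : ∀ {a b} → Cross a b → Cross b a
    cross-sym c x∈T = S-sym (c x∈T)

    Full : Fin n → Fin n → Set
    Full e f = Cross e f × T ⊆ M e f

    abstract
      -- Whether d is near the pair a, b is decided by M alone.
      apart : ∀ {a b d} → Cross a b → d ∈ T → d ∉ M a b → b ∈ M a d → a ∉ M b d
      apart cr d∈T d∉M b∈ a∈ with S⁻ (cr d∈T)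
      ... | inj₁ d∈M        = d∉M d∈M
      ... | inj₂ (inj₁ b∉M) = b∉M b∈
      ... | inj₂ (inj₂ a∉M) = a∉M a∈

      -- `S a d` is strong, meets `M a b` in `a` and has the point `d` outside `M a b`; hence it
      -- absorbs `M a b` and contains `b`.
      cross-new : ∀ {a b d} → Cross a b → d ∉ M a b → Cross a d
      cross-new {a} {b} {d} cr d∉M t∈T = S-mono (a∈S a d)
        (absorb (S-strong a d) (M-F a b) (a∈S a d) (a∈M a b) (b∈S a d) d∉M (b∈M a b)) (cr t∈T)

      cross-new′ : ∀ {a b d} → Cross a b → d ∉ M a b → Cross b d
      cross-new′ cr d∉M = cross-new (cross-sym cr) (λ d∈ → d∉M (M-sym d∈))

    private
      abstract
        -- Otherwise `M a d` and `M b d`, which meet in `d`, cover `M a b`, and one of them contains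
        -- `c`. Then `M c d` contains neither `a` nor `b`, and `M a b` minus `M c d` is a member
        -- through both that lacks `c`.
        third : ∀ {a b c d} → Cross a c → Cross b c → c ∈ M a b → d ∈ T → d ∉ M a b → b ∉ M a d →
          a ∈ M b d
        third {a} {b} {c} {d} ac bc c∈ d∈T d∉ b∉ = decidable-stable (a ∈? M b d) λ a∉ →
          let c∈DV = M-∪ (M-F a d) (M-F b d) (b∈M a d) (b∈M b d) (inj₁ (a∈M a d)) (inj₂ (a∈M b d)) c∈
              a∉cd : a ∉ M c d
              a∉cd = [ (λ c∈D → λ a∈ → apart ac d∈T (λ d∈ → d∉ (M-mono (a∈M a b) c∈ d∈)) c∈D a∈)
                     , (λ c∈V a∈ → a∉ (M-mono c∈V (b∈M b d) a∈)) ]′ c∈DV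
              b∉cd : b ∉ M c d
              b∉cd = [ (λ c∈D b∈ → b∉ (M-mono c∈D (b∈M a d) b∈))
                     , (λ c∈V b∈ → apart bc d∈T (λ d∈ → d∉ (M-mono (b∈M a b) c∈ d∈)) c∈V b∈) ]′ c∈DV
          in M-∖ (M-F a b) (M-F c d) c∈ (a∈M c d) (b∈M c d) d∉ (a∈M a b) a∉cd (b∈M a b) b∉cd c∈ (a∈M c d)

    abstract
      -- As long as `M a b` leaves out a point `d` of `T`, one of the pairs `a`, `d` and `b`, `d`
      -- has a strictly larger least member, which again contains a point of a third child; the size
      -- bounds the number of enlargements. Contrapositively, without full pairs `M a b` reaches no
      -- third child.
      full-pair : ∀ {a b c} → a ∈ T → b ∈ T → Cross a b → Cross a c → Cross b c → c ∈ T → c ∈ M a b →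
        ∃[ e ] ∃[ f ] e ∈ T × f ∈ T × Full e f
      full-pair {a} {b} a∈T b∈T ab ac bc c∈T c∈ = go n a∈T b∈T ab ac bc c∈T c∈ (m≤m+n n _)
        where
        go : ∀ k {a b c} → a ∈ T → b ∈ T → Cross a b → Cross a c → Cross b c → c ∈ T → c ∈ M a b →
          n ≤ k + ∣ M a b ∣ → ∃[ e ] ∃[ f ] e ∈ T × f ∈ T × Full e f
        go k {a} {b} a∈T b∈T ab ac bc c∈T c∈ n≤ with T ⊆? M a b
        go k {a} {b} a∈T b∈T ab ac bc c∈T c∈ n≤ | yes T⊆ = a , b , a∈T , b∈T , ab , T⊆
        go zero {a} {b} a∈T b∈T ab ac bc c∈T c∈ n≤ | no T⊈ = contradiction
          (λ {x} _ → subst (x ∈_) (sym (∣p∣≡n⇒p≡⊤ (≤-antisym (∣p∣≤n (M a b)) n≤))) ∈⊤) T⊈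
        go (suc k) {a} {b} {c} a∈T b∈T ab ac bc c∈T c∈ n≤ | no T⊈ with ⊈⇒∃ {U = T} {M a b} T⊈
        ... | d , d∈T , d∉ = case b ∈? M a d of λ
          { (yes b∈) → extend a∈T b∈T (cross-new ab d∉) ab (cross-sym (cross-new′ ab d∉)) b∈ (a∈M a d) b∈
          ; (no b∉)  → let a∈ = third ac bc c∈ d∈T d∉ b∉ in
              extend b∈T a∈T (cross-new′ ab d∉) (cross-sym ab) (cross-sym (cross-new ab d∉)) a∈ a∈ (a∈M b d)
          }
          where
          extend : ∀ {p q} → p ∈ T → q ∈ T → Cross p d → Cross p q → Cross d q → q ∈ M p d →
            a ∈ M p d → b ∈ M p d → ∃[ e ] ∃[ f ] e ∈ T × f ∈ T × Full e f
          extend {p} {q} p∈T q∈T pd pq dq q∈ a∈ b∈ = go k p∈T d∈T pd pq dq q∈T q∈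
            (≤-trans n≤ (≤-trans (≤-reflexive (sym (+-suc k _))) (+-monoʳ-≤ k
              (p⊂q⇒∣p∣<∣q∣ (M-mono a∈ b∈ , d , b∈M p d , d∉)))))

      -- The sets M e d, for d in T, form a chain if e belongs to a full pair.
      chain : ∀ {e f c d} → f ∈ T → c ∈ T → d ∈ T → Full e f → Cross e c → c ∈ M e d ⊎ d ∈ M e c
      chain {e} {f} {c} {d} f∈T c∈T d∈T (ef , T⊆) ec with c ∈? M e d | d ∈? M e c
      ... | yes c∈ | _      = inj₁ c∈
      ... | no _   | yes d∈ = inj₂ d∈
      ... | no c∉  | no d∉  = contradiction (c∈P , d∈P) λ (c∈ , d∈) → apart cd f∈T f∉cd d∈ c∈
        where
        ed : Cross e d
        ed = cross-new ec d∉
        cd : Cross c d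
        cd = cross-new′ ec d∉
        f∉c : f ∉ M e c
        f∉c f∈ = d∉ (M-mono (a∈M e c) f∈ (T⊆ d∈T))
        f∉d : f ∉ M e d
        f∉d f∈ = c∉ (M-mono (a∈M e d) f∈ (T⊆ c∈T))
        d∈P : d ∈ M c f
        d∈P = [ (λ d∈ → contradiction d∈ d∉) , id ]′
          (M-∪ (M-F e c) (M-F c f) (b∈M e c) (a∈M c f) (inj₁ (a∈M e c)) (inj₂ (b∈M c f)) (T⊆ d∈T))
        c∈P : c ∈ M d f
        c∈P = [ (λ c∈ → contradiction c∈ c∉) , id ]′
          (M-∪ (M-F e d) (M-F d f) (b∈M e d) (a∈M d f) (inj₁ (a∈M e d)) (inj₂ (b∈M d f)) (T⊆ c∈T))
        f∉cd : f ∉ M c d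
        f∉cd f∈ = [ f∉c , f∉d ]′
          (M-∪ (M-F e c) (M-F e d) (a∈M e c) (a∈M e d) (inj₁ (b∈M e c)) (inj₂ (b∈M e d)) f∈)

    private
      abstract
        -- If `M e x` misses a point of `T`, it misses `c` and `d`. Then `M x c` contains `d`, so
        -- `M c d` misses `e`, and the fullness of both pairs at `e` contradicts `apart` for `c` and
        -- `d`.
        full-all : ∀ {e c d x} → c ∈ T → d ∈ T → x ∈ T → e ∈ T → Full e c → Full e d → Cross c d → Cross e x →
          T ⊆ M e x
        full-all {e} {c} {d} {x} c∈T d∈T x∈T e∈T (ec , c⊆) (ed , d⊆) cd ex {t} t∈T =
          decidable-stable (t ∈? M e x) λ t∉ →
          let c∉ : c ∉ M e x
              c∉ c∈ = t∉ (M-mono (a∈M e x) c∈ (c⊆ t∈T))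
              d∉ : d ∉ M e x
              d∉ d∈ = t∉ (M-mono (a∈M e x) d∈ (d⊆ t∈T))
              d∈xc : d ∈ M x c
              d∈xc = [ (λ d∈ → contradiction d∈ d∉) , id ]′
                (M-∪ (M-F e x) (M-F x c) (b∈M e x) (a∈M x c) (inj₁ (a∈M e x)) (inj₂ (b∈M x c)) (c⊆ d∈T))
              e∉cd : e ∉ M c d
              e∉cd e∈ = apart ex c∈T c∉ (c⊆ x∈T) (M-mono (b∈M x c) d∈xc e∈)
          in apart cd e∈T e∉cd (M-sym (c⊆ d∈T)) (M-sym (d⊆ c∈T))

        cross-either : ∀ {e x y} → e ∈ T → Cross x y → Cross e x ⊎ Cross e y
        cross-either {e} {x} {y} e∈T xy with y ∈? S e x
        ... | yes y∈ = inj₁ (λ t∈T → S-mono (b∈S e x) y∈ (xy t∈T))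
        ... | no y∉  = inj₂ (λ t∈T →
          S-mono (absorb (S-strong e y) (S-F e x) (a∈S e y) (a∈S e x) (b∈S e y) y∉ (b∈S e x)) (b∈S e y) (xy t∈T))

    abstract
      -- A node in which some point is in full pairs with two children is prime.
      prime-node : ∀ {e c d} → e ∈ T → c ∈ T → d ∈ T → Full e c → Full e d → Cross c d →
        ∀ {x y} → x ∈ T → y ∈ T → Cross x y → T ⊆ M x y
      prime-node {e} e∈T c∈T d∈T ec ed cd {x} {y} x∈T y∈T xy {t} t∈T with e ∈? M x y
      ... | yes e∈ = by (cross-either e∈T xy)
        where
        by : Cross e x ⊎ Cross e y → t ∈ M x y
        by (inj₁ ex) = M-mono e∈ (a∈M x y) (full-all c∈T d∈T x∈T e∈T ec ed cd ex t∈T)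
        by (inj₂ ey) = M-mono e∈ (b∈M x y) (full-all c∈T d∈T y∈T e∈T ec ed cd ey t∈T)
      ... | no e∉  = contradiction
          (M-sym (full-all c∈T d∈T x∈T e∈T ec ed cd (cross-sym (cross-new xy e∉)) y∈T))
          λ y∈ → apart xy e∈T e∉ y∈ (M-sym (full-all c∈T d∈T y∈T e∈T ec ed cd (cross-sym (cross-new′ xy e∉)) x∈T))

      -- In a node with a full pair that is not prime the chain is strict.
      strict : ∀ {e f c d x y} → e ∈ T → f ∈ T → c ∈ T → d ∈ T → Full e f →
        x ∈ T → y ∈ T → Cross x y → ¬ T ⊆ M x y →
        Cross e c → Cross e d → Cross c d → c ∈ M e d → d ∈ M e c → ⊥
      strict {e} {f} {c} {d} e∈T f∈T c∈T d∈T (ef , T⊆) x∈T y∈T xy T⊈ ec ed cd c∈ d∈ with f ∈? M e c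
      ... | yes f∈ = T⊈ (prime-node e∈T c∈T d∈T
          (ec , λ t∈T → M-mono (a∈M e c) f∈ (T⊆ t∈T))
          (ed , λ t∈T → M-mono (a∈M e d) (M-mono (a∈M e d) c∈ f∈) (T⊆ t∈T)) cd x∈T y∈T xy)
      ... | no f∉ with d ∈? M c f
      ...   | no d∉ = M-∖ (M-F e c) (M-F c f) (b∈M e c) (a∈M c f) (b∈M c f) f∉
          (a∈M e c) (apart ec f∈T f∉ (T⊆ c∈T)) d∈ d∉ c∈ (a∈M c f)
      ...   | yes d∈′ = M-∖ (M-F e d) (M-F d f) (b∈M e d) (a∈M d f) (b∈M d f) f∉d
          (a∈M e d) (apart ed f∈T f∉d (T⊆ d∈T)) c∈ (apart cd f∈T f∉cd d∈′) d∈ (a∈M d f)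
        where
        f∉d : f ∉ M e d
        f∉d f∈ = f∉ (M-mono (a∈M e c) d∈ f∈)
        f∉cd : f ∉ M c d
        f∉cd f∈ = f∉ (M-mono (b∈M e c) d∈ f∈)

      -- `M e x` plays the role of the initial segment ending at `x`. Together with `not-before`
      -- this identifies `M x y` as the segment from `x` to `y`. It holds because `M e x` and
      -- `M x y` meet in `x` and together cover `M e y`.
      between : ∀ {e x y z} → z ∈ M e y → z ∉ M e x → z ∈ M x y
      between {e} {x} {y} z∈ z∉ = [ (λ z∈x → contradiction z∈x z∉) , id ]′
        (M-∪ (M-F e x) (M-F x y) (b∈M e x) (a∈M x y) (inj₁ (a∈M e x)) (inj₂ (b∈M x y)) z∈)

      -- Otherwise `M x y` and `M e z` overlap in `z`, with `e` only in the latter, and removing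
      -- `M e z` leaves a member through `x` and `y` without `z`.
      not-before : ∀ {e x y z} → y ∈ T → Cross e x → x ∈ M e y → y ∉ M e x → z ∈ M e x → x ∉ M e z →
        z ∉ M x y
      not-before {e} {x} {y} {z} y∈T ex x∈ y∉ z∈ x∉ z∈xy =
        M-∖ (M-F x y) (M-F e z) z∈xy (b∈M e z) (a∈M e z) (apart ex y∈T y∉ x∈)
          (a∈M x y) x∉ (b∈M x y) (λ y∈ → y∉ (M-mono (a∈M e x) z∈ y∈)) z∈xy (b∈M e z)

-- Class listings and the naming of classes

unique-++ : ∀ {A : Set} (xs : List A) {ys y} → Unique (xs ++ ys) → y Mem.∈ xs → y Mem.∈ ys → ⊥
unique-++ (x ∷ xs) (x∉ AllPairs.∷ u) (here refl) y∈ys = All.lookup x∉ (Memₚ.∈-++⁺ʳ xs y∈ys) refl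
unique-++ (x ∷ xs) (x∉ AllPairs.∷ u) (there y∈)  y∈ys = unique-++ xs u y∈ y∈ys

unique-++ʳ : ∀ {A : Set} (xs : List A) {ys} → Unique (xs ++ ys) → Unique ys
unique-++ʳ []       u                  = u
unique-++ʳ (x ∷ xs) (_ AllPairs.∷ u) = unique-++ʳ xs u

module _ {m : ℕ} where

  private
    n = suc m

  infix 4 _∈ˡ?_
  _∈ˡ?_ : ∀ (x : Fin n) xs → Dec (x Mem.∈ xs)
  x ∈ˡ? xs = Any.any? (x Finₚ.≟_) xs

  classOf : List (List (Fin n)) → Fin n → List (Fin n)
  classOf []       y = []
  classOf (C ∷ Cs) y = if does (y ∈ˡ? C) then C else classOf Cs y

  -- The element that names a class; zero is a junk value.
  first : List (Fin n) → Fin n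
  first []      = zero
  first (y ∷ _) = y

  first-∈ : ∀ {y C} → y Mem.∈ C → first C Mem.∈ C
  first-∈ (here refl) = here refl
  first-∈ (there _)   = here refl

  classOf-≡ : ∀ Cs {C y} → Unique (concat Cs) → C Mem.∈ Cs → y Mem.∈ C → classOf Cs y ≡ C
  classOf-≡ (C ∷ Cs) {y = y} u (here refl) y∈ with y ∈ˡ? C
  ... | yes _  = refl
  ... | no y∉  = contradiction y∈ y∉
  classOf-≡ (C ∷ Cs) {y = y} u (there C∈) y∈ with y ∈ˡ? C
  ... | yes y∈′ = contradiction (Memₚ.∈-concat⁺′ y∈ C∈) (unique-++ C u y∈′)
  ... | no _    = classOf-≡ Cs (unique-++ʳ C u) C∈ y∈

  classOf-none : ∀ Cs {y} → ¬ y Mem.∈ concat Cs → classOf Cs y ≡ []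
  classOf-none []       y∉ = refl
  classOf-none (C ∷ Cs) {y} y∉ with y ∈ˡ? C
  ... | yes y∈ = contradiction (Memₚ.∈-++⁺ˡ y∈) y∉
  ... | no _   = classOf-none Cs (λ y∈ → y∉ (Memₚ.∈-++⁺ʳ C y∈))

  -- A class is named by its first listed element, which is known as soon as the class is read. The
  -- diagonal gets `zero`, the content of a cell that is never written.
  label : Listing n → Fin n → Fin n → Fin n
  label L x y = first (classOf (L x) y)

-- Umodules in terms of labels, and their weakly partitive family

module Umodules {m : ℕ} (R : HomogeneousRelation (suc m)) (L : Listing (suc m))
  (lists : Lists R L) (self-complemented : SelfComplemented R) where

  private
    n = suc m

  open HomogeneousRelation R
  open Lists lists

  lab : Fin n → Fin n → Fin n
  lab = label L

  H⇒lab : ∀ {x} (y z : Other x) → T (H x y z) → lab x (Other.elem y) ≡ lab x (Other.elem z)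
  H⇒lab {x} y z h with Equivalence.to (classes x y z) h
  ... | C , C∈ , y∈ , z∈ = cong first
    (trans (classOf-≡ (L x) (disjoint x) C∈ y∈) (sym (classOf-≡ (L x) (disjoint x) C∈ z∈)))

  private
    home : ∀ {x} (y : Other x) → ∃[ C ] C Mem.∈ L x × Other.elem y Mem.∈ C × lab x (Other.elem y) Mem.∈ C
    home {x} y with Equivalence.to (classes x y y) (IsEquivalence.refl (isEquivalence x))
    ... | C , C∈ , y∈ , _ = C , C∈ , y∈ ,
      subst (λ D → first D Mem.∈ C) (sym (classOf-≡ (L x) (disjoint x) C∈ y∈)) (first-∈ y∈)

  lab⇒H : ∀ {x} (y z : Other x) → lab x (Other.elem y) ≡ lab x (Other.elem z) → T (H x y z)
  lab⇒H {x} y z eq with home y | home z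
  ... | C , C∈ , y∈ , f∈ | D , D∈ , z∈ , g∈ = Equivalence.from (classes x y z)
    (C , C∈ , y∈ , subst (Other.elem z Mem.∈_)
      (trans (sym (classOf-≡ (L x) (disjoint x) D∈ g∈))
        (trans (cong (classOf (L x)) (sym eq)) (classOf-≡ (L x) (disjoint x) C∈ f∈))) z∈)

  -- IsUmodule in terms of labels.
  UM : Subset n → Set
  UM U = ∀ {u u′ x x′} → u ∈ U → u′ ∈ U → x ∉ U → x′ ∉ U → lab u x ≡ lab u x′ → lab u′ x ≡ lab u′ x′

  IsUmodule⇒UM : ∀ {U} → IsUmodule R U → UM U
  IsUmodule⇒UM um u∈ u′∈ x∉ x′∉ eq = H⇒lab _ _
    (subst T (um u∈ u′∈ x∉ x′∉) (lab⇒H (other _ (separated u∈ x∉)) (other _ (separated u∈ x′∉)) eq))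

  UM⇒IsUmodule : ∀ {U} → UM U → IsUmodule R U
  UM⇒IsUmodule um u∈ u′∈ x∉ x′∉ = T-ext (go u∈ u′∈) (go u′∈ u∈)
    where
    T-ext : ∀ {a b} → (T a → T b) → (T b → T a) → a ≡ b
    T-ext {true}  {true}  f g = refl
    T-ext {true}  {false} f g = ⊥-elim (f tt)
    T-ext {false} {true}  f g = ⊥-elim (g tt)
    T-ext {false} {false} f g = refl
    go : ∀ {u u′} (u∈ : u ∈ _) (u′∈ : u′ ∈ _) →
      T (H u (other _ (separated u∈ x∉)) (other _ (separated u∈ x′∉))) →
      T (H u′ (other _ (separated u′∈ x∉)) (other _ (separated u′∈ x′∉)))
    go u∈ u′∈ h = lab⇒H _ _ (um u∈ u′∈ x∉ x′∉ (H⇒lab (other _ (separated u∈ x∉)) (other _ (separated u∈ x′∉)) h))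

  ∁∁ : ∀ (U : Subset n) → ∁ (∁ U) ≡ U
  ∁∁ U = ⊆-antisym (λ x∈ → x∉∁p⇒x∈p (x∈∁p⇒x∉p x∈)) (λ x∈ → x∉p⇒x∈∁p (x∈p⇒x∉∁p x∈))

  UM-∁ : ∀ {U} → UM U → UM (∁ U)
  UM-∁ um = IsUmodule⇒UM (self-complemented _ (UM⇒IsUmodule um))

  -- A common point `w` mediates: the row of any point of the union is compared with row `w` inside
  -- one of the two sets.
  UM-∪ : ∀ {U V x} → UM U → UM V → x ∈ U → x ∈ V → UM (U ∪ V)
  UM-∪ {U} {V} {w} umU umV w∈U w∈V u∈ u′∈ x∉ x′∉ eq = from u′∈ (to u∈ eq)
    where
    U∌ : ∀ {y} → y ∉ U ∪ V → y ∉ U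
    U∌ y∉ y∈ = y∉ (x∈p∪q⁺ (inj₁ y∈))
    V∌ : ∀ {y} → y ∉ U ∪ V → y ∉ V
    V∌ y∉ y∈ = y∉ (x∈p∪q⁺ (inj₂ y∈))
    to : ∀ {u} → u ∈ U ∪ V → lab u _ ≡ lab u _ → lab w _ ≡ lab w _
    to u∈ eq = [ (λ u∈ → umU u∈ w∈U (U∌ x∉) (U∌ x′∉) eq)
               , (λ u∈ → umV u∈ w∈V (V∌ x∉) (V∌ x′∉) eq) ]′ (x∈p∪q⁻ U V u∈)
    from : ∀ {u} → u ∈ U ∪ V → lab w _ ≡ lab w _ → lab u _ ≡ lab u _
    from u∈ eq = [ (λ u∈ → umU w∈U u∈ (U∌ x∉) (U∌ x′∉) eq)
                 , (λ u∈ → umV w∈V u∈ (V∌ x∉) (V∌ x′∉) eq) ]′ (x∈p∪q⁻ U V u∈)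

  -- Of {U , ∁ U} the side without zero is taken. Being a umodule is then
  -- expressed by closed conditions on triples: this uses that ∁ U is a umodule.

  Agrees : Subset n → Fin n → Set
  Agrees U x = ∀ y → y ∈ U → ∀ z → z ∈ U →
    (lab x y ≡ lab x z → lab zero y ≡ lab zero z) × (lab zero y ≡ lab zero z → lab x y ≡ lab x z)

  abstract
    F : Subset n → Set
    F U = U ≡ full ⊎ (zero ∉ U × Nonempty U × (∀ x → x ∉ U → Agrees U x))

    agrees? : ∀ U x → Dec (Agrees U x)
    agrees? U x = Finₚ.all? λ y → (y ∈? U) →-dec Finₚ.all? λ z → (z ∈? U) →-dec
      (((lab x y Finₚ.≟ lab x z) →-dec (lab zero y Finₚ.≟ lab zero z)) ×-dec
       ((lab zero y Finₚ.≟ lab zero z) →-dec (lab x y Finₚ.≟ lab x z)))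

    F? : ∀ U → Dec (F U)
    F? U = Vecₚ.≡-dec Data.Bool._≟_ U full ⊎-dec
      (¬? (zero ∈? U) ×-dec nonempty? U ×-dec Finₚ.all? λ x → ¬? (x ∈? U) →-dec agrees? U x)

    UM⇒F : ∀ {U} → zero ∉ U → Nonempty U → UM U → F U
    UM⇒F 0∉ ne um = inj₂ (0∉ , ne , λ x x∉ y y∈ z z∈ →
      let go = λ {u} {v} (u∉ : u ∉ _) (v∉ : v ∉ _) → UM-∁ um (x∉p⇒x∈∁p u∉) (x∉p⇒x∈∁p v∉) (x∈p⇒x∉∁p y∈) (x∈p⇒x∉∁p z∈)
      in go x∉ 0∉ , go 0∉ x∉)

    -- Agreement of all outside rows with row `zero` says directly that `∁ U` is a umodule;
    -- self-complementedness carries this back to `U`.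
    agrees⇒UM : ∀ {U} → (∀ x → x ∉ U → Agrees U x) → UM U
    agrees⇒UM {U} ag = subst UM (∁∁ U) (UM-∁ λ u∈ u′∈ x∉ x′∉ eq →
      proj₂ (ag _ (x∈∁p⇒x∉p u′∈) _ (x∉∁p⇒x∈p x∉) _ (x∉∁p⇒x∈p x′∉))
        (proj₁ (ag _ (x∈∁p⇒x∉p u∈) _ (x∉∁p⇒x∈p x∉) _ (x∉∁p⇒x∈p x′∉)) eq))

    F⁺ : ∀ {U} → U ≡ full ⊎ (zero ∉ U × Nonempty U × (∀ x → x ∉ U → Agrees U x)) → F U
    F⁺ = id

    F⁻ : ∀ {U} → F U → U ≡ full ⊎ (zero ∉ U × Nonempty U × (∀ x → x ∉ U → Agrees U x))
    F⁻ = id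

    F-full : F full
    F-full = inj₁ refl

    F-nonempty : ∀ {U} → F U → Nonempty U
    F-nonempty (inj₁ refl)         = zero , ∈⊤
    F-nonempty (inj₂ (_ , ne , _)) = ne

    F-zero : ∀ {U} → F U → zero ∈ U → U ≡ full
    F-zero (inj₁ eq)      _  = eq
    F-zero (inj₂ (0∉ , _)) 0∈ = contradiction 0∈ 0∉

    F-∪ : ∀ {U V x} → F U → F V → x ∈ U → x ∈ V → F (U ∪ V)
    F-∪ {V = V} (inj₁ refl) FV _ _ = inj₁ (⊆-antisym (λ _ → ∈⊤) (λ _ → x∈p∪q⁺ (inj₁ ∈⊤)))
    F-∪ (inj₂ _) (inj₁ refl) _ _ = inj₁ (⊆-antisym (λ _ → ∈⊤) (λ _ → x∈p∪q⁺ (inj₂ ∈⊤)))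
    F-∪ {U} {V} (inj₂ (0∉U , (a , a∈) , agU)) (inj₂ (0∉V , _ , agV)) x∈U x∈V =
      UM⇒F (λ 0∈ → [ 0∉U , 0∉V ]′ (x∈p∪q⁻ U V 0∈)) (a , x∈p∪q⁺ (inj₁ a∈))
        (UM-∪ (agrees⇒UM agU) (agrees⇒UM agV) x∈U x∈V)

    -- A row outside the intersection is outside `U` or outside `V`, and `Agrees` passes to subsets.
    F-∩ : ∀ {U V x} → F U → F V → x ∈ U → x ∈ V → F (U ∩ V)
    F-∩ {V = V} (inj₁ refl) FV _ _ =
      subst F (⊆-antisym (λ x∈ → x∈p∩q⁺ (∈⊤ , x∈)) (λ x∈ → proj₂ (x∈p∩q⁻ full V x∈))) FV
    F-∩ {U} FU@(inj₂ _) (inj₁ refl) _ _ =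
      subst F (⊆-antisym (λ x∈ → x∈p∩q⁺ (x∈ , ∈⊤)) (λ x∈ → proj₁ (x∈p∩q⁻ U full x∈))) FU
    F-∩ {U} {V} (inj₂ (0∉U , _ , agU)) (inj₂ (_ , _ , agV)) x∈U x∈V =
      inj₂ ((λ 0∈ → 0∉U (proj₁ (x∈p∩q⁻ U V 0∈))) , (_ , x∈p∩q⁺ (x∈U , x∈V)) , ag)
      where
      ag : ∀ x → x ∉ U ∩ V → Agrees (U ∩ V) x
      ag x x∉ y y∈ z z∈ with x ∈? U | x∈p∩q⁻ U V y∈ | x∈p∩q⁻ U V z∈
      ... | no x∉U  | y∈U , _ | z∈U , _ = agU x x∉U y y∈U z z∈U
      ... | yes x∈U | _ , y∈V | _ , z∈V = agV x (λ x∈V → x∉ (x∈p∩q⁺ (x∈U , x∈V))) y y∈V z z∈V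

    -- The difference is the complement of `∁ U ∪ V`, a union of two umodules that meet in `y`.
    F-∖ : ∀ {U V x y z} → F U → F V → x ∈ U → x ∈ V → y ∈ V → y ∉ U → z ∈ U → z ∉ V → F (U ∩ ∁ V)
    F-∖ (inj₁ refl) FV _ _ _ y∉ _ _ = contradiction ∈⊤ y∉
    F-∖ (inj₂ _) (inj₁ refl) _ _ _ _ _ z∉ = contradiction ∈⊤ z∉
    F-∖ {U} {V} {z = z} (inj₂ (0∉U , _ , agU)) (inj₂ (_ , _ , agV)) _ _ y∈V y∉U z∈U z∉V =
      UM⇒F (λ 0∈ → 0∉U (proj₁ (∈-∖⁻ U V 0∈))) (z , ∈-∖⁺ z∈U z∉V)
        (subst UM (⊆-antisym below above)
          (UM-∁ (UM-∪ (UM-∁ (agrees⇒UM agU)) (agrees⇒UM agV) (x∉p⇒x∈∁p y∉U) y∈V)))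
      where
      below : ∁ (∁ U ∪ V) ⊆ U ∩ ∁ V
      below x∈ = let x∉ = x∈∁p⇒x∉p x∈ in
        ∈-∖⁺ (x∉∁p⇒x∈p (λ x∈′ → x∉ (x∈p∪q⁺ (inj₁ x∈′)))) (λ x∈′ → x∉ (x∈p∪q⁺ (inj₂ x∈′)))
      above : U ∩ ∁ V ⊆ ∁ (∁ U ∪ V)
      above x∈ = let x∈U , x∉V = ∈-∖⁻ U V x∈ in
        x∉p⇒x∈∁p (λ x∈′ → [ x∈p⇒x∉∁p x∈U , x∉V ]′ (x∈p∪q⁻ (∁ U) V x∈′))

    F-singleton : ∀ {x} → x ≢ zero → F ⁅ x ⁆
    F-singleton {x} x≢0 = UM⇒F (λ 0∈ → x≢0 (sym (x∈⁅y⁆⇒x≡y x 0∈))) (x , x∈⁅x⁆ x)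
      (λ u∈ u′∈ _ _ eq → subst (λ v → lab v _ ≡ lab v _)
        (trans (x∈⁅y⁆⇒x≡y x u∈) (sym (x∈⁅y⁆⇒x≡y x u′∈))) eq)

  open Partitive F F? F-full F-∪ F-∩ F-∖ public

  abstract
    InB⇒F : ∀ {U} → zero ∉ U → InB R U → F U
    InB⇒F {U} 0∉ (um , U≢∅ , _) with nonempty? U
    ... | yes ne = UM⇒F 0∉ ne (IsUmodule⇒UM um)
    ... | no ¬ne = contradiction (Empty-unique ¬ne) U≢∅

    F⇒InB : ∀ {U} → zero ∉ U → F U → InB R U
    F⇒InB 0∉ (inj₁ refl) = contradiction ∈⊤ 0∉
    F⇒InB 0∉ (inj₂ (_ , (x , x∈) , ag)) =
      UM⇒IsUmodule (agrees⇒UM ag) , (λ { refl → ∉⊥ x∈ }) , (λ { refl → 0∉ ∈⊤ })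

    InB-∁ : ∀ {U} → InB R U → InB R (∁ U)
    InB-∁ {U} (um , U≢∅ , U≢full) = self-complemented U um ,
      (λ eq → U≢full (⊆-antisym (λ _ → ∈⊤) (λ {x} _ → x∉∁p⇒x∈p (λ x∈ → ∉⊥ (subst (x ∈_) eq x∈))))) ,
      (λ eq → U≢∅ (⊆-antisym (λ {x} x∈ → contradiction (subst (x ∈_) (sym eq) ∈⊤) (x∈p⇒x∉∁p x∈)) (λ x∈ → contradiction x∈ ∉⊥)))

    Strong-∁ : ∀ {U} → Strong R U → Strong R (∁ U)
    Strong-∁ {U} (inB , st) = InB-∁ inB , λ V inV (a , b , c , d) →
      st V inV (subst (λ U → Nonempty (U ∩ V)) (∁∁ U) c , subst (λ U → Nonempty (U ∩ ∁ V)) (∁∁ U) d , a , b)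

    Strong⇒StrongF : ∀ {U} → zero ∉ U → Strong R U → StrongF U
    Strong⇒StrongF {U} 0∉ (inB , st) = InB⇒F 0∉ inB ,
      λ { (inj₁ refl) _ _ _ _ _ z∉ → z∉ ∈⊤
        ; {V} FV@(inj₂ (0∉V , _)) x∈U x∈V y∈V y∉U z∈U z∉V → st V (F⇒InB 0∉V FV)
            ((_ , x∈p∩q⁺ (x∈U , x∈V)) , (_ , ∈-∖⁺ z∈U z∉V) ,
             (_ , x∈p∩q⁺ (x∉p⇒x∈∁p y∉U , y∈V)) , (zero , ∈-∖⁺ (x∉p⇒x∈∁p 0∉) 0∉V)) }

    -- If `V` contains `zero`, its complement is used instead, which only permutes the four regions
    -- of the overlap.
    StrongF⇒Strong : ∀ {U} → zero ∉ U → StrongF U → Strong R U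
    StrongF⇒Strong {U} 0∉ (FU , st) = F⇒InB 0∉ FU , no-overlap
      where
      no-overlap : ∀ V → InB R V → ¬ Overlap R U V
      no-overlap V inV ((a , a∈) , (b , b∈) , (c , c∈) , (d , d∈))
        with zero ∈? V | x∈p∩q⁻ U V a∈ | ∈-∖⁻ U V b∈ | x∈p∩q⁻ (∁ U) V c∈ | ∈-∖⁻ (∁ U) V d∈
      ... | no 0∉V  | aU , aV | bU , bV | cU , cV | _ =
        st (InB⇒F 0∉V inV) aU aV cV (x∈∁p⇒x∉p cU) bU bV
      ... | yes 0∈V | aU , aV | bU , bV | _ | dU , dV =
        st (InB⇒F (x∈p⇒x∉∁p 0∈V) (InB-∁ inV)) bU (x∉p⇒x∈∁p bV) (x∉p⇒x∈∁p dV) (x∈∁p⇒x∉p dU) aU (x∈p⇒x∉∁p aV)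

-- Duplicate-free lists and simple paths in graphs

unique-++ˡ : ∀ {A : Set} (xs : List A) {ys} → Unique (xs ++ ys) → Unique xs
unique-++ˡ []       u                    = AllPairs.[]
unique-++ˡ (x ∷ xs) (x∉ AllPairs.∷ u) =
  All.tabulate (λ y∈ → All.lookup x∉ (Memₚ.∈-++⁺ˡ y∈)) AllPairs.∷ unique-++ˡ xs u

unique-rotate : ∀ {A : Set} (xs : List A) {a} → Unique (xs ++ [ a ]) → Unique (a ∷ xs)
unique-rotate xs u =
  All.tabulate (λ { y∈ refl → unique-++ xs u y∈ (here refl) }) AllPairs.∷ unique-++ˡ xs u

module Paths {V : Set} (_≟_ : ∀ (v w : V) → Dec (v ≡ w)) (E : V → V → Set) where

  data Walk : V → List V → V → Set where
    stop : ∀ {v} → Walk v [] v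
    step : ∀ {u v w vs} → E u v → Walk v vs w → Walk u (v ∷ vs) w

  suffix : ∀ {u v w vs} → Walk v vs w → Unique (v ∷ vs) → u Mem.∈ v ∷ vs →
    ∃[ us ] Walk u us w × Unique (u ∷ us)
  suffix p          un                  (here refl) = _ , p , un
  suffix (step e p) (_ AllPairs.∷ un) (there u∈)  = suffix p un u∈

  simple : ∀ {v w} → Star E v w → ∃[ vs ] Walk v vs w × Unique (v ∷ vs)
  simple ε = [] , stop , All.[] AllPairs.∷ AllPairs.[]
  simple {v} (_◅_ {j = u} e p) with simple p
  ... | us , q , un with Any.any? (v ≟_) (u ∷ us)
  ...   | yes v∈ = suffix q un v∈
  ...   | no v∉  = u ∷ us , step e q , All.tabulate (λ { w∈ refl → v∉ w∈ }) AllPairs.∷ un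

  -- Brings a walk into the form `u ∷ us ++ [ w ]`, the one in which `acyclic` excludes closed
  -- walks.
  unsnoc : ∀ {u v vs w} → E u v → Walk v vs w →
    ∃[ us ] v ∷ vs ≡ us ++ [ w ] × Linked E (u ∷ us ++ [ w ])
  unsnoc e stop = [] , refl , e Linked.∷ Linked.[-]
  unsnoc {v = v} e (step f p) = let us , eq , l = unsnoc f p in
    v ∷ us , cong (v ∷_) eq , e Linked.∷ l

-- Uniqueness: a decomposition tree is determined by its clusters

module _ {m : ℕ} (R : HomogeneousRelation (suc m)) where

  private
    n = suc m

  -- The clusters of a decomposition tree rooted at the leaf labelled zero.
  Cluster : Subset n → Set
  Cluster C = C ≡ full ⊎ (zero ∉ C × Strong R C)

  infix 4 _⋖_
  _⋖_ : Subset n → Subset n → Set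
  A ⋖ B = A ⊆ B × ¬ B ⊆ A × (∀ C → Cluster C → A ⊆ C → C ⊆ B → C ⊆ A ⊎ B ⊆ C)

  -- The leaf labelled `zero` is the root and has every label below it.
  leafCluster : Fin n → Subset n
  leafCluster zero    = full
  leafCluster (suc x) = ⁅ suc x ⁆

  cluster-nonempty : ∀ {C} → Cluster C → Nonempty C
  cluster-nonempty (inj₁ refl) = zero , ∈⊤
  cluster-nonempty {C} (inj₂ (_ , (_ , C≢∅ , _) , _)) with nonempty? C
  ... | yes ne = ne
  ... | no ¬ne = contradiction (Empty-unique ¬ne) C≢∅

  leafCluster-cluster : ∀ x → Cluster (leafCluster x)
  leafCluster-cluster zero    = inj₁ refl
  leafCluster-cluster (suc x) = inj₂ (0∉ , (umodule , (λ eq → ∉⊥ (subst (suc x ∈_) eq (x∈⁅x⁆ (suc x)))) ,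
      (λ eq → 0∉ (subst (zero ∈_) (sym eq) ∈⊤))) , no-overlap)
    where
    0∉ : zero ∉ ⁅ suc x ⁆
    0∉ 0∈ = case x∈⁅y⁆⇒x≡y (suc x) 0∈ of λ ()
    umodule : IsUmodule R ⁅ suc x ⁆
    umodule u∈ u′∈ _ _ with x∈⁅y⁆⇒x≡y (suc x) u∈ | x∈⁅y⁆⇒x≡y (suc x) u′∈
    ... | refl | refl = refl
    no-overlap : ∀ V → InB R V → ¬ Overlap R ⁅ suc x ⁆ V
    no-overlap V _ ((a , a∈) , (b , b∈) , _)
      with x∈p∩q⁻ ⁅ suc x ⁆ V a∈ | x∈p∩q⁻ ⁅ suc x ⁆ (∁ V) b∈
    ... | aX , aV | bX , b∁V with x∈⁅y⁆⇒x≡y (suc x) aX | x∈⁅y⁆⇒x≡y (suc x) bX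
    ...   | refl | refl = x∈∁p⇒x∉p b∁V aV

  -- A description of vertices, adjacency and leaves by data that depend on `R` alone. Any two
  -- graphs that admit it are therefore isomorphic, by matching vertices with equal clusters.
  record Clusters (G : LabelledGraph n) : Set where
    open LabelledGraph G
    field
      cl       : Vertex → Subset n
      cluster  : ∀ v → Cluster (cl v)
      distinct : ∀ {v w} → cl v ≡ cl w → v ≡ w
      vertex   : ∀ {C} → Cluster C → ∃[ v ] cl v ≡ C
      adjacent : ∀ v w → Adj v w ⇔ (cl v ⋖ cl w ⊎ cl w ⋖ cl v)
      leaves   : ∀ v x → kind v ≡ leaf x ⇔ cl v ≡ leafCluster x

  module _ {G G′ : LabelledGraph n} (K : Clusters G) (K′ : Clusters G′) where
    private
      module K  = Clusters K
      module K′ = Clusters K′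
      module G  = LabelledGraph G
      module G′ = LabelledGraph G′

      to : G.Vertex → G′.Vertex
      to v = proj₁ (K′.vertex (K.cluster v))

      from : G′.Vertex → G.Vertex
      from v = proj₁ (K.vertex (K′.cluster v))

      cl-to : ∀ v → K′.cl (to v) ≡ K.cl v
      cl-to v = proj₂ (K′.vertex (K.cluster v))

      cl-from : ∀ v → K.cl (from v) ≡ K′.cl v
      cl-from v = proj₂ (K.vertex (K′.cluster v))

    clusters-≅ : G ≅ G′
    clusters-≅ = record
      { vertices = mk↔ₛ′ to from
          (λ v → K′.distinct (trans (cl-to (from v)) (cl-from v)))
          (λ v → K.distinct (trans (cl-from (to v)) (cl-to v)))
      ; adjacent = λ v w → mk⇔
          (λ a → Equivalence.from (K′.adjacent (to v) (to w))
            (subst₂ Related (sym (cl-to v)) (sym (cl-to w)) (Equivalence.to (K.adjacent v w) a)))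
          (λ a → Equivalence.from (K.adjacent v w)
            (subst₂ Related (cl-to v) (cl-to w) (Equivalence.to (K′.adjacent (to v) (to w)) a)))
      ; labelled = λ v x → mk⇔
          (λ eq → Equivalence.from (K′.leaves (to v) x) (trans (cl-to v) (Equivalence.to (K.leaves v x) eq)))
          (λ eq → Equivalence.from (K.leaves v x) (trans (sym (cl-to v)) (Equivalence.to (K′.leaves (to v) x) eq)))
      }
      where
      Related : Subset n → Subset n → Set
      Related A B = A ⋖ B ⊎ B ⋖ A

  module Rooted (G : LabelledGraph n) (D : IsUmodularDecompositionTree R G) where
    open LabelledGraph G
    open IsUmodularDecompositionTree D
    open IsTree isTree
    open IsSimple isSimple
    open LeavesLabelledBijectively labelling

    private
      leafOf : Fin n → Vertex
      leafOf x = proj₁ (labels x)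

      leafOf-kind : ∀ x → kind (leafOf x) ≡ leaf x
      leafOf-kind x = proj₁ (proj₂ (labels x))

      leafOf-unique : ∀ {x v} → kind v ≡ leaf x → leafOf x ≡ v
      leafOf-unique {x} = proj₂ (proj₂ (labels x))

      root : Vertex
      root = leafOf zero

      without-sym : ∀ {a b v w} → WithoutEdge a b v w → WithoutEdge a b w v
      without-sym (adj , p , q) = symmetric _ _ adj , (λ (e , f) → q (f , e)) , (λ (e , f) → p (f , e))

      without-swap : ∀ {a b v w} → WithoutEdge a b v w → WithoutEdge b a v w
      without-swap (adj , p , q) = adj , q , p

      vertex⇒edge : ∀ {a b v w} → WithoutVertex a v w → WithoutEdge a b v w
      vertex⇒edge (adj , p , q) = adj , (λ (e , _) → p e) , (λ (_ , f) → q f)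

      -- A walk from `b` back to `a` that avoids the edge can be made simple, and the edge then
      -- closes it to a cycle.
      separates : ∀ {a b} → Adj a b → ¬ Star (WithoutEdge a b) b a
      separates {a} {b} ab p with Paths.simple Fin._≟_ (WithoutEdge a b) p
      ... | .[] , Paths.stop , _ = loopless _ ab
      ... | .(_ ∷ []) , Paths.step (_ , _ , q) Paths.stop , _ = q (refl , refl)
      ... | .(_ ∷ _ ∷ _) , Paths.step e (Paths.step f w) , un
        with Paths.unsnoc Fin._≟_ (WithoutEdge a b) e (Paths.step f w)
      ... | [] , () , _
      ... | v ∷ us , eq , l = acyclic a (b ∷ v ∷ us) (s≤s (s≤s z≤n))
        (unique-rotate (b ∷ v ∷ us) (subst (λ vs → Unique (b ∷ vs)) eq un))
        (ab Linked.∷ Linked.map proj₁ l)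

      two-sides : ∀ a b v → Star (WithoutEdge a b) a v ⊎ Star (WithoutEdge a b) b v
      two-sides a b v = go (connected a v) (inj₁ ε)
        where
        go : ∀ {u} → Star Adj u v → Star (WithoutEdge a b) a u ⊎ Star (WithoutEdge a b) b u →
          Star (WithoutEdge a b) a v ⊎ Star (WithoutEdge a b) b v
        go ε s = s
        go {u} (_◅_ {j = w} e p) s with (u Fin.≟ a) ×-dec (w Fin.≟ b) | (u Fin.≟ b) ×-dec (w Fin.≟ a)
        ... | yes (refl , refl) | _ = go p (inj₂ ε)
        ... | no _ | yes (refl , refl) = go p (inj₁ ε)
        ... | no ¬p | no ¬q =
          go p ([ (λ s → inj₁ (s ◅◅ (e , ¬p , ¬q) ◅ ε)) , (λ s → inj₂ (s ◅◅ (e , ¬p , ¬q) ◅ ε)) ]′ s)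

      Up : Vertex → Vertex → Set
      Up v w = Adj v w × Star (WithoutEdge v w) w root

      -- On a walk from `v` to the root, the step after the last visit to `v` leads to `w`.
      up-exists : ∀ {v} → v ≢ root → ∃[ w ] Up v w
      up-exists {v} v≢ with exit (connected v root)
        where
        exit : ∀ {u} → Star Adj u root →
          Star (WithoutVertex v) u root ⊎ (∃[ w ] Adj v w × Star (WithoutVertex v) w root)
        exit ε = inj₁ ε
        exit {u} (_◅_ {j = w} e p) with exit p
        ... | inj₂ q = inj₂ q
        ... | inj₁ q with u Fin.≟ v | w Fin.≟ v
        ...   | yes refl | _        = inj₂ (w , e , q)
        ...   | no _     | yes refl = contradiction q λ { ε → v≢ refl ; ((_ , v≢v , _) ◅ _) → v≢v refl }
        ...   | no u≢v   | no w≢v   = inj₁ ((e , u≢v , w≢v) ◅ q)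
      ... | inj₁ ε = contradiction refl v≢
      ... | inj₁ ((_ , v≢v , _) ◅ _) = contradiction refl v≢v
      ... | inj₂ (w , vw , p) = w , vw , Star.map vertex⇒edge p

      up-total : ∀ {v w} → Adj v w → Up v w ⊎ Up w v
      up-total {v} {w} vw with two-sides v w root
      ... | inj₁ p = inj₂ (symmetric _ _ vw , Star.map without-swap p)
      ... | inj₂ p = inj₁ (vw , p)

      -- The walk from `w′` to the root cannot pass through `v`, as the edge from `v` to `w′`
      -- separates. Joined to the walk from `w` and closed by the edge from `w′` to `v`, it leads
      -- from `w` to `v` without the edge between these two.
      up-unique : ∀ {v w w′} → Up v w → Up v w′ → w ≡ w′
      up-unique {v} {w} {w′} (vw , p) (vw′ , p′) with w Fin.≟ w′
      ... | yes eq = eq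
      ... | no w≢w′ with visits p′
        where
        visits : ∀ {u} → Star (WithoutEdge v w′) u root →
          Star (WithoutEdge v w′) u v ⊎ Star (WithoutVertex v) u root
        visits ε = inj₂ ε
        visits {u} (_◅_ {j = x} e q) with u Fin.≟ v | x Fin.≟ v | visits q
        ... | yes refl | _        | _       = inj₁ ε
        ... | no _     | yes refl | _       = inj₁ (e ◅ ε)
        ... | no _     | no _     | inj₁ r  = inj₁ (e ◅ r)
        ... | no u≢v   | no x≢v   | inj₂ r  = inj₂ ((proj₁ e , u≢v , x≢v) ◅ r)
      ...   | inj₁ q = contradiction q (separates vw′)
      ...   | inj₂ q = contradiction
        (p ◅◅ Star.reverse without-sym (Star.map vertex⇒edge q) ◅◅
          (symmetric _ _ vw′ , (λ { (refl , _) → loopless _ vw′ }) , (λ (e , _) → w≢w′ (sym e))) ◅ ε)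
        (separates vw)

      up-root : ∀ {w} → ¬ Up root w
      up-root (rw , p) = separates rw p

      up-asym : ∀ {v w} → Up v w → ¬ Up w v
      up-asym (vw , p) (_ , q) =
        separates vw (p ◅◅ Star.reverse without-sym (Star.map without-swap q))

      up-reaches : ∀ v → Star Up v root
      up-reaches v = go (connected v root)
        where
        go : ∀ {v} → Star Adj v root → Star Up v root
        go ε = ε
        go (vw ◅ p) with up-total vw | go p
        ... | inj₁ up | q        = up ◅ q
        ... | inj₂ up | ε        = contradiction up up-root
        ... | inj₂ up | up′ ◅ q with up-unique up up′
        ...   | refl = q

      up-chain : ∀ {x v w} → Star Up x v → Star Up x w → Star Up v w ⊎ Star Up w v
      up-chain ε q = inj₁ q
      up-chain p ε = inj₂ p
      up-chain (u ◅ p) (u′ ◅ q) with up-unique u u′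
      ... | refl = up-chain p q

      data View (v : Vertex) : Set where
        is-root : v ≡ root → View v
        below   : ∀ w → Up v w → View v

      view : ∀ v → View v
      view v with v Fin.≟ root
      ... | yes eq = is-root eq
      ... | no v≢  = let w , up = up-exists v≢ in below w up

      side : ∀ {v} → View v → Subset n
      side (is-root _)        = full
      side {v} (below w (vw , _)) = proj₁ (edgeStrong w v (symmetric _ _ vw))

      cl : Vertex → Subset n
      cl v = side (view v)

      -- Together with `ascend` this shows that the lower side of the edge above `w` consists of the
      -- vertices that climb to `w`; it translates sides of edges into clusters.
      descend : ∀ {w p v} → Up w p → Star Up v w → Star (WithoutEdge p w) w v
      descend {w} {p} {v} up q with v Fin.≟ w
      descend up q | yes refl = ε
      descend up ε | no v≢ = contradiction refl v≢
      descend {w} {p} {v} up@(wp , _) (_◅_ {j = v′} u q) | no v≢ = descend up q ◅◅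
        (symmetric _ _ (proj₁ u) , (λ { (refl , refl) → v≢ refl }) , (λ { (refl , refl) → up-asym up u })) ◅ ε

      ascend : ∀ {w p v} → Up w p → Star (WithoutEdge p w) w v → Star Up v w
      ascend {w} {p} {v} up q = go ε q
        where
        go : ∀ {c} → Star Up c w → Star (WithoutEdge p w) c v → Star Up v w
        go s ε = s
        go {c} s (_◅_ {j = c′} (e , _ , ¬q) r) with up-total e
        ... | inj₂ u = go (u ◅ s) r
        go ε (_◅_ {j = c′} (e , _ , ¬q) r) | inj₁ u with up-unique up u
        ... | refl = contradiction (refl , refl) ¬q
        go (u′ ◅ s) (_◅_ {j = c′} (e , _ , ¬q) r) | inj₁ u with up-unique u u′
        ... | refl = go s r

      ∈-cl : ∀ x w → x ∈ cl w ⇔ Star Up (leafOf x) w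
      ∈-cl x w with view w
      ... | is-root refl = mk⇔ (λ _ → up-reaches (leafOf x)) (λ _ → ∈⊤)
      ... | below p up@(wp , _) with edgeStrong p w (symmetric _ _ wp)
      ...   | U , eside , _ = mk⇔
        (λ x∈ → let v , kv , q = Equivalence.to (eside x) x∈ in
          subst (λ v → Star Up v w) (sym (leafOf-unique kv)) (ascend up q))
        (λ q → Equivalence.from (eside x) (leafOf x , leafOf-kind x , descend up q))

      cl-cluster : ∀ v → Cluster (cl v)
      cl-cluster v with view v
      ... | is-root _ = inj₁ refl
      ... | below p up@(vp , _) with edgeStrong p v (symmetric _ _ vp)
      ...   | U , eside , st = inj₂ (0∉ , st)
        where
        0∉ : zero ∉ U
        0∉ 0∈ = let w , kw , q = Equivalence.to (eside zero) 0∈ in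
          up-asym up (symmetric _ _ vp , subst (Star (WithoutEdge p v) v) (sym (leafOf-unique kw)) q)

      cl-distinct : ∀ {v w} → cl v ≡ cl w → v ≡ w
      cl-distinct {v} {w} eq with view v | view w
      ... | is-root e | is-root f = trans e (sym f)
      ... | is-root _ | below p (wp , _) =
        contradiction (sym eq) (proj₂ (proj₂ (proj₁ (proj₂ (proj₂ (edgeStrong p w (symmetric _ _ wp)))))))
      ... | below p (vp , _) | is-root _ =
        contradiction eq (proj₂ (proj₂ (proj₁ (proj₂ (proj₂ (edgeStrong p v (symmetric _ _ vp)))))))
      ... | below p (vp , _) | below p′ (wp , _)
        with edgeStrong p v (symmetric _ _ vp) | edgeStrong p′ w (symmetric _ _ wp)
      ...   | U , eside , st | U′ , eside′ , _ with eq
      ...     | refl with strongEdge U st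
      ...       | _ , _ , un = cong proj₂
        (trans (sym (un {p , v} (symmetric _ _ vp , eside))) (un {p′ , w} (symmetric _ _ wp , eside′)))

      cl-vertex : ∀ {C} → Cluster C → ∃[ v ] cl v ≡ C
      cl-vertex (inj₁ refl) = root , ⊆-antisym (λ _ → ∈⊤) (λ {x} _ → Equivalence.from (∈-cl x root) (up-reaches (leafOf x)))
      cl-vertex {C} (inj₂ (0∉ , st)) with strongEdge C st
      ... | (a , b) , (ab , eside) , _ with up-total ab
      ...   | inj₁ (_ , p) = contradiction (Equivalence.from (eside zero) (root , leafOf-kind zero , p)) 0∉
      ...   | inj₂ up = b , ⊆-antisym
        (λ {x} x∈ → Equivalence.from (eside x)
          (leafOf x , leafOf-kind x , descend up (Equivalence.to (∈-cl x b) x∈)))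
        (λ {x} x∈ → let v , kv , q = Equivalence.to (eside x) x∈ in Equivalence.from (∈-cl x b)
          (subst (λ v → Star Up v b) (sym (leafOf-unique kv)) (ascend up q)))

      cl-mono : ∀ {v w} → Star Up v w → cl v ⊆ cl w
      cl-mono {v} {w} p {x} x∈ = Equivalence.from (∈-cl x w) (Equivalence.to (∈-cl x v) x∈ ◅◅ p)

      cl-reflects : ∀ {v w} → cl v ⊆ cl w → Star Up v w
      cl-reflects {v} {w} v⊆w with cluster-nonempty (cl-cluster v)
      ... | x , x∈ with up-chain (Equivalence.to (∈-cl x v) x∈) (Equivalence.to (∈-cl x w) (v⊆w x∈))
      ...   | inj₁ p = p
      ...   | inj₂ p with cl-distinct {v} {w} (⊆-antisym v⊆w (cl-mono p))
      ...     | refl = ε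

      up⇒⋖ : ∀ {v w} → Up v w → cl v ⋖ cl w
      up⇒⋖ {v} {w} up = cl-mono (up ◅ ε) , (λ w⊆v → irrefl (cl-distinct {v} {w} (⊆-antisym (cl-mono (up ◅ ε)) w⊆v))) ,
        λ C Cc v⊆C C⊆w → middle Cc (cl-vertex Cc) v⊆C
        where
        irrefl : v ≢ w
        irrefl refl = up-asym up up
        middle : ∀ {C} → Cluster C → ∃[ u ] cl u ≡ C → cl v ⊆ C → C ⊆ cl v ⊎ cl w ⊆ C
        middle _ (u , refl) v⊆u with cl-reflects {v} {u} v⊆u
        ... | ε       = inj₁ id
        ... | up′ ◅ p with up-unique up up′
        ...   | refl  = inj₂ (cl-mono p)

      ⋖⇒up : ∀ {v w} → cl v ⋖ cl w → Up v w
      ⋖⇒up {v} {w} (v⊆w , w⊈v , between) with cl-reflects {v} {w} v⊆w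
      ... | ε = ⊥-elim (w⊈v id)
      ... | _◅_ {j = u} up p with between (cl u) (cl-cluster u) (cl-mono (up ◅ ε)) (cl-mono p)
      ...   | inj₁ u⊆v = ⊥-elim (proj₁ (proj₂ (up⇒⋖ up)) u⊆v)
      ...   | inj₂ w⊆u = subst (Up v) (cl-distinct {u} {w} (⊆-antisym (cl-mono p) w⊆u)) up

      cl-leafOf : ∀ x → cl (leafOf x) ≡ leafCluster x
      cl-leafOf x with cl-vertex (leafCluster-cluster x)
      ... | u , eq = trans (cong cl (sym (minimal x eq))) eq
        where
        minimal : ∀ x → cl u ≡ leafCluster x → u ≡ leafOf x
        minimal zero    eq = cl-distinct {u} {root} (trans eq
          (⊆-antisym (λ {y} _ → Equivalence.from (∈-cl y root) (up-reaches (leafOf y))) (λ _ → ∈⊤)))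
        minimal (suc x) eq = cl-distinct {u} {leafOf (suc x)} (⊆-antisym u⊆ (cl-mono ℓ↝u))
          where
          ℓ↝u : Star Up (leafOf (suc x)) u
          ℓ↝u = Equivalence.to (∈-cl (suc x) u) (subst (suc x ∈_) (sym eq) (x∈⁅x⁆ (suc x)))
          u⊆ : cl u ⊆ cl (leafOf (suc x))
          u⊆ {y} y∈ = subst (_∈ cl (leafOf (suc x)))
            (sym (x∈⁅y⁆⇒x≡y (suc x) (subst (y ∈_) eq y∈)))
            (Equivalence.from (∈-cl (suc x) (leafOf (suc x))) ε)

    clusters : Clusters G
    clusters = record
      { cl = cl ; cluster = cl-cluster ; distinct = cl-distinct ; vertex = cl-vertex
      ; adjacent = λ v w → mk⇔
          (λ vw → [ (λ up → inj₁ (up⇒⋖ up)) , (λ up → inj₂ (up⇒⋖ up)) ]′ (up-total vw))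
          [ (λ c → proj₁ (⋖⇒up c)) , (λ c → symmetric _ _ (proj₁ (⋖⇒up c))) ]′
      ; leaves = λ v x → mk⇔
          (λ eq → trans (cong cl (sym (leafOf-unique eq))) (cl-leafOf x))
          (λ eq → subst (λ v → kind v ≡ leaf x) (cl-distinct {leafOf x} {v} (trans (cl-leafOf x) (sym eq))) (leafOf-kind x))
      }

-- The covering relation among clusters

module Covering {m : ℕ} (R : HomogeneousRelation (suc m)) (L : Listing (suc m))
  (lists : Lists R L) (self-complemented : SelfComplemented R) where

  open Umodules R L lists self-complemented

  abstract
    cluster⇒strong : ∀ {C} → Cluster R C → StrongF C
    cluster⇒strong (inj₁ refl)      = full-strong
    cluster⇒strong (inj₂ (0∉ , st)) = Strong⇒StrongF 0∉ st

    strong⇒cluster : ∀ {C} → StrongF C → Cluster R C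
    strong⇒cluster {C} sC with zero ∈? C
    ... | yes 0∈ = inj₁ (F-zero (proj₁ sC) 0∈)
    ... | no 0∉  = inj₂ (0∉ , StrongF⇒Strong 0∉ sC)

    -- A cluster strictly above `S a b` contains `a` and some `x` outside `S a b`, hence `S a x`,
    -- hence `d` by the minimal choice of `d`.
    cover-cospan : ∀ {a b d} → d ∉ S a b → (∀ {x} → x ∉ S a b → d ∈ S a x) → _⋖_ R (S a b) (S a d)
    cover-cospan {a} {b} {d} d∉ low =
      absorb (S-strong a d) (S-F a b) (a∈S a d) (a∈S a b) (b∈S a d) d∉ ,
      (λ ⊆ → d∉ (⊆ (b∈S a d))) , λ C Cc ⊆C C⊆ → middle C (cluster⇒strong Cc) ⊆C (C ⊆? S a b)
      where
      middle : ∀ C → StrongF C → S a b ⊆ C → Dec (C ⊆ S a b) → C ⊆ S a b ⊎ S a d ⊆ C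
      middle C sC ⊆C (yes C⊆) = inj₁ C⊆
      middle C sC ⊆C (no C⊈)  = let x , x∈C , x∉ = ⊈⇒∃ {U = C} {S a b} C⊈ in
        inj₂ (S-min sC (⊆C (a∈S a b)) (S-min sC (⊆C (a∈S a b)) x∈C (low x∉)))

    cover-above : ∀ {A B C x} → StrongF B → StrongF C → x ∈ A → _⋖_ R A B → _⋖_ R A C → B ≡ C
    cover-above {A} {B} {C} sB sC x∈A (A⊆B , B⊈A , betweenB) (A⊆C , C⊈A , betweenC)
      with nested sB (proj₁ sC) (A⊆B x∈A) (A⊆C x∈A)
    ... | inj₁ B⊆C with betweenC B (strong⇒cluster sB) A⊆B B⊆C
    ...   | inj₁ B⊆A = ⊥-elim (B⊈A B⊆A)
    ...   | inj₂ C⊆B = ⊆-antisym B⊆C C⊆B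
    cover-above {A} {B} {C} sB sC x∈A (A⊆B , B⊈A , betweenB) (A⊆C , C⊈A , betweenC) | inj₂ C⊆B
      with betweenB C (strong⇒cluster sC) A⊆C C⊆B
    ... | inj₁ C⊆A = ⊥-elim (C⊈A C⊆A)
    ... | inj₂ B⊆C = ⊆-antisym B⊆C C⊆B

    cover-below : ∀ {A B C x} → StrongF A → StrongF B → x ∈ A → x ∈ B → _⋖_ R A C → _⋖_ R B C → A ≡ B
    cover-below {A} {B} {C} sA sB x∈A x∈B (A⊆C , C⊈A , betweenA) (B⊆C , C⊈B , betweenB)
      with nested sA (proj₁ sB) x∈A x∈B
    ... | inj₁ A⊆B with betweenA B (strong⇒cluster sB) A⊆B B⊆C
    ...   | inj₁ B⊆A = ⊆-antisym A⊆B B⊆A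
    ...   | inj₂ C⊆B = ⊥-elim (C⊈B C⊆B)
    cover-below {A} {B} {C} sA sB x∈A x∈B (A⊆C , C⊈A , betweenA) (B⊆C , C⊈B , betweenB) | inj₂ B⊆A
      with betweenB A (strong⇒cluster sA) B⊆A A⊆C
    ... | inj₁ A⊆B = ⊆-antisym A⊆B B⊆A
    ... | inj₂ C⊆A = ⊥-elim (C⊈A C⊆A)

-- Sets of positions: sizes, extreme elements, intervals

allPairs-lookup : ∀ {A : Set} {Q : A → A → Set} {xs : List A} → AllPairs.AllPairs Q xs →
  ∀ {i j} → i Fin.< j → Q (List.lookup xs i) (List.lookup xs j)
allPairs-lookup (q AllPairs.∷ qs) {zero}  {suc j} _         = All.lookup q (Memₚ.∈-lookup j)
allPairs-lookup (q AllPairs.∷ qs) {suc i} {suc j} (s≤s i<j) = allPairs-lookup qs i<j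

short-list : ∀ {A : Set} {xs : List A} {y z} → length xs ≤ 1 → y Mem.∈ xs → z Mem.∈ xs → y ≡ z
short-list {xs = x ∷ []}     _        (here refl) (here refl) = refl
short-list {xs = x ∷ y ∷ xs} (s≤s ()) _           _

nonempty-size : ∀ {k} {I : Subset k} {i} → i ∈ I → 1 ≤ ∣ I ∣
nonempty-size {I = I} {i} i∈ = subst (_≤ ∣ I ∣) (∣⁅x⁆∣≡1 i)
  (p⊆q⇒∣p∣≤∣q∣ (λ j∈ → subst (_∈ I) (sym (x∈⁅y⁆⇒x≡y i j∈)) i∈))

proper-size : ∀ {k} {I : Subset k} {i} → i ∉ I → ∣ I ∣ < k
proper-size {k} {I} {i} i∉ = subst (∣ I ∣ <_) (∣⊤∣≡n k) (p⊂q⇒∣p∣<∣q∣ ((λ _ → ∈⊤) , i , ∈⊤ , i∉))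

size-nonempty : ∀ {k} (I : Subset k) → 1 ≤ ∣ I ∣ → Nonempty I
size-nonempty {k} I 1≤ with nonempty? I
... | yes ne = ne
... | no ¬ne rewrite Empty-unique ¬ne | ∣⊥∣≡0 k = case 1≤ of λ ()

size-proper : ∀ {k} (I : Subset k) → ∣ I ∣ < k → ∃[ i ] i ∉ I
size-proper {k} I lt with Finₚ.any? (λ i → ¬? (i ∈? I))
... | yes w = w
... | no ¬w = contradiction (subst (_≤ ∣ I ∣) (∣⊤∣≡n k)
    (p⊆q⇒∣p∣≤∣q∣ {p = full} {I} (λ {i} _ → decidable-stable (i ∈? I) (λ i∉ → ¬w (i , i∉))))) (Data.Nat.Properties.<⇒≱ lt)

least : ∀ {k} (I : Subset k) → Nonempty I → ∃[ a ] a ∈ I × (∀ {i} → i ∈ I → a Fin.≤ i)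
least {suc k} I ne with zero ∈? I
... | yes z∈ = zero , z∈ , λ _ → z≤n
least {suc k} (s ∷ I) ne | no z∉ with least I (tail ne)
  where
  tail : Nonempty (s ∷ I) → Nonempty I
  tail (zero  , i∈)           = contradiction i∈ z∉
  tail (suc i , Vec.there i∈) = i , i∈
...   | a , a∈ , min = suc a , Vec.there a∈ ,
  λ { {zero} i∈ → contradiction i∈ z∉ ; {suc i} (Vec.there i∈) → s≤s (min i∈) }

greatest : ∀ {k} (I : Subset k) → Nonempty I → ∃[ b ] b ∈ I × (∀ {i} → i ∈ I → i Fin.≤ b)
greatest {suc k} (s ∷ I) ne with nonempty? I
... | yes ne′ = let b , b∈ , max = greatest I ne′ in
  suc b , Vec.there b∈ , λ { {zero} _ → z≤n ; {suc i} (Vec.there i∈) → s≤s (max i∈) }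
greatest {suc k} (s ∷ I) (zero , i∈) | no ¬ne =
  zero , i∈ , λ { {zero} _ → z≤n ; {suc i} (Vec.there i∈) → contradiction (i , i∈) ¬ne }
greatest {suc k} (s ∷ I) (suc i , Vec.there i∈) | no ¬ne = contradiction (i , i∈) ¬ne

Convex : ∀ {k} → Subset k → Set
Convex I = ∀ {i j l} → i ∈ I → l ∈ I → i Fin.< j → j Fin.< l → j ∈ I

convex-range : ∀ {k} {I : Subset k} {a b i} → Convex I → a ∈ I → b ∈ I → a Fin.≤ i → i Fin.≤ b → i ∈ I
convex-range {a = a} {b} {i} cv a∈ b∈ a≤ ≤b with a Finₚ.≟ i | i Finₚ.≟ b
... | yes refl | _        = a∈
... | no _     | yes refl = b∈
... | no a≢i   | no i≢b   = cv a∈ b∈ (Finₚ.≤∧≢⇒< a≤ a≢i) (Finₚ.≤∧≢⇒< ≤b i≢b)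

convex⇒interval : ∀ {k} {I : Subset k} → Nonempty I → Convex I → IsInterval I
convex⇒interval {I = I} ne cv = let a , a∈ , min = least I ne ; b , b∈ , max = greatest I ne in
  a , b , λ i → mk⇔ (λ i∈ → min i∈ , max i∈) (λ (a≤ , ≤b) → convex-range cv a∈ b∈ a≤ ≤b)

-- From a table of clusters to the decomposition tree

module Assembled {m : ℕ} (R : HomogeneousRelation (suc m)) (L : Listing (suc m))
  (lists : Lists R L) (self-complemented : SelfComplemented R)
  (order : ℕ) (code : Fin order → Fin (suc m) × Fin (suc m))
  (vtx : Fin (suc m) → Fin (suc m) → Fin order)
  (nbrs : Fin order → List (Fin order)) (kind : Fin order → Kind (suc m))
  (end : Fin order → Fin (suc m)) where

  open Umodules R L lists self-complemented
  open Covering R L lists self-complemented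

  private
    n = suc m

  graph : LabelledGraph n
  graph = record { order = order ; nbrs = nbrs ; kind = kind }

  open LabelledGraph graph using (Vertex; Adj; degree; WithoutEdge; WithoutVertex; LeafOf; EdgeSide; NodeSide)

  rep : Vertex → Fin n
  rep v = proj₁ (code v)

  cl : Vertex → Subset n
  cl v = S (rep v) (proj₂ (code v))

  infix 4 _◁_
  -- Wrapped in a record so that `v` and `w` can be inferred from a proof, which the sets `cl v` and
  -- `cl w` would not allow.
  record _◁_ (v w : Vertex) : Set where
    constructor covered
    field
      cover : _⋖_ R (cl v) (cl w)
  open _◁_ public

  key : Vertex → Vertex → ℕ
  key v w = ∣ M (end v) (rep w) ∣

  -- Children come by increasing key and the parent comes last. Keys of different children may tie,
  -- so distinctness is recorded separately.
  Before : Vertex → Vertex → Vertex → Set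
  Before v w w′ = w ◁ v × (v ◁ w′ ⊎ (w′ ◁ v × w ≢ w′ × key v w ≤ key v w′))

  KindSpec : Vertex → Kind n → Set
  KindSpec v (leaf x) = code v ≡ (x , x)
  KindSpec v complete = rep v ≢ proj₂ (code v) ×
    (∀ {e f} → e ∈ cl v → f ∈ cl v → ¬ Node.Full (cl v) e f)
  KindSpec v circular = rep v ≢ proj₂ (code v) × end v ∈ cl v ×
    (∃[ f ] f ∈ cl v × Node.Full (cl v) (end v) f) ×
    (∃[ x ] ∃[ y ] x ∈ cl v × y ∈ cl v × Node.Cross (cl v) x y × ¬ cl v ⊆ M x y)
  KindSpec v prime    = rep v ≢ proj₂ (code v) ×
    (∀ {x y} → x ∈ cl v → y ∈ cl v → Node.Cross (cl v) x y → cl v ⊆ M x y)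

  -- The interface between the program and the mathematics: these properties of the computed tables
  -- make `graph` a decomposition tree.
  record Spec : Set where
    field
      cl-vtx     : ∀ a b → cl (vtx a b) ≡ S a b
      cl-inj     : ∀ {v w} → cl v ≡ cl w → v ≡ w
      code-diag  : ∀ a → code (vtx a a) ≡ (a , a)
      nbrs-order : ∀ v → AllPairs.AllPairs (Before v) (nbrs v)
      nbrs-adj   : ∀ v w → w Mem.∈ nbrs v ⇔ (w ◁ v ⊎ v ◁ w)
      kind-spec  : ∀ v → KindSpec v (kind v)

  module _ (spec : Spec) where
    open Spec spec

    private
      abstract
        cl-strong : ∀ v → StrongF (cl v)
        cl-strong v = S-strong _ _

        rep∈ : ∀ v → rep v ∈ cl v
        rep∈ v = a∈S _ _

        find : ∀ {T a} → StrongF T → a ∈ T → ∃[ v ] cl v ≡ T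
        find {a = a} sT a∈T = let b , _ , eq = strong-S sT a∈T in vtx a b , trans (cl-vtx a b) (sym eq)

        ◁-⊆ : ∀ {v w} → v ◁ w → cl v ⊆ cl w
        ◁-⊆ c = proj₁ (cover c)

        ◁-⊉ : ∀ {v w} → v ◁ w → ¬ cl w ⊆ cl v
        ◁-⊉ c = proj₁ (proj₂ (cover c))

        ◁-between : ∀ {v w} → v ◁ w → ∀ u → cl v ⊆ cl u → cl u ⊆ cl w → u ≡ v ⊎ u ≡ w
        ◁-between {v} {w} (covered (_ , _ , btw)) u v⊆u u⊆w with btw (cl u) (strong⇒cluster (cl-strong u)) v⊆u u⊆w
        ... | inj₁ u⊆v = inj₁ (cl-inj {u} {v} (⊆-antisym u⊆v v⊆u))
        ... | inj₂ w⊆u = inj₂ (cl-inj {u} {w} (⊆-antisym u⊆w w⊆u))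

        ◁-size : ∀ {v w} → v ◁ w → ∣ cl v ∣ < ∣ cl w ∣
        ◁-size {v} {w} (covered (v⊆w , w⊈v , _)) = p⊂q⇒∣p∣<∣q∣ (v⊆w , ⊈⇒∃ {U = cl w} {cl v} w⊈v)

        ◁-irrefl : ∀ {v} → ¬ v ◁ v
        ◁-irrefl v◁v = <-irrefl refl (◁-size v◁v)

        ◁-asym : ∀ {v w} → v ◁ w → ¬ w ◁ v
        ◁-asym p q = <-irrefl refl (<-trans (◁-size p) (◁-size q))

        meet : ∀ {v w x} → x ∈ cl v → x ∈ cl w → cl v ⊆ cl w ⊎ cl w ⊆ cl v
        meet {v} {w} x∈v x∈w = nested (cl-strong v) (proj₁ (cl-strong w)) x∈v x∈w

        parent-unique : ∀ {v w w′} → v ◁ w → v ◁ w′ → w ≡ w′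
        parent-unique {v} {w} {w′} (covered p) (covered p′) =
          cl-inj {w} {w′} (cover-above (cl-strong w) (cl-strong w′) (rep∈ v) p p′)

        parent : ∀ {v y} → y ∉ cl v → ∃[ p ] v ◁ p
        parent {v} y∉ with cospan {U = cl v} {rep v} y∉
        ... | d , d∉ , low with find (S-strong (rep v) d) (a∈S (rep v) d)
        ...   | p , eq = p , covered (subst (_⋖_ R (cl v)) (sym eq) (cover-cospan d∉ low))

        -- Every step to a parent enlarges the cluster, so `n` minus its size bounds the climb.
        climb : ∀ {v w} → cl v ⊆ cl w → Star _◁_ v w
        climb {v} {w} = go n v (m≤m+n n _)
          where
          go : ∀ k v → n ≤ k + ∣ cl v ∣ → cl v ⊆ cl w → Star _◁_ v w
          go k v n≤ v⊆w with cl w ⊆? cl v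
          ... | yes w⊆v = subst (Star _◁_ v) (cl-inj {v} {w} (⊆-antisym v⊆w w⊆v)) ε
          go zero v n≤ v⊆w | no w⊈v = ⊥-elim (w⊈v λ {x} _ →
            subst (x ∈_) (sym (∣p∣≡n⇒p≡⊤ (≤-antisym (∣p∣≤n (cl v)) n≤))) ∈⊤)
          go (suc k) v n≤ v⊆w | no w⊈v with ⊈⇒∃ {U = cl w} {cl v} w⊈v
          ... | x , x∈w , x∉v with parent {v} x∉v
          ...   | p , v◁p = v◁p ◅ go k p
            (≤-trans n≤ (≤-trans (≤-reflexive (sym (+-suc k _))) (+-monoʳ-≤ k (◁-size v◁p)))) p⊆w
            where
            p⊆w : cl p ⊆ cl w
            p⊆w with meet {p} {w} (◁-⊆ v◁p (rep∈ v)) (v⊆w (rep∈ v))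
            ... | inj₁ p⊆w = p⊆w
            ... | inj₂ w⊆p with ◁-between v◁p w v⊆w w⊆p
            ...   | inj₁ refl = ⊥-elim (w⊈v id)
            ...   | inj₂ refl = id

        star-⊆ : ∀ {v w} → Star _◁_ v w → cl v ⊆ cl w
        star-⊆ ε       = id
        star-⊆ (p ◅ q) = λ x∈ → star-⊆ q (◁-⊆ p x∈)

        child-above : ∀ {v w} → cl v ⊆ cl w → v ≢ w → ∃[ c ] cl v ⊆ cl c × c ◁ w
        child-above {v} {w} v⊆w v≢w = go (climb {v} {w} v⊆w) v≢w
          where
          go : ∀ {v} → Star _◁_ v w → v ≢ w → ∃[ c ] cl v ⊆ cl c × c ◁ w
          go ε v≢ = contradiction refl v≢
          go {v} (_◅_ {j = u} p q) _ with u Finₚ.≟ w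
          ... | yes refl = v , id , p
          ... | no u≢    = let c , u⊆c , c◁w = go q u≢ in c , (λ x∈ → u⊆c (◁-⊆ p x∈)) , c◁w

      root : Vertex
      root = vtx zero zero

      abstract
        cl-root : cl root ≡ full
        cl-root = trans (cl-vtx zero zero) (F-zero (S-F zero zero) (a∈S zero zero))

        zero∉ : ∀ {v} → v ≢ root → zero ∉ cl v
        zero∉ {v} v≢ 0∈ = v≢ (cl-inj {v} {root} (trans (F-zero (proj₁ (cl-strong v)) 0∈) (sym cl-root)))

        child≢root : ∀ {v w} → v ◁ w → v ≢ root
        child≢root {v} {w} v◁w refl = ◁-⊉ v◁w λ {x} _ → subst (x ∈_) (sym cl-root) ∈⊤

        child-zero∉ : ∀ {v w} → v ◁ w → zero ∉ cl v
        child-zero∉ {v} v◁w = zero∉ {v} (child≢root v◁w)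

        has-parent : ∀ {v} → v ≢ root → ∃[ p ] v ◁ p
        has-parent {v} v≢ = parent {v} (zero∉ {v} v≢)

        ◁⇒adj : ∀ {v w} → v ◁ w → Adj v w
        ◁⇒adj p = Equivalence.from (nbrs-adj _ _) (inj₂ p)

        ◁⇒adj′ : ∀ {v w} → v ◁ w → Adj w v
        ◁⇒adj′ p = Equivalence.from (nbrs-adj _ _) (inj₁ p)

        adj-sym : ∀ v w → Adj v w → Adj w v
        adj-sym v w vw = Equivalence.from (nbrs-adj w v)
          ([ inj₂ , inj₁ ]′ (Equivalence.to (nbrs-adj v w) vw))

        adj-◁ : ∀ {v w} → Adj v w → v ◁ w ⊎ w ◁ v
        adj-◁ {v} {w} vw = [ inj₂ , inj₁ ]′ (Equivalence.to (nbrs-adj v w) vw)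

        connected : ∀ v w → Star Adj v w
        connected v w = to-root v ◅◅ Star.reverse (adj-sym _ _) (to-root w)
          where
          to-root : ∀ v → Star Adj v root
          to-root v = Star.map ◁⇒adj (climb {v} {root} λ {x} _ → subst (x ∈_) (sym cl-root) ∈⊤)

      NoBacktrack : List Vertex → Set
      NoBacktrack (u ∷ v ∷ w ∷ ws) = u ≢ w × NoBacktrack (v ∷ w ∷ ws)
      NoBacktrack _                = ⊤

      abstract
        no-backtrack : ∀ {vs z} → Unique vs → All (_≢ z) vs → NoBacktrack (vs ++ [ z ])
        no-backtrack {[]}             _ _ = tt
        no-backtrack {_ ∷ []}         _ _ = tt
        no-backtrack {_ ∷ _ ∷ []}     _ (u≢ All.∷ _) = u≢ , tt
        no-backtrack {_ ∷ _ ∷ _ ∷ _} ((_ All.∷ u≢ All.∷ _) AllPairs.∷ un) (_ All.∷ al) = u≢ , no-backtrack un al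

        -- After a step away from the root a walk can only descend further.
        descending : ∀ {u w ws} → w ◁ u → Linked Adj (u ∷ w ∷ ws) → NoBacktrack (u ∷ w ∷ ws) →
          All (λ y → ∣ cl y ∣ ≤ ∣ cl w ∣) (w ∷ ws)
        descending {ws = []}     w◁u _ _ = ≤-refl All.∷ All.[]
        descending {ws = x ∷ ws} w◁u (_ Linked.∷ l@(e Linked.∷ _)) (u≢x , nb) with adj-◁ e
        ... | inj₁ w◁x = contradiction (parent-unique w◁u w◁x) u≢x
        ... | inj₂ x◁w = ≤-refl All.∷ All.map (λ ≤x → ≤-trans ≤x (<⇒≤ (◁-size x◁w))) (descending x◁w l nb)

      lastOf : Vertex → List Vertex → Vertex
      lastOf u []       = u
      lastOf u (w ∷ ws) = lastOf w ws

      abstract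
        lastOf-∈ : ∀ u w ws → lastOf u (w ∷ ws) Mem.∈ w ∷ ws
        lastOf-∈ u w []        = here refl
        lastOf-∈ u w (x ∷ ws) = there (lastOf-∈ w x ws)

        -- Once a walk without backtracking goes down it keeps going down, as the only way up leads
        -- back. So either every step rises or the last one falls.
        rise-or-fall : ∀ u ws z → Linked Adj (u ∷ ws ++ [ z ]) → NoBacktrack (u ∷ ws ++ [ z ]) →
          ∣ cl u ∣ < ∣ cl z ∣ ⊎ z ◁ lastOf u ws
        rise-or-fall u [] z (e Linked.∷ _) _ = [ (λ p → inj₁ (◁-size p)) , inj₂ ]′ (adj-◁ e)
        rise-or-fall u (w ∷ ws) z (e Linked.∷ l) nb with adj-◁ e | rise-or-fall w ws z l (tail u w ws nb)
          where
          tail : ∀ u w ws → NoBacktrack (u ∷ w ∷ ws ++ [ z ]) → NoBacktrack (w ∷ ws ++ [ z ])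
          tail u w []       (_ , nb) = nb
          tail u w (_ ∷ _) (_ , nb) = nb
        ... | _        | inj₂ q   = inj₂ q
        ... | inj₁ u◁w | inj₁ w<z = inj₁ (<-trans (◁-size u◁w) w<z)
        ... | inj₂ w◁u | inj₁ w<z = contradiction
          (All.lookup (descending w◁u (e Linked.∷ l) nb) (there (Memₚ.∈-++⁺ʳ ws (here refl))))
          (Data.Nat.Properties.<⇒≱ w<z)

        -- A closed walk that starts upwards returns to `v` from the parent of `v`, which is already
        -- its second vertex. One that starts downwards only visits clusters smaller than that of
        -- `v`.
        acyclic : ∀ v vs → 2 ≤ length vs → Unique (v ∷ vs) → ¬ Linked Adj (v ∷ vs ++ [ v ])
        acyclic v (_ ∷ []) (s≤s ()) _ _
        acyclic v (w ∷ x ∷ vs) _ (v≢@(_ All.∷ v≢x All.∷ _) AllPairs.∷ un@(w≢ AllPairs.∷ _)) l@(e Linked.∷ _) =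
          [ first-up , first-down ]′ (adj-◁ e)
          where
          nb : NoBacktrack (v ∷ w ∷ x ∷ vs ++ [ v ])
          nb = v≢x , no-backtrack un (All.map (λ ≢ eq → ≢ (sym eq)) v≢)
          first-up : v ◁ w → ⊥
          first-up v◁w = [ <-irrefl refl , (λ p → All.lookup w≢ (lastOf-∈ w x vs) (parent-unique v◁w p)) ]′
            (rise-or-fall v (w ∷ x ∷ vs) v l nb)
          first-down : w ◁ v → ⊥
          first-down w◁v = Data.Nat.Properties.<⇒≱ (◁-size w◁v)
            (All.lookup (descending w◁v l nb) (there (there (Memₚ.∈-++⁺ʳ vs (here refl)))))

        before-≢ : ∀ {v w w′} → Before v w w′ → w ≢ w′
        before-≢ (w◁v , inj₁ v◁w)          refl = ◁-asym w◁v v◁w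
        before-≢ (_   , inj₂ (_ , w≢ , _)) refl = w≢ refl

      leafVertex : Fin n → Vertex
      leafVertex x = vtx x x

      abstract
        leaf-kind : ∀ x → kind (leafVertex x) ≡ leaf x
        leaf-kind x with kind (leafVertex x) | kind-spec (leafVertex x) | code-diag x
        ... | leaf y   | eq       | eq′ = cong (λ p → leaf (proj₁ p)) (trans (sym eq) eq′)
        ... | complete | ≢ , _ | eq′ = contradiction (trans (cong proj₁ eq′) (sym (cong proj₂ eq′))) ≢
        ... | circular | ≢ , _ | eq′ = contradiction (trans (cong proj₁ eq′) (sym (cong proj₂ eq′))) ≢
        ... | prime    | ≢ , _ | eq′ = contradiction (trans (cong proj₁ eq′) (sym (cong proj₂ eq′))) ≢

        kind-leaf : ∀ {v x} → kind v ≡ leaf x → leafVertex x ≡ v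
        kind-leaf {v} {x} eq = cl-inj {leafVertex x} {v}
          (trans (cl-vtx x x) (cong (λ p → S (proj₁ p) (proj₂ p)) (sym (subst (KindSpec v) eq (kind-spec v)))))

      Inner : Vertex → Set
      Inner v = rep v ≢ proj₂ (code v)

      abstract
        leaf-or-inner : ∀ v → (∃[ x ] v ≡ leafVertex x) ⊎ Inner v
        leaf-or-inner v with rep v Finₚ.≟ proj₂ (code v)
        ... | no ≢   = inj₂ ≢
        ... | yes eq = inj₁ (rep v , cl-inj {v} {leafVertex (rep v)}
          (trans (cong (S (rep v)) (sym eq)) (sym (cl-vtx (rep v) (rep v)))))

        leaf-¬inner : ∀ x → ¬ Inner (leafVertex x)
        leaf-¬inner x ≢ = ≢ (trans (cong proj₁ (code-diag x)) (sym (cong proj₂ (code-diag x))))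

        inner≢root : ∀ {v} → Inner v → v ≢ root
        inner≢root iv refl = leaf-¬inner zero iv

        leaf⊆ : ∀ {x v} → x ∈ cl v → cl (leafVertex x) ⊆ cl v
        leaf⊆ {x} {v} x∈ {y} y∈ = S-min (cl-strong v) x∈ x∈ (subst (y ∈_) (cl-vtx x x) y∈)

        ∈leaf : ∀ x → x ∈ cl (leafVertex x)
        ∈leaf x = subst (x ∈_) (sym (cl-vtx x x)) (a∈S x x)

        cl-leaf : ∀ {x y} → x ≢ zero → y ∈ cl (leafVertex x) → y ≡ x
        cl-leaf {x} {y} x≢ y∈ with S⁻ (subst (y ∈_) (cl-vtx x x) y∈)
        ... | inj₁ y∈M       = x∈⁅y⁆⇒x≡y x (M-min (F-singleton x≢) (x∈⁅x⁆ x) (x∈⁅x⁆ x) y∈M)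
        ... | inj₂ (inj₁ x∉) = contradiction (a∈M x y) x∉
        ... | inj₂ (inj₂ x∉) = contradiction (a∈M x y) x∉

        -- The complement of the one-point set of `zero` is a umodule, and a member with a point
        -- outside it contains `zero` and is full.
        others-strong : ∀ {x : Fin n} → x ≢ zero → StrongF (∁ ⁅ zero ⁆)
        others-strong {x} x≢ = UM⇒F (λ 0∈ → x∈∁p⇒x∉p 0∈ (x∈⁅x⁆ zero)) (x , away x≢)
            (UM-∁ (λ u∈ u′∈ _ _ eq → subst (λ v → lab v _ ≡ lab v _)
              (trans (x∈⁅y⁆⇒x≡y zero u∈) (sym (x∈⁅y⁆⇒x≡y zero u′∈))) eq)) ,
          λ {V} FV _ _ y∈V y∉ _ z∉ → z∉ (subst (_ ∈_) (sym (F-zero FV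
            (subst (_∈ V) (x∈⁅y⁆⇒x≡y zero (x∉∁p⇒x∈p y∉)) y∈V))) ∈⊤)
          where
          away : ∀ {y : Fin n} → y ≢ zero → y ∈ ∁ ⁅ zero ⁆
          away y≢ = x∉p⇒x∈∁p (λ y∈ → y≢ (x∈⁅y⁆⇒x≡y zero y∈))

        -- The only child of the root consists of all other elements.
        root-child : ∀ {v y} → v ◁ root → y ≢ zero → y ∈ cl v
        root-child {v} {y} v◁ y≢ = [ below , above ]′ (proj₂ (proj₂ (cover v◁)) (∁ ⁅ zero ⁆)
            (strong⇒cluster (others-strong y≢)) v⊆ (λ {x} _ → subst (x ∈_) (sym cl-root) ∈⊤))
          where
          y∈ : y ∈ ∁ ⁅ zero ⁆
          y∈ = x∉p⇒x∈∁p (λ y∈ → y≢ (x∈⁅y⁆⇒x≡y zero y∈))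
          v⊆ : cl v ⊆ ∁ ⁅ zero ⁆
          v⊆ {x} x∈ = x∉p⇒x∈∁p (λ x∈′ → child-zero∉ v◁ (subst (_∈ cl v) (x∈⁅y⁆⇒x≡y zero x∈′) x∈))
          below : ∁ ⁅ zero ⁆ ⊆ cl v → y ∈ cl v
          below ⊆ = ⊆ y∈
          above : cl root ⊆ ∁ ⁅ zero ⁆ → y ∈ cl v
          above ⊆ = contradiction (x∈⁅x⁆ zero) (x∈∁p⇒x∉p (⊆ (subst (zero ∈_) (sym cl-root) ∈⊤)))

        inner-child : ∀ {v} → Inner v → ∀ {x} → x ∈ cl v → ∃[ c ] x ∈ cl c × c ◁ v
        inner-child {v} iv {x} x∈ with child-above {leafVertex x} {v} (leaf⊆ {x} {v} x∈) (λ { refl → leaf-¬inner x iv })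
        ... | c , ⊆c , c◁v = c , ⊆c (∈leaf x) , c◁v

        -- A leaf other than `zero` has a one-point cluster and hence no child; the root has no
        -- parent and a single child.
        leaf-degree : ∀ x → degree (leafVertex x) ≤ 1
        leaf-degree x = go (nbrs (leafVertex x)) (nbrs-order (leafVertex x))
          where
          clash : ∀ {w w′} → ¬ Before (leafVertex x) w w′
          clash {w} {w′} (w◁ , r) with x Finₚ.≟ zero
          ... | no x≢ = ◁-⊉ w◁ λ {y} y∈ → subst (_∈ cl w)
            (trans (cl-leaf x≢ (◁-⊆ w◁ (rep∈ w))) (sym (cl-leaf x≢ y∈))) (rep∈ w)
          clash {w} {w′} (w◁ , inj₁ ◁w′) | yes refl = child≢root ◁w′ refl
          clash {w} {w′} (w◁ , inj₂ (w′◁ , w≢ , _)) | yes refl = w≢ (cl-inj {w} {w′} (⊆-antisym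
            (λ {y} y∈ → root-child w′◁ (λ { refl → child-zero∉ w◁ y∈ }))
            (λ {y} y∈ → root-child w◁ (λ { refl → child-zero∉ w′◁ y∈ }))))
          go : ∀ vs → AllPairs.AllPairs (Before (leafVertex x)) vs → length vs ≤ 1
          go []           _ = z≤n
          go (_ ∷ [])     _ = ≤-refl
          go (_ ∷ _ ∷ _) ((b All.∷ _) AllPairs.∷ _) = ⊥-elim (clash b)

        inner-degree : ∀ {v} → Inner v → ¬ degree v ≤ 1
        inner-degree {v} iv d≤ with has-parent (inner≢root iv) | inner-child iv (rep∈ v)
        ... | p , v◁p | c , _ , c◁v with short-list d≤ (◁⇒adj v◁p) (◁⇒adj′ c◁v)
        ...   | refl = ◁-asym v◁p c◁v

      without-sym : ∀ {a b v w} → WithoutEdge a b v w → WithoutEdge a b w v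
      without-sym (adj , p , q) = adj-sym _ _ adj , (λ (e , f) → q (f , e)) , (λ (e , f) → p (f , e))

      withoutV-sym : ∀ {a v w} → WithoutVertex a v w → WithoutVertex a w v
      withoutV-sym (adj , p , q) = adj-sym _ _ adj , q , p

      vertex⇒edge : ∀ {a b v w} → WithoutVertex a v w → WithoutEdge a b v w
      vertex⇒edge (adj , p , q) = adj , (λ (e , _) → p e) , (λ (_ , f) → q f)

      inside : ∀ {E : Vertex → Vertex → Set} {v w} →
        (∀ {x y} → x ◁ y → cl x ⊆ cl w → cl y ⊆ cl w → E x y) → cl v ⊆ cl w → Star E v w
      inside {E} {v} {w} f v⊆w = go (climb {v} {w} v⊆w)
        where
        go : ∀ {v} → Star _◁_ v w → Star E v w
        go ε       = ε
        go (p ◅ q) = f p (λ x∈ → star-⊆ q (◁-⊆ p x∈)) (star-⊆ q) ◅ go q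

      outside : ∀ {E : Vertex → Vertex → Set} {a v} →
        (∀ {x y} → x ◁ y → ¬ cl x ⊆ cl a → ¬ cl y ⊆ cl a → E x y) → ¬ cl v ⊆ cl a → Star E v root
      outside {E} {a} {v} f v⊈a = go (climb {v} {root} λ {x} _ → subst (x ∈_) (sym cl-root) ∈⊤) v⊈a
        where
        go : ∀ {v} → Star _◁_ v root → ¬ cl v ⊆ cl a → Star E v root
        go ε       _   = ε
        go {v} (_◅_ {j = u} p q) v⊈a = f p v⊈a u⊈a ◅ go q u⊈a
          where
          u⊈a : ¬ cl u ⊆ cl a
          u⊈a u⊆a = v⊈a λ x∈ → u⊆a (◁-⊆ p x∈)

      -- The only upward step out of the cluster of `b` starts at `b` itself, and it is the removed
      -- edge.
      stays-inside : ∀ {a b} → b ◁ a → ∀ {v w} → Star (WithoutEdge a b) v w → cl v ⊆ cl b → cl w ⊆ cl b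
      stays-inside b◁a ε v⊆b = v⊆b
      stays-inside {a} {b} b◁a {v} {w} (_◅_ {j = u} (adj , _ , ¬q) p) v⊆b = stays-inside b◁a p (by (adj-◁ adj))
        where
        by : v ◁ u ⊎ u ◁ v → cl u ⊆ cl b
        by (inj₂ u◁v) = λ x∈ → v⊆b (◁-⊆ u◁v x∈)
        by (inj₁ v◁u) with meet {u} {b} (◁-⊆ v◁u (rep∈ v)) (v⊆b (rep∈ v))
        ... | inj₁ u⊆b = u⊆b
        ... | inj₂ b⊆u with ◁-between v◁u b v⊆b b⊆u
        ...   | inj₁ refl = contradiction (refl , parent-unique v◁u b◁a) ¬q
        ...   | inj₂ refl = id

      stays-outside : ∀ {a b} → a ◁ b → ∀ {v w} → Star (WithoutEdge a b) v w → ¬ cl v ⊆ cl a → ¬ cl w ⊆ cl a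
      stays-outside a◁b ε v⊈a = v⊈a
      stays-outside {a} {b} a◁b {v} {w} (_◅_ {j = u} (adj , _ , ¬q) p) v⊈a = stays-outside a◁b p (by (adj-◁ adj))
        where
        by : v ◁ u ⊎ u ◁ v → ¬ cl u ⊆ cl a
        by (inj₁ v◁u) u⊆a = v⊈a λ x∈ → u⊆a (◁-⊆ v◁u x∈)
        by (inj₂ u◁v) u⊆a with meet {v} {a} (◁-⊆ u◁v (rep∈ u)) (u⊆a (rep∈ u))
        ... | inj₁ v⊆a = v⊈a v⊆a
        ... | inj₂ a⊆v with ◁-between u◁v a u⊆a a⊆v
        ...   | inj₁ refl = ¬q (parent-unique u◁v a◁b , refl)
        ...   | inj₂ refl = v⊈a id

      kind-⊆ : ∀ {v x w} → kind v ≡ leaf x → cl v ⊆ cl w → x ∈ cl w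
      kind-⊆ {v} {x} kv v⊆w with kind-leaf {v} {x} kv
      ... | refl = v⊆w (∈leaf x)

      kind-⊈ : ∀ {v x w} → kind v ≡ leaf x → ¬ cl v ⊆ cl w → x ∉ cl w
      kind-⊈ {v} {x} {w} kv v⊈w x∈ with kind-leaf {v} {x} kv
      ... | refl = v⊈w (leaf⊆ {x} {w} x∈)

      side-below : ∀ {a b} → b ◁ a → EdgeSide a b (cl b)
      side-below {a} {b} b◁a x = mk⇔
        (λ x∈ → leafVertex x , leaf-kind x , Star.reverse without-sym (inside {E = WithoutEdge a b}
          (λ p v⊆b w⊆b → ◁⇒adj p ,
            (λ { (refl , _) → ◁-⊉ b◁a v⊆b }) , (λ { (_ , refl) → ◁-⊉ b◁a w⊆b }))
          (leaf⊆ {x} {b} x∈)))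
        (λ (v , kv , p) → kind-⊆ {v} {x} {b} kv (stays-inside b◁a p id))

      child-side : ∀ {N w} → w ◁ N → ∀ x → x ∈ cl w ⇔ LeafOf (WithoutVertex N) w x
      child-side {N} {w} w◁N x = mk⇔
        (λ x∈ → leafVertex x , leaf-kind x , Star.reverse withoutV-sym (inside {E = WithoutVertex N}
          (λ p v⊆w u⊆w → ◁⇒adj p , (λ { refl → ◁-⊉ w◁N v⊆w }) , (λ { refl → ◁-⊉ w◁N u⊆w }))
          (leaf⊆ {x} {w} x∈)))
        (λ (v , kv , p) → Equivalence.from (side-below w◁N x) (v , kv , Star.map vertex⇒edge p))

      side-above : ∀ {a b} → a ◁ b → ∀ x → x ∉ cl a ⇔ LeafOf (WithoutEdge a b) b x
      side-above {a} {b} a◁b x = mk⇔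
        (λ x∉ → leafVertex x , leaf-kind x ,
          (outside {a = a} {b} avoid (◁-⊉ a◁b) ◅◅
           Star.reverse without-sym (outside {a = a} {leafVertex x} avoid (λ ⊆a → x∉ (⊆a (∈leaf x))))))
        (λ (v , kv , p) → kind-⊈ {v} {x} {a} kv (stays-outside a◁b p (◁-⊉ a◁b)))
        where
        avoid : ∀ {v w} → v ◁ w → ¬ cl v ⊆ cl a → ¬ cl w ⊆ cl a → WithoutEdge a b v w
        avoid p v⊈a w⊈a = ◁⇒adj p , (λ { (refl , _) → v⊈a id }) , (λ { (_ , refl) → w⊈a id })

      parent-side : ∀ {N w} → N ◁ w → ∀ x → x ∉ cl N ⇔ LeafOf (WithoutVertex N) w x
      parent-side {N} {w} N◁w x = mk⇔
        (λ x∉ → leafVertex x , leaf-kind x ,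
          (outside {a = N} {w} avoid (◁-⊉ N◁w) ◅◅
           Star.reverse withoutV-sym (outside {a = N} {leafVertex x} avoid (λ ⊆N → x∉ (⊆N (∈leaf x))))))
        (λ (v , kv , p) → Equivalence.from (side-above N◁w x) (v , kv , Star.map vertex⇒edge p))
        where
        avoid : ∀ {v w} → v ◁ w → ¬ cl v ⊆ cl N → ¬ cl w ⊆ cl N → WithoutVertex N v w
        avoid p v⊈ w⊈ = ◁⇒adj p , (λ { refl → v⊈ id }) , (λ { refl → w⊈ id })

      strong-child : ∀ {v w} → v ◁ w → Strong R (cl v)
      strong-child v◁w = StrongF⇒Strong (child-zero∉ v◁w) (cl-strong _)

      edgeStrong : ∀ a b → Adj a b → ∃[ U ] EdgeSide a b U × Strong R U
      edgeStrong a b ab with adj-◁ ab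
      ... | inj₂ b◁a = cl b , side-below b◁a , strong-child b◁a
      ... | inj₁ a◁b = ∁ (cl a) ,
        (λ x → mk⇔ (λ x∈ → Equivalence.to (side-above a◁b x) (x∈∁p⇒x∉p x∈))
                   (λ l → x∉p⇒x∈∁p (Equivalence.from (side-above a◁b x) l))) ,
        Strong-∁ (strong-child a◁b)

      EdgeFor : Subset n → Vertex × Vertex → Set
      EdgeFor U (a , b) = Adj a b × EdgeSide a b U

      edge-below : ∀ {U a b} → EdgeFor U (a , b) → zero ∉ U → b ◁ a × cl b ≡ U
      edge-below {U} {a} {b} (ab , eside) 0∉ with adj-◁ ab
      ... | inj₂ b◁a = b◁a , ⊆-antisym
        (λ {x} x∈ → Equivalence.from (eside x) (Equivalence.to (side-below b◁a x) x∈))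
        (λ {x} x∈ → Equivalence.from (side-below b◁a x) (Equivalence.to (eside x) x∈))
      ... | inj₁ a◁b = contradiction
        (Equivalence.from (eside zero) (Equivalence.to (side-above a◁b zero) (child-zero∉ a◁b))) 0∉

      edge-above : ∀ {U a b} → EdgeFor U (a , b) → zero ∈ U → a ◁ b × cl a ≡ ∁ U
      edge-above {U} {a} {b} (ab , eside) 0∈ with adj-◁ ab
      ... | inj₁ a◁b = a◁b , ⊆-antisym
        (λ {x} x∈ → x∉p⇒x∈∁p λ x∈U → Equivalence.from (side-above a◁b x) (Equivalence.to (eside x) x∈U) x∈)
        (λ {x} x∈ → decidable-stable (x ∈? cl a) λ x∉ → x∈∁p⇒x∉p x∈
          (Equivalence.from (eside x) (Equivalence.to (side-above a◁b x) x∉)))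
      ... | inj₂ b◁a = contradiction
        (Equivalence.from (side-below b◁a zero) (Equivalence.to (eside zero) 0∈)) (child-zero∉ b◁a)

      strong-vertex : ∀ {U} → zero ∉ U → Strong R U → ∃[ v ] cl v ≡ U
      strong-vertex 0∉ st = let sU = Strong⇒StrongF 0∉ st in find sU (proj₂ (F-nonempty (proj₁ sU)))

      not-root : ∀ {v} → zero ∉ cl v → v ≢ root
      not-root {v} 0∉ refl = 0∉ (subst (zero ∈_) (sym cl-root) ∈⊤)

      strongEdge : ∀ U → Strong R U → ∃! _≡_ (EdgeFor U)
      strongEdge U st with zero ∈? U
      ... | no 0∉ with strong-vertex 0∉ st
      ...   | v , refl with has-parent (not-root {v} 0∉)
      ...     | p , v◁p = (p , v) , (◁⇒adj′ v◁p , side-below v◁p) , unique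
        where
        unique : ∀ {e} → EdgeFor (cl v) e → (p , v) ≡ e
        unique {a , b} e with edge-below e 0∉
        ... | b◁a , eq with cl-inj {b} {v} eq
        ...   | refl = cong (_, v) (parent-unique v◁p b◁a)
      strongEdge U st | yes 0∈ with strong-vertex (x∈p⇒x∉∁p 0∈) (Strong-∁ st)
      ... | v , eq with has-parent (not-root {v} (subst (zero ∉_) (sym eq) (x∈p⇒x∉∁p 0∈)))
      ...   | p , v◁p = (v , p) , (◁⇒adj v◁p , eside) , unique
        where
        eside : EdgeSide v p U
        eside x = mk⇔
          (λ x∈ → Equivalence.to (side-above v◁p x) (λ x∈v → x∈p⇒x∉∁p x∈ (subst (x ∈_) eq x∈v)))
          (λ l → x∉∁p⇒x∈p λ x∈ → Equivalence.from (side-above v◁p x) l (subst (x ∈_) (sym eq) x∈))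
        unique : ∀ {e} → EdgeFor U e → (v , p) ≡ e
        unique {a , b} e with edge-above e 0∈
        ... | a◁b , eq′ with cl-inj {a} {v} (trans eq′ (sym eq))
        ...   | refl = cong (v ,_) (parent-unique v◁p a◁b)

      Splits : Subset n → Set
      Splits U = ∃[ N ] ∃[ I ] 1 ≤ ∣ I ∣ × ∣ I ∣ < degree N × Admissible (kind N) I ×
        (NodeSide N I U ⊎ NodeSide N I (∁ U))

      module Inside (N : Vertex) (inner : Inner N) where

        nb : Fin (degree N) → Vertex
        nb = List.lookup (nbrs N)

        place : ∀ {w} → w Mem.∈ nbrs N → ∃[ i ] nb i ≡ w
        place w∈ = Any.index w∈ , sym (Anyₚ.lookup-index w∈)

        before : ∀ {i j} → i Fin.< j → Before N (nb i) (nb j)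
        before = allPairs-lookup (nbrs-order N)

        nb-inj : ∀ {i j} → nb i ≡ nb j → i ≡ j
        nb-inj {i} {j} eq with Finₚ.<-cmp i j
        ... | tri< i<j _ _ = contradiction eq (before-≢ (before i<j))
        ... | tri≈ _ eq′ _ = eq′
        ... | tri> _ _ j<i = contradiction (sym eq) (before-≢ (before j<i))

        up : Vertex
        up = proj₁ (has-parent (inner≢root inner))

        N◁up : N ◁ up
        N◁up = proj₂ (has-parent (inner≢root inner))

        π : Fin (degree N)
        π = proj₁ (place (◁⇒adj N◁up))

        nb-π : nb π ≡ up
        nb-π = proj₂ (place (◁⇒adj N◁up))

        child : ∀ {i} → i ≢ π → nb i ◁ N
        child {i} i≢π with Equivalence.to (nbrs-adj N (nb i)) (Memₚ.∈-lookup i)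
        ... | inj₁ c = c
        ... | inj₂ p = contradiction (nb-inj (trans (parent-unique p N◁up) (sym nb-π))) i≢π

        child-≢π : ∀ {i} → nb i ◁ N → i ≢ π
        child-≢π c refl = ◁-asym N◁up (subst (_◁ N) nb-π c)

        π-last : ∀ {i j} → i Fin.< j → i ≢ π
        π-last i<j = child-≢π (proj₁ (before i<j))

        cell-of : ∀ {x} → x ∈ cl N → ∃[ i ] i ≢ π × x ∈ cl (nb i)
        cell-of x∈ with inner-child inner x∈
        ... | c , x∈c , c◁N with place (◁⇒adj′ c◁N)
        ...   | i , refl = i , child-≢π c◁N , x∈c

        c : Fin (degree N) → Fin n
        c i = rep (nb i)

        c∈ : ∀ i → c i ∈ cl (nb i)
        c∈ i = rep∈ (nb i)

        c∈N : ∀ {i} → i ≢ π → c i ∈ cl N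
        c∈N {i} i≢π = ◁-⊆ (child i≢π) (c∈ i)

        disjoint : ∀ {i j x} → i ≢ π → j ≢ π → x ∈ cl (nb i) → x ∈ cl (nb j) → i ≡ j
        disjoint {i} {j} i≢ j≢ x∈i x∈j with meet {nb i} {nb j} x∈i x∈j
        ... | inj₁ i⊆j = nb-inj ([ sym , (λ eq → contradiction (subst (_◁ N) eq (child j≢)) ◁-irrefl) ]′
          (◁-between (child i≢) (nb j) i⊆j (◁-⊆ (child j≢))))
        ... | inj₂ j⊆i = nb-inj ([ id , (λ eq → contradiction (subst (_◁ N) eq (child i≢)) ◁-irrefl) ]′
          (◁-between (child j≢) (nb i) j⊆i (◁-⊆ (child i≢))))

        Tₙ : Subset n
        Tₙ = cl N

        open Node Tₙ

        crossing : ∀ {i j x y} → i ≢ π → j ≢ π → i ≢ j → x ∈ cl (nb i) → y ∈ cl (nb j) → Cross x y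
        crossing {i} {j} {x} {y} i≢ j≢ i≢j x∈ y∈ with find (S-strong x y) (a∈S x y)
        ... | u , eq = go (meet {u} {nb i} x∈u x∈)
          where
          x∈u : x ∈ cl u
          x∈u = subst (x ∈_) (sym eq) (a∈S x y)
          y∈u : y ∈ cl u
          y∈u = subst (y ∈_) (sym eq) (b∈S x y)
          u⊆N : cl u ⊆ cl N
          u⊆N {z} z∈ = S-min (cl-strong N) (◁-⊆ (child i≢) x∈) (◁-⊆ (child j≢) y∈) (subst (z ∈_) eq z∈)
          go : cl u ⊆ cl (nb i) ⊎ cl (nb i) ⊆ cl u → Tₙ ⊆ S x y
          go (inj₁ u⊆i) = contradiction (disjoint i≢ j≢ (u⊆i y∈u) y∈) i≢j
          go (inj₂ i⊆u) with ◁-between (child i≢) u i⊆u u⊆N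
          ... | inj₁ refl = contradiction (disjoint i≢ j≢ y∈u y∈) i≢j
          ... | inj₂ refl = λ z∈ → subst (_ ∈_) eq z∈

        -- A child is strong, so a member that meets it and also has a point outside cannot cut it.
        closed : ∀ {V i x y} → F V → x ∈ cl (nb i) → x ∈ V → y ∈ V → y ∉ cl (nb i) → cl (nb i) ⊆ V
        closed {V} {i} FV x∈i x∈V y∈V y∉i {z} z∈ = decidable-stable (z ∈? V) λ z∉ →
          y∉i (absorb (cl-strong (nb i)) FV x∈i x∈V z∈ z∉ y∈V)

        apart-cells : ∀ {i j} → i ≢ π → j ≢ π → i ≢ j → c j ∉ cl (nb i)
        apart-cells {i} {j} i≢ j≢ i≢j c∈i = i≢j (disjoint i≢ j≢ c∈i (c∈ j))

        -- V is the union of the children at the positions in J.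
        Union : Subset (degree N) → Subset n → Set
        Union J V = ∀ x → x ∈ V ⇔ (∃[ j ] j ∈ J × x ∈ cl (nb j))

        Children : Subset (degree N) → Set
        Children J = ∀ {j} → j ∈ J → j ≢ π

        union-F : ∀ {J V U} → Union J V → F U → (∀ {j} → j ∈ J → cl (nb j) ⊆ U) →
          (∀ {x} → x ∈ U → ∃[ j ] j ∈ J × x ∈ cl (nb j)) → F V
        union-F un FU ⊇ ⊆ = subst F (⊆-antisym
          (λ {x} x∈ → Equivalence.from (un x) (⊆ x∈))
          (λ {x} x∈ → let j , j∈ , x∈j = Equivalence.to (un x) x∈ in ⊇ j∈ x∈j)) FU

        union-single : ∀ {J V a} → Union J V → a ∈ J → (∀ {j} → j ∈ J → j ≡ a) → F V
        union-single {a = a} un a∈ only = union-F un (proj₁ (cl-strong (nb a)))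
          (λ j∈ {x} x∈ → subst (λ j → x ∈ cl (nb j)) (only j∈) x∈) (λ x∈ → a , a∈ , x∈)

        -- For `j` other than `a`, the set `M (c a) (c j)` is exactly the union of two children,
        -- because a point of a third child would produce a full pair. All these sets share the
        -- child `a`, so their union is a member.
        union-complete : ∀ {J V a} → (∀ {e f} → e ∈ Tₙ → f ∈ Tₙ → ¬ Full e f) →
          Union J V → Children J → a ∈ J → F V
        union-complete {J} {V} {a} none un ch a∈ = let U , FU , a⊆ , ⊆ , ⊇ = grow (allFin (degree N)) in
          union-F un FU (λ {j} j∈ → ⊇ (Memₚ.∈-allFin j) j∈) ⊆
          where
          pair : ∀ {j} → j ∈ J → ∃[ W ] F W × cl (nb a) ⊆ W × cl (nb j) ⊆ W ×
            (∀ {x} → x ∈ W → x ∈ cl (nb a) ⊎ x ∈ cl (nb j))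
          pair {j} j∈ with j Finₚ.≟ a
          ... | yes refl = cl (nb a) , proj₁ (cl-strong (nb a)) , id , id , inj₁
          ... | no j≢a = M (c a) (c j) , M-F _ _ ,
            closed (M-F _ _) (c∈ a) (a∈M _ _) (b∈M _ _) (apart-cells (ch a∈) (ch j∈) (λ eq → j≢a (sym eq))) ,
            closed (M-F _ _) (c∈ j) (b∈M _ _) (a∈M _ _) (apart-cells (ch j∈) (ch a∈) j≢a) , only
            where
            only : ∀ {x} → x ∈ M (c a) (c j) → x ∈ cl (nb a) ⊎ x ∈ cl (nb j)
            only {x} x∈ with M-min (proj₁ (cl-strong N)) (c∈N (ch a∈)) (c∈N (ch j∈)) x∈
            ... | x∈Tₙ with cell-of x∈Tₙ
            ...   | l , l≢π , x∈l with l Finₚ.≟ a | l Finₚ.≟ j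
            ...     | yes refl | _        = inj₁ x∈l
            ...     | no _     | yes refl = inj₂ x∈l
            ...     | no l≢a   | no l≢j   =
              let e , f , e∈ , f∈ , fl = full-pair (c∈N (ch a∈)) (c∈N (ch j∈))
                    (crossing (ch a∈) (ch j∈) (λ eq → j≢a (sym eq)) (c∈ a) (c∈ j))
                    (crossing (ch a∈) l≢π (λ eq → l≢a (sym eq)) (c∈ a) x∈l)
                    (crossing (ch j∈) l≢π (λ eq → l≢j (sym eq)) (c∈ j) x∈l) x∈Tₙ x∈
              in contradiction fl (none e∈ f∈)
          grow : ∀ js → ∃[ U ] F U × cl (nb a) ⊆ U × (∀ {x} → x ∈ U → ∃[ j ] j ∈ J × x ∈ cl (nb j)) ×
            (∀ {j} → j Mem.∈ js → j ∈ J → cl (nb j) ⊆ U)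
          grow [] = cl (nb a) , proj₁ (cl-strong (nb a)) , id , (λ x∈ → a , a∈ , x∈) , λ ()
          grow (j ∷ js) with grow js | j ∈? J
          ... | U , FU , a⊆ , ⊆ , ⊇ | no j∉ =
            U , FU , a⊆ , ⊆ , λ { (here refl) j∈ → contradiction j∈ j∉ ; (there i∈) → ⊇ i∈ }
          ... | U , FU , a⊆ , ⊆ , ⊇ | yes j∈ with pair j∈
          ...   | W , FW , a⊆W , j⊆W , only =
            U ∪ W , F-∪ FU FW (a⊆ (c∈ a)) (a⊆W (c∈ a)) , (λ x∈ → x∈p∪q⁺ (inj₁ (a⊆ x∈))) ,
            (λ x∈ → [ ⊆ , (λ x∈W → [ (λ x∈a → a , a∈ , x∈a) , (λ x∈j → j , j∈ , x∈j) ]′ (only x∈W)) ]′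
              (x∈p∪q⁻ U W x∈)) ,
            λ { (here refl) _ x∈ → x∈p∪q⁺ (inj₂ (j⊆W x∈)) ; (there i∈) j∈ x∈ → x∈p∪q⁺ (inj₁ (⊇ i∈ j∈ x∈)) }

        module Circular (e∈Tₙ : end N ∈ Tₙ) (full-end : ∃[ f ] f ∈ Tₙ × Full (end N) f)
          (not-prime : ∃[ x ] ∃[ y ] x ∈ Tₙ × y ∈ Tₙ × Cross x y × ¬ Tₙ ⊆ M x y)
          (keys : ∀ {i j} → i Fin.< j → j ≢ π → key N (nb i) ≤ key N (nb j)) where

          e : Fin n
          e = end N

          -- With `e` in child `j`, the set `M e (c j)` stays inside that child while `M e (c i)`
          -- properly contains it. Then `j` would have a smaller key than the earlier position `i`.
          e∉later : ∀ {i j} → i Fin.< j → j ≢ π → e ∉ cl (nb j)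
          e∉later {i} {j} i<j j≢π e∈j = <-irrefl refl (<-≤-trans lt (keys i<j j≢π))
            where
            i≢j : j ≢ i
            i≢j eq = Finₚ.<⇒≢ i<j (sym eq)
            lt : key N (nb j) < key N (nb i)
            lt = p⊂q⇒∣p∣<∣q∣
              ((λ x∈ → closed (M-F _ _) e∈j (a∈M _ _) (b∈M _ _) (apart-cells j≢π (π-last i<j) i≢j)
                 (M-min (proj₁ (cl-strong (nb j))) e∈j (c∈ j) x∈)) ,
               c i , b∈M _ _ , λ ci∈ → apart-cells j≢π (π-last i<j) i≢j
                 (M-min (proj₁ (cl-strong (nb j))) e∈j (c∈ j) ci∈))

          cross-later : ∀ {i j} → i Fin.< j → j ≢ π → Cross e (c j)
          cross-later {i} {j} i<j j≢π with cell-of e∈Tₙ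
          ... | k , k≢π , e∈k = crossing k≢π j≢π (λ { refl → e∉later i<j j≢π e∈k }) e∈k (c∈ j)

          -- `chain` makes the two initial segments comparable and `strict` excludes mutual
          -- inclusion, so the keys decide which one is larger. A child that contains `e` is treated
          -- apart, since its points do not cross `e`.
          earlier : ∀ {i j} → i Fin.< j → j ≢ π → c i ∈ M e (c j) × c j ∉ M e (c i)
          earlier {i} {j} i<j j≢π with e ∈? cl (nb i)
          ... | yes e∈i = closed (M-F _ _) e∈i (a∈M _ _) (b∈M _ _) cj∉ (c∈ i) ,
            λ cj∈ → cj∉ (M-min (proj₁ (cl-strong (nb i))) e∈i (c∈ i) cj∈)
            where
            cj∉ : c j ∉ cl (nb i)
            cj∉ = apart-cells (π-last i<j) j≢π (Finₚ.<⇒≢ i<j)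
          ... | no e∉i with cell-of e∈Tₙ
          ...   | k , k≢π , e∈k = by (chain f∈Tₙ (c∈N (π-last i<j)) (c∈N j≢π) full-f ei)
            where
            f∈Tₙ = proj₁ (proj₂ full-end)
            full-f = proj₂ (proj₂ full-end)
            ei : Cross e (c i)
            ei = crossing k≢π (π-last i<j) (λ { refl → e∉i e∈k }) e∈k (c∈ i)
            cj∉ : c j ∉ M e (c i)
            cj∉ cj∈ = let x , y , x∈ , y∈ , xy , T⊈ = not-prime in
              strict e∈Tₙ f∈Tₙ (c∈N (π-last i<j)) (c∈N j≢π) full-f x∈ y∈ xy T⊈ ei
                (cross-later i<j j≢π) (crossing (π-last i<j) j≢π (Finₚ.<⇒≢ i<j) (c∈ i) (c∈ j))
                (decidable-stable (c i ∈? M e (c j)) λ ci∉ →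
                  <-irrefl refl (<-≤-trans (p⊂q⇒∣p∣<∣q∣ (M-mono (a∈M _ _) cj∈ , c i , b∈M _ _ , ci∉)) (keys i<j j≢π)))
                cj∈
            by : c i ∈ M e (c j) ⊎ c j ∈ M e (c i) → c i ∈ M e (c j) × c j ∉ M e (c i)
            by (inj₁ ci∈) = ci∈ , cj∉
            by (inj₂ cj∈) = contradiction cj∈ cj∉

          middle : ∀ {i j l} → i Fin.< j → j Fin.< l → l ≢ π → c j ∈ M (c i) (c l)
          middle i<j j<l l≢π = between (proj₁ (earlier j<l l≢π)) (proj₂ (earlier i<j (π-last j<l)))

          -- For distinct extreme positions `a` and `b` of `J`, the union is the set
          -- `M (c a) (c b)`.
          union-convex : ∀ {J V} → Convex J → Union J V → Children J → Nonempty J → F V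
          union-convex {J} {V} cv un ch ne with least J ne | greatest J ne
          ... | a , a∈ , min | b , b∈ , max with a Finₚ.≟ b
          ...   | yes refl = union-single un a∈ (λ j∈ → Finₚ.≤-antisym (max j∈) (min j∈))
          ...   | no a≢b = union-F un (M-F (c a) (c b)) ⊇ ⊆
            where
            a<b : a Fin.< b
            a<b = Finₚ.≤∧≢⇒< (min b∈) a≢b
            b≢π : b ≢ π
            b≢π = ch b∈
            a≢π : a ≢ π
            a≢π = ch a∈
            other-end : ∀ {i} → i ≢ π → ∃[ y ] y ∈ M (c a) (c b) × y ∉ cl (nb i)
            other-end {i} i≢π with i Finₚ.≟ a
            ... | yes refl = c b , b∈M _ _ , apart-cells a≢π b≢π a≢b
            ... | no i≢a   = c a , a∈M _ _ , apart-cells i≢π a≢π i≢a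
            whole : ∀ {i x} → i ≢ π → x ∈ cl (nb i) → x ∈ M (c a) (c b) → cl (nb i) ⊆ M (c a) (c b)
            whole i≢π x∈i x∈M = let y , y∈ , y∉ = other-end i≢π in closed (M-F _ _) x∈i x∈M y∈ y∉
            ⊇ : ∀ {j} → j ∈ J → cl (nb j) ⊆ M (c a) (c b)
            ⊇ {j} j∈ with a Finₚ.≟ j | j Finₚ.≟ b
            ... | yes refl | _        = whole a≢π (c∈ a) (a∈M _ _)
            ... | no _     | yes refl = whole b≢π (c∈ b) (b∈M _ _)
            ... | no a≢j   | no j≢b   = whole (ch j∈) (c∈ j)
              (middle (Finₚ.≤∧≢⇒< (min j∈) a≢j) (Finₚ.≤∧≢⇒< (max j∈) j≢b) b≢π)
            ⊆ : ∀ {x} → x ∈ M (c a) (c b) → ∃[ j ] j ∈ J × x ∈ cl (nb j)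
            ⊆ {x} x∈ with cell-of (M-min (proj₁ (cl-strong N)) (c∈N a≢π) (c∈N b≢π) x∈)
            ... | l , l≢π , x∈l = l , convex-range cv a∈ b∈ (≮⇒≥ not-left) (≮⇒≥ not-right) , x∈l
              where
              cl∈ : c l ∈ M (c a) (c b)
              cl∈ = whole l≢π x∈l x∈ (c∈ l)
              not-right : ¬ b Fin.< l
              not-right b<l = proj₂ (earlier b<l l≢π) (M-mono (proj₁ (earlier a<b b≢π)) (b∈M _ _) cl∈)
              not-left : ¬ l Fin.< a
              not-left l<a = not-before (c∈N b≢π) (cross-later l<a a≢π)
                (proj₁ (earlier a<b b≢π)) (proj₂ (earlier a<b b≢π))
                (proj₁ (earlier l<a a≢π)) (proj₂ (earlier l<a a≢π)) cl∈

        keys : kind N ≡ circular → ∀ {i j} → i Fin.< j → j ≢ π → key N (nb i) ≤ key N (nb j)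
        keys eq {i} {j} i<j j≢π with before i<j
        ... | _ , inj₁ N◁j         = contradiction N◁j (◁-asym (child j≢π))
        ... | _ , inj₂ (_ , _ , ≤) = ≤

        side⇔ : ∀ {I V} → NodeSide N I V → ∀ x →
          x ∈ V ⇔ (∃[ i ] i ∈ I × ((i ≢ π × x ∈ cl (nb i)) ⊎ (i ≡ π × x ∉ Tₙ)))
        side⇔ ns x = mk⇔
          (λ x∈ → let i , i∈ , l = Equivalence.to (ns x) x∈ in i , i∈ , to l (i Finₚ.≟ π))
          (λ (i , i∈ , s) → Equivalence.from (ns x) (i , i∈ , from s))
          where
          to : ∀ {i} → LeafOf (WithoutVertex N) (nb i) x → Dec (i ≡ π) →
            (i ≢ π × x ∈ cl (nb i)) ⊎ (i ≡ π × x ∉ Tₙ)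
          to l (no i≢π)   = inj₁ (i≢π , Equivalence.from (child-side (child i≢π) x) l)
          to l (yes refl) = inj₂ (refl , Equivalence.from (parent-side (subst (N ◁_) (sym nb-π) N◁up) x) l)
          from : ∀ {i} → (i ≢ π × x ∈ cl (nb i)) ⊎ (i ≡ π × x ∉ Tₙ) → LeafOf (WithoutVertex N) (nb i) x
          from (inj₁ (i≢π , x∈)) = Equivalence.to (child-side (child i≢π) x) x∈
          from (inj₂ (refl , x∉)) = Equivalence.to (parent-side (subst (N ◁_) (sym nb-π) N◁up) x) x∉

        union-side : ∀ {I V} → Children I → Union I V → NodeSide N I V
        union-side ch un x = mk⇔
          (λ x∈ → let i , i∈ , x∈i = Equivalence.to (un x) x∈ in
            i , i∈ , Equivalence.to (child-side (child (ch i∈)) x) x∈i)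
          (λ (i , i∈ , l) → Equivalence.from (un x) (i , i∈ , Equivalence.from (child-side (child (ch i∈)) x) l))

        side-union : ∀ {I V} → NodeSide N I V → π ∉ I → Union I V
        side-union {I} ns π∉ x = mk⇔
          (λ x∈ → let i , i∈ , s = Equivalence.to (side⇔ ns x) x∈ in
            i , i∈ , [ proj₂ , (λ (i≡π , _) → contradiction (subst (_∈ I) i≡π i∈) π∉) ]′ s)
          (λ (i , i∈ , x∈) → Equivalence.from (side⇔ ns x) (i , i∈ , inj₁ ((λ { refl → π∉ i∈ }) , x∈)))

        side-union-∁ : ∀ {I V} → NodeSide N I V → π ∈ I → Union (∁ I) (∁ V)
        side-union-∁ {I} {V} ns π∈ x = mk⇔ to from
          where
          to : x ∈ ∁ V → ∃[ i ] i ∈ ∁ I × x ∈ cl (nb i)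
          to x∈ with x ∈? Tₙ
          ... | no x∉T = contradiction (Equivalence.from (side⇔ ns x) (π , π∈ , inj₂ (refl , x∉T))) (x∈∁p⇒x∉p x∈)
          ... | yes x∈Tₙ = let i , i≢π , x∈i = cell-of x∈Tₙ in i ,
            x∉p⇒x∈∁p (λ i∈ → x∈∁p⇒x∉p x∈ (Equivalence.from (side⇔ ns x) (i , i∈ , inj₁ (i≢π , x∈i)))) , x∈i
          from : (∃[ i ] i ∈ ∁ I × x ∈ cl (nb i)) → x ∈ ∁ V
          from (i , i∈ , x∈i) = x∉p⇒x∈∁p λ x∈ →
            let j , j∈ , s = Equivalence.to (side⇔ ns x) x∈
                i≢π : i ≢ π
                i≢π = λ { refl → x∈∁p⇒x∉p i∈ π∈ }
            in [ (λ (j≢π , x∈j) → x∈∁p⇒x∉p i∈ (subst (_∈ I) (disjoint j≢π i≢π x∈j x∈i) j∈))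
               , (λ (_ , x∉T) → x∉T (◁-⊆ (child i≢π) x∈i)) ]′ s

        interval-convex : ∀ {I : Subset (degree N)} → IsInterval I → Convex I
        interval-convex (a , b , h) {j = j} i∈ l∈ i<j j<l = Equivalence.from (h j)
          (≤-trans (proj₁ (Equivalence.to (h _) i∈)) (<⇒≤ i<j) , ≤-trans (<⇒≤ j<l) (proj₂ (Equivalence.to (h _) l∈)))

        -- The parent has the last position, so an interval that contains it is a final segment and
        -- the complement is an initial one.
        interval-∁-convex : ∀ {I : Subset (degree N)} → IsInterval I → π ∈ I → Convex (∁ I)
        interval-∁-convex {I} (a , b , h) π∈ {i} {j} {l} i∈ l∈ i<j j<l = x∉p⇒x∈∁p λ j∈ → x∈∁p⇒x∉p l∈
          (Equivalence.from (h l) (≤-trans (proj₁ (Equivalence.to (h j) j∈)) (<⇒≤ j<l) ,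
            ≤-trans (≮⇒≥ (λ π<l → π-last π<l refl)) (proj₂ (Equivalence.to (h π) π∈))))

        -- The side without the component of the parent is a union of children; each kind has its
        -- own reason why such a union is a member.
        split-F : ∀ {I V} → Admissible (kind N) I → KindSpec N (kind N) →
          Nonempty I → (∃[ i ] i ∉ I) → NodeSide N I V → (π ∉ I × F V) ⊎ (π ∈ I × F (∁ V))
        split-F {I} {V} adm ks (a , a∈) (b , b∉) ns with π ∈? I
        ... | no π∉ = inj₁ (π∉ , go (kind N) refl adm ks)
          where
          un = side-union ns π∉
          ch : Children I
          ch i∈ refl = π∉ i∈
          go : ∀ k → kind N ≡ k → Admissible k I → KindSpec N k → F V
          go complete _ _ (_ , none)             = union-complete none un ch a∈
          go circular eq iv (_ , e∈ , ef , np)   = Circular.union-convex e∈ ef np (keys eq) (interval-convex iv) un ch (a , a∈)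
          go prime    _ (s , refl) _             = union-single un (x∈⁅x⁆ s) (λ j∈ → x∈⁅y⁆⇒x≡y s j∈)
        ... | yes π∈ = inj₂ (π∈ , go (kind N) refl adm ks)
          where
          un = side-union-∁ ns π∈
          ch : Children (∁ I)
          ch i∈ refl = x∈∁p⇒x∉p i∈ π∈
          go : ∀ k → kind N ≡ k → Admissible k I → KindSpec N k → F (∁ V)
          go complete _ _ (_ , none)             = union-complete none un ch (x∉p⇒x∈∁p b∉)
          go circular eq iv (_ , e∈ , ef , np)   = Circular.union-convex e∈ ef np (keys eq)
            (interval-∁-convex iv π∈) un ch (b , x∉p⇒x∈∁p b∉)
          go prime    _ (s , refl) _ with x∈⁅y⁆⇒x≡y s π∈
          ... | refl = union-F un (proj₁ (cl-strong N))
            (λ j∈ → ◁-⊆ (child (λ { refl → x∈∁p⇒x∉p j∈ π∈ })))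
            (λ x∈ → let i , i≢π , x∈i = cell-of x∈ in
              i , x∉p⇒x∈∁p (λ i∈ → i≢π (x∈⁅y⁆⇒x≡y π i∈)) , x∈i)

        splits-B : ∀ {I V} → Admissible (kind N) I → 1 ≤ ∣ I ∣ → ∣ I ∣ < degree N → NodeSide N I V → InB R V
        splits-B {I} {V} adm 1≤ lt ns with split-F adm (kind-spec N) (size-nonempty I 1≤) (size-proper I lt) ns
        ... | inj₁ (π∉ , FV) = F⇒InB (λ 0∈ → let i , i∈ , 0∈i = Equivalence.to (side-union ns π∉ zero) 0∈ in
            child-zero∉ (child (λ eq → π∉ (subst (_∈ I) eq i∈))) 0∈i) FV
        ... | inj₂ (π∈ , FV) = subst (InB R) (∁∁ V) (InB-∁ (F⇒InB (λ 0∈ →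
            let i , i∈ , 0∈i = Equivalence.to (side-union-∁ ns π∈ zero) 0∈ in
            child-zero∉ (child (λ eq → x∈∁p⇒x∉p (subst (_∈ ∁ I) eq i∈) π∈)) 0∈i) FV))

        single-admissible : (i : Fin (degree N)) → Admissible (kind N) ⁅ i ⁆
        single-admissible i with kind N | kind-spec N
        ... | leaf x   | eq = ⊥-elim (inner (trans (cong proj₁ eq) (sym (cong proj₂ eq))))
        ... | complete | _  = tt
        ... | circular | _  = i , i , λ j → mk⇔
          (λ j∈ → case x∈⁅y⁆⇒x≡y i j∈ of λ { refl → ≤-refl , ≤-refl })
          (λ (i≤ , ≤i) → subst (_∈ ⁅ i ⁆) (Finₚ.≤-antisym i≤ ≤i) (x∈⁅x⁆ i))
        ... | prime    | _  = i , refl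

        some-child : ∃[ i ] i ≢ π
        some-child = let i , i≢π , _ = cell-of (rep∈ N) in i , i≢π

        above-splits : Splits Tₙ
        above-splits = N , ⁅ π ⁆ , nonempty-size (x∈⁅x⁆ π) ,
          proper-size (λ i∈ → proj₂ some-child (x∈⁅y⁆⇒x≡y π i∈)) , single-admissible π , inj₂ λ x → mk⇔
          (λ x∈ → π , x∈⁅x⁆ π , subst (λ w → LeafOf (WithoutVertex N) w x) (sym nb-π)
            (Equivalence.to (parent-side N◁up x) (x∈∁p⇒x∉p x∈)))
          (λ (i , i∈ , l) → x∉p⇒x∈∁p (Equivalence.from (parent-side N◁up x)
            (subst (λ w → LeafOf (WithoutVertex N) w x) (trans (cong nb (x∈⁅y⁆⇒x≡y π i∈)) nb-π) l)))

        child-splits : ∀ {v} → v ◁ N → Splits (cl v)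
        child-splits {v} v◁N with place (◁⇒adj′ v◁N)
        ... | i , refl = N , ⁅ i ⁆ , nonempty-size (x∈⁅x⁆ i) ,
          proper-size (λ π∈ → child-≢π v◁N (sym (x∈⁅y⁆⇒x≡y i π∈))) , single-admissible i , inj₁
          (union-side (λ j∈ → subst (_≢ π) (sym (x∈⁅y⁆⇒x≡y i j∈)) (child-≢π v◁N))
            λ x → mk⇔ (λ x∈ → i , x∈⁅x⁆ i , x∈)
              (λ (j , j∈ , x∈) → subst (λ j → x ∈ cl (nb j)) (x∈⁅y⁆⇒x≡y i j∈) x∈))

        -- As `a` and `b` lie in different children, `V` has points outside every child, so it
        -- contains or avoids each child entirely. In a prime node `M a b` would already contain
        -- `t`.
        weak-splits : ∀ {V a b t} → F V → a ∈ V → b ∈ V → V ⊆ Tₙ → Cross a b → t ∈ Tₙ → t ∉ V → Splits V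
        weak-splits {V} {a} {b} {t} FV a∈ b∈ V⊆Tₙ ab t∈ t∉ =
          N , I , nonempty-size ia∈ , proper-size π∉I , admissible (kind N) refl (kind-spec N) ,
          inj₁ (union-side (λ i∈ → proj₁ (I⁻ i∈)) un)
          where
          chosen? : ∀ i → Dec (i ≢ π × c i ∈ V)
          chosen? i = ¬? (i Finₚ.≟ π) ×-dec (c i ∈? V)
          I : Subset (degree N)
          I = subset chosen?
          I⁻ : ∀ {i} → i ∈ I → i ≢ π × c i ∈ V
          I⁻ = ∈-subset⁻ chosen?
          π∉I : π ∉ I
          π∉I π∈ = proj₁ (I⁻ π∈) refl
          leaves-cell : ∀ {i} → i ≢ π → ∃[ y ] y ∈ V × y ∉ cl (nb i)
          leaves-cell {i} i≢π with a ∈? cl (nb i) | b ∈? cl (nb i)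
          ... | no a∉  | _      = a , a∈ , a∉
          ... | yes _  | no b∉  = b , b∈ , b∉
          ... | yes a∈i | yes b∈i = ⊥-elim (◁-⊉ (child i≢π) λ x∈ → S-min (cl-strong (nb i)) a∈i b∈i (ab x∈))
          whole : ∀ {i x} → i ≢ π → x ∈ cl (nb i) → x ∈ V → cl (nb i) ⊆ V
          whole i≢π x∈i x∈V = let y , y∈ , y∉ = leaves-cell i≢π in closed FV x∈i x∈V y∈ y∉
          un : Union I V
          un x = mk⇔
            (λ x∈ → let i , i≢π , x∈i = cell-of (V⊆Tₙ x∈) in
              i , ∈-subset⁺ chosen? (i≢π , whole i≢π x∈i x∈ (c∈ i)) , x∈i)
            (λ (i , i∈ , x∈i) → whole (proj₁ (I⁻ i∈)) (c∈ i) (proj₂ (I⁻ i∈)) x∈i)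
          ia∈ : proj₁ (Equivalence.to (un a) a∈) ∈ I
          ia∈ = proj₁ (proj₂ (Equivalence.to (un a) a∈))
          admissible : ∀ k → kind N ≡ k → KindSpec N k → Admissible k I
          admissible (leaf x) _ eq = ⊥-elim (inner (trans (cong proj₁ eq) (sym (cong proj₂ eq))))
          admissible complete _ _  = tt
          admissible circular eq (_ , e∈ , ef , np) = convex⇒interval (_ , ia∈)
            λ {i} {j} {l} i∈ l∈ i<j j<l → ∈-subset⁺ chosen? (π-last j<l ,
              M-min FV (proj₂ (I⁻ i∈)) (proj₂ (I⁻ l∈))
                (Circular.middle e∈ ef np (keys eq) i<j j<l (proj₁ (I⁻ l∈))))
          admissible prime _ (_ , all) = ⊥-elim (t∉ (M-min FV a∈ b∈ (all (V⊆Tₙ a∈) (V⊆Tₙ b∈) ab t∈)))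

      root-child-inner : 3 ≤ n → ∀ {v} → v ◁ root → Inner v
      root-child-inner 3≤n {v} v◁ with leaf-or-inner v
      ... | inj₂ iv = iv
      ... | inj₁ (x , refl) with x Finₚ.≟ zero
      ...   | yes refl = contradiction (∈leaf zero) (child-zero∉ v◁)
      ...   | no x≢0 = two-others 3≤n λ y≢0 → cl-leaf x≢0 (root-child v◁ y≢0)
        where
        two-others : ∀ {k A} {x : Fin (suc k)} → 3 ≤ suc k → (∀ {y : Fin (suc k)} → y ≢ zero → y ≡ x) → A
        two-others {suc (suc k)} _ only with only {suc zero} (λ ()) | only {suc (suc zero)} (λ ())
        ... | refl | ()
        two-others {suc zero} (s≤s (s≤s ())) _
        two-others {zero} (s≤s ()) _

      -- `span` provides the least cluster around `V`. If `V` fills an inner one, the edge to its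
      -- parent yields the bipartition; if `V` is smaller, it is a proper union of children. A
      -- one-point `V` is split off at the parent of its leaf: with at least three labels the only
      -- child of the root is inner, so that parent is not the root.
      F-splits : 3 ≤ n → ∀ {V} → zero ∉ V → F V → Splits V
      F-splits 3≤n {V} 0∉ FV with F-nonempty FV
      ... | a , a∈ with span {V} a∈
      ...   | b , b∈ , V⊆S with find (S-strong a b) (a∈S a b)
      ...     | v , eq with cl v ⊆? V
      ...       | yes v⊆V with ⊆-antisym v⊆V (λ {x} x∈ → subst (x ∈_) (sym eq) (V⊆S x∈))
      ...         | refl with leaf-or-inner v
      ...           | inj₂ iv = Inside.above-splits v iv
      ...           | inj₁ (x , refl) with has-parent (not-root {leafVertex x} 0∉)
      ...             | p , x◁p with leaf-or-inner p
      ...               | inj₂ ip = Inside.child-splits p ip x◁p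
      ...               | inj₁ (y , refl) with y Finₚ.≟ zero
      ...                 | yes refl = ⊥-elim (leaf-¬inner x (root-child-inner 3≤n x◁p))
      ...                 | no y≢0 = ⊥-elim (◁-⊉ x◁p λ {z} z∈ → subst (_∈ cl (leafVertex x))
        (trans (cl-leaf y≢0 (◁-⊆ x◁p (∈leaf x))) (sym (cl-leaf y≢0 z∈))) (∈leaf x))
      F-splits 3≤n {V} 0∉ FV | a , a∈ | b , b∈ , V⊆S | v , eq | no v⊈V with ⊈⇒∃ {U = cl v} {V} v⊈V
      ... | t , t∈ , t∉ with leaf-or-inner v
      ...   | inj₂ iv = Inside.weak-splits v iv FV a∈ b∈ (λ {x} x∈ → subst (x ∈_) (sym eq) (V⊆S x∈))
        (λ {x} x∈ → subst (x ∈_) eq x∈) t∈ t∉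
      ...   | inj₁ (x , refl) = ⊥-elim (t∉ (subst (_∈ V) (trans (only a∈v) (sym (only t∈))) a∈))
        where
        a∈v : a ∈ cl (leafVertex x)
        a∈v = subst (a ∈_) (sym eq) (a∈S a b)
        x≢0 : x ≢ zero
        x≢0 refl = x∈∁p⇒x∉p (S-min (others-strong a≢0) (away a∈) (away b∈)
            (subst (zero ∈_) eq (∈leaf zero))) (x∈⁅x⁆ zero)
          where
          a≢0 : a ≢ zero
          a≢0 refl = 0∉ a∈
          away : ∀ {y} → y ∈ V → y ∈ ∁ ⁅ zero ⁆
          away {y} y∈ = x∉p⇒x∈∁p λ y∈0 → 0∉ (subst (_∈ V) (x∈⁅y⁆⇒x≡y zero y∈0) y∈)
        only : ∀ {y} → y ∈ cl (leafVertex x) → y ≡ x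
        only = cl-leaf x≢0

      splits-∁ : ∀ {U} → Splits (∁ U) → Splits U
      splits-∁ {U} (N , I , a , b , adm , inj₁ ns) = N , I , a , b , adm , inj₂ ns
      splits-∁ {U} (N , I , a , b , adm , inj₂ ns) = N , I , a , b , adm , inj₁ (subst (NodeSide N I) (∁∁ U) ns)

      nodes : 3 ≤ n → ∀ U → InB R U ⇔ Splits U
      nodes 3≤n U = mk⇔ to from
        where
        to : InB R U → Splits U
        to inB with zero ∈? U
        ... | no 0∉  = F-splits 3≤n 0∉ (InB⇒F 0∉ inB)
        ... | yes 0∈ = splits-∁ (F-splits 3≤n (x∈p⇒x∉∁p 0∈) (InB⇒F (x∈p⇒x∉∁p 0∈) (InB-∁ inB)))
        from : Splits U → InB R U
        from (N , I , 1≤ , lt , adm , s) with leaf-or-inner N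
        ... | inj₁ (x , refl) = ⊥-elim (subst (λ k → Admissible k I) (leaf-kind x) adm)
        ... | inj₂ iN with s
        ...   | inj₁ ns = Inside.splits-B N iN adm 1≤ lt ns
        ...   | inj₂ ns = subst (InB R) (∁∁ U) (InB-∁ (Inside.splits-B N iN adm 1≤ lt ns))

    isDecompositionTree : IsUmodularDecompositionTree R graph
    isDecompositionTree = record
      { isTree = record
          { isSimple = record
              { unique    = λ v → AllPairs.map before-≢ (nbrs-order v)
              ; loopless  = λ v vv → [ ◁-irrefl , ◁-irrefl ]′ (adj-◁ vv)
              ; symmetric = adj-sym
              }
          ; connected = connected
          ; acyclic   = acyclic
          }
      ; labelling = record
          { leaves = λ v → mk⇔
              (λ d≤ → [ (λ { (x , refl) → x , leaf-kind x }) , (λ iv → contradiction d≤ (inner-degree iv)) ]′ (leaf-or-inner v))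
              (λ (x , kv) → subst (λ v → degree v ≤ 1) (kind-leaf {v} {x} kv) (leaf-degree x))
          ; labels = λ x → leafVertex x , leaf-kind x , λ {v} kv → kind-leaf {v} {x} kv
          }
      ; edgeStrong = edgeStrong
      ; strongEdge = strongEdge
      ; nodes      = nodes
      }

-- A first-order language of bounded loops over tables, compiled to Program

data Ex (d : ℕ) : Set where
  num      : ℕ → Ex d
  var      : Fin d → Ex d
  size ptr : Ex d
  inp      : Ex d → Ex d
  tab      : ℕ → Ex d → Ex d
  bin      : Op → Ex d → Ex d → Ex d
  ite      : Ex d → Ex d → Ex d → Ex d
  sum mu   : Ex (suc d) → Ex d

infixr 5 _⟫_

data Cmd (d : ℕ) : Set where
  set  : ℕ → Ex d → Ex d → Cmd d
  adv  : Cmd d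
  emit : Ex d → Cmd d
  _⟫_  : Cmd d → Cmd d → Cmd d
  when : Ex d → Cmd d → Cmd d
  loop : Cmd (suc d) → Cmd d

record St : Set where
  constructor st
  field
    tabs : Store
    pos  : ℕ
    out  : List ℕ
open St

branch : {A : Set} → ℕ → A → A → A
branch zero    x y = y
branch (suc _) x y = x

sumN : ℕ → (ℕ → ℕ) → ℕ
sumN zero    g = 0
sumN (suc k) g = sumN k g + g k

-- The least i < k with g i ≢ 0, and k if there is none. As long as nothing is
-- found the accumulator equals the index, which is when it is incremented.
muN : ℕ → (ℕ → ℕ) → ℕ
muN zero    g = 0
muN (suc k) g = muN k g + apply mul (apply equal (muN k g) k) (apply equal (g k) 0)

-- Opaque, for otherwise the bodies of loops are unfolded during type checking.
opaque
  iterN : {A : Set} → ℕ → (ℕ → A → A) → A → A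
  iterN zero    f s = s
  iterN (suc k) f s = f k (iterN k f s)

  iterN-zero : {A : Set} (f : ℕ → A → A) (s : A) → iterN 0 f s ≡ s
  iterN-zero f s = refl

  iterN-suc : {A : Set} (k : ℕ) (f : ℕ → A → A) (s : A) → iterN (suc k) f s ≡ f k (iterN k f s)
  iterN-suc k f s = refl

module Semantics (n : ℕ) (input : ℕ → ℕ) where

  eval : ∀ {d} → Store → ℕ → Vec ℕ d → Ex d → ℕ
  eval τ p ρ (num k)     = k
  eval τ p ρ (var i)     = Vec.lookup ρ i
  eval τ p ρ size        = n
  eval τ p ρ ptr         = p
  eval τ p ρ (inp e)     = input (eval τ p ρ e)
  eval τ p ρ (tab T e)   = τ T (eval τ p ρ e)
  eval τ p ρ (bin o e f) = apply o (eval τ p ρ e) (eval τ p ρ f)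
  eval τ p ρ (ite c e f) = branch (eval τ p ρ c) (eval τ p ρ e) (eval τ p ρ f)
  eval τ p ρ (sum e)     = sumN n (λ i → eval τ p (i ∷ ρ) e)
  eval τ p ρ (mu e)      = muN n (λ i → eval τ p (i ∷ ρ) e)

  exec : ∀ {d} → Cmd d → Vec ℕ d → St → St
  exec (set T i e) ρ (st τ p o) = st (τ [ T , eval τ p ρ i ≔ eval τ p ρ e ]) p o
  exec adv         ρ (st τ p o) = st τ (suc p) o
  exec (emit e)    ρ (st τ p o) = st τ p (o ++ [ eval τ p ρ e ])
  exec (c ⟫ c′)    ρ s = exec c′ ρ (exec c ρ s)
  exec (when e c)  ρ s = branch (eval (tabs s) (pos s) ρ e) (exec c ρ s) s
  exec (loop c)    ρ s = iterN n (λ i → exec c (i ∷ ρ)) s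

-- Arrays 0 and 1 hold input and output, array 2 the loop variables, array 3
-- the registers, array 4 the input and output positions, array 5 + T table T.

reg : ℕ → Expr
reg j = read 3 (lit j)

for : ℕ → Program → Program
for d P = write 2 (lit d) (lit 0) ⨾
  while (op less (read 2 (lit d)) (read 0 (lit 0)))
    (P ⨾ write 2 (lit d) (op add (read 2 (lit d)) (lit 1)))

-- The value is left in register `j`, while the registers below `j` keep pending operands. Loop
-- variables are stored by level, so that entering a loop moves none of them; index `i` at depth `d`
-- has level `d ∸ suc i`.
compileEx : ∀ {d} → ℕ → Ex d → Program
compileEx j (num k)     = write 3 (lit j) (lit k)
compileEx {d} j (var i) = write 3 (lit j) (read 2 (lit (d ∸ suc (toℕ i))))
compileEx j size        = write 3 (lit j) (read 0 (lit 0))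
compileEx j ptr         = write 3 (lit j) (read 4 (lit 0))
compileEx j (inp e)     = compileEx j e ⨾ write 3 (lit j) (read 0 (reg j))
compileEx j (tab T e)   = compileEx j e ⨾ write 3 (lit j) (read (5 + T) (reg j))
compileEx j (bin o e f) =
  compileEx j e ⨾ compileEx (suc j) f ⨾ write 3 (lit j) (op o (reg j) (reg (suc j)))
compileEx j (ite c e f) = compileEx j c ⨾ cond (reg j) (compileEx j e) (compileEx j f)
compileEx {d} j (sum e) = write 3 (lit j) (lit 0) ⨾
  for d (compileEx (suc j) e ⨾ write 3 (lit j) (op add (reg j) (reg (suc j))))
compileEx {d} j (mu e) = write 3 (lit j) (lit 0) ⨾
  for d (compileEx (suc j) e ⨾
    write 3 (lit j) (op add (reg j)
      (op mul (op equal (reg j) (read 2 (lit d))) (op equal (reg (suc j)) (lit 0)))))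

compile : ∀ {d} → Cmd d → Program
compile (set T i e) = compileEx 0 i ⨾ compileEx 1 e ⨾ write (5 + T) (reg 0) (reg 1)
compile adv         = write 4 (lit 0) (op add (read 4 (lit 0)) (lit 1))
compile (emit e)    = compileEx 0 e ⨾ write 1 (read 4 (lit 1)) (reg 0) ⨾
  write 4 (lit 1) (op add (read 4 (lit 1)) (lit 1))
compile (c ⟫ c′)    = compile c ⨾ compile c′
compile (when e c)  = compileEx 0 e ⨾ cond (reg 0) (compile c) skip
compile {d} (loop c) = for d (compile c)

-- Rounded up throughout: starting the loop costs 3, each round adds 6 for the test and 6 for the
-- increment, and the final test costs 6.
loopCost : ℕ → ℕ → ℕ
loopCost n b = 16 + (n * (b + 32) + 16)

-- 16 covers each single write and each branch; the dearest write, the update in `mu`, costs 15.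
costEx : ∀ {d} → ℕ → Ex d → ℕ
costEx n (num k)     = 16
costEx n (var i)     = 16
costEx n size        = 16
costEx n ptr         = 16
costEx n (inp e)     = costEx n e + 16
costEx n (tab T e)   = costEx n e + 16
costEx n (bin o e f) = costEx n e + (costEx n f + 16)
costEx n (ite c e f) = costEx n c + (16 + (costEx n e + costEx n f))
costEx n (sum e)     = 16 + loopCost n (costEx n e + 16)
costEx n (mu e)      = 16 + loopCost n (costEx n e + 16)

cost : ∀ {d} → ℕ → Cmd d → ℕ
cost n (set T i e) = costEx n i + (costEx n e + 16)
cost n adv         = 16
cost n (emit e)    = costEx n e + (16 + 16)
cost n (c ⟫ c′)    = cost n c + cost n c′
cost n (when e c)  = costEx n e + (16 + cost n c)
cost n (loop c)    = loopCost n (cost n c)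

-- The cost is at most coeff · (n + 2) ^ depth.

depthEx : ∀ {d} → Ex d → ℕ
depthEx (inp e)     = depthEx e
depthEx (tab T e)   = depthEx e
depthEx (bin o e f) = depthEx e ⊔ depthEx f
depthEx (ite c e f) = depthEx c ⊔ (depthEx e ⊔ depthEx f)
depthEx (sum e)     = suc (depthEx e)
depthEx (mu e)      = suc (depthEx e)
depthEx _           = 0

depth : ∀ {d} → Cmd d → ℕ
depth (set T i e) = depthEx i ⊔ depthEx e
depth adv         = 0
depth (emit e)    = depthEx e
depth (c ⟫ c′)    = depth c ⊔ depth c′
depth (when e c)  = depthEx e ⊔ depth c
depth (loop c)    = suc (depth c)

coeffEx : ∀ {d} → Ex d → ℕ
coeffEx (num k)     = 16
coeffEx (var i)     = 16
coeffEx size        = 16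
coeffEx ptr         = 16
coeffEx (inp e)     = coeffEx e + 16
coeffEx (tab T e)   = coeffEx e + 16
coeffEx (bin o e f) = coeffEx e + (coeffEx f + 16)
coeffEx (ite c e f) = coeffEx c + (16 + (coeffEx e + coeffEx f))
coeffEx (sum e)     = 16 + (16 + ((coeffEx e + 16) + 32 + 16))
coeffEx (mu e)      = 16 + (16 + ((coeffEx e + 16) + 32 + 16))

coeff : ∀ {d} → Cmd d → ℕ
coeff (set T i e) = coeffEx i + (coeffEx e + 16)
coeff adv         = 16
coeff (emit e)    = coeffEx e + (16 + 16)
coeff (c ⟫ c′)    = coeff c + coeff c′
coeff (when e c)  = coeffEx e + (16 + coeff c)
coeff (loop c)    = 16 + (coeff c + 32 + 16)

module _ (n : ℕ) where

  private
    m = n + 2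

    m>0 : 0 < m
    m>0 = ≤-trans (s≤s z≤n) (m≤n+m 2 n)

    pow-mono : ∀ {p q} → p ≤ q → m ^ p ≤ m ^ q
    pow-mono = ^-monoʳ-≤ m {{Data.Nat.>-nonZero m>0}}

    1≤pow : ∀ q → 1 ≤ m ^ q
    1≤pow q = pow-mono (z≤n {q})

    const : ∀ k q → k ≤ k * m ^ q
    const k q = ≤-trans (≤-reflexive (sym (*-identityʳ k))) (*-monoʳ-≤ k (1≤pow q))

    raise : ∀ {x q} k p → p ≤ q → x ≤ k * m ^ p → x ≤ k * m ^ q
    raise k p p≤q h = ≤-trans h (*-monoʳ-≤ k (pow-mono p≤q))

    plus : ∀ {x y} k l q → x ≤ k * m ^ q → y ≤ l * m ^ q → x + y ≤ (k + l) * m ^ q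
    plus k l q hx hy =
      ≤-trans (+-mono-≤ hx hy) (≤-reflexive (sym (Data.Nat.Properties.*-distribʳ-+ (m ^ q) k l)))

    loop-bound : ∀ {x} k q → x ≤ k * m ^ q → loopCost n x ≤ (16 + (k + 32 + 16)) * m ^ suc q
    loop-bound {x} k q h = plus 16 (k + 32 + 16) (suc q) (const 16 (suc q))
      (plus (k + 32) 16 (suc q)
        (≤-trans (*-mono-≤ (m≤m+n n 2) (plus k 32 q h (const 32 q)))
          (≤-reflexive (swap m (k + 32) (m ^ q))))
        (const 16 (suc q)))
      where
      swap : ∀ a b c → a * (b * c) ≡ b * (a * c)
      swap = solve-∀

  costEx≤ : ∀ {d} (e : Ex d) → costEx n e ≤ coeffEx e * m ^ depthEx e
  costEx≤ (num k) = const 16 0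
  costEx≤ (var i) = const 16 0
  costEx≤ size    = const 16 0
  costEx≤ ptr     = const 16 0
  costEx≤ (inp e)   = plus (coeffEx e) 16 (depthEx e) (costEx≤ e) (const 16 (depthEx e))
  costEx≤ (tab T e) = plus (coeffEx e) 16 (depthEx e) (costEx≤ e) (const 16 (depthEx e))
  costEx≤ (bin o e f) = plus (coeffEx e) (coeffEx f + 16) q
    (raise (coeffEx e) (depthEx e) (m≤m⊔n _ _) (costEx≤ e))
    (plus (coeffEx f) 16 q (raise (coeffEx f) (depthEx f) (m≤n⊔m (depthEx e) _) (costEx≤ f)) (const 16 q))
    where q = depthEx e ⊔ depthEx f
  costEx≤ (ite c e f) = plus (coeffEx c) (16 + (coeffEx e + coeffEx f)) q
    (raise (coeffEx c) (depthEx c) (m≤m⊔n _ _) (costEx≤ c))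
    (plus 16 (coeffEx e + coeffEx f) q (const 16 q)
      (raise (coeffEx e + coeffEx f) r (m≤n⊔m (depthEx c) r)
        (plus (coeffEx e) (coeffEx f) r
          (raise (coeffEx e) (depthEx e) (m≤m⊔n _ _) (costEx≤ e))
          (raise (coeffEx f) (depthEx f) (m≤n⊔m (depthEx e) _) (costEx≤ f)))))
    where
    r = depthEx e ⊔ depthEx f
    q = depthEx c ⊔ r
  costEx≤ (sum e) = plus 16 (16 + (coeffEx e + 16 + 32 + 16)) (suc (depthEx e)) (const 16 (suc (depthEx e)))
    (loop-bound (coeffEx e + 16) (depthEx e) (plus (coeffEx e) 16 (depthEx e) (costEx≤ e) (const 16 (depthEx e))))
  costEx≤ (mu e) = plus 16 (16 + (coeffEx e + 16 + 32 + 16)) (suc (depthEx e)) (const 16 (suc (depthEx e)))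
    (loop-bound (coeffEx e + 16) (depthEx e) (plus (coeffEx e) 16 (depthEx e) (costEx≤ e) (const 16 (depthEx e))))

  cost≤ : ∀ {d} (c : Cmd d) → cost n c ≤ coeff c * m ^ depth c
  cost≤ (set T i e) = plus (coeffEx i) (coeffEx e + 16) q
    (raise (coeffEx i) (depthEx i) (m≤m⊔n _ _) (costEx≤ i))
    (plus (coeffEx e) 16 q (raise (coeffEx e) (depthEx e) (m≤n⊔m (depthEx i) _) (costEx≤ e)) (const 16 q))
    where q = depthEx i ⊔ depthEx e
  cost≤ adv      = const 16 0
  cost≤ (emit e) = plus (coeffEx e) 32 (depthEx e) (costEx≤ e) (const 32 (depthEx e))
  cost≤ (c ⟫ c′) = plus (coeff c) (coeff c′) (depth c ⊔ depth c′)
    (raise (coeff c) (depth c) (m≤m⊔n _ _) (cost≤ c)) (raise (coeff c′) (depth c′) (m≤n⊔m (depth c) _) (cost≤ c′))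
  cost≤ (when e c) = plus (coeffEx e) (16 + coeff c) q
    (raise (coeffEx e) (depthEx e) (m≤m⊔n _ _) (costEx≤ e))
    (plus 16 (coeff c) q (const 16 q) (raise (coeff c) (depth c) (m≤n⊔m (depthEx e) _) (cost≤ c)))
    where q = depthEx e ⊔ depth c
  cost≤ (loop c) = loop-bound (coeff c) (depth c) (cost≤ c)

-- Every value of e is less than (n + 2) ^ degree e if every cell of table T
-- is less than (n + 2) ^ deg T.

module Words (deg : ℕ → ℕ) (c : ℕ) where

  degree : ∀ {d} → Ex d → ℕ
  -- `k < 2 ^ k`, and the base `n + 2` is at least 2.
  degree (num k)         = k
  degree (var i)         = 1
  degree size            = 1
  degree ptr             = c
  degree (inp e)         = 1
  degree (tab T e)       = deg T
  -- Adding at most doubles the larger bound, which one more factor of the base absorbs.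
  degree (bin add e f)   = suc (degree e ⊔ degree f)
  degree (bin sub e f)   = degree e
  degree (bin mul e f)   = degree e + degree f
  degree (bin div e f)   = degree e
  degree (bin less e f)  = 1
  degree (bin equal e f) = 1
  degree (ite b e f)     = degree e ⊔ degree f
  degree (sum e)         = suc (degree e)
  degree (mu e)          = 1

  mutual
    -- Only Boolean comparisons of closed numbers occur, so for a concrete program the obligation
    -- evaluates to trivial types. Registers and loop levels below `c` are words, again because
    -- `k < (n + 2) ^ k`.
    OkEx : ∀ {d} → ℕ → Ex d → Set
    OkEx {d} j e = T (suc j ≤ᵇ c) × T (suc d ≤ᵇ c) × T (degree e ≤ᵇ c) × OkSub j e

    OkSub : ∀ {d} → ℕ → Ex d → Set
    OkSub j (inp e)     = OkEx j e
    OkSub j (tab T e)   = OkEx j e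
    OkSub j (bin o e f) = OkEx j e × OkEx (suc j) f
    OkSub j (ite b e f) = OkEx j b × OkEx j e × OkEx j f
    OkSub j (sum e)     = OkEx (suc j) e
    OkSub j (mu e)      = OkEx (suc j) e
    OkSub j _           = ⊤

  Ok : ∀ {d} → Cmd d → Set
  Ok (set t i e) = OkEx 0 i × OkEx 1 e × T (degree e ≤ᵇ deg t)
  Ok adv         = ⊤
  Ok (emit e)    = OkEx 0 e
  Ok (b ⟫ b′)    = Ok b × Ok b′
  Ok (when e b)  = OkEx 0 e × Ok b
  Ok {d} (loop b) = T (suc d ≤ᵇ c) × Ok b

-- Store updates and timed rules for programs

≡ᵇ-refl : ∀ k → (k ≡ᵇ k) ≡ true
≡ᵇ-refl zero    = refl
≡ᵇ-refl (suc k) = ≡ᵇ-refl k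

≢⇒≡ᵇ-false : ∀ {i k} → i ≢ k → (i ≡ᵇ k) ≡ false
≢⇒≡ᵇ-false {i} {k} i≢k with i ≡ᵇ k in eq
... | false = refl
... | true  = contradiction (≡ᵇ⇒≡ i k (subst T (sym eq) tt)) i≢k

update-hit : ∀ (σ : Store) a i v → (σ [ a , i ≔ v ]) a i ≡ v
update-hit σ a i v rewrite ≡ᵇ-refl a | ≡ᵇ-refl i = refl

update-cell : ∀ (σ : Store) a {i j} v b → j ≢ i → (σ [ a , i ≔ v ]) b j ≡ σ b j
update-cell σ a {i} {j} v b j≢i rewrite ≢⇒≡ᵇ-false j≢i | ∧-zeroʳ (b ≡ᵇ a) = refl

update-array : ∀ (σ : Store) {a b} i v j → b ≢ a → (σ [ a , i ≔ v ]) b j ≡ σ b j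
update-array σ i v j b≢a rewrite ≢⇒≡ᵇ-false b≢a = refl

less-true : ∀ {k l} → k < l → apply less k l ≡ 1
less-true {k} {l} k<l with k <ᵇ l | <⇒<ᵇ k<l
... | true | _ = refl

less-irrefl : ∀ k → apply less k k ≡ 0
less-irrefl k with k <ᵇ k in eq
... | false = refl
... | true  = contradiction (<ᵇ⇒< k k (subst T (sym eq) tt)) (<-irrefl refl)

test≤1 : ∀ b → (if b then 1 else 0) ≤ 1
test≤1 true  = ≤-refl
test≤1 false = z≤n

module _ (W : ℕ) where

  -- A total-correctness triple with an upper bound in place of the exact time, so that the rules
  -- may round up.
  Runs : Program → Store → ℕ → (Store → Set) → Set
  Runs P σ B Q = ∃[ σ′ ] ∃[ t ] (W ⊢ P , σ ⇓ σ′ , t × t ≤ B × Q σ′)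

  private
    variable
      P P′ : Program
      σ : Store
      B B′ : ℕ
      Q Q′ : Store → Set

  seqR : Runs P σ B Q → (∀ σ′ → Q σ′ → Runs P′ σ′ B′ Q′) → Runs (P ⨾ P′) σ (B + B′) Q′
  seqR (σ₁ , s , r , s≤ , q) k with k σ₁ q
  ... | σ₂ , t , r′ , t≤ , q′ = σ₂ , s + t , r ⨾ r′ , +-mono-≤ s≤ t≤ , q′

  mapR : B ≤ B′ → (∀ σ′ → Q σ′ → Q′ σ′) → Runs P σ B Q → Runs P σ B′ Q′
  mapR B≤B′ f (σ₁ , s , r , s≤ , q) = σ₁ , s , r , ≤-trans s≤ B≤B′ , f σ₁ q

  writeR : ∀ {a i e} → Fits W σ i → Fits W σ e → 1 + exprCost i + exprCost e ≤ B →
    Q (σ [ a , ⟦ i ⟧ σ ≔ ⟦ e ⟧ σ ]) → Runs (write a i e) σ B Q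
  writeR fi fe ≤B q = _ , _ , write fi fe , ≤B , q

  writeR⨾ : ∀ {a i e} → Fits W σ i → Fits W σ e → 1 + exprCost i + exprCost e ≤ B →
    Runs P (σ [ a , ⟦ i ⟧ σ ≔ ⟦ e ⟧ σ ]) B′ Q → Runs (write a i e ⨾ P) σ (B + B′) Q
  writeR⨾ fi fe ≤B (σ₁ , s , r , s≤ , q) = σ₁ , _ , write fi fe ⨾ r , +-mono-≤ ≤B s≤ , q

  condR : ∀ {e C} → Fits W σ e →
    (⟦ e ⟧ σ ≢ 0 → Runs P σ B Q) → (⟦ e ⟧ σ ≡ 0 → Runs P′ σ B′ Q) →
    1 + exprCost e + (B + B′) ≤ C → Runs (cond e P P′) σ C Q
  condR {σ = σ} {B = B} {B′ = B′} {e = e} fe kt kf ≤C with ⟦ e ⟧ σ in eq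
  ... | suc _ =
    let σ₁ , t , r , t≤ , q = kt (λ ()) in
    σ₁ , _ , cond-true fe (λ z → case trans (sym eq) z of λ ()) r ,
    ≤-trans (+-monoʳ-≤ (1 + exprCost e) (≤-trans t≤ (m≤m+n B B′))) ≤C , q
  ... | zero =
    let σ₁ , t , r , t≤ , q = kf refl in
    σ₁ , _ , cond-false fe eq r ,
    ≤-trans (+-monoʳ-≤ (1 + exprCost e) (≤-trans t≤ (m≤n+m B′ B))) ≤C , q

  -- `step` states the next invariant for the store after the increment, because the increment is
  -- issued by `for` and not by the body `P`.
  module _ {d n : ℕ} (d<W : d < W) (1<W : 1 < W) (n<W : n < W)
    (Inv : ℕ → Store → Set)
    (head : ∀ {k σ} → Inv k σ → σ 2 d ≡ k × σ 0 0 ≡ n)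
    (step : ∀ {k σ} → k < n → Inv k σ →
      Runs P σ B (λ σ′ → σ′ 2 d ≡ k × Inv (suc k) (σ′ [ 2 , d ≔ suc k ])))
    where

    private
      0<W : 0 < W
      0<W = <-trans (s≤s z≤n) 1<W

      test = op less (read 2 (lit d)) (read 0 (lit 0))
      inc  = write 2 (lit d) (op add (read 2 (lit d)) (lit 1))

      fits-test : ∀ {k σ} → k ≤ n → Inv k σ → Fits W σ test
      fits-test k≤n I with head I
      ... | eq , eq′ rewrite eq | eq′ =
        (d<W , ≤-<-trans k≤n n<W) , (0<W , n<W) , ≤-<-trans (test≤1 _) 1<W

      test-true : ∀ {k σ} → k < n → Inv k σ → ⟦ test ⟧ σ ≢ 0
      test-true k<n I z with head I
      ... | eq , eq′ rewrite eq | eq′ = case trans (sym (less-true k<n)) z of λ ()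

      test-false : ∀ {σ} → Inv n σ → ⟦ test ⟧ σ ≡ 0
      test-false I with head I
      ... | eq , eq′ rewrite eq | eq′ = less-irrefl n

      body : ∀ {k σ} → k < n → Inv k σ → Runs (P ⨾ inc) σ (B + 6) (Inv (suc k))
      body {k} k<n I = seqR (step k<n I) λ σ′ (eq , I′) →
        let eq′ = trans (cong (_+ 1) eq) (+-comm k 1) in
        writeR d<W
          ((d<W , subst (_< W) (sym eq) (<-trans k<n n<W)) , 1<W ,
           subst (_< W) (sym eq′) (≤-<-trans k<n n<W))
          ≤-refl (subst (λ v → Inv (suc k) (σ′ [ 2 , d ≔ v ])) (sym eq′) I′)

      loopR : ∀ r {k σ} → k + r ≡ n → Inv k σ →
        Runs (while test (P ⨾ inc)) σ (r * (B + 32) + 16) (Inv n)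
      loopR zero {k} eq I rewrite trans (sym (+-identityʳ k)) eq =
        _ , _ , while-false (fits-test ≤-refl I) (test-false I) , ≤ᵇ⇒≤ 6 16 tt , I
      loopR (suc r) {k} {σ} eq I =
        let k<n = ≤-trans (s≤s (m≤m+n k r)) (≤-reflexive (trans (sym (+-suc k r)) eq))
            σ₁ , s , R , s≤ , I′ = body k<n I
            σ₂ , t , R′ , t≤ , I″ = loopR r (trans (sym (+-suc k r)) eq) I′
        in σ₂ , _ , while-true (fits-test (<⇒≤ k<n) I) (test-true k<n I) R R′ ,
           ≤-trans (+-monoʳ-≤ 6 (+-mono-≤ s≤ t≤)) (≤-trans (m≤m+n _ 20)
             (≤-reflexive (shuffle (r * (B + 32)) B))) , I″
        where
        shuffle : ∀ x y → 6 + ((y + 6) + (x + 16)) + 20 ≡ (y + 32) + x + 16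
        shuffle = solve-∀

    forR : Inv 0 (σ [ 2 , d ≔ 0 ]) → Runs (for d P) σ (loopCost n B) (Inv n)
    forR I = writeR⨾ d<W 0<W (≤ᵇ⇒≤ 3 16 tt) (loopR n refl I)

-- Cells that the evaluation of an expression at loop depth d into register j
-- leaves alone.

Protected : ℕ → ℕ → ℕ → ℕ → Set
Protected d j 2 i = i < d
Protected d j 3 i = i < j
Protected d j _ i = ⊤

Frame : ℕ → ℕ → Store → Store → Set
Frame d j σ σ′ = ∀ a i → Protected d j a i → σ′ a i ≡ σ a i

frame-trans : ∀ {d j σ σ′ σ″} → Frame d j σ σ′ → Frame d j σ′ σ″ → Frame d j σ σ″
frame-trans f g a i p = trans (g a i p) (f a i p)

frame-weaken : ∀ {d j d′ j′ σ σ′} → d ≤ d′ → j ≤ j′ → Frame d′ j′ σ σ′ → Frame d j σ σ′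
frame-weaken d≤ j≤ f 0 i p = f 0 i p
frame-weaken d≤ j≤ f 1 i p = f 1 i p
frame-weaken d≤ j≤ f 2 i p = f 2 i (≤-trans p d≤)
frame-weaken d≤ j≤ f 3 i p = f 3 i (≤-trans p j≤)
frame-weaken d≤ j≤ f (suc (suc (suc (suc a)))) i p = f (suc (suc (suc (suc a)))) i p

frame-reg : ∀ {d j k σ v} → j ≤ k → Frame d j σ (σ [ 3 , k ≔ v ])
frame-reg j≤k 0 i p = refl
frame-reg j≤k 1 i p = refl
frame-reg j≤k 2 i p = refl
frame-reg {σ = σ} j≤k 3 i p = update-cell σ 3 _ 3 λ { refl → <-irrefl refl (≤-trans p j≤k) }
frame-reg j≤k (suc (suc (suc (suc a)))) i p = refl

frame-var : ∀ {d j k σ v} → d ≤ k → Frame d j σ (σ [ 2 , k ≔ v ])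
frame-var d≤k 0 i p = refl
frame-var d≤k 1 i p = refl
frame-var {σ = σ} d≤k 2 i p = update-cell σ 2 _ 2 λ { refl → <-irrefl refl (≤-trans p d≤k) }
frame-var d≤k 3 i p = refl
frame-var d≤k (suc (suc (suc (suc a)))) i p = refl

n<2^n : ∀ n → n < 2 ^ n
n<2^n zero    = s≤s z≤n
n<2^n (suc n) = ≤-trans (s≤s (n<2^n n))
  (+-mono-≤ (≤-trans (s≤s z≤n) (n<2^n n)) (m≤m+n (2 ^ n) 0))

-- Compiled programs simulate the loop language

module Machine (deg : ℕ → ℕ) (c : ℕ) (n : ℕ) (input : ℕ → ℕ)
  (input-size : input 0 ≡ n) (input≤ : ∀ i → input i ≤ n) where

  open Words deg c
  open Semantics n input
  open St

  private
    m = n + 2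
    W = m ^ c

    instance
      m≢0 : NonZero m
      m≢0 = Data.Nat.>-nonZero (≤-trans (s≤s z≤n) (m≤n+m 2 n))

    pow-mono : ∀ {p q} → p ≤ q → m ^ p ≤ m ^ q
    pow-mono = ^-monoʳ-≤ m

    pow-monoᵇ : ∀ p q → T (p ≤ᵇ q) → m ^ p ≤ m ^ q
    pow-monoᵇ p q h = pow-mono (≤ᵇ⇒≤ p q h)

    1≤pow : ∀ q → 1 ≤ m ^ q
    1≤pow = m^n>0 m

    k<pow : ∀ k → k < m ^ k
    k<pow k = ≤-trans (n<2^n k) (^-monoˡ-≤ k (m≤n+m 2 n))

    small : ∀ {k} → T (suc k ≤ᵇ c) → k < W
    small {k} h = <-≤-trans (k<pow k) (pow-mono (<⇒≤ (≤ᵇ⇒≤ (suc k) c h)))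

    n<m : n < m ^ 1
    n<m = ≤-trans (m<m+n n) (≤-reflexive (sym (*-identityʳ m)))
      where
      m<m+n : ∀ n → suc n ≤ n + 2
      m<m+n n = ≤-trans (n≤1+n (suc n)) (≤-reflexive (+-comm 2 n))

    test< : ∀ b → (if b then 1 else 0) < m ^ 1
    test< b = ≤-<-trans (test≤1 b) (k<pow 1)

    pow1≤W : ∀ {j} → T (suc j ≤ᵇ c) → m ^ 1 ≤ W
    pow1≤W {j} h = pow-mono (≤-trans (s≤s z≤n) (≤ᵇ⇒≤ (suc j) c h))

    n<W : ∀ {j} → T (suc j ≤ᵇ c) → n < W
    n<W h = <-≤-trans n<m (pow1≤W h)

    1<W : ∀ {j} → T (suc j ≤ᵇ c) → 1 < W
    1<W h = <-≤-trans (k<pow 1) (pow1≤W h)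

    test<W : ∀ {j} → T (suc j ≤ᵇ c) → ∀ b → (if b then 1 else 0) < W
    test<W h b = <-≤-trans (test< b) (pow1≤W h)

    +-pow : ∀ {x y} p q → x < m ^ p → y < m ^ q → x + y < m ^ suc (p ⊔ q)
    +-pow {x} {y} p q hx hy = <-≤-trans
      (+-mono-<-≤ (<-≤-trans hx (pow-mono (m≤m⊔n p q))) (<⇒≤ (<-≤-trans hy (pow-mono (m≤n⊔m p q)))))
      (≤-trans (≤-reflexive (cong (m ^ (p ⊔ q) +_) (sym (+-identityʳ _)))) (*-monoˡ-≤ (m ^ (p ⊔ q)) (m≤n+m 2 n)))

    *-pow : ∀ {x y} p q → x < m ^ p → y < m ^ q → x * y < m ^ (p + q)
    *-pow {x} {y} p q hx hy =
      subst (x * y <_) (sym (^-distribˡ-+-* m p q)) (Data.Nat.Properties.*-mono-< hx hy)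

  sumN-bound : ∀ {b} k g → (∀ i → i < k → g i ≤ b) → sumN k g ≤ k * b
  sumN-bound zero    g h = z≤n
  sumN-bound {b} (suc k) g h = ≤-trans
    (+-mono-≤ (sumN-bound k g (λ i i<k → h i (Data.Nat.Properties.m<n⇒m<1+n i<k))) (h k ≤-refl))
    (≤-reflexive (+-comm (k * b) b))

  muN≤ : ∀ k g → muN k g ≤ k
  muN≤ zero    g = z≤n
  muN≤ (suc k) g = ≤-trans
    (+-mono-≤ (muN≤ k g) (*-mono-≤ (test≤1 (muN k g ≡ᵇ k)) (test≤1 (g k ≡ᵇ 0))))
    (≤-reflexive (+-comm k 1))

  module _ {τ : Store} {p : ℕ} (τ< : ∀ T i → τ T i < m ^ deg T) (p< : p < W) where

    eval< : ∀ {d} (ρ : Vec ℕ d) (ρ≤ : ∀ i → Vec.lookup ρ i ≤ n) (e : Ex d) →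
      eval τ p ρ e < m ^ degree e
    eval< ρ ρ≤ (num k) = k<pow k
    eval< ρ ρ≤ (var i) = ≤-<-trans (ρ≤ i) n<m
    eval< ρ ρ≤ size    = n<m
    eval< ρ ρ≤ ptr     = p<
    eval< ρ ρ≤ (inp e) = ≤-<-trans (input≤ _) n<m
    eval< ρ ρ≤ (tab T e) = τ< T _
    eval< ρ ρ≤ (bin add e f) = +-pow (degree e) (degree f) (eval< ρ ρ≤ e) (eval< ρ ρ≤ f)
    eval< ρ ρ≤ (bin sub e f) = ≤-<-trans (m∸n≤m _ (eval τ p ρ f)) (eval< ρ ρ≤ e)
    eval< ρ ρ≤ (bin mul e f) = *-pow (degree e) (degree f) (eval< ρ ρ≤ e) (eval< ρ ρ≤ f)
    eval< ρ ρ≤ (bin div e f) with eval τ p ρ f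
    ... | zero  = 1≤pow (degree e)
    ... | suc l = ≤-<-trans (m/n≤m (eval τ p ρ e) (suc l)) (eval< ρ ρ≤ e)
    eval< ρ ρ≤ (bin less e f)  = test< (eval τ p ρ e <ᵇ eval τ p ρ f)
    eval< ρ ρ≤ (bin equal e f) = test< (eval τ p ρ e ≡ᵇ eval τ p ρ f)
    eval< ρ ρ≤ (ite b e f) with eval τ p ρ b
    ... | zero  = <-≤-trans (eval< ρ ρ≤ f) (pow-mono (m≤n⊔m (degree e) (degree f)))
    ... | suc _ = <-≤-trans (eval< ρ ρ≤ e) (pow-mono (m≤m⊔n (degree e) (degree f)))
    eval< {d} ρ ρ≤ (sum e) = <-≤-trans (s≤s (sumN-bound n _ bound)) (≤-trans
      (+-monoˡ-≤ (n * m ^ degree e) (1≤pow (degree e)))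
      (*-monoˡ-≤ (m ^ degree e) (≤-trans (n≤1+n (suc n)) (≤-reflexive (+-comm 2 n)))))
      where
      bound : ∀ i → i < n → eval τ p (i ∷ ρ) e ≤ m ^ degree e
      bound i i<n = <⇒≤ (eval< (i ∷ ρ) (λ { zero → <⇒≤ i<n ; (suc k) → ρ≤ k }) e)
    eval< ρ ρ≤ (mu e) = ≤-<-trans (muN≤ n _) n<m

  record Rel {d} (ρ : Vec ℕ d) (s : St) (σ : Store) : Set where
    field
      input-ok : ∀ i → σ 0 i ≡ input i
      out-ok   : ∀ i → i < length (out s) → σ 1 i ≡ cell (out s) i
      var-ok   : ∀ i → σ 2 (d ∸ suc (toℕ i)) ≡ Vec.lookup ρ i
      pos-ok   : σ 4 0 ≡ pos s
      len-ok   : σ 4 1 ≡ length (out s)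
      tabs-ok  : ∀ T i → σ (5 + T) i ≡ tabs s T i
  open Rel

  private
    level< : ∀ {d} (i : Fin d) → d ∸ suc (toℕ i) < d
    level< {suc d} i = s≤s (m∸n≤m d (toℕ i))

  rel-frame : ∀ {d j} {ρ : Vec ℕ d} {s σ σ′} → Frame d j σ σ′ → Rel ρ s σ → Rel ρ s σ′
  rel-frame f r = record
    { input-ok = λ i → trans (f 0 i tt) (input-ok r i)
    ; out-ok   = λ i i< → trans (f 1 i tt) (out-ok r i i<)
    ; var-ok   = λ i → trans (f 2 _ (level< i)) (var-ok r i)
    ; pos-ok   = trans (f 4 0 tt) (pos-ok r)
    ; len-ok   = trans (f 4 1 tt) (len-ok r)
    ; tabs-ok  = λ T i → trans (f (5 + T) i tt) (tabs-ok r T i)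
    }

  rel-bind : ∀ {d} {ρ : Vec ℕ d} {s σ} k → Rel ρ s σ → Rel (k ∷ ρ) s (σ [ 2 , d ≔ k ])
  rel-bind {d} {σ = σ} k r = record
    { input-ok = input-ok r
    ; out-ok   = out-ok r
    ; var-ok   = λ { zero → update-hit σ 2 d k
                   ; (suc i) → trans (update-cell σ 2 k 2 (<⇒≢ (level< i))) (var-ok r i) }
    ; pos-ok   = pos-ok r
    ; len-ok   = len-ok r
    ; tabs-ok  = tabs-ok r
    }

  rel-drop : ∀ {d k} {ρ : Vec ℕ d} {s σ} → Rel (k ∷ ρ) s σ → Rel ρ s σ
  rel-drop r = record
    { input-ok = input-ok r
    ; out-ok   = out-ok r
    ; var-ok   = λ i → var-ok r (suc i)
    ; pos-ok   = pos-ok r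
    ; len-ok   = len-ok r
    ; tabs-ok  = tabs-ok r
    }

  module _ {s : St} (τ< : ∀ T i → tabs s T i < m ^ deg T) (p< : pos s < W) where

    private
      val : ∀ {d} → Vec ℕ d → Ex d → ℕ
      val = eval (tabs s) (pos s)

    mutual
      simEx : ∀ {d} (e : Ex d) {j σ} (ρ : Vec ℕ d) → (∀ i → Vec.lookup ρ i ≤ n) → OkEx j e →
        Rel ρ s σ →
        Runs W (compileEx j e) σ (costEx n e) (λ σ′ → σ′ 3 j ≡ val ρ e × Frame d j σ σ′)
      simEx {d} e {j} ρ ρ≤ (j< , d< , e≤ , ok) r =
        simSub e ρ ρ≤ (j< , d<) (<-≤-trans (eval< τ< p< ρ ρ≤ e) (pow-monoᵇ (degree e) c e≤)) ok r

      simSub : ∀ {d} (e : Ex d) {j σ} (ρ : Vec ℕ d) → (∀ i → Vec.lookup ρ i ≤ n) →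
        T (suc j ≤ᵇ c) × T (suc d ≤ᵇ c) → val ρ e < W → OkSub j e → Rel ρ s σ →
        Runs W (compileEx j e) σ (costEx n e) (λ σ′ → σ′ 3 j ≡ val ρ e × Frame d j σ σ′)
      simSub {d} (num k) {j} {σ} ρ ρ≤ (j< , d<) v< ok r =
        writeR W (small j<) v< (≤ᵇ⇒≤ 3 16 tt) (update-hit σ 3 j k , frame-reg ≤-refl)
      simSub {d} (var i) {j} {σ} ρ ρ≤ (j< , d<) v< ok r =
        writeR W (small j<)
          (<-trans (level< i) (small d<) , subst (_< W) (sym (var-ok r i)) v<)
          (≤ᵇ⇒≤ 4 16 tt) (trans (update-hit σ 3 j _) (var-ok r i) , frame-reg ≤-refl)
      simSub size {j} {σ} ρ ρ≤ (j< , d<) v< ok r =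
        writeR W (small j<) (1≤pow c , subst (_< W) (sym n≡) v<) (≤ᵇ⇒≤ 4 16 tt)
          (trans (update-hit σ 3 j _) n≡ , frame-reg ≤-refl)
        where n≡ = trans (input-ok r 0) input-size
      simSub ptr {j} {σ} ρ ρ≤ (j< , d<) v< ok r =
        writeR W (small j<) (1≤pow c , subst (_< W) (sym (pos-ok r)) v<) (≤ᵇ⇒≤ 4 16 tt)
          (trans (update-hit σ 3 j _) (pos-ok r) , frame-reg ≤-refl)
      simSub {d} (inp e) {j} ρ ρ≤ (j< , d<) v< ok r =
        seqR W (simEx e ρ ρ≤ ok r) λ σ′ (eq , f) →
        let eq′ = trans (cong (σ′ 0) eq) (input-ok (rel-frame f r) _) in
        writeR W (small j<) ((small j< , subst (_< W) (sym eq) (val<W e ρ ρ≤ ok)) , subst (_< W) (sym eq′) v<)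
          (≤ᵇ⇒≤ 5 16 tt) (trans (update-hit σ′ 3 j _) eq′ , frame-trans f (frame-reg ≤-refl))
      simSub {d} (tab T e) {j} ρ ρ≤ (j< , d<) v< ok r =
        seqR W (simEx e ρ ρ≤ ok r) λ σ′ (eq , f) →
        let eq′ = trans (cong (σ′ (5 + T)) eq) (tabs-ok (rel-frame f r) T _) in
        writeR W (small j<) ((small j< , subst (_< W) (sym eq) (val<W e ρ ρ≤ ok)) , subst (_< W) (sym eq′) v<)
          (≤ᵇ⇒≤ 5 16 tt) (trans (update-hit σ′ 3 j _) eq′ , frame-trans f (frame-reg ≤-refl))
      simSub {d} (bin o e f) {j} ρ ρ≤ (j< , d<) v< (ok , ok′) r =
        seqR W (simEx e ρ ρ≤ ok r) λ σ₁ (eq₁ , f₁) →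
        seqR W (simEx f ρ ρ≤ ok′ (rel-frame f₁ r)) λ σ₂ (eq₂ , f₂) →
        let eq₁′ = trans (f₂ 3 j ≤-refl) eq₁
            eq′  = cong₂ (apply o) eq₁′ eq₂ in
        writeR W (small j<)
          ((small j< , subst (_< W) (sym eq₁′) (val<W e ρ ρ≤ ok)) ,
           (small (proj₁ ok′) , subst (_< W) (sym eq₂) (val<W f ρ ρ≤ ok′)) ,
           subst (_< W) (sym eq′) v<)
          (≤ᵇ⇒≤ 7 16 tt)
          (trans (update-hit σ₂ 3 j _) eq′ ,
           frame-trans f₁ (frame-trans (frame-weaken ≤-refl (n≤1+n j) f₂) (frame-reg ≤-refl)))
      simSub {d} (ite b e f) {j} ρ ρ≤ (j< , d<) v< (okb , oke , okf) r =
        seqR W (simEx b ρ ρ≤ okb r) λ σ₁ (eq₁ , f₁) →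
        condR W {e = reg j} (small j< , subst (_< W) (sym eq₁) (val<W b ρ ρ≤ okb))
          (λ nz → mapR W ≤-refl (λ σ₂ (eq₂ , f₂) →
             trans eq₂ (true-branch eq₁ nz) , frame-trans f₁ f₂) (simEx e ρ ρ≤ oke (rel-frame f₁ r)))
          (λ z → mapR W ≤-refl (λ σ₂ (eq₂ , f₂) →
             trans eq₂ (false-branch (trans (sym eq₁) z)) , frame-trans f₁ f₂) (simEx f ρ ρ≤ okf (rel-frame f₁ r)))
          (+-monoˡ-≤ _ (≤ᵇ⇒≤ 3 16 tt))
        where
        true-branch : ∀ {x} → x ≡ val ρ b → x ≢ 0 → val ρ e ≡ branch (val ρ b) (val ρ e) (val ρ f)
        true-branch refl nz with val ρ b
        ... | zero  = contradiction refl nz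
        ... | suc _ = refl
        false-branch : val ρ b ≡ 0 → val ρ f ≡ branch (val ρ b) (val ρ e) (val ρ f)
        false-branch eq rewrite eq = refl
      simSub {d} (sum e) {j} ρ ρ≤ js v< ok r =
        simFold sumN (λ a k x → a + x) (op add (reg j) (reg (suc j))) refl (λ k → refl)
          (λ k k≤n → ≤-<-trans (sumN-mono k≤n) v<)
          (λ { refl refl refl a< k< x< h → ((small (proj₁ js) , a<) , (small (proj₁ ok) , x<) , h) , refl })
          (≤ᵇ⇒≤ 7 16 tt) e ρ ρ≤ js ok r
        where
        sumN-mono : ∀ {k l g} → k ≤ l → sumN k g ≤ sumN l g
        sumN-mono {k} {l} {g} k≤l = go (Data.Nat.Properties.≤⇒≤′ k≤l)
          where
          go : ∀ {l} → k Data.Nat.≤′ l → sumN k g ≤ sumN l g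
          go Data.Nat.≤′-refl = ≤-refl
          go (Data.Nat.≤′-step {l} h) = ≤-trans (go h) (m≤m+n (sumN l g) (g l))
      simSub {d} (mu e) {j} ρ ρ≤ js v< ok r =
        simFold muN (λ a k x → a + apply mul (apply equal a k) (apply equal x 0))
          (op add (reg j) (op mul (op equal (reg j) (read 2 (lit d))) (op equal (reg (suc j)) (lit 0))))
          refl (λ k → refl)
          (λ k k≤n → ≤-<-trans (≤-trans (muN≤ k _) k≤n) (n<W (proj₁ js)))
          (λ {σ} → λ { refl refl refl a< k< x< h → ((small (proj₁ js) , a<) ,
             (((small (proj₁ js) , a<) , (small (proj₂ js) , k<) , test<W (proj₁ js) (σ 3 j ≡ᵇ σ 2 d)) ,
              ((small (proj₁ ok) , x<) , 1≤pow c , test<W (proj₁ js) (σ 3 (suc j) ≡ᵇ 0)) ,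
              ≤-<-trans (*-mono-≤ (test≤1 (σ 3 j ≡ᵇ σ 2 d)) (test≤1 (σ 3 (suc j) ≡ᵇ 0))) (1<W (proj₁ js))) ,
             h) , refl })
          (≤ᵇ⇒≤ 15 16 tt) e ρ ρ≤ js ok r

      -- `sum` and `mu` compile to the same loop: an accumulator in register `j` is updated by `u`
      -- from the value in register `suc j`. `F k g` is the accumulator after `k` rounds. The
      -- equation for `g` is left to instance search.
      simFold : ∀ {d j σ₀} (F : ℕ → (ℕ → ℕ) → ℕ) (next : ℕ → ℕ → ℕ → ℕ) (u : Expr) →
        ∀ {g} → F 0 g ≡ 0 → (∀ k → F (suc k) g ≡ next (F k g) k (g k)) →
        (∀ k → k ≤ n → F k g < W) →
        (∀ {σ a k x} → σ 3 j ≡ a → σ 2 d ≡ k → σ 3 (suc j) ≡ x → a < W → k < W → x < W →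
          next a k x < W → Fits W σ u × ⟦ u ⟧ σ ≡ next a k x) →
        1 + 1 + exprCost u ≤ 16 →
        (e : Ex (suc d)) (ρ : Vec ℕ d) → (∀ i → Vec.lookup ρ i ≤ n) →
        {{_ : g ≡ (λ i → val (i ∷ ρ) e)}} →
        T (suc j ≤ᵇ c) × T (suc d ≤ᵇ c) → OkEx (suc j) e → Rel ρ s σ₀ →
        Runs W (write 3 (lit j) (lit 0) ⨾ for d (compileEx (suc j) e ⨾ write 3 (lit j) u)) σ₀
          (16 + loopCost n (costEx n e + 16)) (λ σ′ → σ′ 3 j ≡ F n g × Frame d j σ₀ σ′)
      simFold {d} {j} {σ₀} F next u {g} F0 Fsuc F< fits u≤ e ρ ρ≤ {{refl}} (j< , d<) ok r =
        writeR⨾ W (small j<) (1≤pow c) (≤ᵇ⇒≤ 3 16 tt) (mapR W ≤-refl (λ _ (eq , f , _) → eq , f)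
          (forR W (small d<) (1<W j<) (n<W j<) Inv
            (λ (_ , _ , r) → var-ok r zero , trans (input-ok r 0) input-size) step
            (trans (update-hit σ₀ 3 j 0) (sym F0) ,
             frame-trans (frame-reg ≤-refl) (frame-var ≤-refl) ,
             rel-bind 0 (rel-frame (frame-reg (≤-refl {j})) r))))
        where
        Inv : ℕ → Store → Set
        Inv k σ = σ 3 j ≡ F k g × Frame d j σ₀ σ × Rel (k ∷ ρ) s σ

        step : ∀ {k σ} → k < n → Inv k σ →
          Runs W (compileEx (suc j) e ⨾ write 3 (lit j) u) σ (costEx n e + 16)
            (λ σ′ → σ′ 2 d ≡ k × Inv (suc k) (σ′ [ 2 , d ≔ suc k ]))
        step {k} {σ} k<n (eq , f , r) =
          let ρ≤′ = λ { zero → <⇒≤ k<n ; (suc i) → ρ≤ i } in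
          seqR W (simEx e (k ∷ ρ) ρ≤′ ok r) λ σ′ (eq′ , f′) →
          let acc  = trans (f′ 3 j ≤-refl) eq
              idx  = trans (f′ 2 d ≤-refl) (var-ok r zero)
              fu , u≡ = fits acc idx eq′ (F< k (<⇒≤ k<n)) (<-trans k<n (n<W j<)) (val<W e (k ∷ ρ) ρ≤′ ok)
                (subst (_< W) (Fsuc k) (F< (suc k) k<n))
              r′ = rel-frame (frame-reg (≤-refl {j})) (rel-frame f′ r)
          in writeR W (small j<) fu u≤
            (idx , trans (update-hit σ′ 3 j _) (trans u≡ (sym (Fsuc k))) ,
             frame-trans f (frame-trans (frame-weaken (n≤1+n d) (n≤1+n j) f′)
               (frame-trans (frame-reg ≤-refl) (frame-var ≤-refl))) ,
             rel-bind (suc k) (rel-drop r′))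

      val<W : ∀ {d j} (e : Ex d) ρ → (∀ i → Vec.lookup ρ i ≤ n) → OkEx j e → val ρ e < W
      val<W e ρ ρ≤ (_ , _ , e≤ , _) = <-≤-trans (eval< τ< p< ρ ρ≤ e) (pow-monoᵇ (degree e) c e≤)

  cell-++ˡ : ∀ xs ys {i} → i < length xs → cell (xs ++ ys) i ≡ cell xs i
  cell-++ˡ (x ∷ xs) ys {zero}  i<       = refl
  cell-++ˡ (x ∷ xs) ys {suc i} (s≤s i<) = cell-++ˡ xs ys i<

  cell-last : ∀ xs v → cell (xs ++ [ v ]) (length xs) ≡ v
  cell-last []       v = refl
  cell-last (x ∷ xs) v = cell-last xs v

  -- Both positions advance by at most the time spent, so `q` can grow with the cost of the commands
  -- executed. A total cost below `W` then keeps them words.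
  Bounded : St → ℕ → Set
  Bounded s q = (∀ T i → tabs s T i < m ^ deg T) × pos s ≤ q × length (out s) ≤ q

  bounded-weaken : ∀ s {q q′} → q ≤ q′ → Bounded s q → Bounded s q′
  bounded-weaken s q≤ (a , b , c) = a , ≤-trans b q≤ , ≤-trans c q≤

  private
    append : ∀ σ q → 1 < W → σ 3 0 < W → σ 4 1 ≤ q → q + 1 < W →
      Runs W (write 1 (read 4 (lit 1)) (reg 0) ⨾ write 4 (lit 1) (op add (read 4 (lit 1)) (lit 1))) σ (16 + 16)
        (_≡ (σ [ 1 , σ 4 1 ≔ σ 3 0 ]) [ 4 , 1 ≔ σ 4 1 + 1 ])
    append σ q 1<W v<W l≤ q<W = _ , _ , write (1<W , l<W) (0<W , v<W) ⨾ write 1<W ((1<W , l<W) , 1<W , l+1<W) ,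
      ≤ᵇ⇒≤ 11 32 tt , refl
      where
      0<W : 0 < W
      0<W = <-trans (s≤s z≤n) 1<W
      l+1<W : σ 4 1 + 1 < W
      l+1<W = ≤-<-trans (+-monoˡ-≤ 1 l≤) q<W
      l<W : σ 4 1 < W
      l<W = ≤-<-trans (m≤m+n _ 1) l+1<W

  sim : ∀ {d} (b : Cmd d) (ρ : Vec ℕ d) {s σ q} → (∀ i → Vec.lookup ρ i ≤ n) → Ok b →
    Bounded s q → Rel ρ s σ → q + cost n b < W →
    Runs W (compile b) σ (cost n b)
      (λ σ′ → Rel ρ (exec b ρ s) σ′ × Bounded (exec b ρ s) (q + cost n b))
  sim (set T i e) ρ {s} {σ} {q} ρ≤ (oki , oke , e≤) bd@(τ< , p≤ , o≤) r q< =
    seqR W (simEx {s} τ< p< i ρ ρ≤ oki r) λ σ₁ (eq₁ , f₁) →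
    seqR W (simEx {s} τ< p< e ρ ρ≤ oke (rel-frame f₁ r)) λ σ₂ (eq₂ , f₂) →
    let r₂   = rel-frame f₂ (rel-frame f₁ r)
        eq₁′ = trans (f₂ 3 0 ≤-refl) eq₁ in
    writeR W (1≤pow c , subst (_< W) (sym eq₁′) (val<W {s} τ< p< i ρ ρ≤ oki))
      (small (proj₁ oke) , subst (_< W) (sym eq₂) (val<W {s} τ< p< e ρ ρ≤ oke)) (≤ᵇ⇒≤ 5 16 tt)
      (record
        { input-ok = input-ok r₂ ; out-ok = out-ok r₂ ; var-ok = var-ok r₂
        ; pos-ok = pos-ok r₂ ; len-ok = len-ok r₂
        ; tabs-ok = λ U k → updated (U ≡ᵇ T) eq₁′ eq₂ k (tabs-ok r₂ U k) } ,
       (λ U k → cell< U k (U ≡ᵇ T) refl (k ≡ᵇ eval (tabs s) (pos s) ρ i)) ,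
       ≤-trans p≤ (m≤m+n q _) , ≤-trans o≤ (m≤m+n q _))
    where
    p< = ≤-<-trans (≤-trans p≤ (m≤m+n q _)) q<
    updated : ∀ b {i i′ v v′ : ℕ} → i ≡ i′ → v ≡ v′ → ∀ k {x y : ℕ} → x ≡ y →
      (if b ∧ (k ≡ᵇ i) then v else x) ≡ (if b ∧ (k ≡ᵇ i′) then v′ else y)
    updated b refl refl k refl = refl
    cell< : ∀ U k b → (U ≡ᵇ T) ≡ b → ∀ b′ →
      (if b ∧ b′ then eval (tabs s) (pos s) ρ e else tabs s U k) < m ^ deg U
    cell< U k true eq true with ≡ᵇ⇒≡ U T (subst Data.Bool.T (sym eq) tt)
    ... | refl =
      <-≤-trans (eval< τ< p< ρ ρ≤ e) (pow-monoᵇ (degree e) (deg U) e≤)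
    cell< U k true eq false = τ< U k
    cell< U k false eq b′ = τ< U k
  sim adv ρ {s} {σ} {q} ρ≤ ok (τ< , p≤ , o≤) r q< =
    writeR W (1≤pow c) ((1≤pow c , ≤-<-trans (≤-trans (≤-reflexive (pos-ok r)) (≤-trans p≤ (m≤m+n q 16))) q<) ,
        one< , ≤-<-trans (≤-trans (≤-reflexive (cong (_+ 1) (pos-ok r))) (+-mono-≤ p≤ (≤ᵇ⇒≤ 1 16 tt))) q<)
      (≤ᵇ⇒≤ 6 16 tt)
      (record
        { input-ok = input-ok r ; out-ok = out-ok r ; var-ok = var-ok r
        ; pos-ok = trans (cong (_+ 1) (pos-ok r)) (+-comm (pos s) 1)
        ; len-ok = len-ok r ; tabs-ok = tabs-ok r } ,
       τ< , ≤-trans (s≤s p≤) (≤-trans (≤-reflexive (+-comm 1 q)) (+-monoʳ-≤ q (≤ᵇ⇒≤ 1 16 tt))) ,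
       ≤-trans o≤ (m≤m+n q 16))
    where
    one< : 1 < W
    one< = ≤-<-trans (≤-trans (≤ᵇ⇒≤ 1 16 tt) (m≤n+m 16 q)) q<
  sim (emit e) ρ {s} {σ} {q} ρ≤ ok (τ< , p≤ , o≤) r q< =
    seqR W (simEx {s} τ< p< e ρ ρ≤ ok r) λ σ₁ (eq₁ , f₁) →
    let r₁ = rel-frame f₁ r
        l≤ = ≤-trans (≤-reflexive (len-ok r₁)) o≤ in
    mapR W ≤-refl (λ { σ₂ refl →
        (record
          { input-ok = input-ok r₁
          ; out-ok = λ i i< → written σ₁ (len-ok r₁) (out-ok r₁) eq₁ i
              (subst (i <_) (trans (Listₚ.length-++ (out s)) (+-comm _ 1)) i<)
          ; var-ok = var-ok r₁ ; pos-ok = pos-ok r₁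
          ; len-ok = trans (cong (_+ 1) (len-ok r₁)) (sym (Listₚ.length-++ (out s)))
          ; tabs-ok = tabs-ok r₁ } ,
         τ< , ≤-trans p≤ (m≤m+n q _) ,
         ≤-trans (≤-reflexive (Listₚ.length-++ (out s)))
           (+-mono-≤ o≤ (≤-trans (≤ᵇ⇒≤ 1 32 tt) (m≤n+m 32 (costEx n e))))) })
      (append σ₁ q one< (subst (_< W) (sym eq₁) (val<W {s} τ< p< e ρ ρ≤ ok)) l≤ next<)
    where
    p< = ≤-<-trans (≤-trans p≤ (m≤m+n q _)) q<
    one< : 1 < W
    one< = ≤-<-trans (≤-trans (≤-trans (≤ᵇ⇒≤ 1 32 tt) (m≤n+m 32 (costEx n e))) (m≤n+m _ q)) q<
    next< : q + 1 < W
    next< = ≤-<-trans (+-monoʳ-≤ q (≤-trans (≤ᵇ⇒≤ 1 32 tt) (m≤n+m 32 (costEx n e)))) q<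
    v : ℕ
    v = eval (tabs s) (pos s) ρ e
    written : ∀ σ₁ → σ₁ 4 1 ≡ length (out s) → (∀ i → i < length (out s) → σ₁ 1 i ≡ cell (out s) i) →
      σ₁ 3 0 ≡ v → ∀ i → i < suc (length (out s)) →
      (σ₁ [ 1 , σ₁ 4 1 ≔ σ₁ 3 0 ]) 1 i ≡ cell (out s ++ [ v ]) i
    written σ₁ len old eq i (s≤s i≤) with i Data.Nat.≟ length (out s)
    ... | yes refl rewrite len = trans (update-hit σ₁ 1 (length (out s)) _) (trans eq (sym (cell-last (out s) v)))
    ... | no i≢ rewrite len = trans (update-cell σ₁ 1 _ 1 i≢)
      (trans (old i (Data.Nat.Properties.≤∧≢⇒< i≤ i≢)) (sym (cell-++ˡ (out s) [ v ] (Data.Nat.Properties.≤∧≢⇒< i≤ i≢))))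
  sim (b ⟫ b′) ρ {s} {σ} {q} ρ≤ (ok , ok′) bd r q< =
    mapR W ≤-refl (λ _ (r , bd) → r , bounded-weaken (exec b′ ρ (exec b ρ s)) (≤-reflexive (+-assoc q (cost n b) (cost n b′))) bd)
      (seqR W (sim b ρ ρ≤ ok bd r (≤-<-trans (+-monoʳ-≤ q (m≤m+n _ _)) q<)) λ σ₁ (r₁ , bd₁) →
        sim b′ ρ ρ≤ ok′ bd₁ r₁ (subst (_< W) (sym (+-assoc q (cost n b) (cost n b′))) q<))
  sim (when e b) ρ {s} {σ} {q} ρ≤ (ok , ok′) bd@(τ< , p≤ , o≤) r q< =
    seqR W (simEx {s} τ< p< e ρ ρ≤ ok r) λ σ₁ (eq₁ , f₁) →
    condR W {e = reg 0} (small (proj₁ ok) , subst (_< W) (sym eq₁) (val<W {s} τ< p< e ρ ρ≤ ok))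
      (λ nz → mapR W ≤-refl
        (λ _ (r , bd) → taken eq₁ nz (λ s → Rel ρ s _ × Bounded s _)
          (r , bounded-weaken (exec b ρ s) (+-monoʳ-≤ q grow) bd))
        (sim b ρ ρ≤ ok′ bd (rel-frame f₁ r) (≤-<-trans (+-monoʳ-≤ q grow) q<)))
      (λ z → _ , _ , skip , ≤-refl , skipped (trans (sym eq₁) z) (λ s → Rel ρ s _ × Bounded s _)
          (rel-frame f₁ r , bounded-weaken s (m≤m+n q _) bd))
      (≤-trans (≤-reflexive (cong (3 +_) (+-comm (cost n b) 1))) (+-monoˡ-≤ (cost n b) (≤ᵇ⇒≤ 4 16 tt)))
    where
    p< = ≤-<-trans (≤-trans p≤ (m≤m+n q _)) q<
    grow : cost n b ≤ costEx n e + (16 + cost n b)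
    grow = ≤-trans (m≤n+m (cost n b) 16) (m≤n+m _ (costEx n e))
    taken : ∀ {x} → x ≡ eval (tabs s) (pos s) ρ e → x ≢ 0 → (Q : St → Set) →
      Q (exec b ρ s) → Q (exec (when e b) ρ s)
    taken refl nz Q q with eval (tabs s) (pos s) ρ e
    ... | zero  = contradiction refl nz
    ... | suc _ = q
    skipped : eval (tabs s) (pos s) ρ e ≡ 0 → (Q : St → Set) → Q s → Q (exec (when e b) ρ s)
    skipped eq Q q rewrite eq = q
  sim {d} (loop b) ρ {s} {σ} {q} ρ≤ (d< , ok) bd r q< =
    mapR W ≤-refl (λ _ (r , bd) → rel-drop r , bounded-weaken (run n) (+-monoʳ-≤ q (count ≤-refl)) bd)
      (forR W (small d<) (1<W d<) (n<W d<) Inv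
        (λ (r , _) → var-ok r zero , trans (input-ok r 0) input-size)
        (λ {k} k<n (r , bd) → mapR W ≤-refl
          (λ _ (r , bd) → var-ok r zero ,
             subst (Holds (suc k) _) (sym (iterN-suc k (λ i → exec b (i ∷ ρ)) s))
               (rel-bind (suc k) (rel-drop r) ,
                bounded-weaken (exec b (k ∷ ρ) (run k)) (≤-reflexive (next k)) bd))
          (sim b (k ∷ ρ) (λ { zero → <⇒≤ k<n ; (suc i) → ρ≤ i }) ok bd r
            (≤-<-trans (≤-trans (≤-reflexive (next k)) (+-monoʳ-≤ q (count k<n))) q<)))
        (subst (Holds 0 _) (sym (iterN-zero (λ i → exec b (i ∷ ρ)) s))
          (rel-bind 0 r , bounded-weaken s (m≤m+n q 0) bd)))
    where
    run : ℕ → St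
    run k = iterN k (λ i → exec b (i ∷ ρ)) s
    Holds : ℕ → Store → St → Set
    Holds k σ s = Rel (k ∷ ρ) s σ × Bounded s (q + k * cost n b)
    Inv : ℕ → Store → Set
    Inv k σ = Holds k σ (run k)
    next : ∀ k → q + k * cost n b + cost n b ≡ q + suc k * cost n b
    next k = trans (+-assoc q _ _) (cong (q +_) (+-comm (k * cost n b) (cost n b)))
    count : ∀ {k} → k ≤ n → k * cost n b ≤ loopCost n (cost n b)
    count k≤n = ≤-trans (*-mono-≤ k≤n (m≤m+n (cost n b) 32)) (≤-trans (m≤m+n _ 16) (m≤n+m _ 16))

-- Loops that fill tables

agree-sum : ∀ k {g h} → (∀ i → i < k → g i ≡ h i) → sumN k g ≡ sumN k h
agree-sum zero    eq = refl
agree-sum (suc k) eq = cong₂ _+_ (agree-sum k (λ i i< → eq i (Data.Nat.Properties.m<n⇒m<1+n i<))) (eq k ≤-refl)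

agree-mu : ∀ k {g h} → (∀ i → i < k → g i ≡ h i) → muN k g ≡ muN k h
agree-mu zero    eq = refl
agree-mu (suc k) eq = cong₂ (λ a x → a + apply mul (apply equal a k) (apply equal x 0))
  (agree-mu k (λ i i< → eq i (Data.Nat.Properties.m<n⇒m<1+n i<))) (eq k ≤-refl)

iterN-inv : ∀ {A : Set} n {f : ℕ → A → A} (Inv : ℕ → A → Set) →
  (∀ (i : Fin n) s → Inv (toℕ i) s → Inv (suc (toℕ i)) (f (toℕ i) s)) →
  ∀ {s} → Inv 0 s → Inv n (iterN n f s)
iterN-inv n {f} Inv step {s} I = go n ≤-refl
  where
  go : ∀ k → k ≤ n → Inv k (iterN k f s)
  go zero    _   = subst (Inv 0) (sym (iterN-zero f s)) I
  go (suc k) k<n = subst (Inv (suc k)) (sym (iterN-suc k f s)) (subst (λ j → Inv (suc j) (f j (iterN k f s))) (toℕ-fromℕ< k<n)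
    (step (fromℕ< k<n) _ (subst (λ j → Inv j (iterN k f s)) (sym (toℕ-fromℕ< k<n)) (go k (<⇒≤ k<n)))))

ix-injective : ∀ {n a a′ b b′} → b < n → b′ < n → a * n + b ≡ a′ * n + b′ → a ≡ a′ × b ≡ b′
ix-injective {a = zero}  {zero}   b< b′< eq = refl , eq
ix-injective {n} {zero} {suc a′} {b} {b′} b< b′< eq = contradiction b<
  (≤⇒≯ (≤-trans (≤-trans (m≤m+n n (a′ * n)) (m≤m+n _ b′)) (≤-reflexive (sym eq))))
ix-injective {n} {suc a} {zero} {b} {b′} b< b′< eq = contradiction b′<
  (≤⇒≯ (≤-trans (≤-trans (m≤m+n n (a * n)) (m≤m+n _ b)) (≤-reflexive eq)))
ix-injective {n} {suc a} {suc a′} {b} {b′} b< b′< eq =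
  let a≡ , b≡ = ix-injective {n} {a} {a′} b< b′< (+-cancelˡ-≡ n _ _
        (trans (sym (+-assoc n (a * n) b)) (trans eq (+-assoc n (a′ * n) b′))))
  in cong suc a≡ , b≡

-- Tables are filled in increasing order. An expression that passes this test for `T` cannot see
-- table `T`, so its value stays the same while `T` is being filled.
below : ∀ {d} → ℕ → Ex d → Bool
below T (inp e)     = below T e
below T (tab U e)   = (U <ᵇ T) ∧ below T e
below T (bin o e f) = below T e ∧ below T f
below T (ite b e f) = below T b ∧ below T e ∧ below T f
below T (sum e)     = below T e
below T (mu e)      = below T e
below T _           = true

module Execution (n : ℕ) (input : ℕ → ℕ) where

  open Semantics n input
  open St

  record Writes (T : ℕ) {A : Set} (idx val : A → ℕ) (s s′ : St) : Set where
    field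
      hit      : ∀ a → tabs s′ T (idx a) ≡ val a
      miss     : ∀ U j → (U ≡ T → ∀ a → idx a ≢ j) → tabs s′ U j ≡ tabs s U j
      pos-same : pos s′ ≡ pos s
      out-same : out s′ ≡ out s
  open Writes public

  set-writes : ∀ {d} T (i e : Ex d) ρ s → Writes T {⊤} (λ _ → eval (tabs s) (pos s) ρ i)
    (λ _ → eval (tabs s) (pos s) ρ e) s (exec (set T i e) ρ s)
  set-writes T i e ρ (st τ p o) = record
    { hit = λ _ → update-hit τ T _ _
    ; miss = λ U j h → untouched U j h (U Data.Nat.≟ T)
    ; pos-same = refl
    ; out-same = refl
    }
    where
    untouched : ∀ U j → (U ≡ T → ⊤ → eval τ p ρ i ≢ j) → Dec (U ≡ T) →
      (τ [ T , eval τ p ρ i ≔ eval τ p ρ e ]) U j ≡ τ U j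
    untouched U j h (no U≢)    = update-array τ _ _ j U≢
    untouched U j h (yes refl) = update-cell τ T _ T (λ eq → h refl tt (sym eq))

  -- In a loop over i the cells idx i′ _ with i′ < i have been written.
  Partial : ∀ (T : ℕ) {A : Set} → (Fin n → A → ℕ) → ℕ → St → St → Set
  Partial T idx k s₀ s =
    (∀ U j → (U ≡ T → ∀ i a → toℕ i < k → idx i a ≢ j) → tabs s U j ≡ tabs s₀ U j) ×
    pos s ≡ pos s₀ × out s ≡ out s₀

  -- By `inj` different rounds write different cells, so no value is overwritten by a later round.
  loop-writes : ∀ {T} {A : Set} {idx val : Fin n → A → ℕ} {f : ℕ → St → St} {s₀} →
    (∀ {i i′ a a′} → idx i a ≡ idx i′ a′ → i ≡ i′) →
    (∀ i s → Partial T idx (toℕ i) s₀ s → Writes T (idx i) (val i) s (f (toℕ i) s)) →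
    Writes T {Fin n × A} (λ (i , a) → idx i a) (λ (i , a) → val i a) s₀ (iterN n f s₀)
  loop-writes {T} {A} {idx} {val} {f} {s₀} inj body = record
    { hit = λ (i , a) → proj₁ result i a (toℕ<n i)
    ; miss = λ U j h → proj₁ (proj₂ result) U j (λ U≡ i a _ → h U≡ (i , a))
    ; pos-same = proj₁ (proj₂ (proj₂ result))
    ; out-same = proj₂ (proj₂ (proj₂ result))
    }
    where
    Inv : ℕ → St → Set
    Inv k s = (∀ i a → toℕ i < k → tabs s T (idx i a) ≡ val i a) × Partial T idx k s₀ s
    step : ∀ i s → Inv (toℕ i) s → Inv (suc (toℕ i)) (f (toℕ i) s)
    step i s (done , part@(same , p , o)) with body i s part
    ... | w = done′ ,
      (λ U j h → trans (miss w U j (λ U≡ a → h U≡ i a ≤-refl))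
        (same U j (λ U≡ i′ a i′< → h U≡ i′ a (Data.Nat.Properties.m<n⇒m<1+n i′<)))) ,
      trans (pos-same w) p , trans (out-same w) o
      where
      done′ : ∀ i′ a → toℕ i′ < suc (toℕ i) → tabs (f (toℕ i) s) T (idx i′ a) ≡ val i′ a
      done′ i′ a (s≤s i′≤) with i′ Finₚ.≟ i
      ... | yes refl = hit w a
      ... | no i′≢   = trans (miss w T (idx i′ a) (λ _ a′ eq → i′≢ (sym (inj eq))))
        (done i′ a (Finₚ.≤∧≢⇒< i′≤ i′≢))
    result : Inv n (iterN n f s₀)
    result = iterN-inv n Inv step ((λ _ _ ()) , (λ _ _ _ → refl) , refl , refl)

  Agree : ℕ → St → St → Set
  Agree T s s′ = (∀ U j → U < T → tabs s U j ≡ tabs s′ U j) × pos s ≡ pos s′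

  eval-agree : ∀ {d} T (e : Ex d) → Data.Bool.T (below T e) → ∀ ρ s s′ → Agree T s s′ →
    eval (tabs s) (pos s) ρ e ≡ eval (tabs s′) (pos s′) ρ e
  eval-agree T (num k)   _  ρ s s′ ag = refl
  eval-agree T (var i)   _  ρ s s′ ag = refl
  eval-agree T size      _  ρ s s′ ag = refl
  eval-agree T ptr       _  ρ s s′ ag = proj₂ ag
  eval-agree T (inp e)   ok ρ s s′ ag = cong input (eval-agree T e ok ρ s s′ ag)
  eval-agree T (tab U e) ok ρ s s′ ag with U <ᵇ T in eq
  ... | true = trans (cong (tabs s U) (eval-agree T e ok ρ s s′ ag))
    (proj₁ ag U _ (<ᵇ⇒< U T (subst Data.Bool.T (sym eq) tt)))
  eval-agree T (bin o e f) ok ρ s s′ ag = let oke , okf = Equivalence.to T-∧ ok in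
    cong₂ (apply o) (eval-agree T e oke ρ s s′ ag) (eval-agree T f okf ρ s s′ ag)
  eval-agree T (ite b e f) ok ρ s s′ ag
    with okb , okr ← Equivalence.to (T-∧ {below T b}) ok
    with oke , okf ← Equivalence.to (T-∧ {below T e}) okr
    rewrite eval-agree T b okb ρ s s′ ag | eval-agree T e oke ρ s s′ ag | eval-agree T f okf ρ s s′ ag = refl
  eval-agree T (sum e) ok ρ s s′ ag = agree-sum n λ i _ → eval-agree T e ok (i ∷ ρ) s s′ ag
  eval-agree T (mu e)  ok ρ s s′ ag = agree-mu n λ i _ → eval-agree T e ok (i ∷ ρ) s s′ ag

  writes-agree : ∀ {T} {A : Set} {idx val : A → ℕ} {s s′} → Writes T idx val s s′ → Agree T s s′
  writes-agree w =
    (λ U j U< → sym (miss w U j (λ { refl → contradiction refl (<⇒≢ U<) }))) , sym (pos-same w)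

  -- The commands that fill table T with values computed from the tables below it.
  record Fills (T : ℕ) {d} (c : Cmd d) (A : Set) : Set₁ where
    field
      idx    : Vec ℕ d → A → ℕ
      val    : Vec ℕ d → St → A → ℕ
      writes : ∀ ρ s → Writes T (idx ρ) (val ρ s) s (exec c ρ s)
      stable : ∀ ρ s s′ → Agree T s s′ → ∀ a → val ρ s a ≡ val ρ s′ a
  open Fills public

  set-fills : ∀ {d} T (i e : Ex d) → (∀ ρ s s′ → eval (tabs s) (pos s) ρ i ≡ eval (tabs s′) (pos s′) ρ i) →
    Data.Bool.T (below T e) → Fills T (set T i e) ⊤
  set-fills T i e i-const ok = record
    { idx = λ ρ _ → eval (λ _ _ → 0) 0 ρ i
    ; val = λ ρ s _ → eval (tabs s) (pos s) ρ e
    ; writes = λ ρ s → let w = set-writes T i e ρ s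
                           eq = i-const ρ s (st (λ _ _ → 0) 0 []) in record
        { hit = λ a → trans (cong (tabs (exec (set T i e) ρ s) T) (sym eq)) (hit w a)
        ; miss = λ U j h → miss w U j (λ U≡ a eq′ → h U≡ a (trans (sym eq) eq′))
        ; pos-same = pos-same w ; out-same = out-same w }
    ; stable = λ ρ s s′ ag _ → eval-agree T e ok ρ s s′ ag
    }

  -- The values depend on lower tables and the input position only, which the loop leaves alone; so
  -- the values of every round may be computed in the initial state.
  loop-fills : ∀ {T d} {c : Cmd (suc d)} {A : Set} (F : Fills T c A) →
    (∀ ρ {i i′ : Fin n} {a a′} → idx F (toℕ i ∷ ρ) a ≡ idx F (toℕ i′ ∷ ρ) a′ → i ≡ i′) →
    Fills T (loop c) (Fin n × A)
  loop-fills {T} F inj = record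
    { idx = λ ρ (i , a) → idx F (toℕ i ∷ ρ) a
    ; val = λ ρ s (i , a) → val F (toℕ i ∷ ρ) s a
    ; writes = λ ρ s₀ → loop-writes {idx = λ i a → idx F (toℕ i ∷ ρ) a} (inj ρ)
        λ i s (same , p , _) → let w = writes F (toℕ i ∷ ρ) s in record
          { hit = λ a → trans (hit w a) (stable F (toℕ i ∷ ρ) s s₀
              ((λ U j U< → same U j (λ { refl → contradiction refl (<⇒≢ U<) })) , p) a)
          ; miss = miss w ; pos-same = pos-same w ; out-same = out-same w }
    ; stable = λ ρ s s′ ag (i , a) → stable F (toℕ i ∷ ρ) s s′ ag a
    }

lvl : ∀ d k → T (k <ᵇ d) → Fin d
lvl (suc d) zero    _ = Fin.fromℕ d
lvl (suc d) (suc k) p = Fin.inject₁ (lvl d k p)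

-- The variable of the k-th loop or sum, counted from outside.
v : ∀ {d} k {k<d : T (k <ᵇ d)} → Ex d
v {d} k {k<d} = var (lvl d k k<d)

ix2 : ∀ {d} → Ex d → Ex d → Ex d
ix2 a b = bin add (bin mul a size) b

ix3 : ∀ {d} → Ex d → Ex d → Ex d → Ex d
ix3 a b d = ix2 (ix2 a b) d

data Table : Set where
  matrix : Ex 2 → Table
  cube   : Ex 3 → Table

fill : ℕ → Table → Cmd 0
fill T (matrix e) = loop (loop (set T (ix2 (v 0) (v 1)) e))
fill T (cube e)   = loop (loop (loop (set T (ix3 (v 0) (v 1) (v 2)) e)))

fills : ℕ → List Table → Cmd 0 → Cmd 0
fills T []       c = c
fills T (t ∷ ts) c = fill T t ⟫ fills (suc T) ts c

tableBelow : ℕ → Table → Bool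
tableBelow T (matrix e) = below T e
tableBelow T (cube e)   = below T e

AllBelow : ℕ → List Table → Set
AllBelow T []       = ⊤
AllBelow T (t ∷ ts) = Data.Bool.T (tableBelow T t) × AllBelow (suc T) ts

module Filling (n : ℕ) (input : ℕ → ℕ) where

  open Semantics n input
  open Execution n input
  open St

  at2 : Store → ℕ → Fin n → Fin n → ℕ
  at2 τ T a b = τ T (toℕ a * n + toℕ b)

  at3 : Store → ℕ → Fin n → Fin n → Fin n → ℕ
  at3 τ T a b d = τ T ((toℕ a * n + toℕ b) * n + toℕ d)

  Holds : ℕ → Table → St → Set
  Holds T (matrix e) s = ∀ a b → at2 (tabs s) T a b ≡ eval (tabs s) (pos s) (toℕ b ∷ toℕ a ∷ []) e
  Holds T (cube e)   s = ∀ a b d → at3 (tabs s) T a b d ≡ eval (tabs s) (pos s) (toℕ d ∷ toℕ b ∷ toℕ a ∷ []) e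

  AllHold : ℕ → List Table → St → Set
  AllHold T []       s = ⊤
  AllHold T (t ∷ ts) s = Holds T t s × AllHold (suc T) ts s

  private
    matrix-fills : ∀ T e → Data.Bool.T (below T e) → Fills T (fill T (matrix e)) (Fin n × Fin n × ⊤)
    matrix-fills T e ok = loop-fills (loop-fills (set-fills T (ix2 (v 0) (v 1)) e
        (λ { (_ ∷ _ ∷ []) _ _ → refl }) ok)
      (λ { (a ∷ []) {i} {i′} eq → toℕ-injective (proj₂ (ix-injective {n} {a} {a} (toℕ<n i) (toℕ<n i′) eq)) }))
      (λ { [] {i} {i′} {b , _} {b′ , _} eq →
        toℕ-injective (proj₁ (ix-injective {n} {toℕ i} {toℕ i′} (toℕ<n b) (toℕ<n b′) eq)) })

    cube-fills : ∀ T e → Data.Bool.T (below T e) → Fills T (fill T (cube e)) (Fin n × Fin n × Fin n × ⊤)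
    cube-fills T e ok = loop-fills (loop-fills (loop-fills (set-fills T (ix3 (v 0) (v 1) (v 2)) e
        (λ { (_ ∷ _ ∷ _ ∷ []) _ _ → refl }) ok)
      (λ { (b ∷ a ∷ []) {i} {i′} eq →
        toℕ-injective (proj₂ (ix-injective {n} {a * n + b} {a * n + b} (toℕ<n i) (toℕ<n i′) eq)) }))
      (λ { (a ∷ []) {i} {i′} {d , _} {d′ , _} eq → toℕ-injective (proj₂ (ix-injective {n} {a} {a} (toℕ<n i) (toℕ<n i′)
        (proj₁ (ix-injective {n} {a * n + toℕ i} {a * n + toℕ i′} (toℕ<n d) (toℕ<n d′) eq)))) }))
      (λ { [] {i} {i′} {b , d , _} {b′ , d′ , _} eq → toℕ-injective (proj₁ (ix-injective {n} {toℕ i} {toℕ i′} (toℕ<n b) (toℕ<n b′)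
        (proj₁ (ix-injective {n} {toℕ i * n + toℕ b} {toℕ i′ * n + toℕ b′} (toℕ<n d) (toℕ<n d′) eq)))) })

  private
    fill-sound : ∀ T t → Data.Bool.T (tableBelow T t) → ∀ s s′ →
      Agree (suc T) (exec (fill T t) [] s) s′ → Agree T s s′ × out (exec (fill T t) [] s) ≡ out s × Holds T t s′
    fill-sound T (matrix e) ok s s′ ag = ag′ , out-same w , λ a b →
      trans (sym (proj₁ ag T _ ≤-refl)) (trans (hit w (a , b , tt)) (eval-agree T e ok _ s s′ ag′))
      where
      w : Writes T (idx (matrix-fills T e ok) []) (val (matrix-fills T e ok) [] s) s (exec (fill T (matrix e)) [] s)
      w = writes (matrix-fills T e ok) [] s
      ag′ : Agree T s s′
      ag′ = (λ U j U< → trans (proj₁ (writes-agree w) U j U<) (proj₁ ag U j (Data.Nat.Properties.m<n⇒m<1+n U<))) ,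
        trans (proj₂ (writes-agree w)) (proj₂ ag)
    fill-sound T (cube e) ok s s′ ag = ag′ , out-same w , λ a b d →
      trans (sym (proj₁ ag T _ ≤-refl)) (trans (hit w (a , b , d , tt)) (eval-agree T e ok _ s s′ ag′))
      where
      w : Writes T (idx (cube-fills T e ok) []) (val (cube-fills T e ok) [] s) s (exec (fill T (cube e)) [] s)
      w = writes (cube-fills T e ok) [] s
      ag′ : Agree T s s′
      ag′ = (λ U j U< → trans (proj₁ (writes-agree w) U j U<) (proj₁ ag U j (Data.Nat.Properties.m<n⇒m<1+n U<))) ,
        trans (proj₂ (writes-agree w)) (proj₂ ag)

  -- The defining equations of all tables hold simultaneously in one final state, since each filling
  -- touches only its own table and reads only earlier ones.
  fills-sound : ∀ T ts c → AllBelow T ts → ∀ s → ∃[ s′ ]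
    exec (fills T ts c) [] s ≡ exec c [] s′ × Agree T s s′ × out s′ ≡ out s × AllHold T ts s′
  fills-sound T []       c ok s = s , refl , ((λ _ _ _ → refl) , refl) , refl , tt
  fills-sound T (t ∷ ts) c (ok , oks) s with fills-sound (suc T) ts c oks (exec (fill T t) [] s)
  ... | s′ , eq , ag , o , hold with fill-sound T t ok s s′ ag
  ...   | ag′ , o′ , h = s′ , eq , ag′ , trans o o′ , h , hold

-- Commands that only emit leave the tables and the input position alone, so their output is the
-- pure function `yields`.
data Gen (d : ℕ) : Set where
  yield : Ex d → Gen d
  _⟫_   : Gen d → Gen d → Gen d
  when  : Ex d → Gen d → Gen d
  loop  : Gen (suc d) → Gen d

generate : ∀ {d} → Gen d → Cmd d
generate (yield e)  = emit e
generate (g ⟫ h)    = generate g ⟫ generate h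
generate (when e g) = when e (generate g)
generate (loop g)   = loop (generate g)

concatN : {A : Set} → ℕ → (ℕ → List A) → List A
concatN zero    f = []
concatN (suc k) f = concatN k f ++ f k

module Generation (n : ℕ) (input : ℕ → ℕ) where

  open Semantics n input

  yields : ∀ {d} → Store → ℕ → Vec ℕ d → Gen d → List ℕ
  yields τ p ρ (yield e)  = [ eval τ p ρ e ]
  yields τ p ρ (g ⟫ h)    = yields τ p ρ g ++ yields τ p ρ h
  yields τ p ρ (when e g) = branch (eval τ p ρ e) (yields τ p ρ g) []
  yields τ p ρ (loop g)   = concatN n (λ i → yields τ p (i ∷ ρ) g)

  generate-sound : ∀ {d} (g : Gen d) ρ τ p o →
    exec (generate g) ρ (st τ p o) ≡ st τ p (o ++ yields τ p ρ g)
  generate-sound (yield e) ρ τ p o = refl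
  generate-sound (g ⟫ h)   ρ τ p o rewrite generate-sound g ρ τ p o | generate-sound h ρ τ p (o ++ yields τ p ρ g) =
    cong (st τ p) (Listₚ.++-assoc o _ _)
  generate-sound (when e g) ρ τ p o with eval τ p ρ e
  ... | zero  = cong (st τ p) (sym (Listₚ.++-identityʳ o))
  ... | suc _ = generate-sound g ρ τ p o
  generate-sound (loop g)  ρ τ p o = go n
    where
    go : ∀ k → iterN k (λ i → exec (generate g) (i ∷ ρ)) (st τ p o) ≡ st τ p (o ++ concatN k (λ i → yields τ p (i ∷ ρ) g))
    go zero    = trans (iterN-zero _ _) (cong (st τ p) (sym (Listₚ.++-identityʳ o)))
    go (suc k) rewrite iterN-suc k (λ i → exec (generate g) (i ∷ ρ)) (st τ p o) | go k | generate-sound g (k ∷ ρ) τ p (o ++ concatN k (λ i → yields τ p (i ∷ ρ) g)) =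
      cong (st τ p) (Listₚ.++-assoc o _ _)

-- The program. Table CLS holds label, MT the sets M a b, ST the sets S a b.

CLS IN DONE SEEN CUR COUNT LENGTH FIRST MT ST SZM SZS CA CB CAN VID PD CHD KIND END : ℕ
CLS = 0
IN = 1
DONE = 2
SEEN = 3
CUR = 4
COUNT = 5
LENGTH = 6
FIRST = 7
MT = 8
ST = 9
SZM = 10
SZS = 11
CA = 12
CB = 13
CAN = 14
VID = 15
PD = 16
CHD = 17
KIND = 18
END = 19

neg : ∀ {d} → Ex d → Ex d
neg e = bin equal e (num 0)

and or : ∀ {d} → Ex d → Ex d → Ex d
and e f = ite e f (num 0)
or e f = ite e (num 1) f

infix 6 _≐_ _≺_
_≐_ _≺_ : ∀ {d} → Ex d → Ex d → Ex d
_≐_ = bin equal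
_≺_ = bin less

scalar : ∀ {d} → ℕ → Ex d
scalar T = tab T (num 0)

tab2 : ∀ {d} → ℕ → Ex d → Ex d → Ex d
tab2 T a b = tab T (ix2 a b)

tab3 : ∀ {d} → ℕ → Ex d → Ex d → Ex d → Ex d
tab3 T a b c = tab T (ix3 a b c)

-- All loops have length `n`, so the lengths read from the input become guards; no row has more than
-- `n` classes and no class more than `n` elements. `FIRST` is read without advancing, since the
-- same number is read again as an element.
parse : Cmd 0
parse = adv ⟫ loop (set COUNT (num 0) (inp ptr) ⟫ adv ⟫
  loop (when (v 1 ≺ scalar COUNT)
    (set LENGTH (num 0) (inp ptr) ⟫ adv ⟫ set FIRST (num 0) (inp ptr) ⟫
      loop (when (v 2 ≺ scalar LENGTH) (set CLS (ix2 (v 0) (inp ptr)) (scalar FIRST) ⟫ adv)))))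

-- SEEN holds at x, c the successor of the first element with label c in row x
-- that has been processed, so two rows agree on all processed elements iff
-- their entries for these coincide.

clear : Cmd 2
clear =
  loop (set IN (v 2) (or (or (v 0 ≐ num 0) (v 1 ≐ num 0)) (or (v 2 ≐ v 0) (v 2 ≐ v 1)))) ⟫
  loop (set DONE (v 2) (num 0)) ⟫
  loop (loop (set SEEN (ix2 (v 2) (v 3)) (num 0)))

-- `CUR` becomes `n` when nothing is pending, which disables the round. Marks are `CUR + 1`, so that
-- 0 can stand for an empty entry; an occupied entry is kept and thus names the first representative
-- of its class.
choose process : Cmd 3
choose = set CUR (num 0) (mu (and (tab IN (v 3)) (neg (tab DONE (v 3)))))
process =
  set DONE (scalar CUR) (num 1) ⟫
  loop (set SEEN seen (ite (tab SEEN seen) (tab SEEN seen) (bin add (scalar CUR) (num 1)))) ⟫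
  loop (set IN (v 3) (or (tab IN (v 3)) (neg (tab SEEN seen ≐ tab SEEN (tab CLS (scalar CUR))))))
  where
  seen : Ex 4
  seen = ix2 (v 3) (tab2 CLS (v 3) (scalar CUR))

-- A round processes one pending element if there is any, so `n` rounds exhaust the set. Each round
-- is linear, because only the entries for the class of the new element are compared; over all pairs
-- this amounts to loop depth four.
save closure : Cmd 2
save = loop (set MT (ix3 (v 0) (v 1) (v 2)) (ite (tab IN (v 2)) (num 1) (num 0)))
closure = clear ⟫ loop (choose ⟫ when (scalar CUR ≺ size) process) ⟫ save

closures : Cmd 0
closures = loop (loop closure)

nearEx : Ex 3
nearEx = or (tab3 MT (v 0) (v 1) (v 2)) (or (neg (tab3 MT (v 0) (v 2) (v 1))) (neg (tab3 MT (v 1) (v 2) (v 0))))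

-- The strong sets of the pairs x, y and a, b coincide.
sameEx : ∀ {d} → Ex d → Ex d → Ex d → Ex d → Ex d
sameEx x y a b = and (and (tab3 ST a b x) (tab3 ST a b y)) (and (tab3 ST x y a) (tab3 ST x y b))

-- (CA , CB) is the first pair with the same strong set, VID its rank among the
-- pairs for which it is the pair itself, PD a point whose addition leads to
-- the parent, CHD completes a point to the code of a child, and END begins a
-- full pair of points of the node.

canonEx1 canonEx2 canonEx rankEx parentEx kindEx endEx : Ex 2
canonEx1 = mu (sum (sameEx (v 2) (v 3) (v 0) (v 1)))
canonEx2 = mu (sameEx (tab2 CA (v 0) (v 1)) (v 2) (v 0) (v 1))
canonEx = and (tab2 CA (v 0) (v 1) ≐ v 0) (tab2 CB (v 0) (v 1) ≐ v 1)
rankEx = sum (sum (ite (and (tab2 CAN (v 2) (v 3))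
  (or (v 2 ≺ tab2 CA (v 0) (v 1)) (and (v 2 ≐ tab2 CA (v 0) (v 1)) (v 3 ≺ tab2 CB (v 0) (v 1))))) (num 1) (num 0)))
parentEx = mu (and (neg (tab3 ST (v 0) (v 1) (v 2)))
  (neg (sum (and (neg (tab3 ST (v 0) (v 1) (v 3))) (neg (tab3 ST (v 0) (v 3) (v 2)))))))

childEx : Ex 3
childEx = mu (and (tab2 CAN (v 2) (v 3)) (and (tab2 PD (v 2) (v 3) ≺ size)
  (sameEx (v 2) (tab2 PD (v 2) (v 3)) (v 0) (v 1))))

-- `M x y` is contained in `S x y`, so comparing sizes is enough to compare the sets.
fullEx crossEx : ∀ {d} → Ex d → Ex d → Ex d → Ex d → Ex d
crossEx x y a b = sameEx x y a b
fullEx x y a b = and (crossEx x y a b) (tab2 SZM x y ≐ tab2 SZS a b)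

kindEx = ite (v 0 ≐ v 1) (num 0) (ite (sum (sum (fullEx (v 2) (v 3) (v 0) (v 1))))
  (ite (sum (sum (and (crossEx (v 2) (v 3) (v 0) (v 1)) (neg (tab2 SZM (v 2) (v 3) ≐ tab2 SZS (v 0) (v 1))))))
    (num 2) (num 3))
  (num 1))
-- A complete node has no full pair; the first disjunct makes the search succeed at 0 there, so that
-- `END` is always an element.
endEx = mu (or (tab2 KIND (v 0) (v 1) ≐ num 1) (sum (fullEx (v 2) (v 3) (v 0) (v 1))))

sizeEx : ℕ → Ex 2
sizeEx T = sum (ite (tab3 T (v 0) (v 1) (v 2)) (num 1) (num 0))

tables : List Table
tables = cube nearEx ∷ matrix (sizeEx MT) ∷ matrix (sizeEx ST) ∷ matrix canonEx1 ∷ matrix canonEx2 ∷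
  matrix canonEx ∷ matrix rankEx ∷ matrix parentEx ∷ cube childEx ∷ matrix kindEx ∷ matrix endEx ∷ []

-- The child with first code component v 3 has key v 2 + 1.
listed : Ex 4
listed = and (tab3 CHD (v 0) (v 1) (v 3) ≺ size)
  (tab2 SZM (tab2 END (v 0) (v 1)) (v 3) ≐ bin add (v 2) (num 1))

-- Children are sorted by counting: for each key in turn all points are scanned. Keys are sizes of
-- nonempty sets, hence lie between 1 and `n`, and the shift by one fits them to the range of the
-- loop. The parent is emitted last.
block : Gen 2
block =
  yield (tab2 KIND (v 0) (v 1)) ⟫ yield (ite (v 0 ≐ v 1) (v 0) (num 0)) ⟫
  yield (bin add (sum (sum (ite listed (num 1) (num 0)))) (ite (tab2 PD (v 0) (v 1) ≺ size) (num 1) (num 0))) ⟫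
  loop (loop (when listed (yield (tab2 VID (v 3) (tab3 CHD (v 0) (v 1) (v 3)))))) ⟫
  when (tab2 PD (v 0) (v 1) ≺ size) (yield (tab2 VID (v 0) (tab2 PD (v 0) (v 1))))

output : Gen 0
output = yield (sum (sum (ite (tab2 CAN (v 0) (v 1)) (num 1) (num 0)))) ⟫
  loop (loop (when (tab2 CAN (v 0) (v 1)) block))

treeProgram : Cmd 0
treeProgram = parse ⟫ closures ⟫ fills ST tables (generate output)

-- The exponents are the syntactic degrees of what is written: 2 for the incremented marks of `SEEN`
-- and the single sums in `SZM` and `SZS`, 3 for the double sum in `VID` and for the literal 3 in
-- `KIND`.
tableDegree : ℕ → ℕ
tableDegree 3  = 2
tableDegree 10 = 2
tableDegree 11 = 2
tableDegree 15 = 3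
tableDegree 18 = 3
tableDegree _  = 1

program-ok : Words.Ok tableDegree 64 treeProgram
program-ok = _

program-depth : depth treeProgram ≡ 4
program-depth = refl

program-coeff : T (coeff treeProgram <ᵇ 2 ^ 40)
program-coeff = tt

tables-below : AllBelow ST tables
tables-below = _

-- Opaque, for otherwise whole programs are unfolded during type checking.

initialState : St
initialState = st (λ _ _ → 0) 0 []

module _ (n : ℕ) (input : ℕ → ℕ) where

  open Semantics n input
  open Filling n input
  open Generation n input

  opaque
    run : Cmd 0 → St → St
    run c s = exec c [] s

    run-exec : ∀ c s → run c s ≡ exec c [] s
    run-exec c s = refl

    run-⟫ : ∀ c c′ s → run (c ⟫ c′) s ≡ run c′ (run c s)
    run-⟫ c c′ s = refl

    run-generate : ∀ g τ p → out (run (generate g) (st τ p [])) ≡ yields τ p [] g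
    run-generate g τ p = cong out (generate-sound g [] τ p [])

  opaque
    unfolding run
    run-fills : ∀ T ts c → AllBelow T ts → ∀ s → out s ≡ [] → ∃[ τ ] ∃[ p ]
      run (fills T ts c) s ≡ run c (st τ p []) × (∀ U j → U < T → tabs s U j ≡ τ U j) × AllHold T ts (st τ p [])
    run-fills T ts c ok s empty with fills-sound T ts c ok s
    ... | st τ p o , eq , (agree , _) , out≡ , hold with trans out≡ empty
    ...   | refl = τ , p , eq , agree , hold

    run-machine : ∀ deg k → input 0 ≡ n → (∀ i → input i ≤ n) → ∀ c {σ} → Words.Ok deg k c →
      (∀ i → σ 0 i ≡ input i) → (∀ a i → σ (suc a) i ≡ 0) → cost n c < (n + 2) ^ k →
      ∃[ σ′ ] ∃[ t ] ((n + 2) ^ k) ⊢ compile c , σ ⇓ σ′ , t × t ≤ cost n c × Outputs σ′ (out (run c initialState))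
    run-machine deg k input-size input≤ c {σ} ok σ-input σ-zero cost< =
      let σ′ , t , runs , t≤ , rel , _ = Machine.sim deg k n input input-size input≤ c [] {initialState} {σ} {0} (λ ()) ok
            ((λ T _ → m^n>0 (n + 2) {{Data.Nat.>-nonZero (≤-trans (s≤s z≤n) (m≤n+m 2 n))}} (deg T)) , z≤n , z≤n)
            (record { input-ok = σ-input ; out-ok = λ _ () ; var-ok = λ () ; pos-ok = σ-zero 3 0
                    ; len-ok = σ-zero 3 1 ; tabs-ok = λ T i → σ-zero (4 + T) i })
            cost<
      in σ′ , t , runs , t≤ , Machine.Rel.out-ok rel

-- Parsing the listing

unique-length : ∀ {n} {xs : List (Fin n)} → Unique xs → length xs ≤ n
unique-length {n} {xs} u with length xs ≤? n
... | yes ≤ = ≤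
... | no ≰  with Finₚ.pigeonhole (≰⇒> ≰) (List.lookup xs)
...   | i , j , i<j , eq = contradiction eq (allPairs-lookup u i<j)

length-concat : ∀ {A : Set} {xss : List (List A)} → All (_≢ []) xss → length xss ≤ length (concat xss)
length-concat All.[] = z≤n
length-concat {xss = [] ∷ _} (ne All.∷ _) = contradiction refl ne
length-concat {xss = (x ∷ xs) ∷ xss} (_ All.∷ nes) = s≤s (≤-trans (length-concat nes)
  (≤-trans (m≤n+m _ (length xs)) (≤-reflexive (sym (Listₚ.length-++ xs)))))

drop-view : ∀ {A : Set} (xs : List A) j →
  (length xs ≤ j × List.drop j xs ≡ [] × List.drop (suc j) xs ≡ []) ⊎
  (∃[ y ] y Mem.∈ xs × j < length xs × List.drop j xs ≡ y ∷ List.drop (suc j) xs)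
drop-view []       zero    = inj₁ (z≤n , refl , refl)
drop-view []       (suc j) = inj₁ (z≤n , refl , refl)
drop-view (x ∷ xs) zero    = inj₂ (x , here refl , s≤s z≤n , refl)
drop-view (x ∷ xs) (suc j) with drop-view xs j
... | inj₁ (≤ , eq , eq′)   = inj₁ (s≤s ≤ , eq , eq′)
... | inj₂ (y , y∈ , < , eq) = inj₂ (y , there y∈ , s≤s < , eq)

drop-all : ∀ {A : Set} (xs : List A) {j} → length xs ≤ j → List.drop j xs ≡ []
drop-all []       {zero}  _       = refl
drop-all []       {suc j} _       = refl
drop-all (x ∷ xs) {suc j} (s≤s ≤) = drop-all xs ≤

drop-tabulate : ∀ {A : Set} {n} (f : Fin n → A) i →
  List.drop (toℕ i) (List.tabulate f) ≡ f i ∷ List.drop (suc (toℕ i)) (List.tabulate f)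
drop-tabulate f zero    = refl
drop-tabulate f (suc i) = drop-tabulate (f ∘ suc) i

less-≤ : ∀ {j k} → k ≤ j → apply less j k ≡ 0
less-≤ {j} {k} k≤j with j <ᵇ k in eq
... | false = refl
... | true  = contradiction (<ᵇ⇒< j k (subst T (sym eq) tt)) (≤⇒≯ k≤j)

all-concatMap : ∀ {A B : Set} {P : B → Set} (f : A → List B) xs →
  (∀ {x} → x Mem.∈ xs → All P (f x)) → All P (concatMap f xs)
all-concatMap f []       h = All.[]
all-concatMap f (x ∷ xs) h = Allₚ.++⁺ (h (here refl)) (all-concatMap f xs (λ x∈ → h (there x∈)))

module Parsing {m : ℕ} (R : HomogeneousRelation (suc m)) (L : Listing (suc m)) (lists : Lists R L) where

  open Lists lists

  private
    n = suc m

  input : ℕ → ℕ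
  input = cell (encodeListing L)

  private
    encodeClass : List (Fin n) → List ℕ
    encodeClass = encodeList encodeFin

    encodeRow : Fin n → List ℕ
    encodeRow x = encodeList encodeClass (L x)

  class-length : ∀ {x C} → C Mem.∈ L x → length C ≤ n
  class-length {x} {C} C∈ = unique-length (part (L x) (disjoint x) C∈)
    where
    part : ∀ Cs → Unique (concat Cs) → C Mem.∈ Cs → Unique C
    part (D ∷ Cs) u (here refl) = unique-++ˡ D u
    part (D ∷ Cs) u (there C∈)  = part Cs (unique-++ʳ D u) C∈

  row-length : ∀ x → length (L x) ≤ n
  row-length x = ≤-trans (length-concat (nonempty x)) (unique-length (disjoint x))

  input-size : input 0 ≡ n
  input-size = Listₚ.length-tabulate id

  input≤ : ∀ i → input i ≤ n
  input≤ = cell≤ (≤-reflexive input-size All.∷ all-concatMap encodeRow (allFin n) λ {x} _ →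
    row-length x All.∷ all-concatMap encodeClass (L x) λ {C} C∈ →
      class-length C∈ All.∷ all-concatMap encodeFin C λ {y} _ → <⇒≤ (toℕ<n y) All.∷ All.[])
    where
    cell≤ : ∀ {ks} → All (_≤ n) ks → ∀ i → cell ks i ≤ n
    cell≤ All.[]       i       = z≤n
    cell≤ (k≤ All.∷ _) zero    = k≤
    cell≤ (_ All.∷ h)  (suc i) = cell≤ h i

  open Semantics n input
  open Execution n input
  open Filling n input using (at2)
  open St

  private
    record At (p : ℕ) (ks : List ℕ) : Set where
      constructor at
      field rest : ∀ i → input (p + i) ≡ cell ks i

    at-head : ∀ {p k ks} → At p (k ∷ ks) → input p ≡ k
    at-head {p} (at f) = trans (cong input (sym (+-identityʳ p))) (f 0)

    at-tail : ∀ {p k ks} → At p (k ∷ ks) → At (suc p) ks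
    at-tail {p} (at f) = at λ i → trans (cong input (sym (+-suc p i))) (f (suc i))

    at-≡ : ∀ {p ks ks′} → ks ≡ ks′ → At p ks → At p ks′
    at-≡ refl a = a

    Labelled : Store → Fin n → Fin n → Set
    Labelled τ x y = at2 τ CLS x y ≡ toℕ (label L x y)

    -- All entries are right, except that those in P may still be missing.
    record Up-to (P : Fin n → Fin n → Set) (τ : Store) : Set where
      constructor up-to
      field entry : ∀ x y → P x y ⊎ Labelled τ x y
    open Up-to

    up-to-map : ∀ {P Q : Fin n → Fin n → Set} {τ} → (∀ {x y} → P x y → Q x y) → Up-to P τ → Up-to Q τ
    up-to-map f u = up-to λ x y → [ (λ p → inj₁ (f p)) , inj₂ ]′ (entry u x y)

    up-to-write : ∀ {P Q : Fin n → Fin n → Set} {τ} x y {k l} → k ≡ toℕ x * n + toℕ y → l ≡ toℕ (label L x y) →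
      (∀ {x′ y′} → P x′ y′ → Q x′ y′ ⊎ (x′ ≡ x × y′ ≡ y)) → Up-to P τ → Up-to Q (τ [ CLS , k ≔ l ])
    up-to-write {P} {Q} {τ} x y {l = l} refl refl f u = up-to written
      where
      written : ∀ x′ y′ → Q x′ y′ ⊎ Labelled (τ [ CLS , toℕ x * n + toℕ y ≔ l ]) x′ y′
      written x′ y′ with toℕ x′ * n + toℕ y′ Data.Nat.≟ toℕ x * n + toℕ y
      ... | yes eq with ix-injective {n} {toℕ x′} {toℕ x} (toℕ<n y′) (toℕ<n y) eq
      ...   | x≡ , y≡ with toℕ-injective x≡ | toℕ-injective y≡
      ...     | refl | refl = inj₂ (update-hit τ CLS (toℕ x * n + toℕ y) l)
      written x′ y′ | no ≢ =
        [ (λ p → [ inj₁ , (λ { (refl , refl) → contradiction refl ≢ }) ]′ (f p))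
        , (λ lab → inj₂ (trans (update-cell τ CLS l CLS ≢) lab)) ]′ (entry u x′ y′)

    Row : ℕ → Fin n → Fin n → Set
    Row k x y = k ≤ toℕ x × y Mem.∈ concat (L x)

    Pending : Fin n → List (Fin n) → Fin n → Fin n → Set
    Pending x ys x′ y′ = Row (suc (toℕ x)) x′ y′ ⊎ (x′ ≡ x × y′ Mem.∈ ys)

    readElement : Cmd 3
    readElement = when (v 2 ≺ scalar LENGTH) (set CLS (ix2 (v 0) (inp ptr)) (scalar FIRST) ⟫ adv)

    readClass : Cmd 2
    readClass = when (v 1 ≺ scalar COUNT)
      (set LENGTH (num 0) (inp ptr) ⟫ adv ⟫ set FIRST (num 0) (inp ptr) ⟫ loop readElement)

    readRow : Cmd 1
    readRow = set COUNT (num 0) (inp ptr) ⟫ adv ⟫ loop readClass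

    module Element (x : Fin n) (i : ℕ) (C : List (Fin n)) (C∈ : C Mem.∈ L x)
      (ys : List (Fin n)) (ks : List ℕ) (count : ℕ) where

      Inv : ℕ → St → Set
      Inv j s = At (pos s) (concatMap encodeFin (List.drop j C) ++ ks) ×
        (tabs s LENGTH 0 ≡ length C × tabs s FIRST 0 ≡ toℕ (first C) × tabs s COUNT 0 ≡ count × out s ≡ []) ×
        Up-to (Pending x (List.drop j C ++ ys)) (tabs s)

      step : ∀ j s → Inv j s → Inv (suc j) (exec readElement (j ∷ i ∷ toℕ x ∷ []) s)
      step j s (a , (len , fst , cnt , o) , u) with drop-view C j
      ... | inj₁ (≤j , eq , eq′) rewrite trans (cong (apply less j) len) (less-≤ ≤j) =
        at-≡ (cong (λ zs → concatMap encodeFin zs ++ ks) (trans eq (sym eq′))) a , (len , fst , cnt , o) ,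
        subst (λ zs → Up-to (Pending x (zs ++ ys)) (tabs s)) (trans eq (sym eq′)) u
      ... | inj₂ (y , y∈ , j< , eq) rewrite trans (cong (apply less j) len) (less-true j<) =
        at-tail at′ , (len , fst , cnt , o) ,
        up-to-write x y (cong (toℕ x * n +_) (at-head at′))
          (trans fst (cong (λ D → toℕ (first D)) (sym (classOf-≡ (L x) (disjoint x) C∈ y∈))))
          (λ { (inj₁ r) → inj₁ (inj₁ r)
             ; (inj₂ (refl , here refl)) → inj₂ (refl , refl)
             ; (inj₂ (refl , there z∈)) → inj₁ (inj₂ (refl , z∈)) })
          (subst (λ zs → Up-to (Pending x (zs ++ ys)) (tabs s)) eq u)
        where
        at′ : At (pos s) (toℕ y ∷ concatMap encodeFin (List.drop (suc j) C) ++ ks)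
        at′ = at-≡ (cong (λ zs → concatMap encodeFin zs ++ ks) eq) a

      result : ∀ s → Inv 0 s → Inv n (exec (loop readElement) (i ∷ toℕ x ∷ []) s)
      result s = iterN-inv n {λ j → exec readElement (j ∷ i ∷ toℕ x ∷ [])} Inv (λ j s → step (toℕ j) s) {s}

    module Class (x : Fin n) (ks : List ℕ) where

      Inv : ℕ → St → Set
      Inv i s = At (pos s) (concatMap encodeClass (List.drop i (L x)) ++ ks) ×
        (tabs s COUNT 0 ≡ length (L x) × out s ≡ []) ×
        Up-to (Pending x (concat (List.drop i (L x)))) (tabs s)

      step : ∀ i s → Inv i s → Inv (suc i) (exec readClass (i ∷ toℕ x ∷ []) s)
      step i s (a , (cnt , o) , u) with drop-view (L x) i
      ... | inj₁ (≤i , eq , eq′) rewrite trans (cong (apply less i) cnt) (less-≤ ≤i) =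
        at-≡ (cong (λ zs → concatMap encodeClass zs ++ ks) (trans eq (sym eq′))) a , (cnt , o) ,
        subst (λ zs → Up-to (Pending x (concat zs)) (tabs s)) (trans eq (sym eq′)) u
      ... | inj₂ (C , C∈ , i< , eq) rewrite trans (cong (apply less i) cnt) (less-true i<) =
        finish (Element.result x i C C∈ (concat (List.drop (suc i) (L x)))
          (concatMap encodeClass (List.drop (suc i) (L x)) ++ ks) (length (L x))
          (exec (set LENGTH (num 0) (inp ptr) ⟫ adv ⟫ set FIRST (num 0) (inp ptr)) (i ∷ toℕ x ∷ []) s)
          (at-≡ (Listₚ.++-assoc (concatMap encodeFin C) _ ks) (at-tail at′) ,
           (at-head at′ , head-first C (concatMap encodeClass (List.drop (suc i) (L x))) (All.lookup (nonempty x) C∈) (at-tail at′) , cnt , o) ,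
           up-to (entry (subst (λ zs → Up-to (Pending x (concat zs)) (tabs s)) eq u))))
        where
        at′ : At (pos s) (length C ∷ (concatMap encodeFin C ++ concatMap encodeClass (List.drop (suc i) (L x))) ++ ks)
        at′ = at-≡ (cong (λ zs → concatMap encodeClass zs ++ ks) eq) a
        head-first : ∀ {p} (C : List (Fin n)) ls → C ≢ [] → At p ((concatMap encodeFin C ++ ls) ++ ks) → input p ≡ toℕ (first C)
        head-first []      _ C≢ _  = contradiction refl C≢
        head-first (y ∷ C) _ _  a = at-head a
        finish : ∀ {s′} → Element.Inv x i C C∈ (concat (List.drop (suc i) (L x)))
            (concatMap encodeClass (List.drop (suc i) (L x)) ++ ks) (length (L x)) n s′ → Inv (suc i) s′
        finish (a , (_ , _ , cnt , o) , u) rewrite drop-all C (class-length C∈) = a , (cnt , o) , u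

      result : ∀ s → Inv 0 s → Inv n (exec (loop readClass) (toℕ x ∷ []) s)
      result s = iterN-inv n {λ i → exec readClass (i ∷ toℕ x ∷ [])} Inv (λ i s → step (toℕ i) s) {s}

    Inv : ℕ → St → Set
    Inv k s = At (pos s) (concatMap encodeRow (List.drop k (allFin n))) × out s ≡ [] × Up-to (Row k) (tabs s)

    step : ∀ x s → Inv (toℕ x) s → Inv (suc (toℕ x)) (exec readRow (toℕ x ∷ []) s)
    step x s (a , o , u) = finish (Class.result x ks (exec (set COUNT (num 0) (inp ptr) ⟫ adv) (toℕ x ∷ []) s)
        (at-tail at′ , (at-head at′ , o) , up-to-map (λ {x′} (k≤ , y∈) → split x′ k≤ y∈) (up-to (entry u))))
      where
      ks : List ℕ
      ks = concatMap encodeRow (List.drop (suc (toℕ x)) (allFin n))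
      at′ : At (pos s) (length (L x) ∷ concatMap encodeClass (L x) ++ ks)
      at′ = at-≡ (cong (concatMap encodeRow) (drop-tabulate id x)) a
      split : ∀ x′ {y} → toℕ x ≤ toℕ x′ → y Mem.∈ concat (L x′) → Pending x (concat (L x)) x′ y
      split x′ x≤ y∈ with x Finₚ.≟ x′
      ... | yes refl = inj₂ (refl , y∈)
      ... | no x≢    = inj₁ (Finₚ.≤∧≢⇒< x≤ x≢ , y∈)
      finish : ∀ {s′} → Class.Inv x ks n s′ → Inv (suc (toℕ x)) s′
      finish (a , (_ , o) , u) rewrite drop-all (L x) (row-length x) =
        a , o , up-to-map (λ { (inj₁ r) → r }) u

  parsed : St
  parsed = exec parse [] (st (λ _ _ → 0) 0 [])

  parse-sound : out parsed ≡ [] × (∀ x y → at2 (tabs parsed) CLS x y ≡ toℕ (label L x y))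
  parse-sound = let _ , o , u = result in
    o , λ x y → [ (λ (n≤ , _) → contradiction (toℕ<n x) (≤⇒≯ n≤)) , id ]′ (entry u x y)
    where
    start : Up-to (Row 0) (λ _ _ → 0)
    start = up-to go
      where
      go : ∀ x y → Row 0 x y ⊎ Labelled (λ _ _ → 0) x y
      go x y with y ∈ˡ? concat (L x)
      ... | yes y∈ = inj₁ (z≤n , y∈)
      -- Such a `y` is in no class of the row, so its label is `first []`, that is `zero`, which the
      -- untouched cell already holds.
      ... | no y∉  = inj₂ (sym (cong (λ C → toℕ (first C)) (classOf-none (L x) y∉)))
    result : Inv n parsed
    result = iterN-inv n {λ k → exec readRow (k ∷ [])} Inv step {st (λ _ _ → 0) 1 []} (at (λ i → refl) , refl , start)

  run-parse : out (run (suc m) (cell (encodeListing L)) parse initialState) ≡ [] ×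
    (∀ x y → at2 (tabs (run (suc m) (cell (encodeListing L)) parse initialState)) CLS x y ≡ toℕ (label L x y))
  run-parse = subst (λ s → out s ≡ [] × (∀ x y → at2 (tabs s) CLS x y ≡ toℕ (label L x y)))
    (sym (run-exec n input parse initialState)) parse-sound

-- Correctness of the closure computation

equal-yes : ∀ {k l} → k ≡ l → apply equal k l ≡ 1
equal-yes {k} refl rewrite ≡ᵇ-refl k = refl

equal-no : ∀ {k l} → k ≢ l → apply equal k l ≡ 0
equal-no k≢l rewrite ≢⇒≡ᵇ-false k≢l = refl

abstract
  mu-view : ∀ n g → (∃[ i ] muN n g ≡ toℕ {n} i × g (toℕ i) ≢ 0 × (∀ j → toℕ {n} j < toℕ i → g (toℕ j) ≡ 0)) ⊎
    (muN n g ≡ n × (∀ (j : Fin n) → g (toℕ j) ≡ 0))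
  mu-view n g = [ (λ (i , i< , eq , nz , lt) → inj₁ (fromℕ< i< , trans eq (sym (toℕ-fromℕ< i<)) ,
          (λ z → nz (trans (cong g (sym (toℕ-fromℕ< i<))) z)) , λ j j< → lt (toℕ j) (subst (toℕ j <_) (toℕ-fromℕ< i<) j<)))
    , (λ (eq , z) → inj₂ (eq , λ j → z (toℕ j) (toℕ<n j))) ]′ (go n)
    where
    go : ∀ k → (∃[ i ] i < k × muN k g ≡ i × g i ≢ 0 × (∀ j → j < i → g j ≡ 0)) ⊎ (muN k g ≡ k × (∀ j → j < k → g j ≡ 0))
    go zero = inj₂ (refl , λ _ ())
    go (suc k) with go k
    ... | inj₁ (i , i< , eq , nz , lt) rewrite eq | equal-no (<⇒≢ i<) =
      inj₁ (i , Data.Nat.Properties.m<n⇒m<1+n i< , +-identityʳ i , nz , lt)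
    ... | inj₂ (eq , z) rewrite eq | ≡ᵇ-refl k with g k in gk
    ...   | zero  = inj₂ (+-comm k 1 , λ j j<1+k → [ (λ j<k → z j j<k) , (λ { refl → gk }) ]′
      (Data.Nat.Properties.m≤n⇒m<n∨m≡n (Data.Nat.Properties.m<1+n⇒m≤n j<1+k)))
    ...   | suc _ = inj₁ (k , ≤-refl , +-identityʳ k , (λ e → case trans (sym gk) e of λ ()) , z)

χ : ∀ {n} → Subset n → Fin n → ℕ
χ U x = if does (x ∈? U) then 1 else 0

χ-in : ∀ {n} {U : Subset n} {x} → x ∈ U → χ U x ≡ 1
χ-in {U = U} {x} x∈ rewrite dec-true (x ∈? U) x∈ = refl

χ-out : ∀ {n} {U : Subset n} {x} → x ∉ U → χ U x ≡ 0
χ-out {U = U} {x} x∉ rewrite dec-false (x ∈? U) x∉ = refl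

χ-≢0 : ∀ {n} {U : Subset n} {x} → χ U x ≢ 0 → x ∈ U
χ-≢0 {U = U} {x} nz = decidable-stable (x ∈? U) (λ x∉ → nz (χ-out x∉))

module Closing {m : ℕ} (R : HomogeneousRelation (suc m)) (L : Listing (suc m))
  (lists : Lists R L) (self-complemented : SelfComplemented R) where

  open Umodules R L lists self-complemented

  private
    n = suc m

  input : ℕ → ℕ
  input = cell (encodeListing L)

  open Semantics n input
  open Execution n input
  open Filling n input using (at2; at3)
  open St

  writes-cong : ∀ {T} {A : Set} {idx idx′ val val′ : A → ℕ} {s s′} →
    (∀ a → idx a ≡ idx′ a) → (∀ a → val a ≡ val′ a) → Writes T idx val s s′ → Writes T idx′ val′ s s′
  writes-cong {T} {s′ = s′} ei ev w = record
    { hit = λ a → trans (cong (tabs s′ T) (sym (ei a))) (trans (hit w a) (ev a))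
    ; miss = λ U j h → miss w U j (λ U≡ a eq → h U≡ a (trans (sym (ei a)) eq))
    ; pos-same = pos-same w ; out-same = out-same w }

  private
    cell-injective : ∀ {x x′ y y′ : Fin n} → toℕ x * n + toℕ y ≡ toℕ x′ * n + toℕ y′ → x ≡ x′ × y ≡ y′
    cell-injective {x} {x′} {y} {y′} eq = let p , q = ix-injective {n} {toℕ x} {toℕ x′} (toℕ<n y) (toℕ<n y′) eq in
      toℕ-injective p , toℕ-injective q

    Labels : St → Set
    Labels s = ∀ x y → at2 (tabs s) CLS x y ≡ toℕ (lab x y)

  module Pair (a b : Fin n) where

    private
      ρ : Vec ℕ 2
      ρ = toℕ b ∷ toℕ a ∷ []

    -- `U` is the set under construction and `D` its processed part. Nonzero entries of `SEEN` name
    -- processed representatives of classes; `seen₃` says that rows outside `U` have the same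
    -- representatives as row `zero`, hence induce the same partition of `D`. `count` measures
    -- progress: `D` gains an element in every round until `U` is exhausted.
    record Inv (s₀ : St) (k : ℕ) (s : St) : Set where
      field
        U D    : Subset n
        labels : Labels s
        in-U   : ∀ y → tabs s IN (toℕ y) ≡ χ U y
        done-D : ∀ y → tabs s DONE (toℕ y) ≡ χ D y
        a∈U    : a ∈ U
        b∈U    : b ∈ U
        U⊆M    : U ⊆ M a b
        D⊆U    : D ⊆ U
        0∈U    : zero ∈ U → U ≡ full
        seen₁  : ∀ x {y} → y ∈ D → at2 (tabs s) SEEN x (lab x y) ≢ 0
        seen₂  : ∀ x c {k} → at2 (tabs s) SEEN x c ≡ suc k → ∃[ y ] toℕ y ≡ k × y ∈ D × lab x y ≡ c
        seen₃  : ∀ {x y} → x ∉ U → y ∈ D → at2 (tabs s) SEEN x (lab x y) ≡ at2 (tabs s) SEEN zero (lab zero y)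
        count  : k ≤ ∣ D ∣ ⊎ U ⊆ D
        others : (∀ j → tabs s MT j ≡ tabs s₀ MT j) × out s ≡ out s₀

    -- One round in which the element u is processed.
    module Round {s₀ k s} (I : Inv s₀ k s) (u : Fin n) (u∈U : u ∈ Inv.U I) (u∉D : u ∉ Inv.D I)
      (s₁ : St) (cur : tabs s₁ CUR 0 ≡ toℕ u)
      (same₁ : ∀ T j → T ≢ CUR → tabs s₁ T j ≡ tabs s T j) (out₁ : out s₁ ≡ out s) (t : ℕ) where

      open Inv I

      private
        ρ₃ : Vec ℕ 3
        ρ₃ = t ∷ ρ

        seen : Ex 4
        seen = ix2 (v 3) (tab2 CLS (v 3) (scalar CUR))

        markE addE : Ex 4
        markE = ite (tab SEEN seen) (tab SEEN seen) (bin add (scalar CUR) (num 1))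
        addE = or (tab IN (v 3)) (neg (tab SEEN seen ≐ tab SEEN (tab CLS (scalar CUR))))

        markC addC : Cmd 4
        markC = set SEEN seen markE
        addC = set IN (v 3) addE

        s₂ s₃ s₄ : St
        s₂ = exec (set DONE (scalar CUR) (num 1)) ρ₃ s₁
        s₃ = exec (loop markC) ρ₃ s₂
        s₄ = exec (loop addC) ρ₃ s₃

        old : Fin n → ℕ
        old x = at2 (tabs s) SEEN x (lab x u)

        new : Fin n → ℕ
        new x = branch (old x) (old x) (suc (toℕ u))

        w₂ : Writes DONE {⊤} (λ _ → toℕ u) (λ _ → 1) s₁ s₂
        w₂ = writes-cong (λ _ → cur) (λ _ → refl) (set-writes DONE (scalar CUR) (num 1) ρ₃ s₁)

        same₂ : ∀ T j → T ≢ CUR → T ≢ DONE → tabs s₂ T j ≡ tabs s T j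
        same₂ T j T≢ T≢′ = trans (miss w₂ T j (λ eq → contradiction eq T≢′)) (same₁ T j T≢)

        cur₂ : tabs s₂ CUR 0 ≡ toℕ u
        cur₂ = trans (miss w₂ CUR 0 λ ()) cur

        w₃ : Writes SEEN {Fin n × ⊤} (λ (x , _) → toℕ x * n + toℕ (lab x u)) (λ (x , _) → new x) s₂ s₃
        w₃ = loop-writes {idx = λ x _ → toℕ x * n + toℕ (lab x u)} {val = λ x _ → new x} {f = λ i → exec markC (i ∷ ρ₃)}
          (λ eq → proj₁ (cell-injective eq)) body
          where
          body : ∀ x s → Partial SEEN (λ x _ → toℕ x * n + toℕ (lab x u)) (toℕ x) s₂ s →
            Writes SEEN {⊤} (λ _ → toℕ x * n + toℕ (lab x u)) (λ _ → new x) s (exec markC (toℕ x ∷ ρ₃) s)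
          body x s′ (same , _) = writes-cong (λ _ → ix≡)
            (λ _ → cong₂ (λ p q → branch p p q) old≡ (trans (cong (_+ 1) cur≡) (+-comm _ 1)))
            (set-writes SEEN seen markE (toℕ x ∷ ρ₃) s′)
            where
            cur≡ : tabs s′ CUR 0 ≡ toℕ u
            cur≡ = trans (same CUR 0 λ ()) cur₂
            ix≡ : toℕ x * n + tabs s′ CLS (toℕ x * n + tabs s′ CUR 0) ≡ toℕ x * n + toℕ (lab x u)
            ix≡ = cong (toℕ x * n +_) (trans (cong (λ c → tabs s′ CLS (toℕ x * n + c)) cur≡)
              (trans (same CLS _ λ ()) (trans (same₂ CLS _ (λ ()) λ ()) (labels x u))))
            old≡ : tabs s′ SEEN (toℕ x * n + tabs s′ CLS (toℕ x * n + tabs s′ CUR 0)) ≡ old x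
            old≡ = trans (cong (tabs s′ SEEN) ix≡) (trans
              (same SEEN _ (λ _ i _ i< eq → <-irrefl (cong toℕ (proj₁ (cell-injective {i} {x} eq))) i<))
              (same₂ SEEN _ (λ ()) λ ()))

        same₃ : ∀ T j → T ≢ CUR → T ≢ DONE → T ≢ SEEN → tabs s₃ T j ≡ tabs s T j
        same₃ T j p q r = trans (miss w₃ T j (λ eq → contradiction eq r)) (same₂ T j p q)

        cur₃ : tabs s₃ CUR 0 ≡ toℕ u
        cur₃ = trans (miss w₃ CUR 0 λ ()) cur₂

        added : Fin n → ℕ
        added x = branch (χ U x) 1 (apply equal (apply equal (new x) (new zero)) 0)

        w₄ : Writes IN {Fin n × ⊤} (λ (x , _) → toℕ x) (λ (x , _) → added x) s₃ s₄
        w₄ = loop-writes {idx = λ x _ → toℕ x} {val = λ x _ → added x} {f = λ i → exec addC (i ∷ ρ₃)} toℕ-injective body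
          where
          body : ∀ x s → Partial IN (λ x _ → toℕ x) (toℕ x) s₃ s →
            Writes IN {⊤} (λ _ → toℕ x) (λ _ → added x) s (exec addC (toℕ x ∷ ρ₃) s)
          body x s′ (same , _) = writes-cong (λ _ → refl)
            (λ _ → cong₂ (λ p q → branch p 1 (apply equal q 0))
              (trans (same IN _ (λ _ i _ i< eq → <-irrefl eq i<)) (trans (same₃ IN _ (λ ()) (λ ()) λ ()) (in-U x)))
              (cong₂ (apply equal)
                (trans (cong (λ c → tabs s′ SEEN (toℕ x * n + c)) (label≡ x)) (trans (same SEEN _ λ ()) (hit w₃ (x , tt))))
                (trans (cong (tabs s′ SEEN) (label≡ zero)) (trans (same SEEN _ λ ()) (hit w₃ (zero , tt))))))
            (set-writes IN (v 3) addE (toℕ x ∷ ρ₃) s′)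
            where
            label≡ : ∀ x → tabs s′ CLS (toℕ x * n + tabs s′ CUR 0) ≡ toℕ (lab x u)
            label≡ x = trans (cong (λ c → tabs s′ CLS (toℕ x * n + c)) (trans (same CUR 0 λ ()) cur₃))
              (trans (same CLS _ λ ()) (trans (same₃ CLS _ (λ ()) (λ ()) λ ()) (labels x u)))

        after : Fin n → Fin n → ℕ
        after x c = at2 (tabs s₄) SEEN x c

        after-new : ∀ x → after x (lab x u) ≡ new x
        after-new x = trans (miss w₄ SEEN _ λ ()) (hit w₃ (x , tt))

        after-other : ∀ {x c} → c ≢ lab x u → after x c ≡ at2 (tabs s) SEEN x c
        after-other {x} {c} c≢ = trans (miss w₄ SEEN _ λ ()) (trans
          (miss w₃ SEEN _ λ { _ (x′ , _) eq → case cell-injective {x′} {x} eq of λ { (refl , eq′) → c≢ (sym eq′) } })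
          (same₂ SEEN _ (λ ()) λ ()))

        new-keep : ∀ x → old x ≢ 0 → new x ≡ old x
        new-keep x nz with old x
        ... | zero  = contradiction refl nz
        ... | suc _ = refl

        new-≢0 : ∀ x → new x ≢ 0
        new-≢0 x with old x
        ... | zero  = λ ()
        ... | suc _ = λ ()

        after-keep : ∀ x c → at2 (tabs s) SEEN x c ≢ 0 → after x c ≡ at2 (tabs s) SEEN x c
        after-keep x c nz with c Finₚ.≟ lab x u
        ... | yes refl = trans (after-new x) (new-keep x nz)
        ... | no c≢    = after-other c≢

        U′? : ∀ x → Dec (x ∈ U ⊎ new x ≢ new zero)
        U′? x = (x ∈? U) ⊎-dec ¬? (new x Data.Nat.≟ new zero)

        U′ D′ : Subset n
        U′ = subset U′?
        D′ = D ∪ ⁅ u ⁆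

        D′⁻ : ∀ {y} → y ∈ D′ → y ∈ D ⊎ y ≡ u
        D′⁻ y∈ = [ inj₁ , (λ y∈u → inj₂ (x∈⁅y⁆⇒x≡y u y∈u)) ]′ (x∈p∪q⁻ D ⁅ u ⁆ y∈)

        added-χ : ∀ x → added x ≡ χ U′ x
        added-χ x with x ∈? U | new x Data.Nat.≟ new zero
        ... | yes x∈ | _ = sym (χ-in (∈-subset⁺ U′? (inj₁ x∈)))
        ... | no x∉ | yes eq rewrite equal-yes eq = sym (χ-out (λ x∈ → [ x∉ , (λ ≢ → ≢ eq) ]′ (∈-subset⁻ U′? x∈)))
        ... | no x∉ | no ≢ rewrite equal-no ≢ = sym (χ-in (∈-subset⁺ U′? (inj₂ ≢)))

        -- Row `x` and row `zero` agree on `M a b`, so the class of `u` has the same earlier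
        -- representative in both rows, or none in either. Hence the closure adds no point outside
        -- `M a b`.
        new-M : ∀ {x} → x ∉ M a b → new x ≡ new zero
        new-M {x} x∉ with F⁻ (M-F a b)
        ... | inj₁ eq = contradiction (subst (x ∈_) (sym eq) ∈⊤) x∉
        ... | inj₂ (_ , _ , agree) = cases (old x) refl (old zero) refl
          where
          x∉U : x ∉ U
          x∉U x∈ = x∉ (U⊆M x∈)
          ag : ∀ {y} → y ∈ D → (lab x y ≡ lab x u → lab zero y ≡ lab zero u) × (lab zero y ≡ lab zero u → lab x y ≡ lab x u)
          ag y∈ = agree x x∉ _ (U⊆M (D⊆U y∈)) u (U⊆M u∈U)
          cases : ∀ p → old x ≡ p → ∀ q → old zero ≡ q → new x ≡ new zero
          cases zero eq zero eq′ rewrite eq | eq′ = refl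
          cases (suc p) eq q eq′ with seen₂ x (lab x u) eq
          ... | y , _ , y∈ , l≡ = trans (new-keep x (λ z → case trans (sym eq) z of λ ()))
            (trans (sym old≡) (sym (new-keep zero (λ z → case trans (sym eq) (trans (sym old≡) z) of λ ()))))
            where
            old≡ : old zero ≡ old x
            old≡ = trans (cong (at2 (tabs s) SEEN zero) (sym (proj₁ (ag y∈) l≡)))
              (trans (sym (seen₃ x∉U y∈)) (cong (at2 (tabs s) SEEN x) l≡))
          cases zero eq (suc q) eq′ with seen₂ zero (lab zero u) eq′
          ... | y , _ , y∈ , l≡ = contradiction (trans (cong (at2 (tabs s) SEEN x) (proj₂ (ag y∈) l≡)) eq) (seen₁ x y∈)

      result : Inv s₀ (suc k) (exec process ρ₃ s₁)
      result = record
        { U = U′ ; D = D′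
        ; labels = λ x y → trans (miss w₄ CLS _ λ ()) (trans (same₃ CLS _ (λ ()) (λ ()) λ ()) (labels x y))
        ; in-U = λ y → trans (hit w₄ (y , tt)) (added-χ y)
        ; done-D = done′
        ; a∈U = ∈-subset⁺ U′? (inj₁ a∈U)
        ; b∈U = ∈-subset⁺ U′? (inj₁ b∈U)
        ; U⊆M = λ {x} x∈ → [ U⊆M , (λ ≢ → decidable-stable (x ∈? M a b) (λ x∉ → ≢ (new-M x∉))) ]′ (∈-subset⁻ U′? x∈)
        ; D⊆U = λ y∈ → ∈-subset⁺ U′? (inj₁ ([ D⊆U , (λ { refl → u∈U }) ]′ (D′⁻ y∈)))
        ; 0∈U = λ 0∈ → ⊆-antisym (λ _ → ∈⊤) (λ {x} _ → ∈-subset⁺ U′? (inj₁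
            (subst (x ∈_) (sym (0∈U ([ id , (λ ≢ → contradiction refl ≢) ]′ (∈-subset⁻ U′? 0∈)))) ∈⊤)))
        ; seen₁ = λ x y∈ → [ (λ y∈D z → seen₁ x y∈D (trans (sym (after-keep x _ (seen₁ x y∈D))) z))
                           , (λ { refl z → new-≢0 x (trans (sym (after-new x)) z) }) ]′ (D′⁻ y∈)
        ; seen₂ = seen₂′
        ; seen₃ = seen₃′
        ; count = inj₁ ([ (λ k≤ → ≤-trans (s≤s k≤) (p⊂q⇒∣p∣<∣q∣
              ((λ y∈ → x∈p∪q⁺ (inj₁ y∈)) , u , x∈p∪q⁺ (inj₂ (x∈⁅x⁆ u)) , u∉D)))
            , (λ U⊆D → contradiction (U⊆D u∈U) u∉D) ]′ count)
        ; others = (λ j → trans (miss w₄ MT j λ ()) (trans (same₃ MT j (λ ()) (λ ()) λ ()) (proj₁ others j))) ,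
            trans (out-same w₄) (trans (out-same w₃) (trans (out-same w₂) (trans out₁ (proj₂ others))))
        }
        where
        done′ : ∀ y → tabs s₄ DONE (toℕ y) ≡ χ D′ y
        done′ y with y Finₚ.≟ u
        ... | yes refl = trans (miss w₄ DONE _ λ ()) (trans (miss w₃ DONE _ λ ()) (trans (hit w₂ tt)
          (sym (χ-in {U = D′} {y} (x∈p∪q⁺ (inj₂ (x∈⁅x⁆ u)))))))
        ... | no y≢ = trans (miss w₄ DONE _ λ ()) (trans (miss w₃ DONE _ λ ())
          (trans (miss w₂ DONE _ (λ _ _ eq → y≢ (sym (toℕ-injective eq))))
          (trans (same₁ DONE _ λ ()) (trans (done-D y) (χ≡ (y ∈? D))))))
          where
          χ≡ : Dec (y ∈ D) → χ D y ≡ χ D′ y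
          χ≡ (yes y∈) = trans (χ-in y∈) (sym (χ-in (x∈p∪q⁺ (inj₁ y∈))))
          χ≡ (no y∉)  = trans (χ-out y∉) (sym (χ-out (λ y∈ → [ y∉ , y≢ ]′ (D′⁻ y∈))))
        seen₂′ : ∀ x c {k} → after x c ≡ suc k → ∃[ y ] toℕ y ≡ k × y ∈ D′ × lab x y ≡ c
        seen₂′ x c eq with c Finₚ.≟ lab x u
        ... | no c≢ = let y , y≡ , y∈ , l≡ = seen₂ x c (trans (sym (after-other c≢)) eq) in
          y , y≡ , x∈p∪q⁺ (inj₁ y∈) , l≡
        ... | yes refl = cases (old x) refl
          where
          cases : ∀ p → old x ≡ p → ∃[ y ] toℕ y ≡ _ × y ∈ D′ × lab x y ≡ lab x u
          cases zero e = u , Data.Nat.Properties.suc-injective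
            (trans (sym (cong (λ p → branch p p (suc (toℕ u))) e)) (trans (sym (after-new x)) eq)) ,
            x∈p∪q⁺ (inj₂ (x∈⁅x⁆ u)) , refl
          cases (suc p) e = let y , y≡ , y∈ , l≡ = seen₂ x (lab x u)
                                  (trans (sym (new-keep x (λ z → case trans (sym e) z of λ ()))) (trans (sym (after-new x)) eq))
            in y , y≡ , x∈p∪q⁺ (inj₁ y∈) , l≡
        seen₃′ : ∀ {x y} → x ∉ U′ → y ∈ D′ → after x (lab x y) ≡ after zero (lab zero y)
        seen₃′ {x} {y} x∉ y∈ = [ (λ y∈D → trans (after-keep x _ (seen₁ x y∈D)) (trans
              (seen₃ (λ x∈ → x∉ (∈-subset⁺ U′? (inj₁ x∈))) y∈D) (sym (after-keep zero _ (seen₁ zero y∈D)))))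
          , (λ { refl → trans (after-new x) (trans
              (decidable-stable (new x Data.Nat.≟ new zero) (λ ≢ → x∉ (∈-subset⁺ U′? (inj₂ ≢)))) (sym (after-new zero))) }) ]′
          (D′⁻ y∈)

    round : Cmd 3
    round = choose ⟫ when (scalar CUR ≺ size) process

    round-sound : ∀ {s₀} t k s → Inv s₀ k s → Inv s₀ (suc k) (exec round (t ∷ ρ) s)
    round-sound {s₀} t k s I = go (mu-view n undone)
      where
      open Inv I
      undone : ℕ → ℕ
      undone i = branch (tabs s IN i) (apply equal (tabs s DONE i) 0) 0
      s₁ : St
      s₁ = exec choose (t ∷ ρ) s
      w : Writes CUR {⊤} (λ _ → 0) (λ _ → muN n undone) s s₁
      w = set-writes CUR (num 0) (mu (and (tab IN (v 3)) (neg (tab DONE (v 3))))) (t ∷ ρ) s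
      same : ∀ T j → T ≢ CUR → tabs s₁ T j ≡ tabs s T j
      same T j T≢ = miss w T j (λ eq → contradiction eq T≢)
      undone-in : ∀ u → undone (toℕ u) ≢ 0 → u ∈ U × u ∉ D
      undone-in u nz rewrite in-U u | done-D u with u ∈? U | u ∈? D
      ... | yes u∈ | no u∉ = u∈ , u∉
      ... | yes _  | yes _ = contradiction refl nz
      ... | no _   | _     = contradiction refl nz
      undone-out : (∀ u → undone (toℕ u) ≡ 0) → U ⊆ D
      undone-out z {u} u∈ with z u
      ... | zu rewrite in-U u | done-D u | χ-in u∈ with u ∈? D
      ...   | yes u∈D = u∈D
      ...   | no _    = case zu of λ ()
      go : (∃[ u ] muN n undone ≡ toℕ u × undone (toℕ u) ≢ 0 × _) ⊎ (muN n undone ≡ n × (∀ (u : Fin n) → undone (toℕ u) ≡ 0)) →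
        Inv s₀ (suc k) (exec round (t ∷ ρ) s)
      go (inj₁ (u , eq , nz , _)) = subst (λ c → Inv s₀ (suc k) (branch c (exec process (t ∷ ρ) s₁) s₁))
        (sym (trans (cong (λ c → apply less c n) (trans (hit w tt) eq)) (less-true (toℕ<n u))))
        (Round.result I u (proj₁ (undone-in u nz)) (proj₂ (undone-in u nz)) s₁ (trans (hit w tt) eq) same (out-same w) t)
      go (inj₂ (eq , z)) = subst (λ c → Inv s₀ (suc k) (branch c (exec process (t ∷ ρ) s₁) s₁))
        (sym (trans (cong (λ c → apply less c n) (trans (hit w tt) eq)) (less-irrefl n)))
        (record
          { U = U ; D = D
          ; labels = λ x y → trans (same CLS _ λ ()) (labels x y)
          ; in-U = λ y → trans (same IN _ λ ()) (in-U y)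
          ; done-D = λ y → trans (same DONE _ λ ()) (done-D y)
          ; a∈U = a∈U ; b∈U = b∈U ; U⊆M = U⊆M ; D⊆U = D⊆U ; 0∈U = 0∈U
          ; seen₁ = λ x y∈ e → seen₁ x y∈ (trans (sym (same SEEN _ λ ())) e)
          ; seen₂ = λ x c e → seen₂ x c (trans (sym (same SEEN _ λ ())) e)
          ; seen₃ = λ x∉ y∈ → trans (same SEEN _ λ ()) (trans (seen₃ x∉ y∈) (sym (same SEEN _ λ ())))
          ; count = inj₂ (undone-out z)
          ; others = (λ j → trans (same MT j λ ()) (proj₁ others j)) , trans (out-same w) (proj₂ others)
          })

    clear-sound : ∀ s → Labels s → Inv s 0 (exec clear ρ s)
    clear-sound s labs = record
      { U = U ; D = ∅
      ; labels = λ x y → trans (miss w₃ CLS _ λ ()) (trans (miss w₂ CLS _ λ ()) (trans (miss w₁ CLS _ λ ()) (labs x y)))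
      ; in-U = λ y → trans (miss w₃ IN _ λ ()) (trans (miss w₂ IN _ λ ()) (trans (hit w₁ (y , tt)) (start-χ y)))
      ; done-D = λ y → trans (miss w₃ DONE _ λ ()) (trans (hit w₂ (y , tt)) (sym (χ-out {U = ∅} {y} ∉⊥)))
      ; a∈U = ∈-subset⁺ start? (inj₂ (inj₁ refl)) ; b∈U = ∈-subset⁺ start? (inj₂ (inj₂ refl))
      ; U⊆M = λ x∈ → start-M (∈-subset⁻ start? x∈)
      ; D⊆U = λ y∈ → contradiction y∈ ∉⊥
      ; 0∈U = λ 0∈ → ⊆-antisym (λ _ → ∈⊤) (λ _ → ∈-subset⁺ start? (inj₁ (start-zero (∈-subset⁻ start? 0∈))))
      ; seen₁ = λ _ y∈ → contradiction y∈ ∉⊥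
      ; seen₂ = λ x c e → case trans (sym e) (hit w₃ (x , c , tt)) of λ ()
      ; seen₃ = λ _ y∈ → contradiction y∈ ∉⊥
      ; count = inj₁ z≤n
      ; others = (λ j → trans (miss w₃ MT j λ ()) (trans (miss w₂ MT j λ ()) (miss w₁ MT j λ ()))) ,
          trans (out-same w₃) (trans (out-same w₂) (out-same w₁))
      }
      where
      inE : Ex 3
      inE = or (or (v 0 ≐ num 0) (v 1 ≐ num 0)) (or (v 2 ≐ v 0) (v 2 ≐ v 1))
      inC doneC : Cmd 3
      inC = set IN (v 2) inE
      doneC = set DONE (v 2) (num 0)
      s₁ s₂ : St
      s₁ = exec (loop inC) ρ s
      s₂ = exec (loop doneC) ρ s₁
      start : ℕ → ℕ
      start x = branch (branch (apply equal (toℕ a) 0) 1 (apply equal (toℕ b) 0)) 1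
        (branch (apply equal x (toℕ a)) 1 (apply equal x (toℕ b)))
      w₁ : Writes IN {Fin n × ⊤} (λ (x , _) → toℕ x) (λ (x , _) → start (toℕ x)) s s₁
      w₁ = writes (loop-fills (set-fills IN (v 2) inE (λ { (_ ∷ _ ∷ _ ∷ []) _ _ → refl }) tt)
        (λ { (_ ∷ _ ∷ []) eq → toℕ-injective eq })) ρ s
      w₂ : Writes DONE {Fin n × ⊤} (λ (x , _) → toℕ x) (λ _ → 0) s₁ s₂
      w₂ = writes (loop-fills (set-fills DONE (v 2) (num 0) (λ { (_ ∷ _ ∷ _ ∷ []) _ _ → refl }) tt)
        (λ { (_ ∷ _ ∷ []) eq → toℕ-injective eq })) ρ s₁
      w₃ : Writes SEEN {Fin n × Fin n × ⊤} (λ (x , c , _) → toℕ x * n + toℕ c) (λ _ → 0) s₂ (exec clear ρ s)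
      w₃ = writes (loop-fills (loop-fills (set-fills SEEN (ix2 (v 2) (v 3)) (num 0) (λ { (_ ∷ _ ∷ _ ∷ _ ∷ []) _ _ → refl }) tt)
        (λ { (x ∷ _ ∷ _ ∷ []) {c} {c′} eq → toℕ-injective (proj₂ (ix-injective {n} {x} {x} (toℕ<n c) (toℕ<n c′) eq)) }))
        (λ { (_ ∷ _ ∷ []) {x} {x′} {c , _} {c′ , _} eq → proj₁ (cell-injective {x} {x′} {c} {c′} eq) })) ρ s₂
      Start : Fin n → Set
      Start x = (a ≡ zero ⊎ b ≡ zero) ⊎ (x ≡ a ⊎ x ≡ b)
      start? : ∀ x → Dec (Start x)
      start? x = ((a Finₚ.≟ zero) ⊎-dec (b Finₚ.≟ zero)) ⊎-dec ((x Finₚ.≟ a) ⊎-dec (x Finₚ.≟ b))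
      U : Subset n
      U = subset start?
      indicator : ∀ {A : Set} → Dec A → ℕ
      indicator A? = if does A? then 1 else 0
      equal-fin : ∀ (x y : Fin n) → apply equal (toℕ x) (toℕ y) ≡ indicator (x Finₚ.≟ y)
      equal-fin x y with x Finₚ.≟ y
      ... | yes refl = equal-yes {toℕ x} refl
      ... | no x≢    = equal-no (λ eq → x≢ (toℕ-injective eq))
      decide : ∀ x (p : Dec (a ≡ zero)) (q : Dec (b ≡ zero)) (r : Dec (x ≡ a)) (t : Dec (x ≡ b)) →
        branch (branch (indicator p) 1 (indicator q)) 1 (branch (indicator r) 1 (indicator t)) ≡ χ U x
      decide x (yes p) _       _       _       = sym (χ-in {U = U} {x} (∈-subset⁺ start? (inj₁ (inj₁ p))))
      decide x (no _)  (yes q) _       _       = sym (χ-in {U = U} {x} (∈-subset⁺ start? (inj₁ (inj₂ q))))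
      decide x (no _)  (no _)  (yes r) _       = sym (χ-in {U = U} {x} (∈-subset⁺ start? (inj₂ (inj₁ r))))
      decide x (no _)  (no _)  (no _)  (yes t) = sym (χ-in {U = U} {x} (∈-subset⁺ start? (inj₂ (inj₂ t))))
      decide x (no p)  (no q)  (no r)  (no t)  =
        sym (χ-out {U = U} {x} (λ x∈ → [ [ p , q ]′ , [ r , t ]′ ]′ (∈-subset⁻ start? x∈)))
      start-χ : ∀ x → start (toℕ x) ≡ χ U x
      start-χ x = trans
        (cong₂ (λ p q → branch p 1 q)
          (cong₂ (λ p q → branch p 1 q) (equal-fin a zero) (equal-fin b zero))
          (cong₂ (λ p q → branch p 1 q) (equal-fin x a) (equal-fin x b)))
        (decide x (a Finₚ.≟ zero) (b Finₚ.≟ zero) (x Finₚ.≟ a) (x Finₚ.≟ b))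
      start-M : ∀ {x} → Start x → x ∈ M a b
      start-M (inj₁ (inj₁ refl)) = subst (_ ∈_) (sym (F-zero (M-F a b) (a∈M a b))) ∈⊤
      start-M (inj₁ (inj₂ refl)) = subst (_ ∈_) (sym (F-zero (M-F a b) (b∈M a b))) ∈⊤
      start-M (inj₂ (inj₁ refl)) = a∈M a b
      start-M (inj₂ (inj₂ refl)) = b∈M a b
      start-zero : Start zero → a ≡ zero ⊎ b ≡ zero
      start-zero (inj₁ p)        = p
      start-zero (inj₂ (inj₁ p)) = inj₁ (sym p)
      start-zero (inj₂ (inj₂ p)) = inj₂ (sym p)

    -- After `n` rounds all of `U` is processed, and `seen₃` becomes the row condition in `F`. So
    -- `U` is a member through `a` and `b`, and minimality of `M a b` gives the missing inclusion.
    closed : ∀ {s₀ s} (I : Inv s₀ n s) → Inv.U I ≡ M a b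
    closed {s = s} I = ⊆-antisym U⊆M (M-min U-F a∈U b∈U)
      where
      open Inv I
      U⊆D : U ⊆ D
      U⊆D {y} with count
      ... | inj₁ n≤ = λ _ → subst (y ∈_) (sym (∣p∣≡n⇒p≡⊤ (≤-antisym (∣p∣≤n D) n≤))) ∈⊤
      ... | inj₂ U⊆ = U⊆
      -- The common value of SEEN at two labels names an element with both.
      merge : ∀ x {y z} → y ∈ D → at2 (tabs s) SEEN x (lab x y) ≡ at2 (tabs s) SEEN x (lab x z) → lab x y ≡ lab x z
      merge x {y} {z} y∈ eq = go (at2 (tabs s) SEEN x (lab x y)) refl
        where
        go : ∀ p → at2 (tabs s) SEEN x (lab x y) ≡ p → lab x y ≡ lab x z
        go zero    e = contradiction e (seen₁ x y∈)
        go (suc p) e with seen₂ x (lab x y) e | seen₂ x (lab x z) (trans (sym eq) e)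
        ... | w , w≡ , _ , l≡ | w′ , w′≡ , _ , l′≡ with toℕ-injective (trans w≡ (sym w′≡))
        ...   | refl = trans (sym l≡) l′≡
      U-F : F U
      U-F with zero ∈? U
      ... | yes 0∈ = subst F (sym (0∈U 0∈)) F-full
      ... | no 0∉  = F⁺ (inj₂ (0∉ , (a , a∈U) , λ x x∉ y y∈ z z∈ →
        (λ eq → merge zero (U⊆D y∈) (trans (sym (seen₃ x∉ (U⊆D y∈)))
          (trans (cong (at2 (tabs s) SEEN x) eq) (seen₃ x∉ (U⊆D z∈))))) ,
        (λ eq → merge x (U⊆D y∈) (trans (seen₃ x∉ (U⊆D y∈))
          (trans (cong (at2 (tabs s) SEEN zero) eq) (sym (seen₃ x∉ (U⊆D z∈))))))))

    closure-sound : ∀ s → Labels s → Labels (exec closure ρ s) × out (exec closure ρ s) ≡ out s ×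
      (∀ x → at3 (tabs (exec closure ρ s)) MT a b x ≡ χ (M a b) x) ×
      (∀ j → (∀ x → (toℕ a * n + toℕ b) * n + toℕ {n} x ≢ j) → tabs (exec closure ρ s) MT j ≡ tabs s MT j)
    closure-sound s labs = finish (iterN-inv n {λ t → exec round (t ∷ ρ)} (Inv s)
      (λ t s′ → round-sound (toℕ t) (toℕ t) s′) {exec clear ρ s} (clear-sound s labs))
      where
      s₁ : St
      s₁ = exec (loop round) ρ (exec clear ρ s)
      w : Writes MT {Fin n × ⊤} (λ (x , _) → (toℕ a * n + toℕ b) * n + toℕ x) (λ (x , _) → branch (tabs s₁ IN (toℕ x)) 1 0) s₁
        (exec closure ρ s)
      w = writes (loop-fills (set-fills MT (ix3 (v 0) (v 1) (v 2)) (ite (tab IN (v 2)) (num 1) (num 0))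
          (λ { (_ ∷ _ ∷ _ ∷ []) _ _ → refl }) tt)
        (λ { (b ∷ a ∷ []) {x} {x′} eq →
          toℕ-injective (proj₂ (ix-injective {n} {a * n + b} {a * n + b} (toℕ<n x) (toℕ<n x′) eq)) })) ρ s₁
      finish : Inv s n s₁ → _
      finish I = (λ x y → trans (miss w CLS _ λ ()) (Inv.labels I x y)) , trans (out-same w) (proj₂ (Inv.others I)) ,
        (λ x → trans (hit w (x , tt)) (trans (cong (λ c → branch c 1 0) (Inv.in-U I x))
          (trans (branch-χ (x ∈? Inv.U I)) (cong (λ V → χ V x) (closed I))))) ,
        (λ j h → trans (miss w MT j (λ _ (x , _) → h x)) (proj₁ (Inv.others I) j))
        where
        branch-χ : ∀ {x} → Dec (x ∈ Inv.U I) → branch (χ (Inv.U I) x) 1 0 ≡ χ (Inv.U I) x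
        branch-χ (yes x∈) rewrite χ-in x∈ = refl
        branch-χ (no x∉)  rewrite χ-out x∉ = refl

  private
    Correct : St → Fin n → Fin n → Set
    Correct s a b = ∀ x → at3 (tabs s) MT a b x ≡ χ (M a b) x

    -- The state after a command is generalised to a variable s′, because
    -- case analysis would otherwise normalise it.
    Away : Fin n → Fin n → St → St → Set
    Away a b s s′ = ∀ j → (∀ x → (toℕ a * n + toℕ b) * n + toℕ {n} x ≢ j) → tabs s′ MT j ≡ tabs s MT j

    preserve : ∀ {a b s s′} → Correct s′ a b → Away a b s s′ → ∀ a′ b′ → Correct s a′ b′ → Correct s′ a′ b′
    preserve {a} {b} now away a′ b′ cor with a Finₚ.≟ a′ | b Finₚ.≟ b′
    ... | yes refl | yes refl = now
    ... | no a≢    | _ = λ x → trans (away _ λ x′ eq →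
      a≢ (proj₁ (cell-injective {a} {a′} {b} {b′} (proj₁ (ix-injective {n} (toℕ<n x′) (toℕ<n x) eq))))) (cor x)
    ... | yes refl | no b≢ = λ x → trans (away _ λ x′ eq →
      b≢ (proj₂ (cell-injective {a} {a} {b} {b′} (proj₁ (ix-injective {n} (toℕ<n x′) (toℕ<n x) eq))))) (cor x)

    RowInv : St → Fin n → ℕ → St → Set
    RowInv s₀ a k s = Labels s × out s ≡ out s₀ × (∀ b → toℕ b < k → Correct s a b) ×
      (∀ a′ b′ → Correct s₀ a′ b′ → Correct s a′ b′)

    row-extend : ∀ {s₀ a b s s′} → RowInv s₀ a (toℕ b) s →
      Labels s′ × out s′ ≡ out s × Correct s′ a b × Away a b s s′ → RowInv s₀ a (suc (toℕ b)) s′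
    row-extend {s₀} {a} {b} {s} {s′} (labs , o , done , keep) (labs′ , o′ , now , away) =
      labs′ , trans o′ o , done′ , λ a′ b′ cor → keep′ a′ b′ (keep a′ b′ cor)
      where
      keep′ : ∀ a′ b′ → Correct s a′ b′ → Correct s′ a′ b′
      keep′ = preserve {a} {b} {s} {s′} now away
      done′ : ∀ b′ → toℕ b′ < suc (toℕ b) → Correct s′ a b′
      done′ b′ (s≤s b′≤) with b′ Finₚ.≟ b
      ... | yes refl = now
      ... | no b′≢   = keep′ a b′ (done b′ (Finₚ.≤∧≢⇒< b′≤ b′≢))

    TableInv : St → ℕ → St → Set
    TableInv s₀ k s = Labels s × out s ≡ out s₀ × (∀ a b → toℕ a < k → Correct s a b)

    table-extend : ∀ {s₀ a s s′} → TableInv s₀ (toℕ a) s → RowInv s a n s′ → TableInv s₀ (suc (toℕ a)) s′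
    table-extend {s₀} {a} {s} {s′} (labs , o , done) (labs′ , o′ , row , keep) = labs′ , trans o′ o , done′
      where
      done′ : ∀ a′ b → toℕ a′ < suc (toℕ a) → Correct s′ a′ b
      done′ a′ b (s≤s a′≤) with a′ Finₚ.≟ a
      ... | yes refl = row b (toℕ<n b)
      ... | no a′≢   = keep a′ b (done a′ b (Finₚ.≤∧≢⇒< a′≤ a′≢))

    table-step : ∀ s₀ a s → TableInv s₀ (toℕ a) s → TableInv s₀ (suc (toℕ a)) (exec (loop closure) (toℕ a ∷ []) s)
    table-step s₀ a s I = table-extend {s₀} {a} {s} {exec (loop closure) (toℕ a ∷ []) s} I (iterN-inv n {λ b → exec closure (b ∷ toℕ a ∷ [])} (RowInv s a)
      (λ b s′ J → row-extend {s} {a} {b} {s′} {exec closure (toℕ b ∷ toℕ a ∷ []) s′} J (Pair.closure-sound a b s′ (proj₁ J)))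
      {s} (proj₁ I , refl , (λ _ ()) , λ _ _ cor → cor))

  closures-sound : ∀ s → Labels s → out (exec closures [] s) ≡ out s ×
    (∀ a b x → at3 (tabs (exec closures [] s)) MT a b x ≡ χ (M a b) x)
  closures-sound s labs = finish {exec closures [] s} (iterN-inv n {λ a → exec (loop closure) (a ∷ [])} (TableInv s)
    (table-step s) {s} (labs , refl , λ _ _ ()))
    where
    finish : ∀ {s′} → TableInv s n s′ → out s′ ≡ out s × (∀ a b x → at3 (tabs s′) MT a b x ≡ χ (M a b) x)
    finish (_ , o , cor) = o , λ a b → cor a b (toℕ<n a)

  run-closures : ∀ s → Labels s → out (run (suc m) (cell (encodeListing L)) closures s) ≡ out s ×
    (∀ a b x → at3 (tabs (run (suc m) (cell (encodeListing L)) closures s)) MT a b x ≡ χ (M a b) x)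
  run-closures s labs = subst (λ s′ → out s′ ≡ out s × (∀ a b x → at3 (tabs s′) MT a b x ≡ χ (M a b) x))
    (sym (run-exec n input closures s)) (closures-sound s labs)

-- k is a truth value for P.
record Tr (k : ℕ) (P : Set) : Set where
  constructor tr
  field
    sound    : k ≢ 0 → P
    holds : P → k ≢ 0
open Tr public

tr-≡ : ∀ {k l P} → k ≡ l → Tr l P → Tr k P
tr-≡ refl t = t

tr-map : ∀ {k P Q} → (P → Q) → (Q → P) → Tr k P → Tr k Q
tr-map f g t = tr (λ nz → f (sound t nz)) (λ q → holds t (g q))

tr-zero : ∀ {k P} → Tr k P → ¬ P → k ≡ 0
tr-zero {zero}  t ¬p = refl
tr-zero {suc k} t ¬p = contradiction (sound t λ ()) ¬p

tr-neg : ∀ {k P} → Tr k P → Tr (apply equal k 0) (¬ P)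
tr-neg {zero}  t = tr (λ _ p → holds t p refl) (λ _ ())
tr-neg {suc k} t = tr (λ nz → contradiction refl nz) (λ ¬p → contradiction (sound t λ ()) ¬p)

-- The second test may rely on the success of the first, as a table lookup does that is guarded by a
-- range check.
tr-and : ∀ {k l P Q} → Tr k P → (P → Tr l Q) → Tr (branch k l 0) (P × Q)
tr-and {zero}  t u = tr (λ nz → contradiction refl nz) (λ (p , _) → holds t p)
tr-and {suc k} t u = tr (λ nz → sound t (λ ()) , sound (u (sound t λ ())) nz) (λ (p , q) → holds (u p) q)

tr-or : ∀ {k l P Q} → Tr k P → Tr l Q → Tr (branch k 1 l) (P ⊎ Q)
tr-or {zero}  t u = tr (λ nz → inj₂ (sound u nz)) [ (λ p → contradiction refl (holds t p)) , holds u ]′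
tr-or {suc k} t u = tr (λ _ → inj₁ (sound t λ ())) (λ _ ())

tr-eq : ∀ k l → Tr (apply equal k l) (k ≡ l)
tr-eq k l with k Data.Nat.≟ l
... | yes refl rewrite equal-yes {k} refl = tr (λ _ → refl) (λ _ ())
... | no k≢l   rewrite equal-no k≢l = tr (λ nz → contradiction refl nz) (λ eq → contradiction eq k≢l)

tr-less : ∀ k l → Tr (apply less k l) (k < l)
tr-less k l with k <? l
... | yes k<l rewrite less-true k<l = tr (λ _ → k<l) (λ _ ())
... | no k≮l  rewrite less-≤ (≮⇒≥ k≮l) = tr (λ nz → contradiction refl nz) (λ k<l → contradiction k<l k≮l)

tr-fin : ∀ {n} (x y : Fin n) → Tr (apply equal (toℕ x) (toℕ y)) (x ≡ y)
tr-fin x y = tr-map toℕ-injective (cong toℕ) (tr-eq (toℕ x) (toℕ y))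

tr-χ : ∀ {n} {U : Subset n} {x k} → k ≡ χ U x → Tr k (x ∈ U)
tr-χ {U = U} {x} refl = tr χ-≢0 (λ x∈ z → case trans (sym (χ-in x∈)) z of λ ())

tr-sum : ∀ {n} {g : ℕ → ℕ} {P : Fin n → Set} → (∀ i → Tr (g (toℕ i)) (P i)) → Tr (sumN n g) (∃ P)
tr-sum {n} {g} {P} t = tr (λ nz → go n ≤-refl nz) (λ (i , p) z → holds (t i) p (zeros n z (toℕ i) (toℕ<n i)))
  where
  go : ∀ k → k ≤ n → sumN k g ≢ 0 → ∃ P
  go zero    _   nz = contradiction refl nz
  go (suc k) k<n nz with g k in eq
  ... | suc _ = fromℕ< k<n , sound (t (fromℕ< k<n)) (subst (λ j → g j ≢ 0) (sym (toℕ-fromℕ< k<n))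
    (λ z → case trans (sym eq) z of λ ()))
  ... | zero  = go k (<⇒≤ k<n) (λ z → nz (trans (+-identityʳ _) z))
  zeros : ∀ k → sumN k g ≡ 0 → ∀ i → i < k → g i ≡ 0
  zeros (suc k) z i i<1+k = [ zeros k (Data.Nat.Properties.m+n≡0⇒m≡0 (sumN k g) z) i
    , (λ { refl → Data.Nat.Properties.m+n≡0⇒n≡0 (sumN k g) z }) ]′
    (Data.Nat.Properties.m≤n⇒m<n∨m≡n (Data.Nat.Properties.m<1+n⇒m≤n i<1+k))

branch-≢0 : ∀ {A : Set} {k} {x y : A} → k ≢ 0 → branch k x y ≡ x
branch-≢0 {k = zero}  nz = contradiction refl nz
branch-≢0 {k = suc k} nz = refl

sumN-cons : ∀ k g → sumN (suc k) g ≡ g 0 + sumN k (g ∘ suc)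
sumN-cons zero    g = +-comm 0 (g 0)
sumN-cons (suc k) g = trans (cong (_+ g (suc k)) (sumN-cons k g)) (+-assoc (g 0) _ _)

sum-size : ∀ {n} (U : Subset n) {g : ℕ → ℕ} → (∀ x → Tr (g (toℕ x)) (x ∈ U)) → sumN n (λ i → branch (g i) 1 0) ≡ ∣ U ∣
sum-size []      t = refl
sum-size {suc n} (s ∷ U) {g} t = trans (sumN-cons n (λ i → branch (g i) 1 0))
  (trans (cong (branch (g 0) 1 0 +_) (sum-size U {g ∘ suc} λ x → tr-map (λ { (Vec.there x∈) → x∈ }) Vec.there (t (suc x)))) (head s (t zero)))
  where
  head : ∀ s → Tr (g 0) (zero ∈ s ∷ U) → branch (g 0) 1 0 + ∣ U ∣ ≡ ∣ s ∷ U ∣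
  head true  t = cong (_+ ∣ U ∣) (branch-≢0 (holds t Vec.here))
  head false t = cong (λ c → branch c 1 0 + ∣ U ∣) (tr-zero t λ ())

opaque
  -- A counterpart of `concatN` that recurses from the front over `Fin`, which suits proofs about
  -- membership and order.
  gather : {B : Set} (k : ℕ) → (Fin k → List B) → List B
  gather zero    f = []
  gather (suc k) f = f zero ++ gather k (f ∘ suc)

module _ {B : Set} where

  opaque
    unfolding gather

    gather-cong : ∀ k {f g : Fin k → List B} → (∀ i → f i ≡ g i) → gather k f ≡ gather k g
    gather-cong zero    eq = refl
    gather-cong (suc k) eq = cong₂ _++_ (eq zero) (gather-cong k (eq ∘ suc))

    ∈-gather⁺ : ∀ k {f : Fin k → List B} i {x} → x Mem.∈ f i → x Mem.∈ gather k f
    ∈-gather⁺ (suc k) zero    x∈ = Memₚ.∈-++⁺ˡ x∈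
    ∈-gather⁺ (suc k) {f} (suc i) x∈ = Memₚ.∈-++⁺ʳ (f zero) (∈-gather⁺ k i x∈)

    ∈-gather⁻ : ∀ k {f : Fin k → List B} {x} → x Mem.∈ gather k f → ∃[ i ] x Mem.∈ f i
    ∈-gather⁻ (suc k) {f} x∈ with Memₚ.∈-++⁻ (f zero) x∈
    ... | inj₁ x∈f = zero , x∈f
    ... | inj₂ x∈g = let i , x∈f = ∈-gather⁻ k x∈g in suc i , x∈f

    gather-allPairs : ∀ k {f : Fin k → List B} {Q : B → B → Set} → (∀ i → AllPairs.AllPairs Q (f i)) →
      (∀ {i j x y} → i Fin.< j → x Mem.∈ f i → y Mem.∈ f j → Q x y) → AllPairs.AllPairs Q (gather k f)
    gather-allPairs zero    each cross = AllPairs.[]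
    gather-allPairs (suc k) each cross = AllPairsₚ.++⁺ (each zero)
      (gather-allPairs k (each ∘ suc) (λ i<j → cross (s≤s i<j)))
      (All.tabulate λ x∈ → All.tabulate λ y∈ → let j , y∈f = ∈-gather⁻ k y∈ in cross (s≤s z≤n) x∈ y∈f)

    concatN-cons : ∀ k (F : ℕ → List B) → concatN (suc k) F ≡ F 0 ++ concatN k (F ∘ suc)
    concatN-cons zero    F = sym (Listₚ.++-identityʳ (F 0))
    concatN-cons (suc k) F = trans (cong (_++ F (suc k)) (concatN-cons k F)) (Listₚ.++-assoc (F 0) _ _)

    concatN-gather : ∀ k (F : ℕ → List B) → concatN k F ≡ gather k (F ∘ toℕ)
    concatN-gather zero    F = refl
    concatN-gather (suc k) F = trans (concatN-cons k F) (cong (F 0 ++_) (concatN-gather k (F ∘ suc)))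

    length-gather : ∀ k (f : Fin k → List B) (g : ℕ → ℕ) → (∀ i → length (f i) ≡ g (toℕ i)) →
      length (gather k f) ≡ sumN k g
    length-gather zero    f g eq = refl
    length-gather (suc k) f g eq = trans (Listₚ.length-++ (f zero))
      (trans (cong₂ _+_ (eq zero) (length-gather k (f ∘ suc) (g ∘ suc) (eq ∘ suc))) (sym (sumN-cons k g)))

    gather-lookup : ∀ {A : Set} (h : A → List B) xs → gather (length xs) (h ∘ List.lookup xs) ≡ concatMap h xs
    gather-lookup h []       = refl
    gather-lookup h (x ∷ xs) = cong (h x ++_) (gather-lookup h xs)

    concatMap-++ : ∀ {A : Set} (h : A → List B) xs ys → concatMap h (xs ++ ys) ≡ concatMap h xs ++ concatMap h ys
    concatMap-++ h []       ys = refl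
    concatMap-++ h (x ∷ xs) ys = trans (cong (h x ++_) (concatMap-++ h xs ys)) (sym (Listₚ.++-assoc (h x) _ _))

    concatMap-gather : ∀ {A : Set} (h : A → List B) k f → concatMap h (gather k f) ≡ gather k (concatMap h ∘ f)
    concatMap-gather h zero    f = refl
    concatMap-gather h (suc k) f =
      trans (concatMap-++ h (f zero) _) (cong (concatMap h (f zero) ++_) (concatMap-gather h k (f ∘ suc)))

    concatMap-tabulate : ∀ {A : Set} (h : A → List B) k (f : Fin k → A) →
      concatMap h (List.tabulate f) ≡ gather k (h ∘ f)
    concatMap-tabulate h zero    f = refl
    concatMap-tabulate h (suc k) f = cong (h (f zero) ++_) (concatMap-tabulate h k (f ∘ suc))

-- In a strictly increasing list the position of an element is the number of
-- smaller elements.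
position : ∀ {A : Set} {_≺_ : A → A → Set} (lt : A → A → ℕ) → (∀ x y → Tr (lt x y) (x ≺ y)) →
  (∀ {x} → ¬ x ≺ x) → (∀ {x y} → x ≺ y → ¬ y ≺ x) → ∀ {xs x} → AllPairs.AllPairs _≺_ xs → (x∈ : x Mem.∈ xs) →
  length (concatMap (λ y → branch (lt y x) [ tt ] []) xs) ≡ toℕ (Any.index x∈)
position {_≺_ = _≺_} lt lt-tr irrefl asym (x≺ AllPairs.∷ ps) (here {x = x} refl) =
  trans (cong length (cong₂ _++_ (cong (λ c → branch c [ tt ] []) (tr-zero (lt-tr x x) irrefl)) (none x≺))) refl
  where
  none : ∀ {x ys} → All (x ≺_) ys → concatMap (λ y → branch (lt y x) [ tt ] []) ys ≡ []
  none All.[] = refl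
  none {x} {y ∷ ys} (x≺y All.∷ x≺) rewrite tr-zero (lt-tr y x) (asym x≺y) = none x≺
position lt lt-tr irrefl asym {y ∷ _} {x} (y≺ AllPairs.∷ ps) (there x∈)
  with lt y x | holds (lt-tr y x) (All.lookup y≺ x∈)
... | zero  | nz = contradiction refl nz
... | suc _ | _  = cong suc (position lt lt-tr irrefl asym ps x∈)

-- The output encodes the decomposition tree

module Result {m : ℕ} (R : HomogeneousRelation (suc m)) (L : Listing (suc m))
  (lists : Lists R L) (self-complemented : SelfComplemented R) (τ : Store) (p : ℕ)
  (mt : ∀ a b x → Filling.at3 (suc m) (cell (encodeListing L)) τ MT a b x ≡
    χ (Umodules.M R L lists self-complemented a b) x)
  (tables-hold : Filling.AllHold (suc m) (cell (encodeListing L)) ST tables (st τ p [])) where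

  open Umodules R L lists self-complemented
  open Covering R L lists self-complemented

  private
    n = suc m

  input : ℕ → ℕ
  input = cell (encodeListing L)

  open Semantics n input
  open Filling n input
  open Generation n input

  private
    opaque
      toFin : ℕ → Fin n
      toFin k with k <? n
      ... | yes k<n = fromℕ< k<n
      ... | no _    = zero

      toℕ-toFin : ∀ {k} → k < n → toℕ (toFin k) ≡ k
      toℕ-toFin {k} k<n with k <? n
      ... | yes k<n′ = toℕ-fromℕ< k<n′
      ... | no k≮n   = contradiction k<n k≮n

    toFin-toℕ : ∀ {k i} → k ≡ toℕ i → toFin k ≡ i
    toFin-toℕ {i = i} refl = toℕ-injective (toℕ-toFin (toℕ<n i))

    hold₁ = proj₂ tables-hold
    hold₂ = proj₂ hold₁
    hold₃ = proj₂ hold₂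
    hold₄ = proj₂ hold₃
    hold₅ = proj₂ hold₄
    hold₆ = proj₂ hold₅
    hold₇ = proj₂ hold₆
    hold₈ = proj₂ hold₇
    hold₉ = proj₂ hold₈
    hold₁₀ = proj₂ hold₉

    S-table : ∀ a b d → Tr (at3 τ ST a b d) (d ∈ S a b)
    S-table a b d = tr-≡ (proj₁ tables-hold a b d) (tr-map S⁺ S⁻
      (tr-or (tr-χ (mt a b d)) (tr-or (tr-neg (tr-χ (mt a d b))) (tr-neg (tr-χ (mt b d a))))))

    M-size : ∀ a b → at2 τ SZM a b ≡ ∣ M a b ∣
    M-size a b = trans (proj₁ hold₁ a b) (sum-size (M a b) (λ x → tr-χ (mt a b x)))

    S-size : ∀ a b → at2 τ SZS a b ≡ ∣ S a b ∣
    S-size a b = trans (proj₁ hold₂ a b) (sum-size (S a b) (S-table a b))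

    same-value : ℕ → ℕ → ℕ → ℕ → ℕ
    same-value x y a b = eval τ p (b ∷ a ∷ y ∷ x ∷ []) (sameEx {4} (v 0) (v 1) (v 2) (v 3))

    same-tr : ∀ x y a b → Tr (same-value (toℕ x) (toℕ y) (toℕ a) (toℕ b)) (S x y ≡ S a b)
    same-tr x y a b = tr-map
      (λ ((x∈ , y∈) , (a∈ , b∈)) → S-cong a∈ b∈ x∈ y∈)
      (λ eq → (subst (x ∈_) eq (a∈S x y) , subst (y ∈_) eq (b∈S x y)) ,
              (subst (a ∈_) (sym eq) (a∈S a b) , subst (b ∈_) (sym eq) (b∈S a b)))
      (tr-and (tr-and (S-table a b x) (λ _ → S-table a b y)) (λ _ → tr-and (S-table x y a) (λ _ → S-table x y b)))

    record Canonical (a b : Fin n) : Set where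
      field
        c d   : Fin n
        CA≡   : at2 τ CA a b ≡ toℕ c
        CB≡   : at2 τ CB a b ≡ toℕ d
        same  : S c d ≡ S a b
        min₁  : ∀ {a′ b′} → S a′ b′ ≡ S a b → c Fin.≤ a′
        min₂  : ∀ {b′} → S c b′ ≡ S a b → d Fin.≤ b′

    opaque
      -- The first component is the least one that some second component completes; the second is
      -- then the least completion. The outcome is the lexicographically least pair with the given
      -- strong set.
      canonical : ∀ a b → Canonical a b
      canonical a b with mu-view n (λ i → sumN n (λ j → same-value i j (toℕ a) (toℕ b)))
      ... | inj₂ (_ , z) = contradiction (z a) (holds (tr-sum λ j → same-tr a j a b) (b , refl))
      ... | inj₁ (c , eq , nz , lt) with mu-view n (λ j → same-value (toℕ c) j (toℕ a) (toℕ b))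
      ...   | inj₂ (_ , z) = let d , s = sound (tr-sum λ j → same-tr c j a b) nz in
        contradiction (z d) (holds (same-tr c d a b) s)
      ...   | inj₁ (d , eq′ , nz′ , lt′) = record
        { c = c ; d = d ; CA≡ = ca
        ; CB≡ = trans (proj₁ hold₄ a b) (trans
            (cong (λ k → muN n (λ j → same-value k j (toℕ a) (toℕ b))) ca) eq′)
        ; same = sound (same-tr c d a b) nz′
        ; min₁ = λ {a′} {b′} s → ≮⇒≥ (λ a′< →
            holds (tr-sum λ j → same-tr a′ j a b) (b′ , s) (lt a′ a′<))
        ; min₂ = λ {b′} s → ≮⇒≥ (λ b′< → holds (same-tr c b′ a b) s (lt′ b′ b′<))
        }
        where
        ca : at2 τ CA a b ≡ toℕ c
        ca = trans (proj₁ hold₃ a b) eq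

    P : Set
    P = Fin n × Fin n

    canon : Fin n → Fin n → P
    canon a b = Canonical.c (canonical a b) , Canonical.d (canonical a b)

    opaque
      canon-S : ∀ a b → S (proj₁ (canon a b)) (proj₂ (canon a b)) ≡ S a b
      canon-S a b = Canonical.same (canonical a b)

      canon-cong : ∀ {a b a′ b′} → S a b ≡ S a′ b′ → canon a b ≡ canon a′ b′
      canon-cong {a} {b} {a′} {b′} eq = cong₂ _,_ c≡ (Finₚ.≤-antisym
          (K.min₂ (trans (cong (λ c → S c K′.d) c≡) (trans K′.same (sym eq))))
          (K′.min₂ (trans (cong (λ c → S c K.d) (sym c≡)) (trans K.same eq))))
        where
        module K = Canonical (canonical a b)
        module K′ = Canonical (canonical a′ b′)
        c≡ : K.c ≡ K′.c
        c≡ = Finₚ.≤-antisym (K.min₁ (trans K′.same (sym eq))) (K′.min₁ (trans K.same eq))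

      canon-tr : ∀ a b → Tr (at2 τ CAN a b) (canon a b ≡ (a , b))
      canon-tr a b = tr-≡ (proj₁ hold₅ a b) (tr-map (λ (e , f) → cong₂ _,_ e f) (λ eq → cong proj₁ eq , cong proj₂ eq)
        (tr-and (tr-≡ (cong (λ k → apply equal k (toℕ a)) (Canonical.CA≡ (canonical a b))) (tr-fin _ a))
          (λ _ → tr-≡ (cong (λ k → apply equal k (toℕ b)) (Canonical.CB≡ (canonical a b))) (tr-fin _ b))))

      ∈-branch : ∀ {A : Set} k (x : A) {y} → y Mem.∈ branch k [ x ] [] → k ≢ 0 × y ≡ x
      ∈-branch (suc k) x (here refl) = (λ ()) , refl

      branch-∈ : ∀ {A : Set} k {x : A} → k ≢ 0 → x Mem.∈ branch k [ x ] []
      branch-∈ zero    nz = contradiction refl nz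
      branch-∈ (suc k) nz = here refl

      branch-allPairs : ∀ {A : Set} {Q : A → A → Set} k {x : A} → AllPairs.AllPairs Q (branch k [ x ] [])
      branch-allPairs zero    = AllPairs.[]
      branch-allPairs (suc k) = All.[] AllPairs.∷ AllPairs.[]

    infix 4 _<ₗ_
    _<ₗ_ : P → P → Set
    (a , b) <ₗ (a′ , b′) = a Fin.< a′ ⊎ (a ≡ a′ × b Fin.< b′)

    opaque
      reps : List P
      reps = gather n (λ a → gather n (λ b → branch (at2 τ CAN a b) [ a , b ] []))

      reps-sorted : AllPairs.AllPairs _<ₗ_ reps
      reps-sorted = gather-allPairs n
        (λ a → gather-allPairs n (λ b → branch-allPairs (at2 τ CAN a b))
          (λ {b} {b′} b<b′ x∈ y∈ → subst₂ _<ₗ_ (sym (proj₂ (∈-branch (at2 τ CAN a b) (a , b) x∈)))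
            (sym (proj₂ (∈-branch (at2 τ CAN a b′) (a , b′) y∈))) (inj₂ (refl , b<b′))))
        (λ {a} {a′} a<a′ x∈ y∈ → let b , x∈′ = ∈-gather⁻ n x∈ ; b′ , y∈′ = ∈-gather⁻ n y∈ in
          subst₂ _<ₗ_ (sym (proj₂ (∈-branch (at2 τ CAN a b) (a , b) x∈′)))
            (sym (proj₂ (∈-branch (at2 τ CAN a′ b′) (a′ , b′) y∈′))) (inj₁ a<a′))

      reps-canon : ∀ {a b} → (a , b) Mem.∈ reps → canon a b ≡ (a , b)
      reps-canon {a} {b} ab∈ with ∈-gather⁻ n ab∈
      ... | a′ , ab∈′ with ∈-gather⁻ n ab∈′
      ...   | b′ , ab∈″ with ∈-branch (at2 τ CAN a′ b′) (a′ , b′) ab∈″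
      ...     | nz , refl = sound (canon-tr a b) nz

      canon-∈ : ∀ a b → canon a b Mem.∈ reps
      canon-∈ a b = ∈-gather⁺ n (proj₁ (canon a b)) (∈-gather⁺ n (proj₂ (canon a b))
        (branch-∈ (at2 τ CAN (proj₁ (canon a b)) (proj₂ (canon a b)))
          (holds (canon-tr (proj₁ (canon a b)) (proj₂ (canon a b))) (canon-cong (canon-S a b)))))

    order : ℕ
    order = length reps

    code : Fin order → P
    code = List.lookup reps

    opaque
      vtx : Fin n → Fin n → Fin order
      vtx a b = Any.index (canon-∈ a b)

      code-vtx : ∀ a b → code (vtx a b) ≡ canon a b
      code-vtx a b = sym (Anyₚ.lookup-index (canon-∈ a b))

      code-canon : ∀ v → canon (proj₁ (code v)) (proj₂ (code v)) ≡ code v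
      code-canon v = reps-canon (Memₚ.∈-lookup v)

      code-injective : ∀ {v w} → code v ≡ code w → v ≡ w
      code-injective {v} {w} eq with Finₚ.<-cmp v w
      ... | tri≈ _ v≡w _ = v≡w
      ... | tri< v<w _ _ = contradiction eq (<ₗ-≢ (allPairs-lookup reps-sorted v<w))
        where
        <ₗ-≢ : ∀ {x y} → x <ₗ y → x ≢ y
        <ₗ-≢ (inj₁ a<a)       refl = <-irrefl refl a<a
        <ₗ-≢ (inj₂ (_ , b<b)) refl = <-irrefl refl b<b
      ... | tri> _ _ w<v = contradiction (sym eq) (<ₗ-≢ (allPairs-lookup reps-sorted w<v))
        where
        <ₗ-≢ : ∀ {x y} → x <ₗ y → x ≢ y
        <ₗ-≢ (inj₁ a<a)       refl = <-irrefl refl a<a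
        <ₗ-≢ (inj₂ (_ , b<b)) refl = <-irrefl refl b<b

    lt-value : P → P → ℕ
    lt-value (a , b) (c , d) = branch (apply less (toℕ a) (toℕ c)) 1
      (branch (apply equal (toℕ a) (toℕ c)) (apply less (toℕ b) (toℕ d)) 0)

    lt-tr : ∀ x y → Tr (lt-value x y) (x <ₗ y)
    lt-tr (a , b) (c , d) = tr-or (tr-less (toℕ a) (toℕ c)) (tr-and (tr-fin a c) (λ _ → tr-less (toℕ b) (toℕ d)))

    opaque
      unfolding reps vtx
      -- The table counts the representatives smaller than the canonical pair; by `position` this is
      -- its index in the sorted list `reps`.
      vid : ∀ a b → at2 τ VID a b ≡ toℕ (vtx a b)
      vid a b = trans (proj₁ hold₆ a b) (trans
        (cong₂ (λ c d → sumN n (λ i → sumN n (λ j → branch (branch (τ CAN (i * n + j))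
          (branch (apply less i c) 1 (branch (apply equal i c) (apply less j d) 0)) 0) 1 0)))
          (Canonical.CA≡ (canonical a b)) (Canonical.CB≡ (canonical a b)))
        (trans (sym (trans (cong length (trans (concatMap-gather h n _) (gather-cong n λ i → concatMap-gather h n _)))
          (length-gather n _ _ λ i → length-gather n _ _ λ j → one (at2 τ CAN i j) (i , j))))
        (position lt-value lt-tr irrefl asym reps-sorted (canon-∈ a b))))
        where
        h : P → List ⊤
        h y = branch (lt-value y (canon a b)) [ tt ] []
        tick : ∀ l → length (branch l [ tt ] [] ++ []) ≡ branch l 1 0
        tick zero    = refl
        tick (suc l) = refl
        one : ∀ k y → length (concatMap h (branch k [ y ] [])) ≡ branch (branch k (lt-value y (canon a b)) 0) 1 0
        one zero    y = refl
        one (suc k) y = tick (lt-value y (canon a b))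
        irrefl : ∀ {x} → ¬ x <ₗ x
        irrefl (inj₁ a<a)       = <-irrefl refl a<a
        irrefl (inj₂ (_ , b<b)) = <-irrefl refl b<b
        asym : ∀ {x y} → x <ₗ y → ¬ y <ₗ x
        asym (inj₁ a<c)          (inj₁ c<a)          = <-irrefl refl (<-trans a<c c<a)
        asym (inj₁ a<c)          (inj₂ (refl , _))   = <-irrefl refl a<c
        asym (inj₂ (refl , _))   (inj₁ c<a)          = <-irrefl refl c<a
        asym (inj₂ (refl , b<d)) (inj₂ (_ , d<b))    = <-irrefl refl (<-trans b<d d<b)

    Least : (ℕ → ℕ) → Set
    Least f = (Σ[ d ∈ Fin n ] muN n f ≡ toℕ d × f (toℕ d) ≢ 0 × (∀ (j : Fin n) → toℕ j < toℕ d → f (toℕ j) ≡ 0)) ⊎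
      (muN n f ≡ n × (∀ (d : Fin n) → f (toℕ d) ≡ 0))

    data Parent (a b : Fin n) : Set where
      parent    : ∀ d → at2 τ PD a b ≡ toℕ d → _⋖_ R (S a b) (S a d) → Parent a b
      no-parent : at2 τ PD a b ≡ n → S a b ≡ full → Parent a b

    opaque
      -- The search looks for a point with the property provided by `cospan`. It fails, with result
      -- `n`, only when no point lies outside the cluster.
      parent-view : ∀ a b → Parent a b
      parent-view a b = go (mu-view n top)
        where
        top : ℕ → ℕ
        top i = eval τ p (i ∷ toℕ b ∷ toℕ a ∷ []) (and (neg (tab3 ST (v 0) (v 1) (v 2)))
          (neg (sum (and (neg (tab3 ST (v 0) (v 1) (v 3))) (neg (tab3 ST (v 0) (v 3) (v 2)))))))
        top-tr : ∀ d → Tr (top (toℕ d)) (d ∉ S a b × ¬ (∃[ x ] x ∉ S a b × d ∉ S a x))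
        top-tr d = tr-and (tr-neg (S-table a b d))
          (λ _ → tr-neg (tr-sum λ x → tr-and (tr-neg (S-table a b x)) (λ _ → tr-neg (S-table a x d))))
        go : Least top → Parent a b
        go (inj₁ (d , eq , nz , _)) = let d∉ , low = sound (top-tr d) nz in
          parent d (trans (proj₁ hold₇ a b) eq)
            (cover-cospan d∉ (λ {x} x∉ → decidable-stable (d ∈? S a x) (λ d∉ → low (x , x∉ , d∉))))
        go (inj₂ (eq , z)) = no-parent (trans (proj₁ hold₇ a b) eq) (⊆-antisym (λ _ → ∈⊤) (λ {y} _ →
          decidable-stable (y ∈? S a b) λ y∉ → let d , d∉ , low = cospan {S a b} {a} y∉ in
            holds (top-tr d) (d∉ , λ (x , x∉ , d∉′) → d∉′ (low x∉)) (z d)))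

    -- `PD` supplies a point `e` for which `S d e` is the parent cluster of `S d d′`, so comparing
    -- it with `S a b` tests whether the node is the parent.
    Child : Fin n → Fin n → Fin n → Fin n → Set
    Child a b d d′ = canon d d′ ≡ (d , d′) × (Σ[ e ∈ Fin n ] at2 τ PD d d′ ≡ toℕ e × S d e ≡ S a b)

    opaque
      child-covered : ∀ {a b d d′} → Child a b d d′ → _⋖_ R (S d d′) (S a b)
      child-covered {a} {b} {d} {d′} (_ , e , eq , s) with parent-view d d′
      ... | parent e′ eq′ cov = subst (_⋖_ R (S d d′))
        (trans (cong (S d) (toℕ-injective (trans (sym eq′) eq))) s) cov
      ... | no-parent eq′ _ = contradiction (trans (sym eq) eq′) (<⇒≢ (toℕ<n e))

      covered-child : ∀ {a b d d′} → canon d d′ ≡ (d , d′) → _⋖_ R (S d d′) (S a b) → Child a b d d′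
      covered-child {a} {b} {d} {d′} can cov with parent-view d d′
      ... | parent e eq cov′ = can , e , eq , cover-above (S-strong d e) (S-strong a b) (a∈S d d′) cov′ cov
      ... | no-parent _ eq = ⊥-elim (proj₁ (proj₂ cov) λ {x} _ → subst (x ∈_) (sym eq) ∈⊤)

      -- Children of a node are disjoint, so the first code component identifies a child. This is
      -- why `CHD` is indexed by the node and `d` alone.
      child-unique : ∀ {a b d d′ d″} → Child a b d d′ → Child a b d d″ → d′ ≡ d″
      child-unique {a} {b} {d} {d′} {d″} c c′ = cong proj₂ (trans (sym (proj₁ c)) (trans
        (canon-cong (cover-below (S-strong d d′) (S-strong d d″) (a∈S d d′) (a∈S d d″) (child-covered c) (child-covered c′)))
        (proj₁ c′)))

      child-view : ∀ a b d → (Σ[ d′ ∈ Fin n ] at3 τ CHD a b d ≡ toℕ d′ × Child a b d d′) ⊎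
        (at3 τ CHD a b d ≡ n × (∀ d′ → ¬ Child a b d d′))
      child-view a b d = go (mu-view n test)
        where
        test : ℕ → ℕ
        test i = eval τ p (i ∷ toℕ d ∷ toℕ b ∷ toℕ a ∷ []) (and (tab2 CAN (v 2) (v 3)) (and (tab2 PD (v 2) (v 3) ≺ size)
          (sameEx (v 2) (tab2 PD (v 2) (v 3)) (v 0) (v 1))))
        test-tr : ∀ d′ → Tr (test (toℕ d′)) (Child a b d d′)
        test-tr d′ = tr-and (canon-tr d d′) λ _ → tr-map proj₂
          (λ (e , eq , s) → subst (_< n) (sym eq) (toℕ<n e) , e , eq , s)
          (tr-and (tr-less (at2 τ PD d d′) n) λ lt → tr-≡
            (cong (λ k → same-value (toℕ d) k (toℕ a) (toℕ b)) (sym (toℕ-fromℕ< lt)))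
            (tr-map (λ s → fromℕ< lt , sym (toℕ-fromℕ< lt) , s)
              (λ (e , eq , s) → subst (λ e → S d e ≡ S a b) (toℕ-injective (trans (sym eq) (sym (toℕ-fromℕ< lt)))) s)
              (same-tr d (fromℕ< lt) a b)))
        go : Least test →
          (Σ[ d′ ∈ Fin n ] at3 τ CHD a b d ≡ toℕ d′ × Child a b d d′) ⊎ (at3 τ CHD a b d ≡ n × (∀ d′ → ¬ Child a b d d′))
        go (inj₁ (d′ , eq , nz , _)) = inj₁ (d′ , trans (proj₁ hold₈ a b d) eq , sound (test-tr d′) nz)
        go (inj₂ (eq , z)) = inj₂ (trans (proj₁ hold₈ a b d) eq , λ d′ c → holds (test-tr d′) c (z d′))

    full-value cross-value : ℕ → ℕ → ℕ → ℕ → ℕ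
    full-value x y a b = eval τ p (b ∷ a ∷ y ∷ x ∷ []) (fullEx {4} (v 0) (v 1) (v 2) (v 3))
    cross-value x y a b = eval τ p (b ∷ a ∷ y ∷ x ∷ [])
      (and (crossEx {4} (v 0) (v 1) (v 2) (v 3)) (neg (tab2 SZM (v 0) (v 1) ≐ tab2 SZS (v 2) (v 3))))

    size-tr : ∀ x y a b → Tr (apply equal (at2 τ SZM x y) (at2 τ SZS a b)) (∣ M x y ∣ ≡ ∣ S a b ∣)
    size-tr x y a b rewrite M-size x y | S-size a b = tr-eq ∣ M x y ∣ ∣ S a b ∣

    full-tr : ∀ x y a b → Tr (full-value (toℕ x) (toℕ y) (toℕ a) (toℕ b)) (S x y ≡ S a b × ∣ M x y ∣ ≡ ∣ S a b ∣)
    full-tr x y a b = tr-and (same-tr x y a b) (λ _ → size-tr x y a b)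

    cross-tr : ∀ x y a b → Tr (cross-value (toℕ x) (toℕ y) (toℕ a) (toℕ b)) (S x y ≡ S a b × ∣ M x y ∣ ≢ ∣ S a b ∣)
    cross-tr x y a b = tr-and (same-tr x y a b) (λ _ → tr-neg (size-tr x y a b))

    HasFull HasPartial : Fin n → Fin n → Set
    HasFull a b = ∃[ x ] ∃[ y ] S x y ≡ S a b × ∣ M x y ∣ ≡ ∣ S a b ∣
    HasPartial a b = ∃[ x ] ∃[ y ] S x y ≡ S a b × ∣ M x y ∣ ≢ ∣ S a b ∣

    kindNumber : ℕ → Kind n
    kindNumber 1 = complete
    kindNumber 2 = circular
    kindNumber _ = prime

    kindOf : Fin n → Fin n → Kind n
    kindOf a b = if does (a Finₚ.≟ b) then leaf a else kindNumber (at2 τ KIND a b)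

    data KindView (a b : Fin n) : Set where
      is-leaf     : a ≡ b → at2 τ KIND a b ≡ 0 → KindView a b
      is-complete : a ≢ b → at2 τ KIND a b ≡ 1 → ¬ HasFull a b → KindView a b
      is-circular : a ≢ b → at2 τ KIND a b ≡ 2 → HasFull a b → HasPartial a b → KindView a b
      is-prime    : a ≢ b → at2 τ KIND a b ≡ 3 → HasFull a b → ¬ HasPartial a b → KindView a b

    opaque
      kind-view : ∀ a b → KindView a b
      kind-view a b with a Finₚ.≟ b
      ... | yes refl = is-leaf refl (trans (proj₁ hold₉ a a)
        (cong (λ k → branch k 0 (branch fulls (branch partials 2 3) 1)) (equal-yes {toℕ a} refl)))
        where
        fulls partials : ℕ
        fulls    = sumN n (λ i → sumN n (λ j → full-value i j (toℕ a) (toℕ a)))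
        partials = sumN n (λ i → sumN n (λ j → cross-value i j (toℕ a) (toℕ a)))
      ... | no a≢b = go fulls refl partials refl
        where
        fulls partials : ℕ
        fulls    = sumN n (λ i → sumN n (λ j → full-value i j (toℕ a) (toℕ b)))
        partials = sumN n (λ i → sumN n (λ j → cross-value i j (toℕ a) (toℕ b)))
        fulls-tr : Tr fulls (HasFull a b)
        fulls-tr = tr-sum λ x → tr-sum λ y → full-tr x y a b
        partials-tr : Tr partials (HasPartial a b)
        partials-tr = tr-sum λ x → tr-sum λ y → cross-tr x y a b
        value : at2 τ KIND a b ≡ branch fulls (branch partials 2 3) 1
        value = trans (proj₁ hold₉ a b)
          (cong (λ k → branch k 0 (branch fulls (branch partials 2 3) 1)) (equal-no (λ eq → a≢b (toℕ-injective eq))))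
        go : ∀ f → fulls ≡ f → ∀ k → partials ≡ k → KindView a b
        go zero    eq k       eq′ = is-complete a≢b (trans value (cong (λ f → branch f (branch partials 2 3) 1) eq))
          (λ h → holds fulls-tr h eq)
        go (suc f) eq zero    eq′ = is-prime a≢b (trans value (cong₂ (λ f k → branch f (branch k 2 3) 1) eq eq′))
          (sound fulls-tr (λ z → case trans (sym eq) z of λ ())) (λ h → holds partials-tr h eq′)
        go (suc f) eq (suc k) eq′ = is-circular a≢b (trans value (cong₂ (λ f k → branch f (branch k 2 3) 1) eq eq′))
          (sound fulls-tr (λ z → case trans (sym eq) z of λ ())) (sound partials-tr (λ z → case trans (sym eq′) z of λ ()))

      kindOf-leaf : ∀ a → kindOf a a ≡ leaf a
      kindOf-leaf a rewrite dec-true (a Finₚ.≟ a) refl = refl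

      kindOf-inner : ∀ {a b} → a ≢ b → kindOf a b ≡ kindNumber (at2 τ KIND a b)
      kindOf-inner {a} {b} a≢b rewrite dec-false (a Finₚ.≟ b) a≢b = refl

      -- It gives the search for `END` a result at leaves, where the kind does not already settle
      -- it.
      diagonal-full : ∀ a → HasFull a a
      diagonal-full a = a , a , refl , cong ∣_∣ (⊆-antisym M⊆S λ d∈ → by (S⁻ d∈))
        where
        by : ∀ {d} → Near a a d → d ∈ M a a
        by (inj₁ d∈)        = d∈
        by (inj₂ (inj₁ a∉)) = contradiction (a∈M a _) a∉
        by (inj₂ (inj₂ a∉)) = contradiction (a∈M a _) a∉

      end-view : ∀ a b → Σ[ e ∈ Fin n ] at2 τ END a b ≡ toℕ e ×
        (at2 τ KIND a b ≡ 1 ⊎ (∃[ f ] S e f ≡ S a b × ∣ M e f ∣ ≡ ∣ S a b ∣))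
      end-view a b = go (mu-view n test)
        where
        test : ℕ → ℕ
        test i = branch (apply equal (at2 τ KIND a b) 1) 1 (sumN n (λ j → full-value i j (toℕ a) (toℕ b)))
        test-tr : ∀ e → Tr (test (toℕ e)) (at2 τ KIND a b ≡ 1 ⊎ (∃[ f ] S e f ≡ S a b × ∣ M e f ∣ ≡ ∣ S a b ∣))
        test-tr e = tr-or (tr-eq (at2 τ KIND a b) 1) (tr-sum λ f → full-tr e f a b)
        some : ∃[ e ] (at2 τ KIND a b ≡ 1 ⊎ (∃[ f ] S e f ≡ S a b × ∣ M e f ∣ ≡ ∣ S a b ∣))
        some with kind-view a b
        ... | is-leaf refl _                     = let e , h = diagonal-full a in e , inj₂ h
        ... | is-complete _ eq _                 = zero , inj₁ eq
        ... | is-circular _ _ (e , h) _ = e , inj₂ h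
        ... | is-prime _ _ (e , h) _    = e , inj₂ h
        go : Least test →
          Σ[ e ∈ Fin n ] at2 τ END a b ≡ toℕ e × (at2 τ KIND a b ≡ 1 ⊎ (∃[ f ] S e f ≡ S a b × ∣ M e f ∣ ≡ ∣ S a b ∣))
        go (inj₁ (e , eq , nz , _)) = e , trans (proj₁ hold₁₀ a b) eq , sound (test-tr e) nz
        go (inj₂ (_ , z)) = let e , h = some in contradiction (z e) (holds (test-tr e) h)

    endOf : Fin n → Fin n → Fin n
    endOf a b = toFin (at2 τ END a b)

    opaque
      end-≡ : ∀ a b → at2 τ END a b ≡ toℕ (endOf a b)
      end-≡ a b = let e , eq , _ = end-view a b in trans eq (cong toℕ (sym (toFin-toℕ eq)))

      end-full : ∀ a b → at2 τ KIND a b ≢ 1 → ∃[ f ] S (endOf a b) f ≡ S a b × ∣ M (endOf a b) f ∣ ≡ ∣ S a b ∣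
      end-full a b ≢1 with end-view a b
      ... | e , eq , inj₁ ≡1 = contradiction ≡1 ≢1
      ... | e , eq , inj₂ h  =
        subst (λ e → ∃[ f ] S e f ≡ S a b × ∣ M e f ∣ ≡ ∣ S a b ∣) (sym (toFin-toℕ eq)) h

    Listed : Fin n → Fin n → Fin n → Fin n → Set
    Listed s d a b = at3 τ CHD a b d < n × ∣ M (endOf a b) d ∣ ≡ suc (toℕ s)

    opaque
      listed-value : ℕ → ℕ → ℕ → ℕ → ℕ
      listed-value s d a b = eval τ p (d ∷ s ∷ b ∷ a ∷ []) listed

      listed-tr : ∀ s d a b → Tr (listed-value (toℕ s) (toℕ d) (toℕ a) (toℕ b)) (Listed s d a b)
      listed-tr s d a b = tr-and (tr-less (at3 τ CHD a b d) n) λ _ → tr-≡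
        (cong₂ (apply equal) (trans (cong (λ e → τ SZM (e * n + toℕ d)) (end-≡ a b)) (M-size (endOf a b) d)) (+-comm (toℕ s) 1))
        (tr-eq ∣ M (endOf a b) d ∣ (suc (toℕ s)))

    opaque
      kids : Fin n → Fin n → List (Fin n)
      kids a b = gather n (λ s → gather n (λ d → branch (listed-value (toℕ s) (toℕ d) (toℕ a) (toℕ b)) [ d ] []))

    childVertex : Fin n → Fin n → Fin n → Fin order
    childVertex a b d = vtx d (toFin (at3 τ CHD a b d))

    parents : Fin n → Fin n → List (Fin order)
    parents a b = branch (apply less (at2 τ PD a b) n) [ vtx a (toFin (at2 τ PD a b)) ] []

    nbrsOf : Fin n → Fin n → List (Fin order)
    nbrsOf a b = map (childVertex a b) (kids a b) ++ parents a b

    opaque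
      kids⁻ : ∀ {a b} {s d : Fin n} → listed-value (toℕ s) (toℕ d) (toℕ a) (toℕ b) ≢ 0 →
        (Σ[ d′ ∈ Fin n ] Child a b d d′ × code (childVertex a b d) ≡ (d , d′)) × ∣ M (endOf a b) d ∣ ≡ suc (toℕ s)
      kids⁻ {a} {b} {s} {d} nz = child (child-view a b d) , proj₂ listed-sound
        where
        listed-sound : Listed s d a b
        listed-sound = sound (listed-tr s d a b) nz
        child : (Σ[ d′ ∈ Fin n ] at3 τ CHD a b d ≡ toℕ d′ × Child a b d d′) ⊎ (at3 τ CHD a b d ≡ n × (∀ d′ → ¬ Child a b d d′)) →
          Σ[ d′ ∈ Fin n ] Child a b d d′ × code (childVertex a b d) ≡ (d , d′)
        child (inj₂ (eq , _))      = contradiction (proj₁ listed-sound) (λ lt → <-irrefl eq lt)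
        child (inj₁ (d′ , eq , c)) =
          d′ , c , trans (cong (λ e → code (vtx d e)) (toFin-toℕ eq)) (trans (code-vtx d d′) (proj₁ c))

    opaque
      unfolding kids
      kids-∈⁻ : ∀ {a b d} → d Mem.∈ kids a b → Σ[ d′ ∈ Fin n ] Child a b d d′ × code (childVertex a b d) ≡ (d , d′)
      kids-∈⁻ {a} {b} d∈ with ∈-gather⁻ n d∈
      ... | s , d∈′ with ∈-gather⁻ n d∈′
      ...   | d′ , d∈″ with ∈-branch (listed-value (toℕ s) (toℕ d′) (toℕ a) (toℕ b)) d′ d∈″
      ...     | nz , refl = proj₁ (kids⁻ {a} {b} {s} {d′} nz)

      kids-∈⁺ : ∀ {a b d d′} → Child a b d d′ → d Mem.∈ kids a b × code (childVertex a b d) ≡ (d , d′)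
      kids-∈⁺ {a} {b} {d} {d′} c with child-view a b d
      ... | inj₂ (_ , none) = contradiction c (none d′)
      ... | inj₁ (d″ , eq , c′) with child-unique c c′
      ...   | refl = ∈-gather⁺ n s (∈-gather⁺ n d (branch-∈ (listed-value (toℕ s) (toℕ d) (toℕ a) (toℕ b))
          (holds (listed-tr s d a b) (subst (_< n) (sym eq) (toℕ<n d′) , sz)))) ,
        trans (cong (λ e → code (vtx d e)) (toFin-toℕ eq)) (trans (code-vtx d d′) (proj₁ c))
        where
        -- The key lies between 1 and `n`, so its predecessor is one of the indices of the loop over
        -- keys.
        positive : 1 ≤ ∣ M (endOf a b) d ∣
        positive = nonempty-size (b∈M (endOf a b) d)
        predecessor : ∀ k → 1 ≤ k → k ≤ n → ∃[ s ] k ≡ suc (toℕ {n} s)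
        predecessor (suc k) _ k<n = fromℕ< k<n , cong suc (sym (toℕ-fromℕ< k<n))
        s : Fin n
        s = proj₁ (predecessor ∣ M (endOf a b) d ∣ positive (∣p∣≤n (M (endOf a b) d)))
        sz : ∣ M (endOf a b) d ∣ ≡ suc (toℕ s)
        sz = proj₂ (predecessor ∣ M (endOf a b) d ∣ positive (∣p∣≤n (M (endOf a b) d)))

    opaque
      parents-∈⁻ : ∀ {a b w} → w Mem.∈ parents a b → _⋖_ R (S a b) (S (proj₁ (code w)) (proj₂ (code w)))
      parents-∈⁻ {a} {b} {w} w∈ with ∈-branch (apply less (at2 τ PD a b) n) (vtx a (toFin (at2 τ PD a b))) w∈
      ... | nz , refl with parent-view a b
      ...   | no-parent eq _ = contradiction (trans (cong (λ k → apply less k n) eq) (less-irrefl n)) nz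
      ...   | parent d eq cov = subst (_⋖_ R (S a b)) (sym (trans
        (cong (λ c → S (proj₁ c) (proj₂ c)) (trans (cong (λ e → code (vtx a e)) (toFin-toℕ eq)) (code-vtx a d)))
        (canon-S a d))) cov

      parents-∈⁺ : ∀ {a b} w → _⋖_ R (S a b) (S (proj₁ (code w)) (proj₂ (code w))) → w Mem.∈ parents a b
      parents-∈⁺ {a} {b} w cov with parent-view a b
      ... | no-parent _ eq = ⊥-elim (proj₁ (proj₂ cov) λ {x} _ → subst (x ∈_) (sym eq) ∈⊤)
      ... | parent d eq cov′ = subst (Mem._∈ parents a b) (code-injective (trans
          (trans (cong (λ e → code (vtx a e)) (toFin-toℕ eq)) (code-vtx a d)) (trans
          (canon-cong (cover-above (S-strong a d) (S-strong _ _) (a∈S a b) cov′ cov)) (code-canon w))))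
        (branch-∈ (apply less (at2 τ PD a b) n) (holds (tr-less (at2 τ PD a b) n) (subst (_< n) (sym eq) (toℕ<n d))))

  nbrs : Fin order → List (Fin order)
  nbrs v = nbrsOf (proj₁ (code v)) (proj₂ (code v))

  kind : Fin order → Kind n
  kind v = kindOf (proj₁ (code v)) (proj₂ (code v))

  end : Fin order → Fin n
  end v = endOf (proj₁ (code v)) (proj₂ (code v))

  open Assembled R L lists self-complemented order code vtx nbrs kind end public

  private
    opaque
      code-child : ∀ {a b d d′ w} → code w ≡ (d , d′) → Child a b d d′ →
        _⋖_ R (S (proj₁ (code w)) (proj₂ (code w))) (S a b)
      code-child {a} {b} eq c = subst (λ q → _⋖_ R (S (proj₁ q) (proj₂ q)) (S a b)) (sym eq) (child-covered c)

    opaque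
      unfolding kids
      -- The outer loop runs through the keys and the inner one through the first code components,
      -- so children with equal keys are still distinct.
      kids-sorted : ∀ v → AllPairs.AllPairs (λ d d′ → Before v
        (childVertex (proj₁ (code v)) (proj₂ (code v)) d) (childVertex (proj₁ (code v)) (proj₂ (code v)) d′))
        (kids (proj₁ (code v)) (proj₂ (code v)))
      kids-sorted v = gather-allPairs n
        (λ s → gather-allPairs n (λ d → branch-allPairs (lv s d))
          (λ {d} {d′} d<d′ x∈ y∈ → ordered {s} {s} {d} {d′} (∈-branch (lv s d) d x∈) (∈-branch (lv s d′) d′ y∈)
            (λ { refl → <-irrefl refl d<d′ }) ≤-refl))
        (λ {s} {s′} s<s′ x∈ y∈ → let d , x∈′ = ∈-gather⁻ n x∈ ; d′ , y∈′ = ∈-gather⁻ n y∈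
                                     xk = ∈-branch (lv s d) d x∈′ ; yk = ∈-branch (lv s′ d′) d′ y∈′ in
          ordered {s} {s′} {d} {d′} xk yk (λ d≡ → <-irrefl (Data.Nat.Properties.suc-injective (trans
            (sym (proj₂ (kids⁻ {a} {b} {s} {d} (proj₁ xk)))) (trans (cong (λ d → ∣ M (endOf a b) d ∣) d≡)
              (proj₂ (kids⁻ {a} {b} {s′} {d′} (proj₁ yk)))))) s<s′) (<⇒≤ s<s′))
        where
        a b : Fin n
        a = proj₁ (code v)
        b = proj₂ (code v)
        lv : Fin n → Fin n → ℕ
        lv s d = listed-value (toℕ s) (toℕ d) (toℕ a) (toℕ b)
        ordered : ∀ {s s′ d d′ x y : Fin n} → lv s d ≢ 0 × x ≡ d → lv s′ d′ ≢ 0 × y ≡ d′ → d ≢ d′ → s Fin.≤ s′ →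
          Before v (childVertex a b x) (childVertex a b y)
        ordered {s} {s′} {d} {d′} (nz , refl) (nz′ , refl) d≢ s≤
          with kids⁻ {a} {b} {s} {d} nz | kids⁻ {a} {b} {s′} {d′} nz′
        ... | (e , c , eq) , sz | (e′ , c′ , eq′) , sz′ =
          covered (code-child {w = childVertex a b d} eq c) , inj₂ (covered (code-child {w = childVertex a b d′} eq′ c′) ,
            (λ w≡ → d≢ (trans (sym (cong proj₁ eq)) (trans (cong (λ w → proj₁ (code w)) w≡) (cong proj₁ eq′)))) ,
            subst₂ _≤_ (sym (trans (cong (λ q → ∣ M (end v) (proj₁ q) ∣) eq) sz))
              (sym (trans (cong (λ q → ∣ M (end v) (proj₁ q) ∣) eq′) sz′)) (s≤s s≤))

    opaque
      full-⊆ : ∀ {A B : Subset n} → A ⊆ B → ∣ A ∣ ≡ ∣ B ∣ → B ⊆ A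
      full-⊆ {A} {B} A⊆B eq {x} x∈ = decidable-stable (x ∈? A) λ x∉ →
        <-irrefl eq (p⊂q⇒∣p∣<∣q∣ (A⊆B , x , x∈ , x∉))

      -- For points of the cluster, `M x y` is contained in `cl v`; equality of sizes is then
      -- equality of sets, so the numeric tests decide fullness.
      kindSpec : ∀ v → KindSpec v (kind v)
      kindSpec v with kind-view (proj₁ (code v)) (proj₂ (code v))
      ... | is-leaf eq _ = subst (KindSpec v) (sym (trans (cong (kindOf a) (sym eq)) (kindOf-leaf a))) (cong (a ,_) (sym eq))
        where
        a : Fin n
        a = proj₁ (code v)
      ... | is-complete a≢b k none = subst (KindSpec v) (sym (trans (kindOf-inner a≢b) (cong kindNumber k)))
        (a≢b , λ {e} {f} e∈ f∈ (cr , T⊆) → none (e , f , ⊆-antisym (S-mono e∈ f∈) cr ,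
          cong ∣_∣ (⊆-antisym (M-min (S-F _ _) e∈ f∈) T⊆)))
      ... | is-circular a≢b k _ (x , y , s , ≢) = subst (KindSpec v) (sym (trans (kindOf-inner a≢b) (cong kindNumber k)))
        (a≢b , e∈ , (f , f∈ , (λ z∈ → subst (_ ∈_) (sym se) z∈) , full-⊆ M⊆ sizes) ,
         x , y , subst (x ∈_) s (a∈S x y) , subst (y ∈_) s (b∈S x y) , (λ z∈ → subst (_ ∈_) (sym s) z∈) ,
         λ T⊆ → ≢ (cong ∣_∣ (⊆-antisym (λ z∈ → subst (_ ∈_) s (M⊆S z∈)) T⊆)))
        where
        ends : Σ[ f ∈ Fin n ] S (end v) f ≡ cl v × ∣ M (end v) f ∣ ≡ ∣ cl v ∣
        ends = end-full (proj₁ (code v)) (proj₂ (code v)) (λ ≡1 → case trans (sym k) ≡1 of λ ())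
        f : Fin n
        f = proj₁ ends
        se : S (end v) f ≡ cl v
        se = proj₁ (proj₂ ends)
        sizes : ∣ M (end v) f ∣ ≡ ∣ cl v ∣
        sizes = proj₂ (proj₂ ends)
        e∈ : end v ∈ cl v
        e∈ = subst (end v ∈_) se (a∈S (end v) f)
        f∈ : f ∈ cl v
        f∈ = subst (f ∈_) se (b∈S (end v) f)
        M⊆ : M (end v) f ⊆ cl v
        M⊆ = M-min (S-F _ _) e∈ f∈
      ... | is-prime a≢b k _ none = subst (KindSpec v) (sym (trans (kindOf-inner a≢b) (cong kindNumber k)))
        (a≢b , λ {x} {y} x∈ y∈ cr → full-⊆ (M-min (S-F _ _) x∈ y∈) (decidable-stable (∣ M x y ∣ Data.Nat.≟ ∣ cl v ∣)
          λ ≢ → none (x , y , ⊆-antisym (S-mono x∈ y∈) cr , ≢)))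

      adjacency : ∀ v w → w Mem.∈ nbrs v ⇔ (w ◁ v ⊎ v ◁ w)
      adjacency v w = mk⇔ to from
        where
        a b : Fin n
        a = proj₁ (code v)
        b = proj₂ (code v)
        to : w Mem.∈ nbrs v → w ◁ v ⊎ v ◁ w
        to w∈ with Memₚ.∈-++⁻ (map (childVertex a b) (kids a b)) w∈
        ... | inj₂ w∈p = inj₂ (covered (parents-∈⁻ {a} {b} w∈p))
        ... | inj₁ w∈c with Memₚ.∈-map⁻ (childVertex a b) w∈c
        ...   | d , d∈ , refl with kids-∈⁻ {a} {b} {d} d∈
        ...     | d′ , c , eq = inj₁ (covered (code-child {w = childVertex a b d} eq c))
        from : w ◁ v ⊎ v ◁ w → w Mem.∈ nbrs v
        from (inj₂ (covered cov)) = Memₚ.∈-++⁺ʳ (map (childVertex a b) (kids a b)) (parents-∈⁺ {a} {b} w cov)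
        from (inj₁ (covered cov)) =
          let d∈ , eq = kids-∈⁺ {a} {b} (covered-child {a} {b} (code-canon w) cov) in
          Memₚ.∈-++⁺ˡ (subst (Mem._∈ map (childVertex a b) (kids a b)) (code-injective eq) (Memₚ.∈-map⁺ (childVertex a b) d∈))

      spec : Spec
      spec = record
        { cl-vtx = λ a b → trans (cong (λ q → S (proj₁ q) (proj₂ q)) (code-vtx a b)) (canon-S a b)
        ; cl-inj = λ {v} {w} eq → code-injective (trans (sym (code-canon v)) (trans (canon-cong eq) (code-canon w)))
        ; code-diag = λ a → trans (code-vtx a a) (diagonal a)
        ; nbrs-order = λ v → AllPairsₚ.++⁺ (AllPairsₚ.map⁺ (kids-sorted v))
            (branch-allPairs (apply less (at2 τ PD (proj₁ (code v)) (proj₂ (code v))) n))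
            (All.tabulate λ x∈ → All.tabulate λ y∈ → before v x∈ y∈)
        ; nbrs-adj = adjacency
        ; kind-spec = kindSpec
        }
        where
        before : ∀ v {x y} → x Mem.∈ map (childVertex (proj₁ (code v)) (proj₂ (code v))) (kids (proj₁ (code v)) (proj₂ (code v))) →
          y Mem.∈ parents (proj₁ (code v)) (proj₂ (code v)) → Before v x y
        before v x∈ y∈ with Memₚ.∈-map⁻ (childVertex (proj₁ (code v)) (proj₂ (code v))) x∈
        ... | d , d∈ , refl with kids-∈⁻ {proj₁ (code v)} {proj₂ (code v)} {d} d∈
        ...   | d′ , c , eq = covered (code-child {w = childVertex (proj₁ (code v)) (proj₂ (code v)) d} eq c) ,
          inj₁ (covered (parents-∈⁻ {proj₁ (code v)} {proj₂ (code v)} y∈))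
        -- For `a` other than `zero` the strong set is a single point, so both components are `a`;
        -- for `zero` it is everything, and the least pair is diagonal as well.
        diagonal : ∀ a → canon a a ≡ (a , a)
        diagonal a with a Finₚ.≟ zero
        ... | yes refl = cong₂ _,_ (Finₚ.≤-antisym (Canonical.min₁ K {zero} {zero} refl) z≤n)
          (Finₚ.≤-antisym (Canonical.min₂ K {zero} (trans (cong (λ c → S c zero) c≡) refl)) z≤n)
          where
          K : Canonical zero zero
          K = canonical zero zero
          c≡ : Canonical.c K ≡ zero
          c≡ = Finₚ.≤-antisym (Canonical.min₁ K {zero} {zero} refl) z≤n
        ... | no a≢0 = cong₂ _,_ (only (a∈S _ _)) (only (b∈S _ _))
          where
          only : ∀ {x} → x ∈ S (proj₁ (canon a a)) (proj₂ (canon a a)) → x ≡ a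
          only x∈ with S⁻ (subst (_ ∈_) (canon-S a a) x∈)
          ... | inj₁ x∈M       = x∈⁅y⁆⇒x≡y a (M-min (F-singleton a≢0) (x∈⁅x⁆ a) (x∈⁅x⁆ a) x∈M)
          ... | inj₂ (inj₁ a∉) = contradiction (a∈M a _) a∉
          ... | inj₂ (inj₂ a∉) = contradiction (a∈M a _) a∉

  decompositionTree : IsUmodularDecompositionTree R graph
  decompositionTree = isDecompositionTree spec

  private
    blockOf : P → List ℕ
    blockOf (a , b) = encodeKind (kindOf a b) ++ encodeList encodeFin (nbrsOf a b)

    opaque
      kind-block : ∀ a b → at2 τ KIND a b ∷ branch (apply equal (toℕ a) (toℕ b)) (toℕ a) 0 ∷ [] ≡ encodeKind (kindOf a b)
      kind-block a b with kind-view a b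
      ... | is-leaf refl k = trans (cong₂ (λ k l → k ∷ branch l (toℕ a) 0 ∷ []) k (equal-yes {toℕ a} refl))
        (cong encodeKind (sym (kindOf-leaf a)))
      ... | is-complete a≢b k _ = trans (cong₂ (λ k l → k ∷ branch l (toℕ a) 0 ∷ []) k (equal-no (λ eq → a≢b (toℕ-injective eq))))
        (cong encodeKind (sym (trans (kindOf-inner a≢b) (cong kindNumber k))))
      ... | is-circular a≢b k _ _ = trans (cong₂ (λ k l → k ∷ branch l (toℕ a) 0 ∷ []) k (equal-no (λ eq → a≢b (toℕ-injective eq))))
        (cong encodeKind (sym (trans (kindOf-inner a≢b) (cong kindNumber k))))
      ... | is-prime a≢b k _ _ = trans (cong₂ (λ k l → k ∷ branch l (toℕ a) 0 ∷ []) k (equal-no (λ eq → a≢b (toℕ-injective eq))))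
        (cong encodeKind (sym (trans (kindOf-inner a≢b) (cong kindNumber k))))

      length-branch : ∀ {A : Set} k {x : A} → length (branch k [ x ] []) ≡ branch k 1 0
      length-branch zero    = refl
      length-branch (suc k) = refl

    opaque
      unfolding kids listed-value
      degree-block : ∀ a b → sumN n (λ s → sumN n (λ d → branch (listed-value s d (toℕ a) (toℕ b)) 1 0)) +
        branch (apply less (at2 τ PD a b) n) 1 0 ≡ length (nbrsOf a b)
      degree-block a b = sym (trans (Listₚ.length-++ (map (childVertex a b) (kids a b))) (cong₂ _+_
        (trans (Listₚ.length-map (childVertex a b) (kids a b))
          (length-gather n _ _ λ s → length-gather n _ _ λ d → length-branch (listed-value (toℕ s) (toℕ d) (toℕ a) (toℕ b))))
        (length-branch (apply less (at2 τ PD a b) n))))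

      encode-map : ∀ {A : Set} (f : A → Fin order) xs → concatMap encodeFin (map f xs) ≡ concatMap (λ x → [ toℕ (f x) ]) xs
      encode-map f []       = refl
      encode-map f (x ∷ xs) = cong (toℕ (f x) ∷_) (encode-map f xs)

      children-block : ∀ a b → concatN n (λ s → concatN n (λ d → branch (listed-value s d (toℕ a) (toℕ b))
          [ τ VID (d * n + τ CHD ((toℕ a * n + toℕ b) * n + d)) ] [])) ≡
        concatMap encodeFin (map (childVertex a b) (kids a b))
      children-block a b = trans (concatN-gather n _) (trans (gather-cong n λ s → trans (concatN-gather n _)
          (trans (gather-cong n λ d → one s d (listed-value (toℕ s) (toℕ d) (toℕ a) (toℕ b)) refl)
            (sym (concatMap-gather (λ d → [ toℕ (childVertex a b d) ]) n _))))
        (trans (sym (concatMap-gather (λ d → [ toℕ (childVertex a b d) ]) n _))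
          (sym (encode-map (childVertex a b) (kids a b)))))
        where
        one : ∀ (s d : Fin n) k → listed-value (toℕ s) (toℕ d) (toℕ a) (toℕ b) ≡ k →
          branch k [ τ VID (toℕ d * n + at3 τ CHD a b d) ] [] ≡
          concatMap (λ d → [ toℕ (childVertex a b d) ]) (branch k [ d ] [])
        one s d zero    eq = refl
        one s d (suc k) eq = cong [_] (trans (cong (λ c → τ VID (toℕ d * n + c))
            (sym (toℕ-toFin (proj₁ (sound (listed-tr s d a b) (λ z → case trans (sym eq) z of λ ()))))))
          (vid d (toFin (at3 τ CHD a b d))))

      parent-block : ∀ a b → branch (apply less (at2 τ PD a b) n) [ τ VID (toℕ a * n + at2 τ PD a b) ] [] ≡
        concatMap encodeFin (parents a b)
      parent-block a b = one (apply less (at2 τ PD a b) n) refl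
        where
        one : ∀ k → apply less (at2 τ PD a b) n ≡ k →
          branch k [ τ VID (toℕ a * n + at2 τ PD a b) ] [] ≡ concatMap encodeFin (branch k [ vtx a (toFin (at2 τ PD a b)) ] [])
        one zero    eq = refl
        one (suc k) eq = cong [_] (trans (cong (λ c → τ VID (toℕ a * n + c))
            (sym (toℕ-toFin (sound (tr-less (at2 τ PD a b) n) (λ z → case trans (sym eq) z of λ ())))))
          (vid a (toFin (at2 τ PD a b))))

      block-sound : ∀ a b → yields τ p (toℕ b ∷ toℕ a ∷ []) block ≡ blockOf (a , b)
      block-sound a b = cong₂ _++_ (kind-block a b) (cong₂ _∷_ (degree-block a b)
        (trans (cong₂ _++_ (children-block a b) (parent-block a b))
          (sym (concatMap-++ encodeFin (map (childVertex a b) (kids a b)) (parents a b)))))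

  private
    opaque
      unfolding reps
      output-sound : yields τ p [] output ≡ encodeGraph graph
      output-sound = cong₂ _∷_
        (trans (sym (trans (length-gather n _ _ λ a → length-gather n _ _ λ b → length-branch (at2 τ CAN a b)) refl))
          (sym (Listₚ.length-tabulate {n = order} id)))
        (trans (concatN-gather n _) (trans (gather-cong n λ a → trans (concatN-gather n _) (trans
            (gather-cong n λ b → one a b (at2 τ CAN a b)) (sym (concatMap-gather blockOf n _))))
          (trans (sym (concatMap-gather blockOf n _)) (trans (sym (gather-lookup blockOf reps))
            (sym (concatMap-tabulate (λ v → blockOf (code v)) order id))))))
        where
        one : ∀ a b k → branch k (yields τ p (toℕ b ∷ toℕ a ∷ []) block) [] ≡ concatMap blockOf (branch k [ a , b ] [])
        one a b zero    = refl
        one a b (suc k) = trans (block-sound a b) (sym (Listₚ.++-identityʳ (blockOf (a , b))))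

  run-output : out (run (suc m) (cell (encodeListing L)) (generate output) (st τ p [])) ≡ encodeGraph graph
  run-output = trans (run-generate n input output τ p) output-sound

-- Word size, asymptotics and assembly

private
  below-power : ∀ {x k m} p q c → 2 ≤ m → q + p ≤ c → k < 2 ^ q → x ≤ k * m ^ p → x < m ^ c
  below-power {x} {k} {m} p q c 2≤m ≤c k< x≤ = begin-strict
    x             ≤⟨ x≤ ⟩
    k * m ^ p     <⟨ Data.Nat.Properties.*-monoˡ-< (m ^ p) k< ⟩
    2 ^ q * m ^ p ≤⟨ *-monoˡ-≤ (m ^ p) (^-monoˡ-≤ q 2≤m) ⟩
    m ^ q * m ^ p ≡⟨ ^-distribˡ-+-* m q p ⟨
    m ^ (q + p)   ≤⟨ ^-monoʳ-≤ m ≤c ⟩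
    m ^ c         ∎
    where
    open ≤-Reasoning
    instance
      nonZero : NonZero m
      nonZero = Data.Nat.>-nonZero (<⇒≤ 2≤m)
      nonZeroPower : NonZero (m ^ p)
      nonZeroPower = Data.Nat.>-nonZero (m^n>0 m p)

  -- From 2 on, `n + 2` is at most `n + n`, which costs the factor 16, the fourth power of 2, and
  -- the logarithm is at least 1.
  quartic-growth : ∀ k n → 2 ≤ n → k * (n + 2) ^ 4 ≤ (k * 16) * (n ^ 4 * ⌊log₂ n ⌋)
  quartic-growth k n 2≤n = begin
    k * (n + 2) ^ 4                 ≤⟨ *-monoʳ-≤ k (^-monoˡ-≤ 4 (+-monoʳ-≤ n 2≤n)) ⟩
    k * (n + n) ^ 4                 ≡⟨ double k n ⟩
    (k * 16) * (n ^ 4 * 1)          ≤⟨ *-monoʳ-≤ (k * 16) (*-monoʳ-≤ (n ^ 4) log≥1) ⟩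
    (k * 16) * (n ^ 4 * ⌊log₂ n ⌋)  ∎
    where
    open ≤-Reasoning
    double : ∀ k n → k * ((n + n) * ((n + n) * ((n + n) * ((n + n) * 1)))) ≡ (k * 16) * (n * (n * (n * (n * 1))) * 1)
    double = solve-∀
    log≥1 : 1 ≤ ⌊log₂ n ⌋
    log≥1 = ≤-trans (≤-reflexive (sym (⌊log₂[2^n]⌋≡n 1))) (⌊log₂⌋-mono-≤ 2≤n)

treeProgram-runs : ∀ {n} (L : Listing n) → cell (encodeListing L) 0 ≡ n → (∀ i → cell (encodeListing L) i ≤ n) →
  ∃[ σ ] ∃[ t ] ((n + 2) ^ 64) ⊢ compile treeProgram , initial (encodeListing L) ⇓ σ , t ×
    t ≤ coeff treeProgram * (n + 2) ^ 4 × Outputs σ (out (run n (cell (encodeListing L)) treeProgram initialState))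
treeProgram-runs {n} L input-size input≤ =
  let σ , t , runs , t≤ , outputs = run-machine n (cell (encodeListing L)) tableDegree 64 input-size input≤ treeProgram
        program-ok (λ _ → refl) (λ _ _ → refl)
        -- The coefficient is below `2 ^ 40`, so the cost is below `(n + 2) ^ 44`. The whole running
        -- time has to be a word because it bounds the input and output positions.
        (below-power 4 40 64 (m≤n+m 2 n) (≤ᵇ⇒≤ 44 64 tt) (<ᵇ⇒< (coeff treeProgram) (2 ^ 40) program-coeff) bound)
  in σ , t , runs , ≤-trans t≤ bound , outputs
  where
  bound : cost n treeProgram ≤ coeff treeProgram * (n + 2) ^ 4
  bound = subst (λ d → cost n treeProgram ≤ coeff treeProgram * (n + 2) ^ d) program-depth (cost≤ n treeProgram)

treeProgram-correct : ∀ {m} (R : HomogeneousRelation (suc m)) (L : Listing (suc m)) → Lists R L → SelfComplemented R →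
  ∃[ G ] out (run (suc m) (cell (encodeListing L)) treeProgram initialState) ≡ encodeGraph G × IsUmodularDecompositionTree R G
treeProgram-correct {m} R L lists self-complemented =
  let parsed    = run (suc m) input parse initialState
      closed    = run (suc m) input closures parsed
      o , label≡ = Parsing.run-parse R L lists
      o′ , M≡   = Closing.run-closures R L lists self-complemented parsed label≡
      τ , p , filled , agree , hold =
        run-fills (suc m) input ST tables (generate output) tables-below closed (trans o′ o)
      M≡′ = λ a b x → trans (sym (agree MT _ ≤-refl)) (M≡ a b x)
  in Result.graph R L lists self-complemented τ p M≡′ hold ,
     trans (cong out (trans (run-⟫ (suc m) input parse (closures ⟫ fills ST tables (generate output)) initialState)
         (trans (run-⟫ (suc m) input closures (fills ST tables (generate output)) parsed) filled)))
       (Result.run-output R L lists self-complemented τ p M≡′ hold) ,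
     Result.decompositionTree R L lists self-complemented τ p M≡′ hold
  where
  input : ℕ → ℕ
  input = cell (encodeListing L)

-- The empty ground set

module _ (R : HomogeneousRelation 0) where

  private
    strong-absurd : ∀ U → ¬ Strong R U
    strong-absurd [] ((_ , U≢∅ , _) , _) = U≢∅ refl

  emptyGraph : LabelledGraph 0
  emptyGraph = record { order = 0 ; nbrs = λ () ; kind = λ () }

  emptyTree : IsUmodularDecompositionTree R emptyGraph
  emptyTree = record
    { isTree = record
      { isSimple = record { unique = λ () ; loopless = λ () ; symmetric = λ () } ; connected = λ () ; acyclic = λ () }
    ; labelling = record { leaves = λ () ; labels = λ () }
    ; edgeStrong = λ ()
    ; strongEdge = λ U s → ⊥-elim (strong-absurd U s)
    ; nodes = λ ()
    }

  -- There are no strong bipartitions, hence no edges. A vertex would then have degree 0 and be a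
  -- leaf, but there is no label for it.
  emptyTree-unique : ∀ G → IsUmodularDecompositionTree R G → emptyGraph ≅ G
  emptyTree-unique G D = record
    { vertices = mk↔ₛ′ (λ ()) (λ v → ⊥-elim (no-vertex v)) (λ v → ⊥-elim (no-vertex v)) (λ ())
    ; adjacent = λ () ; labelled = λ () }
    where
    open LabelledGraph G
    open IsUmodularDecompositionTree D
    open LeavesLabelledBijectively labelling
    degree≤1 : ∀ {v} ws → (∀ w → w Mem.∈ ws → Adj v w) → length ws ≤ 1
    degree≤1 []       adj = z≤n
    degree≤1 {v} (w ∷ ws) adj = let U , _ , s = edgeStrong v w (adj w (here refl)) in ⊥-elim (strong-absurd U s)
    no-vertex : Vertex → ⊥
    no-vertex v = case proj₁ (Equivalence.to (leaves v) (degree≤1 (nbrs v) (λ _ w∈ → w∈))) of λ ()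

private
  opaque
    unfolding iterN run
    treeProgram-empty : out (run 0 (cell (0 ∷ [])) treeProgram initialState) ≡ 0 ∷ []
    treeProgram-empty = refl

theorem4 : ∃[ P ] ∃[ c ] ∃[ time ]
    time ∈O (λ n → n ^ 4 * ⌊log₂ n ⌋) ×
    (∀ (n : ℕ) (R : HomogeneousRelation n) (L : Listing n) →
    Lists R L → SelfComplemented R →
    ∃[ σ ] ∃[ t ] ∃[ G ]
    ((n + 2) ^ c) ⊢ P , initial (encodeListing L) ⇓ σ , t ×
    t ≤ time n ×
    Outputs σ (encodeGraph G) ×
    IsUmodularDecompositionTree R G ×
    (∀ (G′ : LabelledGraph n) → IsUmodularDecompositionTree R G′ → G ≅ G′))
theorem4 = compile treeProgram , 64 , (λ n → coeff treeProgram * (n + 2) ^ 4) ,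
    (coeff treeProgram * 16 , 2 , quartic-growth (coeff treeProgram)) , correct
  where
  correct : ∀ (n : ℕ) (R : HomogeneousRelation n) (L : Listing n) → Lists R L → SelfComplemented R →
    ∃[ σ ] ∃[ t ] ∃[ G ]
    ((n + 2) ^ 64) ⊢ compile treeProgram , initial (encodeListing L) ⇓ σ , t ×
    t ≤ coeff treeProgram * (n + 2) ^ 4 ×
    Outputs σ (encodeGraph G) ×
    IsUmodularDecompositionTree R G ×
    (∀ (G′ : LabelledGraph n) → IsUmodularDecompositionTree R G′ → G ≅ G′)
  correct zero R L _ _ =
    let σ , t , run , t≤ , outputs = treeProgram-runs L refl (λ { zero → z≤n ; (suc i) → z≤n }) in
    σ , t , emptyGraph R , run , t≤ , subst (Outputs σ) treeProgram-empty outputs , emptyTree R , emptyTree-unique R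
  correct (suc m) R L lists self-complemented =
    let σ , t , run , t≤ , outputs = treeProgram-runs L (Parsing.input-size R L lists) (Parsing.input≤ R L lists)
        G , output≡ , tree = treeProgram-correct R L lists self-complemented
    in σ , t , G , run , t≤ , subst (Outputs σ) output≡ outputs , tree ,
       -- Both trees are described by the clusters of `R`, which do not depend on the tree.
       λ G′ tree′ → clusters-≅ R (Rooted.clusters R G tree) (Rooted.clusters R G′ tree′)
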